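{- Let $k \neq 0$ be an integer and let $C_k \subset \mathbb{P}^2$ be the plane quartic curve $$C_k : x^3 z + x^2 y^2 + y^3 z = k z^4.$$ Consider the three elliptic curves over $\mathbb{Q}$ $$E_{1,k} : y^2 + 3xy = x^3 + k,\qquad E_{2,k} : y^2 = x^3 + 4k x^2 + 16k^2,\qquad E_{3,k} : y^2 = x^3 - 27x^2 - 1728k.$$ Suppose that at least one of $E_{1,k}(\mathbb{Q})$, $E_{2,k}(\mathbb{Q})$, $E_{3,k}(\mathbb{Q})$ has Mordell–Weil rank zero. Then: \begin{itemize} \item If $k \neq 2a^3 + a^4$ for every integer $a$, then $C_k(\mathbb{Q}) = \{(1:0:0),\,(0:1:0)\}$. \item If $k = 2a^3 + a^4$ for some integer $a \notin \{ -1, 3\}$, then $C_k(\mathbb{Q}) = \{(1:0:0),\,(0:1:0),\,(a:a:1)\}$. \item If $k = -1$ (i.e. $a=-1$), then $C_k(\mathbb{Q}) = \{(1:0:0),\,(0:1:0),\,(-1:0:1),\,(0:-1:1),\,(-1:-1:1)\}$. \item If $k = 135$ (i.e. $a=3$), then $C_k(\mathbb{Q}) = \{(1:0:0),\,(0:1:0),\,(3:3:1),\,(-6:3:1),\,(3:-6:1)\}$. \end{itemize}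
   Context: $C_k(\mathbb{Q})$ denotes the set of points of $C_k$ with rational projective coordinates. The rank of an elliptic curve $E/\mathbb{Q}$ is the rank of the finitely generated abelian group $E(\mathbb{Q})$. (For $k\neq 0$ these three elliptic curves are images of $C_k$ under explicit morphisms defined over $\mathbb{Q}$; this is background and not part of the hypotheses.) -}

module Defs where

open import Data.Nat using (ℕ; zero; suc)
open import Data.Integer as ℤ using (ℤ; +_; -[1+_])
open import Data.Rational using (ℚ; _/_; 0ℚ; 1ℚ; _+_; _*_; _-_; -_)
open import Data.List using (List; _∷_; [])
open import Data.List.Relation.Unary.Any using (Any)
open import Data.Product using (Σ; ∃; _×_; _,_)
open import Relation.Binary.PropositionalEquality using (_≡_; _≢_)
open import Relation.Nullary using (¬_)
open import Function.Bundles using (_⇔_)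

ι : ℤ → ℚ
ι z = z / 1

record Weierstrass : Set where
  constructor W
  field a₁ a₂ a₃ a₄ a₆ : ℚ

module _ (E : Weierstrass) where
  open Weierstrass E

  OnCurve : ℚ → ℚ → Set
  OnCurve x y = y * y + a₁ * x * y + a₃ * y ≡ x * x * x + a₂ * x * x + a₄ * x + a₆

  data Pt : Set where
    O   : Pt
    aff : (x y : ℚ) → OnCurve x y → Pt

  -- third point from slope λ (standard chord–tangent formulas)
  x₃ : ℚ → ℚ → ℚ → ℚ
  x₃ λ' x₁ x₂ = λ' * λ' + a₁ * λ' - a₂ - x₁ - x₂

  y₃ : ℚ → ℚ → ℚ → ℚ → ℚ
  y₃ λ' x₁ y₁ x = - ((λ' + a₁) * x) - (y₁ - λ' * x₁) - a₃

  -- the group law of E(ℚ), as the graph relation  P + Q = R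
  -- (only x/y-coordinates of R are compared; the curve-membership proof is irrelevant data)
  data AddR : Pt → Pt → Pt → Set where
    O-l  : ∀ Q → AddR O Q Q
    O-r  : ∀ P → AddR P O P
    neg  : ∀ {x₁ y₁ x₂ y₂ p q} → x₁ ≡ x₂ → y₁ + y₂ + a₁ * x₂ + a₃ ≡ 0ℚ →
           AddR (aff x₁ y₁ p) (aff x₂ y₂ q) O
    chord : ∀ {x₁ y₁ x₂ y₂ p q} (λ' : ℚ) {r} → x₁ ≢ x₂ →
           λ' * (x₂ - x₁) ≡ y₂ - y₁ →
           AddR (aff x₁ y₁ p) (aff x₂ y₂ q)
                (aff (x₃ λ' x₁ x₂) (y₃ λ' x₁ y₁ (x₃ λ' x₁ x₂)) r)
    tangent : ∀ {x₁ y₁ p q} (λ' : ℚ) {r} →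
           y₁ + y₁ + a₁ * x₁ + a₃ ≢ 0ℚ →
           λ' * (y₁ + y₁ + a₁ * x₁ + a₃) ≡ ι (+ 3) * x₁ * x₁ + ι (+ 2) * a₂ * x₁ + a₄ - a₁ * y₁ →
           AddR (aff x₁ y₁ p) (aff x₁ y₁ q)
                (aff (x₃ λ' x₁ x₁) (y₃ λ' x₁ y₁ (x₃ λ' x₁ x₁)) r)

  data MulR : ℕ → Pt → Pt → Set where
    mul0 : ∀ P → MulR zero P O
    mulS : ∀ {n P S R} → MulR n P S → AddR S P R → MulR (suc n) P R

  IsTorsion : Pt → Set
  IsTorsion P = Σ ℕ λ n → MulR (suc n) P O

  -- Mordell–Weil rank zero: the finitely generated abelian group E(ℚ)
  -- has rank 0, i.e. every element has finite order
  RankZero : Set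
  RankZero = ∀ P → IsTorsion P

E₁ E₂ E₃ : ℤ → Weierstrass
E₁ k = W (ι (+ 3)) 0ℚ 0ℚ 0ℚ (ι k)
E₂ k = W 0ℚ (ι (ℤ._*_ (+ 4) k)) 0ℚ 0ℚ (ι (ℤ._*_ (+ 16) (ℤ._*_ k k)))
E₃ k = W 0ℚ (ι (ℤ.- (+ 27))) 0ℚ 0ℚ (ι (ℤ.- (ℤ._*_ (+ 1728) k)))

Triple : Set
Triple = ℚ × ℚ × ℚ

NonZeroTriple : Triple → Set
NonZeroTriple (x , y , z) = ¬ (x ≡ 0ℚ × y ≡ 0ℚ × z ≡ 0ℚ)

OnC : ℤ → Triple → Set
OnC k (x , y , z) =
  x * x * x * z + x * x * y * y + y * y * y * z ≡ ι k * z * z * z * z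

_∼_ : Triple → Triple → Set
(x , y , z) ∼ (x' , y' , z') =
  Σ ℚ λ c → c ≢ 0ℚ × x ≡ c * x' × y ≡ c * y' × z ≡ c * z'

pt : ℤ → ℤ → ℤ → Triple
pt a b c = ι a , ι b , ι c

CkPointsAre : ℤ → List Triple → Set
CkPointsAre k L = ∀ P → NonZeroTriple P → (OnC k P ⇔ Any (P ∼_) L)

quartic : ℤ → ℤ
quartic a = ℤ._+_ (ℤ._*_ (+ 2) (ℤ._*_ a (ℤ._*_ a a))) (ℤ._*_ a (ℤ._*_ a (ℤ._*_ a a)))

{-# OPTIONS --safe #-}
-- On a curve of rank zero every rational point is torsion, so by the theorem of Lutz and Nagell it has integral
-- coordinates on a model Y² = X³ + AX² + B with integers A, B. The same holds for its multiples, whence the slopes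
-- of the tangents and chords that produce the multiples are integers as well. These divisibilities do all the work;
-- they are applied to the images of an affine point (x, y) of C_k, such as (-4 (x + y), 8xy - 12 (x + y)) on
-- Y² = X³ + 9X² + 64k for E₁.
-- E₂: the multiples of the explicit point (0, 4k) leave only k = -1 and k = -2, and integrality of the images of
-- (x, y) and (y, x) then bounds 2/x and 2/y.
-- E₃: congruences modulo 2 and 3, in the second case on the curve rescaled by 3 as well, show that the image of
-- a point with x ≠ y has order two, and these points can be listed.
-- E₁: the denominators of x and y divide 4, and parity makes x and y integers. By congruences modulo 2 and 3 the
-- image P has small order, or 3 (2P) = O, or x and y are multiples of 3 and (x/3, y/3) is an integral point of a
-- conic (2l + 1) x y = (x + y) (x + y + l) with l (l + 1) + x + y dividing 2xy - (x + y). The small orders are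
-- excluded by factorisation and by a descent for m² = 768 c⁴ + 1, the points of the conics are found by Vieta
-- jumping and a finite search, and the values of k that remain are excluded by an explicit integral point whose
-- tangent has a nonintegral slope.
module Submission where

import Defs
open import Defs using (E₁; E₂; E₃; RankZero; quartic; CkPointsAre; pt)
open import Algebra.Structures using (IsCommutativeRing)
open import Data.Bool using (Bool; true; false; T; _∧_; _∨_; not; if_then_else_)
open import Data.Empty using (⊥; ⊥-elim)
open import Data.Fin using (Fin; zero; suc)
open import Data.Integer as ℤ using (ℤ; +_; -[1+_])
import Data.Integer.DivMod as IntDM
open import Data.Integer.Divisibility.Signed using (_∣_; divides; ∣⇒∣ᵤ; _∣?_)
import Data.Integer.Properties as ℤₚ
open import Data.List using (List; _∷_; [])
open import Data.List.Relation.Unary.All as All using (All)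
open import Data.List.Relation.Unary.Any using (Any; here; there)
open import Data.Nat as ℕ using (ℕ; zero; suc)
import Data.Nat.Divisibility as ℕDivₚ
import Data.Nat.Divisibility.Core as ℕDiv
open import Data.Nat.GCD using (module GCD; module Bézout)
open import Data.Nat.Induction using (<-rec)
import Data.Nat.Properties as ℕₚ
open import Data.Product using (∃-syntax; _×_; _,_; proj₁; proj₂)
open import Data.Sum using (_⊎_; inj₁; inj₂; [_,_]′)
open import Data.Unit using (⊤; tt)
open import Data.Vec using (Vec; _∷_; []; lookup)
open import Function.Bundles using (mk⇔)
open import Relation.Binary.PropositionalEquality
open import Relation.Binary.Definitions using (DecidableEquality)
open import Relation.Nullary using (¬_; Dec; yes; no; does; contradiction)
open import Relation.Nullary.Decidable using (dec-true; from-no)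

-- No bound on torsion orders is used, so every contradiction has to come from low multiples of a
-- point P. Two divisibilities carry them: that of the tangent slope M = (3X² + 2AX) / 2Y, and that
-- of N = 2Y / (X(2P) - X(P)), an integer because it is minus the sum of the slopes producing 2P and
-- 3P. A denominator that vanishes means 2P = O or 3P = O; this is why small orders have to be
-- treated on their own, for P and again for 2P in place of P. E₁ arises from C_k by exchanging x
-- and y, so its points know only s = x + y and p = xy. That x and y are rational comes back as the
-- condition that s² - 4p is a square, and the searches with `non-square` test a multiple of this
-- discriminant. Points with x = y never lead to a contradiction, as the family k = 2a³ + a⁴
-- consists of them. On the conic with l = -1 the divisibility condition holds automatically. There
-- the slope of the tangent at 2P decides, and the two extra points for k = 135 come from this case.

-- Rings over ℤ and a verifier for ideal membership.

record ℤ-Algebra : Set₁ where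
  infixl 6 _+_ _-_
  infixl 7 _*_
  infix 8 -_
  field
    Carrier : Set
    _+_ _*_ : Carrier → Carrier → Carrier
    -_ : Carrier → Carrier
    0# 1# : Carrier
    isCommutativeRing : IsCommutativeRing _≡_ _+_ _*_ -_ 0# 1#
    ι# : ℤ → Carrier
    ι-+ : ∀ a b → ι# (a ℤ.+ b) ≡ ι# a + ι# b
    ι-* : ∀ a b → ι# (a ℤ.* b) ≡ ι# a * ι# b
    ι-neg : ∀ a → ι# (ℤ.- a) ≡ - ι# a
    ι-0 : ι# (+ 0) ≡ 0#
    ι-1 : ι# (+ 1) ≡ 1#

  _-_ : Carrier → Carrier → Carrier
  x - y = x + - y

  open IsCommutativeRing isCommutativeRing public
    hiding (_-_; refl; sym; trans; reflexive; setoid)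

infixl 7 _:+_ _:-_
infixl 8 _:*_
infix 9 :-_
infix 6 _·_≈_
infix 4 _:=_from_

data Expr (n : ℕ) : Set where
  var : Fin n → Expr n
  # : ℤ → Expr n
  _:+_ _:-_ _:*_ : Expr n → Expr n → Expr n
  :-_ : Expr n → Expr n

♯ : ∀ {n} → ℕ → Expr n
♯ m = # (+ m)

-- The cofactor is the factor of left minus right in the combination that yields the goal. It is
-- given together with the hypothesis, so that only a polynomial identity has to be verified and no
-- cofactor is ever searched for.
record Hypothesis (n : ℕ) : Set where
  constructor _·_≈_
  field cofactor left right : Expr n

record Problem (n : ℕ) : Set where
  constructor _:=_from_
  field
    left right : Expr n
    hypotheses : List (Hypothesis n)

-- Horner form, recursively in the number of variables; the constant coefficient comes first.
Poly : ℕ → Set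
Poly zero = ℤ
Poly (suc n) = List (Poly n)

module Horner where
  0ₚ : ∀ n → Poly n
  0ₚ zero = + 0
  0ₚ (suc n) = []

  constₚ : ∀ {n} → ℤ → Poly n
  constₚ {zero} c = c
  constₚ {suc n} c = constₚ c ∷ []

  varₚ : ∀ {n} → Fin n → Poly n
  varₚ {suc n} zero = 0ₚ n ∷ constₚ (+ 1) ∷ []
  varₚ (suc i) = varₚ i ∷ []

  addₚ : ∀ {n} → Poly n → Poly n → Poly n
  addₚ {zero} p q = p ℤ.+ q
  addₚ {suc n} [] q = q
  addₚ {suc n} p@(_ ∷ _) [] = p
  addₚ {suc n} (a ∷ p) (b ∷ q) = addₚ a b ∷ addₚ p q

  negₚ : ∀ {n} → Poly n → Poly n
  negₚ {zero} p = ℤ.- p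
  negₚ {suc n} [] = []
  negₚ {suc n} (a ∷ p) = negₚ a ∷ negₚ p

  shiftₚ : ∀ {n} → Poly (suc n) → Poly (suc n)
  shiftₚ [] = []
  shiftₚ {n} p@(_ ∷ _) = 0ₚ n ∷ p

  mutual
    mulₚ : ∀ {n} → Poly n → Poly n → Poly n
    mulₚ {zero} p q = p ℤ.* q
    mulₚ {suc n} [] q = []
    mulₚ {suc n} (a ∷ p) q = addₚ (scaleₚ a q) (shiftₚ (mulₚ p q))

    scaleₚ : ∀ {n} → Poly n → Poly (suc n) → Poly (suc n)
    scaleₚ a [] = []
    scaleₚ a (b ∷ q) = mulₚ a b ∷ scaleₚ a q

  ⟦_⟧ₚ : ∀ {n} → Expr n → Poly n
  ⟦ var i ⟧ₚ = varₚ i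
  ⟦ # c ⟧ₚ = constₚ c
  ⟦ e :+ f ⟧ₚ = addₚ ⟦ e ⟧ₚ ⟦ f ⟧ₚ
  ⟦ e :- f ⟧ₚ = addₚ ⟦ e ⟧ₚ (negₚ ⟦ f ⟧ₚ)
  ⟦ e :* f ⟧ₚ = mulₚ ⟦ e ⟧ₚ ⟦ f ⟧ₚ
  ⟦ :- e ⟧ₚ = negₚ ⟦ e ⟧ₚ

  isZeroₚ : ∀ {n} → Poly n → Bool
  isZeroₚ {zero} (+ 0) = true
  isZeroₚ {zero} _ = false
  isZeroₚ {suc n} [] = true
  isZeroₚ {suc n} (a ∷ p) = isZeroₚ a ∧ isZeroₚ p

  combination : ∀ {n} → List (Hypothesis n) → Expr n
  combination [] = ♯ 0
  combination (c · l ≈ r ∷ hs) = c :* (l :- r) :+ combination hs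

  certificate : ∀ {n} → Problem n → Expr n
  certificate (l := r from hs) = (l :- r) :- combination hs

open Horner

-- Curried, so that a problem can be written as a lambda abstraction whose bound variables name the
-- indeterminates.
Fun : ℕ → Set → Set → Set
Fun zero A B = B
Fun (suc n) A B = A → Fun n A B

apply : ∀ {n A B} → Fun n A B → Vec A n → B
apply f [] = f
apply f (x ∷ xs) = apply (f x) xs

vars : ∀ n → Vec (Expr n) n
vars n = Data.Vec.tabulate var

checks : ∀ {n} → Problem n → Bool
checks p = isZeroₚ ⟦ certificate p ⟧ₚ

module RingSolver (R : ℤ-Algebra) where
  open ℤ-Algebra R
  open ≡-Reasoning

  ⟦_⟧ : ∀ {n} → Expr n → Vec Carrier n → Carrier
  ⟦ var i ⟧ ρ = lookup ρ i
  ⟦ # c ⟧ ρ = ι# c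
  ⟦ e :+ f ⟧ ρ = ⟦ e ⟧ ρ + ⟦ f ⟧ ρ
  ⟦ e :- f ⟧ ρ = ⟦ e ⟧ ρ - ⟦ f ⟧ ρ
  ⟦ e :* f ⟧ ρ = ⟦ e ⟧ ρ * ⟦ f ⟧ ρ
  ⟦ :- e ⟧ ρ = - ⟦ e ⟧ ρ

  Hold : ∀ {n} → List (Hypothesis n) → Vec Carrier n → Set
  Hold [] ρ = ⊤
  Hold (c · l ≈ r ∷ hs) ρ = ⟦ l ⟧ ρ ≡ ⟦ r ⟧ ρ × Hold hs ρ

  module Soundness where
    ev : ∀ {n} → Poly n → Vec Carrier n → Carrier
    ev {zero} c [] = ι# c
    ev {suc n} [] ρ = 0#
    ev {suc n} (a ∷ p) (x ∷ ρ) = ev a ρ + x * ev p (x ∷ ρ)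

    ev-0 : ∀ n ρ → ev (0ₚ n) ρ ≡ 0#
    ev-0 zero [] = ι-0
    ev-0 (suc n) ρ = refl

    ev-const : ∀ {n} c (ρ : Vec Carrier n) → ev (constₚ c) ρ ≡ ι# c
    ev-const c [] = refl
    ev-const c (x ∷ ρ) = trans (cong₂ _+_ (ev-const c ρ) (zeroʳ x)) (+-identityʳ _)

    ev-var : ∀ {n} i (ρ : Vec Carrier n) → ev (varₚ i) ρ ≡ lookup ρ i
    ev-var zero (x ∷ ρ) = begin
      ev (0ₚ _) ρ + x * (ev (constₚ (+ 1)) ρ + x * 0#)
        ≡⟨ cong₂ (λ u v → u + x * v) (ev-0 _ ρ) (ev-const (+ 1) (x ∷ ρ)) ⟩
      0# + x * ι# (+ 1) ≡⟨ +-identityˡ _ ⟩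
      x * ι# (+ 1) ≡⟨ cong (x *_) ι-1 ⟩
      x * 1# ≡⟨ *-identityʳ x ⟩
      x ∎
    ev-var (suc i) (x ∷ ρ) = trans (cong₂ _+_ (ev-var i ρ) (zeroʳ x)) (+-identityʳ _)

    interchange : ∀ a b c d → (a + b) + (c + d) ≡ (a + c) + (b + d)
    interchange a b c d = begin
      (a + b) + (c + d) ≡⟨ +-assoc a b _ ⟩
      a + (b + (c + d)) ≡⟨ cong (_+_ a) (sym (+-assoc b c d)) ⟩
      a + ((b + c) + d) ≡⟨ cong (λ u → a + (u + d)) (+-comm b c) ⟩
      a + ((c + b) + d) ≡⟨ cong (_+_ a) (+-assoc c b d) ⟩
      a + (c + (b + d)) ≡⟨ sym (+-assoc a c _) ⟩
      (a + c) + (b + d) ∎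

    ev-add : ∀ {n} (p q : Poly n) ρ → ev (addₚ p q) ρ ≡ ev p ρ + ev q ρ
    ev-add {zero} p q [] = ι-+ p q
    ev-add {suc n} [] q ρ = sym (+-identityˡ _)
    ev-add {suc n} (a ∷ p) [] (x ∷ ρ) = sym (+-identityʳ _)
    ev-add {suc n} (a ∷ p) (b ∷ q) (x ∷ ρ) = begin
      ev (addₚ a b) ρ + x * ev (addₚ p q) (x ∷ ρ)
        ≡⟨ cong₂ (λ u v → u + x * v) (ev-add a b ρ) (ev-add p q (x ∷ ρ)) ⟩
      (ev a ρ + ev b ρ) + x * (ev p (x ∷ ρ) + ev q (x ∷ ρ))
        ≡⟨ cong (_+_ (ev a ρ + ev b ρ)) (distribˡ x _ _) ⟩
      (ev a ρ + ev b ρ) + (x * ev p (x ∷ ρ) + x * ev q (x ∷ ρ)) ≡⟨ interchange _ _ _ _ ⟩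
      (ev a ρ + x * ev p (x ∷ ρ)) + (ev b ρ + x * ev q (x ∷ ρ)) ∎

    neg-unique : ∀ {a b} → a + b ≡ 0# → b ≡ - a
    neg-unique {a} {b} h = begin
      b ≡⟨ sym (+-identityˡ b) ⟩
      0# + b ≡⟨ cong (_+ b) (sym (-‿inverseˡ a)) ⟩
      (- a + a) + b ≡⟨ +-assoc _ _ _ ⟩
      - a + (a + b) ≡⟨ cong (_+_ (- a)) h ⟩
      - a + 0# ≡⟨ +-identityʳ _ ⟩
      - a ∎

    ev-neg : ∀ {n} (p : Poly n) ρ → ev (negₚ p) ρ ≡ - ev p ρ
    ev-neg {zero} p [] = ι-neg p
    ev-neg {suc n} [] ρ = neg-unique (+-identityʳ 0#)
    ev-neg {suc n} (a ∷ p) (x ∷ ρ) = neg-unique (begin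
      (ev a ρ + x * ev p (x ∷ ρ)) + (ev (negₚ a) ρ + x * ev (negₚ p) (x ∷ ρ))
        ≡⟨ cong₂ (λ u v → (ev a ρ + x * ev p (x ∷ ρ)) + (u + x * v)) (ev-neg a ρ) (ev-neg p (x ∷ ρ)) ⟩
      (ev a ρ + x * ev p (x ∷ ρ)) + (- ev a ρ + x * - ev p (x ∷ ρ)) ≡⟨ interchange _ _ _ _ ⟩
      (ev a ρ + - ev a ρ) + (x * ev p (x ∷ ρ) + x * - ev p (x ∷ ρ))
        ≡⟨ cong₂ _+_ (-‿inverseʳ _) (sym (distribˡ x _ _)) ⟩
      0# + x * (ev p (x ∷ ρ) + - ev p (x ∷ ρ)) ≡⟨ +-identityˡ _ ⟩
      x * (ev p (x ∷ ρ) + - ev p (x ∷ ρ)) ≡⟨ cong (x *_) (-‿inverseʳ _) ⟩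
      x * 0# ≡⟨ zeroʳ x ⟩
      0# ∎)

    ev-shift : ∀ {n} (p : Poly (suc n)) x ρ → ev (shiftₚ p) (x ∷ ρ) ≡ x * ev p (x ∷ ρ)
    ev-shift [] x ρ = sym (zeroʳ x)
    ev-shift (a ∷ p) x ρ = trans (cong (_+ (x * ev (a ∷ p) (x ∷ ρ))) (ev-0 _ ρ)) (+-identityˡ _)

    mutual
      ev-mul : ∀ {n} (p q : Poly n) ρ → ev (mulₚ p q) ρ ≡ ev p ρ * ev q ρ
      ev-mul {zero} p q [] = ι-* p q
      ev-mul {suc n} [] q ρ = sym (zeroˡ _)
      ev-mul {suc n} (a ∷ p) q (x ∷ ρ) = begin
        ev (addₚ (scaleₚ a q) (shiftₚ (mulₚ p q))) (x ∷ ρ) ≡⟨ ev-add (scaleₚ a q) _ _ ⟩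
        ev (scaleₚ a q) (x ∷ ρ) + ev (shiftₚ (mulₚ p q)) (x ∷ ρ)
          ≡⟨ cong₂ _+_ (ev-scale a q x ρ) (ev-shift (mulₚ p q) x ρ) ⟩
        ev a ρ * Q + x * ev (mulₚ p q) (x ∷ ρ) ≡⟨ cong (λ u → ev a ρ * Q + x * u) (ev-mul p q (x ∷ ρ)) ⟩
        ev a ρ * Q + x * (ev p (x ∷ ρ) * Q) ≡⟨ cong (_+_ (ev a ρ * Q)) (sym (*-assoc x _ Q)) ⟩
        ev a ρ * Q + (x * ev p (x ∷ ρ)) * Q ≡⟨ sym (distribʳ Q _ _) ⟩
        (ev a ρ + x * ev p (x ∷ ρ)) * Q ∎
        where Q = ev q (x ∷ ρ)

      ev-scale : ∀ {n} (a : Poly n) q x ρ → ev (scaleₚ a q) (x ∷ ρ) ≡ ev a ρ * ev q (x ∷ ρ)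
      ev-scale a [] x ρ = sym (zeroʳ _)
      ev-scale a (b ∷ q) x ρ = begin
        ev (mulₚ a b) ρ + x * ev (scaleₚ a q) (x ∷ ρ)
          ≡⟨ cong₂ (λ u v → u + x * v) (ev-mul a b ρ) (ev-scale a q x ρ) ⟩
        A * ev b ρ + x * (A * Q) ≡⟨ cong (_+_ (A * ev b ρ)) (sym (*-assoc x A Q)) ⟩
        A * ev b ρ + x * A * Q ≡⟨ cong (λ u → A * ev b ρ + u * Q) (*-comm x A) ⟩
        A * ev b ρ + A * x * Q ≡⟨ cong (_+_ (A * ev b ρ)) (*-assoc A x Q) ⟩
        A * ev b ρ + A * (x * Q) ≡⟨ sym (distribˡ A _ _) ⟩
        A * (ev b ρ + x * Q) ∎
        where
        A = ev a ρ
        Q = ev q (x ∷ ρ)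

    ev-⟦⟧ : ∀ {n} (e : Expr n) ρ → ev ⟦ e ⟧ₚ ρ ≡ ⟦ e ⟧ ρ
    ev-⟦⟧ (var i) ρ = ev-var i ρ
    ev-⟦⟧ (# c) ρ = ev-const c ρ
    ev-⟦⟧ (e :+ f) ρ = trans (ev-add ⟦ e ⟧ₚ _ ρ) (cong₂ _+_ (ev-⟦⟧ e ρ) (ev-⟦⟧ f ρ))
    ev-⟦⟧ (e :- f) ρ = trans (ev-add ⟦ e ⟧ₚ _ ρ)
      (cong₂ _+_ (ev-⟦⟧ e ρ) (trans (ev-neg ⟦ f ⟧ₚ ρ) (cong -_ (ev-⟦⟧ f ρ))))
    ev-⟦⟧ (e :* f) ρ = trans (ev-mul ⟦ e ⟧ₚ _ ρ) (cong₂ _*_ (ev-⟦⟧ e ρ) (ev-⟦⟧ f ρ))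
    ev-⟦⟧ (:- e) ρ = trans (ev-neg ⟦ e ⟧ₚ ρ) (cong -_ (ev-⟦⟧ e ρ))

    ∧-true : ∀ {a b} → a ∧ b ≡ true → a ≡ true × b ≡ true
    ∧-true {true} {true} refl = refl , refl

    ev-isZero : ∀ {n} (p : Poly n) → isZeroₚ p ≡ true → ∀ ρ → ev p ρ ≡ 0#
    ev-isZero {zero} (+ 0) h [] = ι-0
    ev-isZero {suc n} [] h ρ = refl
    ev-isZero {suc n} (a ∷ p) h (x ∷ ρ) with ∧-true h
    ... | ha , hp = begin
      ev a ρ + x * ev p (x ∷ ρ)
        ≡⟨ cong₂ (λ u v → u + x * v) (ev-isZero a ha ρ) (ev-isZero p hp (x ∷ ρ)) ⟩
      0# + x * 0# ≡⟨ trans (+-identityˡ _) (zeroʳ x) ⟩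
      0# ∎

    minus-self : ∀ {a b} → a ≡ b → a - b ≡ 0#
    minus-self refl = -‿inverseʳ _

    minus-zero : ∀ {a b} → a - b ≡ 0# → a ≡ b
    minus-zero {a} {b} h = begin
      a ≡⟨ sym (+-identityʳ a) ⟩
      a + 0# ≡⟨ cong (_+_ a) (sym (-‿inverseˡ b)) ⟩
      a + (- b + b) ≡⟨ sym (+-assoc _ _ _) ⟩
      (a - b) + b ≡⟨ cong (_+ b) h ⟩
      0# + b ≡⟨ +-identityˡ b ⟩
      b ∎

    combination-zero : ∀ {n} (hs : List (Hypothesis n)) ρ → Hold hs ρ → ⟦ combination hs ⟧ ρ ≡ 0#
    combination-zero [] ρ _ = ι-0
    combination-zero (c · l ≈ r ∷ hs) ρ (h , rest) = begin
      ⟦ c ⟧ ρ * (⟦ l ⟧ ρ - ⟦ r ⟧ ρ) + ⟦ combination hs ⟧ ρ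
        ≡⟨ cong₂ (λ u v → ⟦ c ⟧ ρ * u + v) (minus-self h) (combination-zero hs ρ rest) ⟩
      ⟦ c ⟧ ρ * 0# + 0# ≡⟨ trans (+-identityʳ _) (zeroʳ _) ⟩
      0# ∎

  open Soundness

  -- An equation follows from others when left minus right side is the given combination
  -- of their differences; this is decided by comparing Horner forms.
  ring : ∀ n (f : Fun n (Expr n) (Problem n)) → let p = apply f (vars n) in checks p ≡ true →
    ∀ ρ → Hold (Problem.hypotheses p) ρ → ⟦ Problem.left p ⟧ ρ ≡ ⟦ Problem.right p ⟧ ρ
  ring n f ok ρ = solve (apply f (vars n)) ok
    where
    solve : ∀ p → checks p ≡ true → Hold (Problem.hypotheses p) ρ → ⟦ Problem.left p ⟧ ρ ≡ ⟦ Problem.right p ⟧ ρ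
    solve p@(l := r from hs) ok hyps = minus-zero (minus-zero (begin
      (⟦ l ⟧ ρ - ⟦ r ⟧ ρ) - 0# ≡⟨ cong (λ u → (⟦ l ⟧ ρ - ⟦ r ⟧ ρ) - u) (sym (combination-zero hs ρ hyps)) ⟩
      ⟦ certificate p ⟧ ρ ≡⟨ sym (ev-⟦⟧ (certificate p) ρ) ⟩
      ev ⟦ certificate p ⟧ₚ ρ ≡⟨ ev-isZero _ ok ρ ⟩
      0# ∎))

-- Fields of fractions of ℤ.

-- These axioms determine ℚ up to isomorphism. As a parameter the field does not compute, so no
-- normalisation of fractions is unfolded when points of curves are compared.
record FractionField : Set₁ where
  field
    algebra : ℤ-Algebra
  open ℤ-Algebra algebra public
  field
    _≟_ : DecidableEquality Carrier
    inverse : ∀ x → x ≢ ι# (+ 0) → ∃[ y ] x * y ≡ ι# (+ 1)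
    ι-injective : ∀ {a b} → ι# a ≡ ι# b → a ≡ b
    fraction : ∀ x → ∃[ n ] ∃[ d ] (d ≢ + 0 × x * ι# d ≡ ι# n)

module FieldProperties (K : FractionField) where
  open FractionField K
  open RingSolver algebra public

  cancelˡ : ∀ {a b c} → c ≢ ι# (+ 0) → c * a ≡ c * b → a ≡ b
  cancelˡ {a} {b} {c} c≢0 h with inverse c c≢0
  ... | u , cu = ring 4 (λ a b c u → a := b from (u · c :* a ≈ c :* b ∷ (b :- a) · c :* u ≈ ♯ 1 ∷ []))
    refl (a ∷ b ∷ c ∷ u ∷ []) (h , cu , tt)

  zero-product : ∀ {a b} → a ≢ ι# (+ 0) → a * b ≡ ι# (+ 0) → b ≡ ι# (+ 0)
  zero-product {a} {b} a≢0 h = cancelˡ a≢0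
    (ring 2 (λ a b → a :* b := a :* ♯ 0 from (♯ 1 · a :* b ≈ ♯ 0 ∷ [])) refl (a ∷ b ∷ []) (h , tt))

  product-nonzero : ∀ {a b} → a ≢ ι# (+ 0) → b ≢ ι# (+ 0) → a * b ≢ ι# (+ 0)
  product-nonzero a≢0 b≢0 h = b≢0 (zero-product a≢0 h)

  difference-nonzero : ∀ {a b} → a ≢ b → b - a ≢ ι# (+ 0)
  difference-nonzero {a} {b} a≢b h = a≢b
    (ring 2 (λ a b → a := b from (:- ♯ 1 · b :- a ≈ ♯ 0 ∷ [])) refl (a ∷ b ∷ []) (h , tt))

  ι-nonzero : ∀ {n} → n ≢ + 0 → ι# n ≢ ι# (+ 0)
  ι-nonzero n≢0 h = n≢0 (ι-injective h)

-- The group law on Y² = X³ + AX² + B.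

module EllipticCurve (K : FractionField) (A B : FractionField.Carrier K) where
  open FractionField K
  open FieldProperties K

  OnCurve : Carrier → Carrier → Set
  OnCurve x y = y * y ≡ x * x * x + A * x * x + B

  -- A singular point has y = 0 and lies over a multiple root of the cubic; the second formula is
  -- the derivative of the cubic.
  Nonsingular : Set
  Nonsingular = ∀ x → x * x * x + A * x * x + B ≡ ι# (+ 0) → ι# (+ 3) * x * x + ι# (+ 2) * A * x ≢ ι# (+ 0)

  data Point : Set where
    O : Point
    aff : ∀ x y → OnCurve x y → Point

  aff-cong : ∀ {x x′ y y′ p p′} → x ≡ x′ → y ≡ y′ → aff x y p ≡ aff x′ y′ p′
  aff-cong {p = p} {p′} refl refl = cong (aff _ _) (uip p p′)
    where
    uip : ∀ {a b : Carrier} (p q : a ≡ b) → p ≡ q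
    uip refl refl = refl

  -- One pair of equations covers chords and tangents: the second one is the chord equation
  -- multiplied by the conjugate and divided by the difference of the abscissae.
  record Slope (x₁ y₁ x₂ y₂ m : Carrier) : Set where
    constructor slope
    field
      chord : m * (x₂ - x₁) ≡ y₂ - y₁
      tangent : m * (y₁ + y₂) ≡ x₁ * x₁ + x₁ * x₂ + x₂ * x₂ + A * (x₁ + x₂)

  Opposite : (x₁ y₁ x₂ y₂ : Carrier) → Set
  Opposite x₁ y₁ x₂ y₂ = x₁ ≡ x₂ × y₁ + y₂ ≡ ι# (+ 0)

  data Add : Point → Point → Point → Set where
    O-l : ∀ Q → Add O Q Q
    O-r : ∀ {x y p} → Add (aff x y p) O (aff x y p)
    opposite : ∀ {x₁ y₁ p₁ x₂ y₂ p₂} → Opposite x₁ y₁ x₂ y₂ → Add (aff x₁ y₁ p₁) (aff x₂ y₂ p₂) O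
    line : ∀ {x₁ y₁ p₁ x₂ y₂ p₂ x₃ y₃ p₃} m → ¬ Opposite x₁ y₁ x₂ y₂ → Slope x₁ y₁ x₂ y₂ m →
      x₃ ≡ m * m - A - x₁ - x₂ → y₃ ≡ - (y₁ + m * (x₃ - x₁)) → Add (aff x₁ y₁ p₁) (aff x₂ y₂ p₂) (aff x₃ y₃ p₃)

  private
    opposite? : ∀ x₁ y₁ x₂ y₂ → Dec (Opposite x₁ y₁ x₂ y₂)
    opposite? x₁ y₁ x₂ y₂ with x₁ ≟ x₂ | (y₁ + y₂) ≟ ι# (+ 0)
    ... | yes p | yes q = yes (p , q)
    ... | no ¬p | _ = no λ (p , _) → ¬p p
    ... | yes _ | no ¬q = no λ (_ , q) → ¬q q

    cubic : ∀ {n} → Expr n → Expr n → Expr n → Expr n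
    cubic A B x = x :* x :* x :+ A :* x :* x :+ B

    quad : ∀ {n} → Expr n → Expr n → Expr n → Expr n
    quad A x z = x :* x :+ x :* z :+ z :* z :+ A :* (x :+ z)

    third : ∀ {n} → Expr n → Expr n → Expr n → Expr n → Expr n
    third A m x₁ x₂ = m :* m :- A :- x₁ :- x₂

  -- With distinct abscissae the chord equation determines m and the tangent equation follows. With
  -- equal ones y₁² = y₂² and y₁ + y₂ ≠ 0 give y₁ = y₂, so that the chord equation is trivial and
  -- the tangent equation determines m.
  slope-exists : ∀ {x₁ y₁ x₂ y₂} → OnCurve x₁ y₁ → OnCurve x₂ y₂ → ¬ Opposite x₁ y₁ x₂ y₂ → ∃[ m ] Slope x₁ y₁ x₂ y₂ m
  slope-exists {x₁} {y₁} {x₂} {y₂} p q ¬opp with x₁ ≟ x₂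
  ... | no x₁≢x₂ with inverse (x₂ - x₁) (difference-nonzero x₁≢x₂)
  ...   | u , du = m , slope chord (cancelˡ (difference-nonzero x₁≢x₂)
      (ring 7 (λ A B x₁ y₁ x₂ y₂ m → (x₂ :- x₁) :* (m :* (y₁ :+ y₂)) := (x₂ :- x₁) :* quad A x₁ x₂ from
        (y₁ :+ y₂ · m :* (x₂ :- x₁) ≈ y₂ :- y₁ ∷ :- ♯ 1 · y₁ :* y₁ ≈ cubic A B x₁
        ∷ ♯ 1 · y₂ :* y₂ ≈ cubic A B x₂ ∷ []))
        refl (A ∷ B ∷ x₁ ∷ y₁ ∷ x₂ ∷ y₂ ∷ m ∷ []) (chord , p , q , tt)))
    where
    m = (y₂ - y₁) * u
    chord : m * (x₂ - x₁) ≡ y₂ - y₁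
    chord = ring 3 (λ a d u → a :* u :* d := a from (a · d :* u ≈ ♯ 1 ∷ [])) refl (y₂ - y₁ ∷ x₂ - x₁ ∷ u ∷ []) (du , tt)
  slope-exists {x₁} {y₁} {x₂} {y₂} p q ¬opp | yes refl = m ,
      slope (ring 4 (λ m x y z → m :* (x :- x) := y :- z from (♯ 1 · z ≈ y ∷ [])) refl (m ∷ x₁ ∷ y₂ ∷ y₁ ∷ []) (y₁≡y₂ , tt))
        (ring 3 (λ a d u → a :* u :* d := a from (a · d :* u ≈ ♯ 1 ∷ [])) refl (_ ∷ y₁ + y₂ ∷ proj₁ inv ∷ []) (proj₂ inv , tt))
    where
    sum≢0 : y₁ + y₂ ≢ ι# (+ 0)
    sum≢0 h = ¬opp (refl , h)
    inv = inverse (y₁ + y₂) sum≢0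
    m = (x₁ * x₁ + x₁ * x₁ + x₁ * x₁ + A * (x₁ + x₁)) * proj₁ inv
    y₁≡y₂ : y₁ ≡ y₂
    y₁≡y₂ = cancelˡ sum≢0 (ring 3 (λ y₁ y₂ c → (y₁ :+ y₂) :* y₁ := (y₁ :+ y₂) :* y₂ from
      (♯ 1 · y₁ :* y₁ ≈ c ∷ :- ♯ 1 · y₂ :* y₂ ≈ c ∷ [])) refl (y₁ ∷ y₂ ∷ _ ∷ []) (p , q , tt))

  slope-unique : ∀ {x₁ y₁ x₂ y₂ m n} → ¬ Opposite x₁ y₁ x₂ y₂ → Slope x₁ y₁ x₂ y₂ m → Slope x₁ y₁ x₂ y₂ n → m ≡ n
  slope-unique {x₁} {y₁} {x₂} {y₂} ¬opp (slope c t) (slope c′ t′) with x₁ ≟ x₂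
  ... | no x₁≢x₂ = cancelˡ (difference-nonzero x₁≢x₂) (trans (*-comm _ _) (trans (trans c (sym c′)) (*-comm _ _)))
  ... | yes refl = cancelˡ (λ h → ¬opp (refl , h)) (trans (*-comm _ _) (trans (trans t (sym t′)) (*-comm _ _)))

  third-on-curve : ∀ {x₁ y₁ x₂ y₂ m} → OnCurve x₁ y₁ → OnCurve x₂ y₂ → Slope x₁ y₁ x₂ y₂ m →
    let x₃ = m * m - A - x₁ - x₂ in OnCurve x₃ (- (y₁ + m * (x₃ - x₁)))
  third-on-curve {x₁} {y₁} {x₂} {y₂} {m} p q (slope c t) =
    ring 7 (λ A B x₁ y₁ x₂ y₂ m → let x₃ = third A m x₁ x₂ ; y₃ = :- (y₁ :+ m :* (x₃ :- x₁)) in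
      y₃ :* y₃ := cubic A B x₃ from
      (m :* m :* m :+ ♯ 2 :* y₁ :+ ♯ 2 :* y₂ :- A :* m :- ♯ 2 :* m :* x₁ :- m :* x₂ · m :* (x₂ :- x₁) ≈ y₂ :- y₁
      ∷ :- A :+ m :* m :- ♯ 3 :* x₂ · m :* (y₁ :+ y₂) ≈ quad A x₁ x₂
      ∷ :- ♯ 1 · y₁ :* y₁ ≈ cubic A B x₁ ∷ ♯ 2 · y₂ :* y₂ ≈ cubic A B x₂ ∷ []))
      refl (A ∷ B ∷ x₁ ∷ y₁ ∷ x₂ ∷ y₂ ∷ m ∷ []) (c , t , p , q , tt)

  add-total : ∀ P Q → ∃[ R ] Add P Q R
  add-total O Q = Q , O-l Q
  add-total (aff x y p) O = aff x y p , O-r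
  add-total (aff x₁ y₁ p) (aff x₂ y₂ q) with opposite? x₁ y₁ x₂ y₂
  ... | yes opp = O , opposite opp
  ... | no ¬opp with slope-exists p q ¬opp
  ...   | m , s = aff _ _ (third-on-curve p q s) , line m ¬opp s refl refl

  add-functional : ∀ {P Q R R′} → Add P Q R → Add P Q R′ → R ≡ R′
  add-functional (O-l _) (O-l _) = refl
  add-functional O-r O-r = refl
  add-functional (opposite _) (opposite _) = refl
  add-functional (opposite opp) (line _ ¬opp _ _ _) = contradiction opp ¬opp
  add-functional (line _ ¬opp _ _ _) (opposite opp) = contradiction opp ¬opp
  add-functional (line m ¬opp s refl refl) (line n _ s′ refl refl) with slope-unique ¬opp s s′
  ... | refl = aff-cong refl refl

  opposite-comm : ∀ {x₁ y₁ x₂ y₂} → Opposite x₁ y₁ x₂ y₂ → Opposite x₂ y₂ x₁ y₁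
  opposite-comm (p , q) = sym p , trans (+-comm _ _) q

  add-comm : ∀ {P Q R} → Add P Q R → Add Q P R
  add-comm (O-l O) = O-l O
  add-comm (O-l (aff _ _ _)) = O-r
  add-comm O-r = O-l _
  add-comm (opposite opp) = opposite (opposite-comm opp)
  add-comm (line {x₁} {y₁} {_} {x₂} {y₂} {_} {x₃} m ¬opp (slope c t) x₃≡ y₃≡) =
    line m (λ opp → ¬opp (opposite-comm opp))
      (slope (ring 5 (λ m x₁ y₁ x₂ y₂ → m :* (x₁ :- x₂) := y₁ :- y₂ from (:- ♯ 1 · m :* (x₂ :- x₁) ≈ y₂ :- y₁ ∷ []))
          refl (m ∷ x₁ ∷ y₁ ∷ x₂ ∷ y₂ ∷ []) (c , tt))
        (ring 6 (λ A m x₁ y₁ x₂ y₂ → m :* (y₂ :+ y₁) := quad A x₂ x₁ from (♯ 1 · m :* (y₁ :+ y₂) ≈ quad A x₁ x₂ ∷ []))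
          refl (A ∷ m ∷ x₁ ∷ y₁ ∷ x₂ ∷ y₂ ∷ []) (t , tt)))
      (trans x₃≡ (ring 4 (λ A m x₁ x₂ → third A m x₁ x₂ := third A m x₂ x₁ from []) refl (A ∷ m ∷ x₁ ∷ x₂ ∷ []) tt))
      (trans y₃≡ (ring 6 (λ m x₁ y₁ x₂ y₂ x₃ → :- (y₁ :+ m :* (x₃ :- x₁)) := :- (y₂ :+ m :* (x₃ :- x₂)) from
        (:- ♯ 1 · m :* (x₂ :- x₁) ≈ y₂ :- y₁ ∷ [])) refl (m ∷ x₁ ∷ y₁ ∷ x₂ ∷ y₂ ∷ x₃ ∷ []) (c , tt)))

  opposite-on-curve : ∀ {x y} → OnCurve x y → OnCurve x (- y)
  opposite-on-curve {x} {y} p = trans (ring 1 (λ y → (:- y) :* (:- y) := y :* y from []) refl (y ∷ []) tt) p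

  infix 9 ⊖_
  ⊖_ : Point → Point
  ⊖ O = O
  ⊖ aff x y p = aff x (- y) (opposite-on-curve p)

  ⊖-involutive : ∀ P → ⊖ ⊖ P ≡ P
  ⊖-involutive O = refl
  ⊖-involutive (aff x y p) = aff-cong refl (ring 1 (λ y → :- (:- y) := y from []) refl (y ∷ []) tt)

  add-inverse : ∀ P → Add P (⊖ P) O
  add-inverse O = O-l O
  add-inverse (aff x y p) = opposite (refl , ring 1 (λ y → y :+ :- y := ♯ 0 from []) refl (y ∷ []) tt)

  add-O⇒⊖ : ∀ {P Q} → Add P Q O → Q ≡ ⊖ P
  add-O⇒⊖ (O-l _) = refl
  add-O⇒⊖ (opposite {y₁ = y₁} {y₂ = y₂} (refl , h)) = aff-cong refl
    (ring 2 (λ y₁ y₂ → y₂ := :- y₁ from (♯ 1 · y₁ :+ y₂ ≈ ♯ 0 ∷ [])) refl (y₁ ∷ y₂ ∷ []) (h , tt))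

  add-⊖ : ∀ {P Q R} → Add P Q R → Add (⊖ P) (⊖ Q) (⊖ R)
  add-⊖ (O-l _) = O-l _
  add-⊖ O-r = O-r
  add-⊖ (opposite {y₁ = y₁} {y₂ = y₂} (e , h)) = opposite (e ,
    ring 2 (λ y₁ y₂ → :- y₁ :+ :- y₂ := ♯ 0 from (:- ♯ 1 · y₁ :+ y₂ ≈ ♯ 0 ∷ [])) refl (y₁ ∷ y₂ ∷ []) (h , tt))
  add-⊖ (line {x₁} {y₁} {_} {x₂} {y₂} {_} {x₃} {y₃} m ¬opp (slope c t) x₃≡ y₃≡) = line (- m)
    (λ (e , h) → ¬opp (e , ring 2 (λ y₁ y₂ → y₁ :+ y₂ := ♯ 0 from (:- ♯ 1 · :- y₁ :+ :- y₂ ≈ ♯ 0 ∷ [])) refl (y₁ ∷ y₂ ∷ []) (h , tt)))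
    (slope (ring 5 (λ m x₁ y₁ x₂ y₂ → (:- m) :* (x₂ :- x₁) := :- y₂ :- :- y₁ from (:- ♯ 1 · m :* (x₂ :- x₁) ≈ y₂ :- y₁ ∷ []))
        refl (m ∷ x₁ ∷ y₁ ∷ x₂ ∷ y₂ ∷ []) (c , tt))
      (ring 6 (λ A m x₁ y₁ x₂ y₂ → (:- m) :* (:- y₁ :+ :- y₂) := quad A x₁ x₂ from (♯ 1 · m :* (y₁ :+ y₂) ≈ quad A x₁ x₂ ∷ []))
        refl (A ∷ m ∷ x₁ ∷ y₁ ∷ x₂ ∷ y₂ ∷ []) (t , tt)))
    (trans x₃≡ (ring 4 (λ A m x₁ x₂ → third A m x₁ x₂ := third A (:- m) x₁ x₂ from []) refl (A ∷ m ∷ x₁ ∷ x₂ ∷ []) tt))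
    (ring 5 (λ m x₁ y₁ x₃ y₃ → :- y₃ := :- (:- y₁ :+ (:- m) :* (x₃ :- x₁)) from
      (:- ♯ 1 · y₃ ≈ :- (y₁ :+ m :* (x₃ :- x₁)) ∷ [])) refl (m ∷ x₁ ∷ y₁ ∷ x₃ ∷ y₃ ∷ []) (y₃≡ , tt))

  module Group (nonsingular : Nonsingular) where

    2≢0 : ι# (+ 2) ≢ ι# (+ 0)
    2≢0 = ι-nonzero (λ ())

    -- The line through -P and Q, reflected, is the line through P and R, so its slope is -m. What
    -- needs an argument is that R is not -P: otherwise y + y₃ = 0, the chord equation gives y = y₃
    -- and hence y = 0, and by the tangent equation the derivative of the cubic vanishes at x as
    -- well. Here nonsingularity enters.
    add-cancel : ∀ {P Q R} → Add (⊖ P) Q R → Add P R Q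
    add-cancel {O} (O-l Q) = O-l Q
    add-cancel {aff x y p} O-r = add-inverse _
    add-cancel {aff x y p} (opposite {y₂ = y₂} (refl , h)) = subst (Add _ O) (aff-cong refl
      (ring 2 (λ y y₂ → y := y₂ from (:- ♯ 1 · :- y :+ y₂ ≈ ♯ 0 ∷ [])) refl (y ∷ y₂ ∷ []) (h , tt))) O-r
    add-cancel {aff x y p} (line {x₂ = x₂} {y₂} {x₃ = x₃} {y₃} m ¬opp (slope c t) refl refl) = line (- m)
      (λ (x≡x₃ , s) → tangent-at-2-torsion x≡x₃ s)
      (slope chord₃ tangent₃)
      (ring 4 (λ A m x x₂ → x₂ := third A (:- m) x (third A m x x₂) from []) refl (A ∷ m ∷ x ∷ x₂ ∷ []) tt)
      (ring 5 (λ m x y x₂ y₂ → y₂ := :- (y :+ (:- m) :* (x₂ :- x)) from (:- ♯ 1 · m :* (x₂ :- x) ≈ y₂ :- :- y ∷ []))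
        refl (m ∷ x ∷ y ∷ x₂ ∷ y₂ ∷ []) (c , tt))
      where
      chord₃ : - m * (x₃ - x) ≡ y₃ - y
      chord₃ = ring 4 (λ m x y x₃ → (:- m) :* (x₃ :- x) := :- (:- y :+ m :* (x₃ :- x)) :- y from []) refl (m ∷ x ∷ y ∷ x₃ ∷ []) tt
      tangent₃ : - m * (y + y₃) ≡ x * x + x * x₃ + x₃ * x₃ + A * (x + x₃)
      tangent₃ = ring 6 (λ A m x y x₂ y₂ → let x₃ = third A m x x₂ in
          (:- m) :* (y :+ :- (:- y :+ m :* (x₃ :- x))) := quad A x x₃ from
          (m · m :* (x₂ :- x) ≈ y₂ :- :- y ∷ ♯ 1 · m :* (:- y :+ y₂) ≈ quad A x x₂ ∷ []))
          refl (A ∷ m ∷ x ∷ y ∷ x₂ ∷ y₂ ∷ []) (c , t , tt)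
      tangent-at-2-torsion : x ≡ x₃ → y + y₃ ≡ ι# (+ 0) → ⊥
      tangent-at-2-torsion x≡x₃ s = nonsingular x
        (ring 4 (λ A B x y → cubic A B x := ♯ 0 from (:- ♯ 1 · y :* y ≈ cubic A B x ∷ y · y ≈ ♯ 0 ∷ []))
          refl (A ∷ B ∷ x ∷ y ∷ []) (p , y≡0 , tt))
        (ring 5 (λ A m x x₃ s → ♯ 3 :* x :* x :+ ♯ 2 :* A :* x := ♯ 0 from
          (:- m · s ≈ ♯ 0 ∷ :- ♯ 1 · (:- m) :* s ≈ quad A x x₃ ∷ ♯ 2 :* x :+ x₃ :+ A · x ≈ x₃ ∷ []))
          refl (A ∷ m ∷ x ∷ x₃ ∷ y + y₃ ∷ []) (s , tangent₃ , x≡x₃ , tt))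
        where
        y≡0 : y ≡ ι# (+ 0)
        y≡0 = zero-product 2≢0 (ring 5 (λ m x x₃ y y₃ → ♯ 2 :* y := ♯ 0 from
          (♯ 1 · y :+ y₃ ≈ ♯ 0 ∷ ♯ 1 · (:- m) :* (x₃ :- x) ≈ y₃ :- y ∷ :- m · x ≈ x₃ ∷ []))
          refl (m ∷ x ∷ x₃ ∷ y ∷ y₃ ∷ []) (s , chord₃ , x≡x₃ , tt))

    private
      module Lines {xA yA xB yB xC yC m n k : Carrier} (¬BC : ¬ Opposite xB yB xC yC)
        (sAB : Slope xA yA xB yB m) (sBC : Slope xB yB xC yC n)
        (sSC : Slope (m * m - A - xA - xB) (- (yA + m * (m * m - A - xA - xB - xA))) xC yC k) where
        open Slope sAB renaming (chord to s₁; tangent to s₂)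
        open Slope sBC renaming (chord to t₁; tangent to t₂)
        open Slope sSC renaming (chord to u₁; tangent to u₂)

        xS = m * m - A - xA - xB
        yS = - (yA + m * (xS - xA))
        xT = n * n - A - xB - xC
        yT = - (yB + n * (xT - xB))
        -- The slope is a 2-cocycle: slope(A, B) + slope(A + B, C) = slope(B, C) + slope(A, B + C).
        -- This predicts the slope of the line through A and T = B + C, and both slope equations are
        -- then verified for it.
        l = k + m - n

        ρ : Vec Carrier 10
        ρ = A ∷ xA ∷ yA ∷ xB ∷ yB ∷ xC ∷ yC ∷ m ∷ n ∷ k ∷ []

        lines : Fun 10 (Expr 10) (Expr 10 × Expr 10 × List (Expr 10)) → Fun 10 (Expr 10) (Problem 10)
        lines h A xA yA xB yB xC yC m n k = go (h A xA yA xB yB xC yC m n k)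
          where
          xSₑ = third A m xA xB
          ySₑ = :- (yA :+ m :* (xSₑ :- xA))
          hyps : List (Expr 10) → List (Hypothesis 10)
          hyps (c₁ ∷ c₂ ∷ c₃ ∷ c₄ ∷ c₅ ∷ c₆ ∷ _) =
            c₁ · m :* (xB :- xA) ≈ yB :- yA ∷ c₂ · m :* (yA :+ yB) ≈ quad A xA xB
            ∷ c₃ · n :* (xC :- xB) ≈ yC :- yB ∷ c₄ · n :* (yB :+ yC) ≈ quad A xB xC
            ∷ c₅ · k :* (xC :- xSₑ) ≈ yC :- ySₑ ∷ c₆ · k :* (ySₑ :+ yC) ≈ quad A xSₑ xC ∷ []
          hyps _ = []
          go : Expr 10 × Expr 10 × List (Expr 10) → Problem 10
          go (l , r , cs) = l := r from hyps cs

        given = s₁ , s₂ , t₁ , t₂ , u₁ , u₂ , tt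

        key-S : (xC - xS) * ((n - m) * (k + m)) ≡ (xC - xS) * (xC - xA)
        key-S = ring 10 (lines λ A xA yA xB yB xC yC m n k → let xS = third A m xA xB in
          (xC :- xS) :* ((n :- m) :* (k :+ m)) , (xC :- xS) :* (xC :- xA) ,
          n ∷ :- ♯ 1 ∷ m ∷ ♯ 1 ∷ n :- m ∷ ♯ 0 ∷ []) refl ρ given

        key-B : (xC - xB) * ((n - m) * (k + m)) ≡ (xC - xB) * (xC - xA)
        key-B = ring 10 (lines λ A xA yA xB yB xC yC m n k →
          (xC :- xB) :* ((n :- m) :* (k :+ m)) , (xC :- xB) :* (xC :- xA) ,
          k ∷ :- ♯ 1 ∷ k :+ m ∷ ♯ 0 ∷ :- m ∷ ♯ 1 ∷ []) refl ρ given

        -- The identity behind the cocycle relation. It follows from the slope equations only after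
        -- multiplication by xC - xS or by xC - xB, so that one of these factors has to be nonzero.
        key : (n - m) * (k + m) ≡ xC - xA
        key = cases (xS ≟ xC) (xB ≟ xC)
          where
          yB≡yC : xB ≡ xC → yB ≡ yC
          yB≡yC xB≡xC = ring 5 (λ n xB xC yB yC → yB := yC from (♯ 1 · n :* (xC :- xB) ≈ yC :- yB ∷ n · xB ≈ xC ∷ []))
            refl (n ∷ xB ∷ xC ∷ yB ∷ yC ∷ []) (t₁ , xB≡xC , tt)
          yC≡yS : xS ≡ xC → yC ≡ yS
          yC≡yS xS≡xC = ring 5 (λ n xB xC yB yC → yC := yB from (:- ♯ 1 · n :* (xC :- xB) ≈ yC :- yB ∷ :- n · xB ≈ xC ∷ []))
            refl (k ∷ xS ∷ xC ∷ yS ∷ yC ∷ []) (u₁ , xS≡xC , tt)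
          s₁′ : xB ≡ xC → xS ≡ xC → m * (xS - xA) ≡ yB - yA
          s₁′ xB≡xC xS≡xC = subst (λ x → m * (x - xA) ≡ yB - yA) (trans xB≡xC (sym xS≡xC)) s₁
          cases : Dec (xS ≡ xC) → Dec (xB ≡ xC) → (n - m) * (k + m) ≡ xC - xA
          cases (no ≢) _ = cancelˡ (difference-nonzero ≢) key-S
          cases (yes _) (no ≢) = cancelˡ (difference-nonzero ≢) key-B
          -- If all three abscissae agree, then yB = yC = yS. The line through A and B gives yS =
          -- -yB, because xS = xB, and so B and C would be opposite.
          cases (yes xS≡xC) (yes xB≡xC) = ⊥-elim (¬BC (xB≡xC , trans (cong (_+ yC) (yB≡yC xB≡xC))
            (ring 6 (λ m yA yC xS xA yB → yC :+ yC := ♯ 0 from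
              (♯ 1 · yC ≈ :- (yA :+ m :* (xS :- xA)) ∷ :- ♯ 1 · yB ≈ yC ∷ :- ♯ 1 · m :* (xS :- xA) ≈ yB :- yA ∷ []))
              refl (m ∷ yA ∷ yC ∷ xS ∷ xA ∷ yB ∷ []) (yC≡yS xS≡xC , yB≡yC xB≡xC , s₁′ xB≡xC xS≡xC , tt))))

        chord-AT : l * (xT - xA) ≡ yT - yA
        chord-AT = cases (m ≟ n)
          where
          xC≡xA : m ≡ n → xC ≡ xA
          xC≡xA m≡n = ring 5 (λ xA xC m n k → xC := xA from (:- ♯ 1 · (n :- m) :* (k :+ m) ≈ xC :- xA ∷ :- (k :+ m) · m ≈ n ∷ []))
            refl (xA ∷ xC ∷ m ∷ n ∷ k ∷ []) (key , m≡n , tt)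
          yC≡yA : m ≡ n → yC ≡ yA
          yC≡yA m≡n = ring 8 (λ xA yA xB yB xC yC m n → yC := yA from
            (:- ♯ 1 · m :* (xB :- xA) ≈ yB :- yA ∷ :- ♯ 1 · n :* (xC :- xB) ≈ yC :- yB
            ∷ xB :- xA · m ≈ n ∷ n · xC ≈ xA ∷ [])) refl (xA ∷ yA ∷ xB ∷ yB ∷ xC ∷ yC ∷ m ∷ n ∷ []) (s₁ , t₁ , m≡n , xC≡xA m≡n , tt)
          cases : Dec (m ≡ n) → l * (xT - xA) ≡ yT - yA
          cases (no m≢n) = cancelˡ (difference-nonzero m≢n) (ring 10 (λ A xA yA xB yB xC yC m n k →
            let xT = third A n xB xC; yT = :- (yB :+ n :* (xT :- xB)) in
            (n :- m) :* ((k :+ m :- n) :* (xT :- xA)) := (n :- m) :* (yT :- yA) from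
            (n :- m · n :* (xC :- xB) ≈ yC :- yB ∷ m :- n · k :* (xC :- third A m xA xB) ≈ yC :- :- (yA :+ m :* (third A m xA xB :- xA))
            ∷ n :* n :- m :* m · (n :- m) :* (k :+ m) ≈ xC :- xA ∷ [])) refl ρ (t₁ , u₁ , key , tt))
          -- Equal slopes force A = C by `key`, and the chord equation can be checked without
          -- dividing by n - m.
          cases (yes m≡n) = ring 10 (λ A xA yA xB yB xC yC m n k →
            let xT = third A n xB xC; yT = :- (yB :+ n :* (xT :- xB)) in
            (k :+ m :- n) :* (xT :- xA) := yT :- yA from
            (:- ♯ 1 · m :* (xB :- xA) ≈ yB :- yA
            ∷ :- ♯ 1 · k :* (xC :- third A m xA xB) ≈ yC :- :- (yA :+ m :* (third A m xA xB :- xA))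
            ∷ :- (m :* m :- xB :+ xC :+ k :* m :+ k :* n :+ m :* n) · m ≈ n ∷ :- n · xC ≈ xA ∷ :- ♯ 1 · yC ≈ yA ∷ []))
            refl ρ (s₁ , u₁ , m≡n , xC≡xA m≡n , yC≡yA m≡n , tt)

        tangent-AT : l * (yA + yT) ≡ xA * xA + xA * xT + xT * xT + A * (xA + xT)
        tangent-AT = ring 10 (λ A xA yA xB yB xC yC m n k →
          let xT = third A n xB xC; yT = :- (yB :+ n :* (xT :- xB)); xS = third A m xA xB; yS = :- (yA :+ m :* (xS :- xA)) in
          (k :+ m :- n) :* (yA :+ yT) := quad A xA xT from
          (m · m :* (xB :- xA) ≈ yB :- yA ∷ ♯ 1 · m :* (yA :+ yB) ≈ quad A xA xB
          ∷ :- k :- m · n :* (xC :- xB) ≈ yC :- yB ∷ ♯ 1 · n :* (yB :+ yC) ≈ quad A xB xC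
          ∷ m :+ n · k :* (xC :- xS) ≈ yC :- yS ∷ :- ♯ 1 · k :* (yS :+ yC) ≈ quad A xS xC
          ∷ :- n :* n :- xA :+ xC :- m :* n · (n :- m) :* (k :+ m) ≈ xC :- xA ∷ [])) refl ρ
          (s₁ , s₂ , t₁ , t₂ , u₁ , u₂ , key , tt)

        x-AT : k * k - A - xS - xC ≡ l * l - A - xA - xT
        x-AT = ring 8 (λ A xA xB xC m n k _ →
          third A k (third A m xA xB) xC := third A (k :+ m :- n) xA (third A n xB xC) from
          (♯ 2 · (n :- m) :* (k :+ m) ≈ xC :- xA ∷ [])) refl (A ∷ xA ∷ xB ∷ xC ∷ m ∷ n ∷ k ∷ k ∷ []) (key , tt)

        y-AT : ∀ xU → xU ≡ k * k - A - xS - xC → - (yS + k * (xU - xS)) ≡ - (yA + l * (xU - xA))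
        y-AT _ refl = ring 10 (λ A xA yA xB yB xC yC m n k →
          let xS = third A m xA xB; yS = :- (yA :+ m :* (xS :- xA)); xU = third A k xS xC in
          :- (yS :+ k :* (xU :- xS)) := :- (yA :+ (k :+ m :- n) :* (xU :- xA)) from
          (♯ 1 · m :* (xB :- xA) ≈ yB :- yA ∷ ♯ 1 · n :* (xC :- xB) ≈ yC :- yB
          ∷ :- ♯ 1 · k :* (xC :- xS) ≈ yC :- yS ∷ m :- k · (n :- m) :* (k :+ m) ≈ xC :- xA ∷ [])) refl ρ
          (s₁ , t₁ , u₁ , key , tt)

    affine≢O : ∀ {x y p} → aff x y p ≢ O
    affine≢O ()

    add-Oʳ : ∀ P → Add P O P
    add-Oʳ O = O-l O
    add-Oʳ (aff _ _ _) = O-r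

    add-cancel′ : ∀ {P Q R} → Add P Q R → Add R (⊖ Q) P
    add-cancel′ {P} {Q} {R} s = add-comm (add-cancel (subst (λ Z → Add Z P R) (sym (⊖-involutive Q)) (add-comm s)))

    add-opposite-sum : ∀ {P Q R S T} → Add P Q R → Add R T O → Add Q T S → Add P S O
    add-opposite-sum {P} {Q} {R} {S} {T} s u t = subst (λ Z → Add P Z O) (add-functional -P t) (add-inverse P)
      where
      -P : Add Q T (⊖ P)
      -P = subst₂ (λ Y Z → Add Y Z (⊖ P)) (⊖-involutive Q) (sym (add-O⇒⊖ u)) (add-⊖ (add-comm (add-cancel′ s)))

    add-opposite-first : ∀ {P Q R T} → Add P Q O → Add Q R T → Add P T R
    add-opposite-first {R = R} {T} s t = add-cancel (subst (λ Z → Add Z R T) (add-O⇒⊖ s) t)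

    add-opposite-second : ∀ {P Q R S U} → Add P Q S → Add Q R O → Add S R U → Add P O U
    add-opposite-second {P} {Q} {R} {S} s t u = subst (Add P O)
      (add-functional (subst (λ Z → Add S Z P) (sym (add-O⇒⊖ t)) (add-cancel′ s)) u) (add-Oʳ P)

    -- Wherever one of the sums is O, the law follows from cancellation and the inverse laws. The
    -- remaining case has four proper lines and rests on the cocycle relation for slopes.
    add-assoc : ∀ {P Q R S T U} → Add P Q S → Add Q R T → Add S R U → Add P T U
    add-assoc {T = T} (O-l _) t u = subst (Add O T) (add-functional t u) (O-l T)
    add-assoc O-r (O-l _) u = u
    add-assoc s@(opposite _) O-r (O-l _) = s
    add-assoc s@(line _ _ _ _ _) O-r O-r = s
    add-assoc s@(opposite _) t@(opposite _) u@(O-l _) = add-opposite-second s t u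
    add-assoc s@(opposite _) t@(line _ _ _ _ _) (O-l _) = add-opposite-first s t
    add-assoc s@(line _ _ _ _ _) t@(opposite _) u = add-opposite-second s t u
    add-assoc s@(line _ _ _ _ _) t@(line _ _ _ _ _) u@(opposite _) = add-opposite-sum s u t
    add-assoc s@(line {xA} {yA} m _ sAB refl refl) t@(line {p₃ = pT} n ¬BC sBC refl refl) u@(line k _ sSC refl refl) =
      line (k + m - n) ¬AT (slope chord-AT tangent-AT) x-AT (y-AT _ refl)
      where
      open Lines ¬BC sAB sBC sSC
      -- If A were opposite to B + C, then C would be opposite to A + B, whereas S + C is an affine
      -- point.
      ¬AT : ¬ Opposite xA yA xT yT
      ¬AT opp = affine≢O (add-functional u (add-comm (add-opposite-sum (add-comm t) (add-comm (opposite opp)) (add-comm s))))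

-- Coprimality in ℤ.

ℤ-algebra : ℤ-Algebra
ℤ-algebra = record
  { isCommutativeRing = ℤₚ.+-*-isCommutativeRing
  ; ι# = λ z → z
  ; ι-+ = λ _ _ → refl
  ; ι-* = λ _ _ → refl
  ; ι-neg = λ _ → refl
  ; ι-0 = refl
  ; ι-1 = refl
  }

module ℤArithmetic where
  open import Data.Integer using (_+_; _*_; -_; _-_; ∣_∣; _^_)
  open RingSolver ℤ-algebra public using () renaming (ring to ringℤ)

  cancelℤ : ∀ {a b c} → c ≢ + 0 → c * a ≡ c * b → a ≡ b
  cancelℤ {a} {b} {c} c≢0 = ℤₚ.*-cancelˡ-≡ c a b {{ℤ.≢-nonZero c≢0}}

  zero-productℤ : ∀ {a b} → a ≢ + 0 → a * b ≡ + 0 → b ≡ + 0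
  zero-productℤ {a} {b} a≢0 h = cancelℤ {c = a} a≢0 (trans h (sym (ℤₚ.*-zeroʳ a)))

  product-nonzeroℤ : ∀ {a b} → a ≢ + 0 → b ≢ + 0 → a * b ≢ + 0
  product-nonzeroℤ a≢0 b≢0 h = b≢0 (zero-productℤ a≢0 h)

  -- Coprimality is carried by Bézout coefficients: its rules become polynomial identities, and no
  -- greatest common divisor has to be handled later.
  record Comaximal (a b : ℤ) : Set where
    constructor bezout
    field
      u v : ℤ
      identity : u * a + v * b ≡ + 1

  comaximal-sym : ∀ {a b} → Comaximal a b → Comaximal b a
  comaximal-sym {a} {b} (bezout u v e) = bezout v u (trans (ℤₚ.+-comm (v * b) (u * a)) e)

  comaximal-*ʳ : ∀ {a b c} → Comaximal a b → Comaximal a c → Comaximal a (b * c)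
  comaximal-*ʳ {a} {b} {c} (bezout u v e) (bezout u′ v′ e′) = bezout (u * u′ * a + u * v′ * c + v * b * u′) (v * v′)
    (ringℤ 7 (λ a b c u v u′ v′ → (u :* u′ :* a :+ u :* v′ :* c :+ v :* b :* u′) :* a :+ v :* v′ :* (b :* c) := ♯ 1 from
      (u′ :* a :+ v′ :* c · u :* a :+ v :* b ≈ ♯ 1 ∷ ♯ 1 · u′ :* a :+ v′ :* c ≈ ♯ 1 ∷ []))
      refl (a ∷ b ∷ c ∷ u ∷ v ∷ u′ ∷ v′ ∷ []) (e , e′ , tt))

  comaximal-*ˡ : ∀ {a b c} → Comaximal a c → Comaximal b c → Comaximal (a * b) c
  comaximal-*ˡ h h′ = comaximal-sym (comaximal-*ʳ (comaximal-sym h) (comaximal-sym h′))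

  comaximal-1 : ∀ {a} → Comaximal a (+ 1)
  comaximal-1 = bezout (+ 0) (+ 1) refl

  comaximal-^ʳ : ∀ {a b} n → Comaximal a b → Comaximal a (b ^ n)
  comaximal-^ʳ zero h = comaximal-1
  comaximal-^ʳ (suc n) h = comaximal-*ʳ h (comaximal-^ʳ n h)

  comaximal-divisor : ∀ {a b c} → c ∣ b → Comaximal a b → Comaximal a c
  comaximal-divisor {a} {b} {c} (divides q refl) (bezout u v e) = bezout u (v * q)
    (trans (cong (_+_ (u * a)) (ℤₚ.*-assoc v q c)) e)

  comaximal-shift : ∀ {e n} k → Comaximal e n → Comaximal e (n + e * k)
  comaximal-shift {e} {n} k (bezout u v c) = bezout (u - v * k) v
    (ringℤ 5 (λ e n k u v → (u :- v :* k) :* e :+ v :* (n :+ e :* k) := ♯ 1 from (♯ 1 · u :* e :+ v :* n ≈ ♯ 1 ∷ []))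
      refl (e ∷ n ∷ k ∷ u ∷ v ∷ []) (c , tt))

  divides-cancelˡ : ∀ {a b c} → Comaximal a b → a ∣ b * c → a ∣ c
  divides-cancelˡ {a} {b} {c} (bezout u v e) (divides q h) = divides (u * c + v * q)
    (ringℤ 6 (λ a b c u v q → c := (u :* c :+ v :* q) :* a from
      (:- c · u :* a :+ v :* b ≈ ♯ 1 ∷ v · b :* c ≈ q :* a ∷ [])) refl (a ∷ b ∷ c ∷ u ∷ v ∷ q ∷ []) (e , h , tt))

  sign-split : ∀ n → ∃[ s ] (s * s ≡ + 1 × n ≡ s * + ∣ n ∣)
  sign-split (+ n) = + 1 , refl , sym (ℤₚ.*-identityˡ (+ n))
  sign-split -[1+ n ] = -[1+ 0 ] , refl , sym (ℤₚ.-1*i≡-i (+ suc n))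

  record Reduced (n d : ℤ) : Set where
    constructor reduced
    field
      g n′ d′ : ℤ
      n≡ : n ≡ g * n′
      d≡ : d ≡ g * d′
      coprime : Comaximal d′ n′

  reduce : ∀ n d → d ≢ + 0 → Reduced n d
  reduce n d d≢0 with sign-split n | sign-split d | Bézout.lemma ∣ n ∣ ∣ d ∣
  ... | s , ss , n≡ | t , tt₁ , d≡ | Bézout.result g (GCD.is (ℕDiv.divides p n₁ , ℕDiv.divides q d₁) _) b =
    reduced (+ g) (s * + p) (t * + q) (factor {n} {s} n≡ n₁) (factor {d} {t} d≡ d₁) (coprime b)
    where
    factor : ∀ {m s k p} → m ≡ s * + k → k ≡ p ℕ.* g → m ≡ + g * (s * + p)
    factor {s = s} {p = p} refl refl = trans (cong (s *_) (ℤₚ.pos-* p g))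
      (ringℤ 3 (λ s p g → s :* (p :* g) := g :* (s :* p) from []) refl (s ∷ + p ∷ + g ∷ []) tt)
    g≢0 : + g ≢ + 0
    g≢0 h = d≢0 (trans (factor {d} {t} d≡ d₁) (trans (cong (_* (t * + q)) h) (ℤₚ.*-zeroˡ (t * + q))))
    pos : ∀ x {m} p → m ≡ p ℕ.* g → + (x ℕ.* m) ≡ + x * (+ p * + g)
    pos x p refl = trans (ℤₚ.pos-* x (p ℕ.* g)) (cong (+ x *_) (ℤₚ.pos-* p g))
    coprime : Bézout.Identity g ∣ n ∣ ∣ d ∣ → Comaximal (t * + q) (s * + p)
    coprime (Bézout.+- x y e) = bezout (- (+ y * t)) (+ x * s) (cancelℤ {c = + g} g≢0
      (ringℤ 7 (λ g x y s t p q → g :* ((:- (y :* t)) :* (t :* q) :+ x :* s :* (s :* p)) := g :* ♯ 1 from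
        (:- g :* y :* q · t :* t ≈ ♯ 1 ∷ g :* x :* p · s :* s ≈ ♯ 1
        ∷ :- ♯ 1 · g :+ y :* (q :* g) ≈ x :* (p :* g) ∷ []))
        refl (+ g ∷ + x ∷ + y ∷ s ∷ t ∷ + p ∷ + q ∷ [])
        (tt₁ , ss , trans (cong (_+_ (+ g)) (sym (pos y q d₁))) (trans (cong +_ e) (pos x p n₁)) , tt)))
    coprime (Bézout.-+ x y e) = bezout (+ y * t) (- (+ x * s)) (cancelℤ {c = + g} g≢0
      (ringℤ 7 (λ g x y s t p q → g :* (y :* t :* (t :* q) :+ (:- (x :* s)) :* (s :* p)) := g :* ♯ 1 from
        (g :* y :* q · t :* t ≈ ♯ 1 ∷ :- g :* x :* p · s :* s ≈ ♯ 1
        ∷ :- ♯ 1 · g :+ x :* (p :* g) ≈ y :* (q :* g) ∷ []))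
        refl (+ g ∷ + x ∷ + y ∷ s ∷ t ∷ + p ∷ + q ∷ [])
        (tt₁ , ss , trans (cong (_+_ (+ g)) (sym (pos x p n₁))) (trans (cong +_ e) (pos y q d₁)) , tt)))

open ℤArithmetic public

-- Integral elements and the rational root theorem.

module Integrality (K : FractionField) where
  open FractionField K
  open FieldProperties K

  Integral : Carrier → Set
  Integral x = ∃[ n ] x ≡ ι# n

  horner : List ℤ → Carrier → Carrier
  horner [] x = ι# (+ 1)
  horner (c ∷ cs) x = ι# c + x * horner cs x

  record LowestTerms (x : Carrier) : Set where
    constructor lowest
    field
      num den : ℤ
      den≢0 : den ≢ + 0
      x≡ : x * ι# den ≡ ι# num
      coprime : Comaximal den num

  lowest-terms : ∀ x → LowestTerms x
  lowest-terms x with fraction x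
  ... | n , d , d≢0 , x≡ with reduce n d d≢0
  ...   | reduced g n′ d′ refl refl c = lowest n′ d′ (λ { refl → d≢0 (ℤₚ.*-zeroʳ g) })
    (cancelˡ (ι-nonzero g≢0) (ring 4 (λ x g n d → g :* (x :* d) := g :* n from (♯ 1 · x :* (g :* d) ≈ g :* n ∷ []))
      refl (x ∷ ι# g ∷ ι# n′ ∷ ι# d′ ∷ []) (trans (cong (x *_) (sym (ι-* g d′))) (trans x≡ (ι-* g n′)) , tt))) c
    where
    g≢0 : g ≢ + 0
    g≢0 refl = d≢0 (ℤₚ.*-zeroˡ d′)

  unit-denominator : ∀ {x d n} e → x * ι# d ≡ ι# n → d ℤ.* e ≡ + 1 → Integral x
  unit-denominator {x} {d} {n} e x≡ de = n ℤ.* e ,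
    ring 5 (λ x d n e ne → x := ne from (:- x · d :* e ≈ ♯ 1 ∷ e · x :* d ≈ n ∷ :- ♯ 1 · ne ≈ n :* e ∷ []))
      refl (x ∷ ι# d ∷ ι# n ∷ ι# e ∷ ι# (n ℤ.* e) ∷ []) (trans (sym (ι-* d e)) (cong ι# de) , x≡ , ι-* n e , tt)

  private
    -- For a monic polynomial of degree l the value at n/d times d^l is n^l modulo d. At a root this
    -- makes d a divisor of n^l, to which it is prime.
    clear-denominators : ∀ {x d n} → x * ι# d ≡ ι# n → ∀ cs →
      ∃[ l ] ∃[ k ] ι# (d ℤ.^ l) * horner cs x ≡ ι# (n ℤ.^ l ℤ.+ d ℤ.* k)
    clear-denominators {d = d} x≡ [] = 0 , + 0 , trans (ring 1 (λ a → a :* ♯ 1 := a from []) refl (ι# (+ 1) ∷ []) tt)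
      (cong ι# (sym (trans (cong (ℤ._+_ (+ 1)) (ℤₚ.*-zeroʳ d)) refl)))
    clear-denominators {x} {d} {n} x≡ (c ∷ cs) with clear-denominators x≡ cs
    ... | l , k , h = suc l , d^l ℤ.* c ℤ.+ n ℤ.* k , (begin
      ι# (d ℤ.* d^l) * (ι# c + x * horner cs x) ≡⟨ cong (_* (ι# c + x * horner cs x)) (ι-* d d^l) ⟩
      ι# d * ι# d^l * (ι# c + x * horner cs x) ≡⟨ ring 8 (λ x d n D c h N _ →
          d :* D :* (c :+ x :* h) := d :* (D :* c) :+ n :* N from
          (D :* h · x :* d ≈ n ∷ n · D :* h ≈ N ∷ [])) refl
          (x ∷ ι# d ∷ ι# n ∷ ι# d^l ∷ ι# c ∷ horner cs x ∷ ι# N ∷ x ∷ []) (x≡ , h , tt) ⟩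
      ι# d * (ι# d^l * ι# c) + ι# n * ι# N
        ≡⟨ cong₂ (λ u v → u + v) (trans (cong (ι# d *_) (sym (ι-* d^l c))) (sym (ι-* d (d^l ℤ.* c)))) (sym (ι-* n N)) ⟩
      ι# (d ℤ.* (d^l ℤ.* c)) + ι# (n ℤ.* N) ≡⟨ sym (ι-+ (d ℤ.* (d^l ℤ.* c)) (n ℤ.* N)) ⟩
      ι# (d ℤ.* (d^l ℤ.* c) ℤ.+ n ℤ.* N) ≡⟨ cong ι# (ringℤ 6 (λ d n D c k P →
          d :* (D :* c) :+ n :* (P :+ d :* k) := n :* P :+ d :* (D :* c :+ n :* k) from []) refl
          (d ∷ n ∷ d^l ∷ c ∷ k ∷ n ℤ.^ l ∷ []) tt) ⟩
      ι# (n ℤ.* n ℤ.^ l ℤ.+ d ℤ.* (d^l ℤ.* c ℤ.+ n ℤ.* k)) ∎)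
      where
      open ≡-Reasoning
      d^l = d ℤ.^ l
      N = n ℤ.^ l ℤ.+ d ℤ.* k

  -- horner cs is monic: the leading coefficient 1 is implicit.
  monic-root : ∀ cs {x} → horner cs x ≡ ι# (+ 0) → Integral x
  monic-root cs {x} root with lowest-terms x
  ... | lowest n d d≢0 x≡ c with clear-denominators x≡ cs
  ...   | l , k , h with comaximal-^ʳ l c
  ...     | bezout u v e = unit-denominator (u ℤ.- v ℤ.* k) x≡
    (ringℤ 5 (λ d k u v N → d :* (u :- v :* k) := ♯ 1 from
      (♯ 1 · u :* d :+ v :* N ≈ ♯ 1 ∷ :- v · N :+ d :* k ≈ ♯ 0 ∷ [])) refl (d ∷ k ∷ u ∷ v ∷ n ℤ.^ l ∷ [])
      (e , ι-injective (trans (sym h) (trans (cong (ι# (d ℤ.^ l) *_) root)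
        (ring 1 (λ a → a :* ♯ 0 := ♯ 0 from []) refl (ι# (d ℤ.^ l) ∷ []) tt))) , tt))

-- The formal group and the theorem of Lutz and Nagell.

module Localisation (K : FractionField) (e : ℤ) where
  open FractionField K
  open FieldProperties K
  open Integrality K

  -- x lies in e^j times the ring of fractions with denominator prime to e.
  record Near (j : ℕ) (x : Carrier) : Set where
    constructor near
    field
      den num : ℤ
      coprime : Comaximal e den
      equation : x * ι# den ≡ ι# (e ℤ.^ j ℤ.* num)

  near-ι : ∀ n → Near 0 (ι# n)
  near-ι n = near (+ 1) n comaximal-1 (trans (sym (ι-* n (+ 1)))
    (cong ι# (ringℤ 1 (λ n → n :* ♯ 1 := ♯ 1 :* n from []) refl (n ∷ []) tt)))

  near-* : ∀ {i j x y} → Near i x → Near j y → Near (i ℕ.+ j) (x * y)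
  near-* {i} {j} {x} {y} (near d n c h) (near d′ n′ c′ h′) = near (d ℤ.* d′) (n ℤ.* n′) (comaximal-*ʳ c c′) (begin
    x * y * ι# (d ℤ.* d′) ≡⟨ cong (x * y *_) (ι-* d d′) ⟩
    x * y * (ι# d * ι# d′) ≡⟨ ring 6 (λ x y d d′ p q → x :* y :* (d :* d′) := p :* q from
        (y :* d′ · x :* d ≈ p ∷ p · y :* d′ ≈ q ∷ [])) refl (x ∷ y ∷ ι# d ∷ ι# d′ ∷ _ ∷ _ ∷ []) (h , h′ , tt) ⟩
    ι# (e ℤ.^ i ℤ.* n) * ι# (e ℤ.^ j ℤ.* n′) ≡⟨ sym (ι-* (e ℤ.^ i ℤ.* n) (e ℤ.^ j ℤ.* n′)) ⟩
    ι# (e ℤ.^ i ℤ.* n ℤ.* (e ℤ.^ j ℤ.* n′)) ≡⟨ cong ι# (trans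
        (ringℤ 4 (λ p q n n′ → p :* n :* (q :* n′) := p :* q :* (n :* n′) from []) refl (e ℤ.^ i ∷ e ℤ.^ j ∷ n ∷ n′ ∷ []) tt)
        (cong (ℤ._* (n ℤ.* n′)) (sym (ℤₚ.^-distribˡ-+-* e i j)))) ⟩
    ι# (e ℤ.^ (i ℕ.+ j) ℤ.* (n ℤ.* n′)) ∎)
    where open ≡-Reasoning

  near-+ : ∀ {j x y} → Near j x → Near j y → Near j (x + y)
  near-+ {j} {x} {y} (near d n c h) (near d′ n′ c′ h′) = near (d ℤ.* d′) (n ℤ.* d′ ℤ.+ n′ ℤ.* d) (comaximal-*ʳ c c′) (begin
    (x + y) * ι# (d ℤ.* d′) ≡⟨ cong ((x + y) *_) (ι-* d d′) ⟩
    (x + y) * (ι# d * ι# d′) ≡⟨ ring 6 (λ x y d d′ p q → (x :+ y) :* (d :* d′) := p :* d′ :+ q :* d from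
        (d′ · x :* d ≈ p ∷ d · y :* d′ ≈ q ∷ [])) refl (x ∷ y ∷ ι# d ∷ ι# d′ ∷ _ ∷ _ ∷ []) (h , h′ , tt) ⟩
    ι# (E ℤ.* n) * ι# d′ + ι# (E ℤ.* n′) * ι# d ≡⟨ cong₂ _+_ (sym (ι-* (E ℤ.* n) d′)) (sym (ι-* (E ℤ.* n′) d)) ⟩
    ι# (E ℤ.* n ℤ.* d′) + ι# (E ℤ.* n′ ℤ.* d) ≡⟨ sym (ι-+ (E ℤ.* n ℤ.* d′) (E ℤ.* n′ ℤ.* d)) ⟩
    ι# (E ℤ.* n ℤ.* d′ ℤ.+ E ℤ.* n′ ℤ.* d) ≡⟨ cong ι# (ringℤ 5 (λ E n d n′ d′ →
        E :* n :* d′ :+ E :* n′ :* d := E :* (n :* d′ :+ n′ :* d) from []) refl (E ∷ n ∷ d ∷ n′ ∷ d′ ∷ []) tt) ⟩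
    ι# (E ℤ.* (n ℤ.* d′ ℤ.+ n′ ℤ.* d)) ∎)
    where
    open ≡-Reasoning
    E = e ℤ.^ j

  near-weaken : ∀ i {j x} → Near (i ℕ.+ j) x → Near j x
  near-weaken i {j} (near d n c h) = near d (e ℤ.^ i ℤ.* n) c (trans h (cong ι# (trans
    (cong (ℤ._* n) (ℤₚ.^-distribˡ-+-* e i j))
    (ringℤ 3 (λ p q n → p :* q :* n := q :* (p :* n) from []) refl (e ℤ.^ i ∷ e ℤ.^ j ∷ n ∷ []) tt))))

  near-0 : ∀ {j x} → x ≡ ι# (+ 0) → Near j x
  near-0 {j} refl = near (+ 1) (+ 0) comaximal-1 (trans (sym (ι-* (+ 0) (+ 1))) (cong ι# (sym (ℤₚ.*-zeroʳ (e ℤ.^ j)))))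

  near-neg : ∀ {j x} → Near j x → Near j (- x)
  near-neg {j} {x} h = subst (Near j) (trans (cong (_* x) (ι-neg (+ 1)))
    (ring 1 (λ x → (:- ♯ 1) :* x := :- x from []) refl (x ∷ []) tt)) (near-* {0} {j} (near-ι -[1+ 0 ]) h)

  near-scale : ∀ {j x} n → Near j x → Near j (ι# n * x)
  near-scale {j} n h = near-* {0} {j} (near-ι n) h

  near-integer : ∀ {j n} → Near j (ι# n) → e ℤ.^ j ∣ n
  near-integer {j} {n} (near d m c h) = divides-cancelˡ {b = d} (comaximal-sym (comaximal-^ʳ j (comaximal-sym c)))
    (divides m (trans (ℤₚ.*-comm d n) (trans (ι-injective (trans (ι-* n d) h)) (ℤₚ.*-comm (e ℤ.^ j) m))))

  module _ (e∤1 : ¬ e ∣ + 1) where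

    near-unit-nonzero : ∀ {x} → Near 1 (x - ι# (+ 1)) → x ≢ ι# (+ 0)
    near-unit-nonzero {x} h refl = e∤1 (subst (_∣ + 1) (ℤₚ.*-identityʳ e) (near-integer {1} {+ 1}
      (subst (Near 1) (ring 0 (:- (♯ 0 :- ♯ 1) := ♯ 1 from []) refl [] tt) (near-neg h))))

    -- An x that is 1 modulo e is a unit at e: with (x - 1) d = em its numerator d + em is prime to
    -- e just like d.
    near-divide : ∀ {j a x n} → Near 1 (x - ι# (+ 1)) → a * x ≡ n → Near j n → Near j a
    near-divide {j} {a} {x} {n} (near d m c h) ax (near d′ m′ c′ h′) =
      near ((d ℤ.+ e ℤ.* m) ℤ.* d′) (m′ ℤ.* d) (comaximal-*ʳ (comaximal-shift m c) c′) (begin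
      a * ι# ((d ℤ.+ e ℤ.* m) ℤ.* d′) ≡⟨ cong (a *_) (trans (ι-* (d ℤ.+ e ℤ.* m) d′)
          (cong (_* ι# d′) (trans (cong (λ z → ι# (d ℤ.+ z ℤ.* m)) (sym (ℤₚ.*-identityʳ e))) (ι-+ d (e ℤ.* + 1 ℤ.* m))))) ⟩
      a * ((ι# d + ι# (e ℤ.^ 1 ℤ.* m)) * ι# d′) ≡⟨ ring 7 (λ a x n d p d′ p′ → a :* ((d :+ p) :* d′) := p′ :* d from
          (:- a :* d′ · (x :- ♯ 1) :* d ≈ p ∷ d :* d′ · a :* x ≈ n ∷ d · n :* d′ ≈ p′ ∷ []))
          refl (a ∷ x ∷ n ∷ ι# d ∷ _ ∷ ι# d′ ∷ _ ∷ []) (h , ax , h′ , tt) ⟩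
      ι# (e ℤ.^ j ℤ.* m′) * ι# d ≡⟨ sym (ι-* (e ℤ.^ j ℤ.* m′) d) ⟩
      ι# (e ℤ.^ j ℤ.* m′ ℤ.* d) ≡⟨ cong ι# (ℤₚ.*-assoc (e ℤ.^ j) m′ d) ⟩
      ι# (e ℤ.^ j ℤ.* (m′ ℤ.* d)) ∎)
      where open ≡-Reasoning

-- Later e is the whole denominator of a point and need not be prime: coprimality to e replaces a
-- valuation, and no factorisation into primes occurs.
module FormalGroup (K : FractionField) (A B : ℤ) (e : ℤ) (e∤1 : ¬ e ∣ + 1) where
  open FractionField K
  open FieldProperties K
  open Localisation K e
  open EllipticCurve K (ι# A) (ι# B)

  -- The point reduces to O modulo e; t = x / y and w = 1 / y are the coordinates at infinity.
  data Close : Point → Carrier → Set where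
    close-O : Close O (ι# (+ 0))
    close-aff : ∀ {x y p} w → y * w ≡ ι# (+ 1) → Near 1 (x * w) → Near 3 w → Close (aff x y p) (x * w)

  module Chord {x₁ y₁ w₁ x₂ y₂ w₂ m} (p : OnCurve x₁ y₁) (q : OnCurve x₂ y₂) (s : Slope x₁ y₁ x₂ y₂ m)
    (yw₁ : y₁ * w₁ ≡ ι# (+ 1)) (yw₂ : y₂ * w₂ ≡ ι# (+ 1)) where
    open Slope s

    t₁ = x₁ * w₁
    t₂ = x₂ * w₂
    b = y₁ - m * x₁

    -- In the coordinates t, w the curve is w = t³ + A t² w + B w³. Subtracting the equations of two
    -- points and separating the factors w₂ - w₁ and t₂ - t₁ leaves U and V as their coefficients;
    -- near O the first is a unit and the second is divisible by e².
    U = ι# (+ 1) - ι# A * t₂ * t₂ - ι# B * (w₁ * w₁ + w₁ * w₂ + w₂ * w₂)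
    V = t₁ * t₁ + t₁ * t₂ + t₂ * t₂ + ι# A * w₁ * (t₁ + t₂)

    private
      ρ : Vec Carrier 9
      ρ = ι# A ∷ ι# B ∷ x₁ ∷ y₁ ∷ w₁ ∷ x₂ ∷ y₂ ∷ w₂ ∷ m ∷ []

      cubic : ∀ {n} → Expr n → Expr n → Expr n → Expr n
      cubic A B x = x :* x :* x :+ A :* x :* x :+ B

      quad : ∀ {n} → Expr n → Expr n → Expr n → Expr n
      quad A x z = x :* x :+ x :* z :+ z :* z :+ A :* (x :+ z)

      from-hypotheses : Expr 9 → Expr 9 → (A B x₁ y₁ w₁ x₂ y₂ w₂ m c₁ c₂ c₃ c₄ : Expr 9) → Problem 9
      from-hypotheses l r A B x₁ y₁ w₁ x₂ y₂ w₂ m c₁ c₂ c₃ c₄ = l := r from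
        (c₁ · m :* (x₂ :- x₁) ≈ y₂ :- y₁ ∷ c₂ · m :* (y₁ :+ y₂) ≈ quad A x₁ x₂
        ∷ c₃ · y₁ :* y₁ ≈ cubic A B x₁ ∷ c₄ · y₂ :* y₂ ≈ cubic A B x₂ ∷ [])

      polynomial-key : m * (y₁ * y₁ * y₂ * y₂ - ι# A * x₂ * x₂ * y₁ * y₁ - ι# B * (y₂ * y₂ + y₁ * y₂ + y₁ * y₁))
        + b * (x₁ * x₁ * y₂ * y₂ + x₁ * x₂ * y₁ * y₂ + x₂ * x₂ * y₁ * y₁ + ι# A * y₂ * (x₁ * y₂ + x₂ * y₁)) ≡ ι# (+ 0)
      polynomial-key = ring 9 (λ A B x₁ y₁ w₁ x₂ y₂ w₂ m → from-hypotheses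
        (m :* (y₁ :* y₁ :* y₂ :* y₂ :- A :* x₂ :* x₂ :* y₁ :* y₁ :- B :* (y₂ :* y₂ :+ y₁ :* y₂ :+ y₁ :* y₁))
         :+ (y₁ :- m :* x₁) :* (x₁ :* x₁ :* y₂ :* y₂ :+ x₁ :* x₂ :* y₁ :* y₂ :+ x₂ :* x₂ :* y₁ :* y₁ :+ A :* y₂ :* (x₁ :* y₂ :+ x₂ :* y₁)))
        (♯ 0) A B x₁ y₁ w₁ x₂ y₂ w₂ m
        (:- x₁ :* x₁ :* y₂ :* y₂ :+ x₂ :* x₂ :* y₁ :* y₁ :- x₂ :* x₂ :* y₂ :* y₂ :- x₁ :* x₂ :* y₂ :* y₂ :- x₁ :* x₁ :* y₁ :* y₂ :+ A :* x₂ :* y₁ :* y₂)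
        (:- x₁ :* x₁ :* x₁ :* y₂ :+ x₂ :* x₂ :* x₂ :* y₂ :- y₁ :* y₂ :* y₂)
        (m :* y₂ :* y₂ :+ x₁ :* x₁ :* y₂ :+ x₂ :* x₂ :* y₂ :+ x₁ :* x₂ :* y₂)
        (m :* y₁ :* y₁ :- x₁ :* x₁ :* y₂ :- x₂ :* x₂ :* y₂ :+ m :* y₁ :* y₂ :- x₁ :* x₂ :* y₂)) refl ρ
        (chord , tangent , p , q , tt)

    -- The three points of the line y = mx + b have ordinates whose product is, up to the factor
    -- -m³, the value of the cubic at the zero -b/m of the line. The third ordinate is taken before
    -- the reflection.
    polynomial-product : ∀ x₃ → x₃ ≡ m * m - ι# A - x₁ - x₂ →
      y₁ * y₂ * (m * x₃ + b) ≡ b * b * b - ι# A * m * b * b - ι# B * m * m * m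
    polynomial-product _ refl = ring 9 (λ A B x₁ y₁ w₁ x₂ y₂ w₂ m → let b = y₁ :- m :* x₁ in from-hypotheses
      (y₁ :* y₂ :* (m :* (m :* m :- A :- x₁ :- x₂) :+ b)) (b :* b :* b :- A :* m :* b :* b :- B :* m :* m :* m)
      A B x₁ y₁ w₁ x₂ y₂ w₂ m
      (♯ 2 :* x₁ :* x₁ :* x₁ :- ♯ 2 :* x₂ :* x₂ :* x₂ :- ♯ 3 :* y₁ :* y₁ :+ ♯ 2 :* y₂ :* y₂ :+ ♯ 2 :* A :* x₁ :* x₁ :- ♯ 2 :* A :* x₂ :* x₂ :+ A :* m :* y₁ :- ♯ 2 :* m :* x₁ :* y₂ :- m :* x₂ :* y₁ :- ♯ 2 :* m :* x₂ :* y₂)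
      (:- ♯ 2 :* m :* x₁ :* x₁ :+ ♯ 2 :* m :* x₂ :* x₂ :+ m :* m :* y₁)
      (:- ♯ 1 :* m :* m :* m :+ ♯ 2 :* y₁ :- ♯ 2 :* y₂ :+ ♯ 4 :* m :* x₂)
      (:- ♯ 2 :* y₁ :+ ♯ 2 :* y₂ :- ♯ 4 :* m :* x₂)) refl ρ (chord , tangent , p , q , tt)

    -- Vieta for the sum of t = x/y over the three points of the line, multiplied by the product of
    -- the ordinates to clear denominators. Again the third point is the one before the reflection.
    polynomial-sum : ∀ x₃ → x₃ ≡ m * m - ι# A - x₁ - x₂ → let y₃ = m * x₃ + b in
      x₁ * y₂ * y₃ + x₂ * y₁ * y₃ + x₃ * y₁ * y₂ ≡ - (ι# (+ 3) * m * m * ι# B + ι# A * b * b)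
    polynomial-sum _ refl = ring 9 (λ A B x₁ y₁ w₁ x₂ y₂ w₂ m →
      let b = y₁ :- m :* x₁; x₃ = m :* m :- A :- x₁ :- x₂; y₃ = m :* x₃ :+ b in from-hypotheses
      (x₁ :* y₂ :* y₃ :+ x₂ :* y₁ :* y₃ :+ x₃ :* y₁ :* y₂) (:- (♯ 3 :* m :* m :* B :+ A :* b :* b))
      A B x₁ y₁ w₁ x₂ y₂ w₂ m
      (A :* y₁ :+ m :* x₁ :* x₁ :- m :* x₂ :* x₂ :- m :* m :* y₂ :+ x₂ :* y₁ :- A :* m :* x₂)
      (m :* y₁ :+ m :* y₂ :+ m :* m :* x₂) (:- ♯ 1 :* m :* m) (:- ♯ 2 :* m :* m)) refl ρ (chord , tangent , p , q , tt)

    -- Both sides of w₂ - w₁ = (t₂ - t₁) V / U, the slope of the line in the coordinates t, w.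
    key : m * U + b * V ≡ ι# (+ 0)
    key = begin
      m * U + b * V ≡⟨ ring 10 (λ A B x₁ x₂ w₁ w₂ m b u₁ u₂ →
          m :* (♯ 1 :- A :* (x₂ :* w₂) :* (x₂ :* w₂) :- B :* (w₁ :* w₁ :+ w₁ :* w₂ :+ w₂ :* w₂))
          :+ b :* (x₁ :* w₁ :* (x₁ :* w₁) :+ x₁ :* w₁ :* (x₂ :* w₂) :+ x₂ :* w₂ :* (x₂ :* w₂) :+ A :* w₁ :* (x₁ :* w₁ :+ x₂ :* w₂))
          := m :* (u₁ :* u₁ :* u₂ :* u₂ :- A :* x₂ :* x₂ :* u₁ :* u₁ :* w₂ :* w₂ :- B :* (u₂ :* u₂ :* w₁ :* w₁ :+ u₁ :* u₂ :* w₁ :* w₂ :+ u₁ :* u₁ :* w₂ :* w₂))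
          :+ b :* (x₁ :* x₁ :* u₂ :* u₂ :* w₁ :* w₁ :+ x₁ :* x₂ :* w₁ :* w₂ :* u₁ :* u₂ :+ x₂ :* x₂ :* u₁ :* u₁ :* w₂ :* w₂
            :+ A :* u₂ :* w₁ :* (x₁ :* u₂ :* w₁ :+ x₂ :* u₁ :* w₂)) from
          (m :* (♯ 0 :- (u₁ :+ ♯ 1) :* u₂ :* u₂ :+ A :* x₂ :* x₂ :* (u₁ :+ ♯ 1) :* w₂ :* w₂
              :+ B :* (u₂ :* w₁ :* w₂ :+ (u₁ :+ ♯ 1) :* w₂ :* w₂))
            :- b :* (x₁ :* x₂ :* w₁ :* w₂ :* u₂ :+ x₂ :* x₂ :* (u₁ :+ ♯ 1) :* w₂ :* w₂ :+ A :* u₂ :* w₁ :* x₂ :* w₂) · u₁ ≈ ♯ 1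
          ∷ m :* (:- (u₂ :+ ♯ 1) :+ B :* ((u₂ :+ ♯ 1) :* w₁ :* w₁ :+ w₁ :* w₂))
            :- b :* (x₁ :* x₁ :* (u₂ :+ ♯ 1) :* w₁ :* w₁ :+ x₁ :* x₂ :* w₁ :* w₂ :+ A :* w₁ :* (x₁ :* (u₂ :+ ♯ 1) :* w₁ :+ x₂ :* w₂)) · u₂ ≈ ♯ 1 ∷ []))
          refl (ι# A ∷ ι# B ∷ x₁ ∷ x₂ ∷ w₁ ∷ w₂ ∷ m ∷ b ∷ y₁ * w₁ ∷ y₂ * w₂ ∷ []) (yw₁ , yw₂ , tt) ⟩
      _ ≡⟨ ring 10 (λ A B x₁ y₁ w₁ x₂ y₂ w₂ m b → let u₁ = y₁ :* w₁; u₂ = y₂ :* w₂ in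
          m :* (u₁ :* u₁ :* u₂ :* u₂ :- A :* x₂ :* x₂ :* u₁ :* u₁ :* w₂ :* w₂ :- B :* (u₂ :* u₂ :* w₁ :* w₁ :+ u₁ :* u₂ :* w₁ :* w₂ :+ u₁ :* u₁ :* w₂ :* w₂))
          :+ b :* (x₁ :* x₁ :* u₂ :* u₂ :* w₁ :* w₁ :+ x₁ :* x₂ :* w₁ :* w₂ :* u₁ :* u₂ :+ x₂ :* x₂ :* u₁ :* u₁ :* w₂ :* w₂
            :+ A :* u₂ :* w₁ :* (x₁ :* u₂ :* w₁ :+ x₂ :* u₁ :* w₂)) := ♯ 0 from
          (w₁ :* w₁ :* w₂ :* w₂ ·
            m :* (y₁ :* y₁ :* y₂ :* y₂ :- A :* x₂ :* x₂ :* y₁ :* y₁ :- B :* (y₂ :* y₂ :+ y₁ :* y₂ :+ y₁ :* y₁))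
            :+ b :* (x₁ :* x₁ :* y₂ :* y₂ :+ x₁ :* x₂ :* y₁ :* y₂ :+ x₂ :* x₂ :* y₁ :* y₁ :+ A :* y₂ :* (x₁ :* y₂ :+ x₂ :* y₁)) ≈ ♯ 0 ∷ []))
          refl (ι# A ∷ ι# B ∷ x₁ ∷ y₁ ∷ w₁ ∷ x₂ ∷ y₂ ∷ w₂ ∷ m ∷ b ∷ []) (polynomial-key , tt) ⟩
      ι# (+ 0) ∎
      where open ≡-Reasoning

    module _ (n₁ : Near 1 t₁) (n₂ : Near 1 t₂) (n₃ : Near 3 w₁) (n₄ : Near 3 w₂) where

      private
        A# : Near 0 (ι# A)
        A# = near-ι A
        B# : Near 0 (ι# B)
        B# = near-ι B

      U-unit : Near 1 (U - ι# (+ 1))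
      U-unit = subst (Near 1) (ring 2 (λ x y → :- (x :+ y) := ♯ 1 :- x :- y :- ♯ 1 from []) refl (_ ∷ _ ∷ []) tt)
        (near-neg (near-+ (near-weaken 1 {1} (near-* {1} {1} (near-* {0} {1} A# n₁′) n₂))
          (near-* {0} {1} B# (near-weaken 5 {1} (near-+ (near-+ (near-* {3} {3} n₃ n₃) (near-* {3} {3} n₃ n₄)) (near-* {3} {3} n₄ n₄))))))
        where n₁′ = n₂

      V-near : Near 2 V
      V-near = near-+ (near-+ (near-+ (near-* {1} {1} n₁ n₁) (near-* {1} {1} n₁ n₂)) (near-* {1} {1} n₂ n₂))
        (near-weaken 2 {2} (near-* {3} {1} (near-* {0} {3} A# n₃) (near-+ n₁ n₂)))

      private
        U≢0 = near-unit-nonzero e∤1 U-unit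
        U⁻¹ = proj₁ (inverse U U≢0)
        UU⁻¹ = proj₂ (inverse U U≢0)

      -- The line in the coordinates at infinity is w = αt + β. Substituting it into w = t³ + A t² w
      -- + B w³ gives a cubic in t with leading coefficient γ and next coefficient (A + 3Bα²)β.
      α β γ : Carrier
      α = V * U⁻¹
      β = w₁ - α * t₁
      γ = ι# (+ 1) + ι# A * α + ι# B * α * α * α

      αU : α * U ≡ V
      αU = ring 3 (λ V u U → V :* u :* U := V from (V · U :* u ≈ ♯ 1 ∷ [])) refl (V ∷ U⁻¹ ∷ U ∷ []) (UU⁻¹ , tt)

      α-near : Near 2 α
      α-near = near-divide e∤1 {2} U-unit αU V-near

      β-near : Near 3 β
      β-near = near-+ n₃ (near-neg (near-* {2} {1} α-near n₁))

      γ-unit : Near 1 (γ - ι# (+ 1))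
      γ-unit = subst (Near 1) (ring 2 (λ x y → x :+ y := ♯ 1 :+ x :+ y :- ♯ 1 from []) refl (_ ∷ _ ∷ []) tt)
        (near-+ (near-weaken 1 {1} (near-* {0} {2} A# α-near))
          (near-weaken 5 {1} (near-* {4} {2} (near-* {2} {2} (near-* {0} {2} B# α-near) α-near) α-near)))

      -- Dividing y = mx + b by y turns it into 1 = mt + bw, so that α = -m/b and β = 1/b.
      m≡ : m ≡ - (b * α)
      m≡ = cancelˡ U≢0 (ring 5 (λ m b U V α → U :* m := U :* (:- (b :* α)) from
        (♯ 1 · m :* U :+ b :* V ≈ ♯ 0 ∷ b · α :* U ≈ V ∷ [])) refl (m ∷ b ∷ U ∷ V ∷ α ∷ []) (key , αU , tt))

      bβ : b * β ≡ ι# (+ 1)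
      bβ = ring 5 (λ m x₁ y₁ w₁ α → (y₁ :- m :* x₁) :* (w₁ :- α :* (x₁ :* w₁)) := ♯ 1 from
        (♯ 1 · y₁ :* w₁ ≈ ♯ 1 ∷ :- (x₁ :* w₁) · m ≈ :- ((y₁ :- m :* x₁) :* α) ∷ []))
        refl (m ∷ x₁ ∷ y₁ ∷ w₁ ∷ α ∷ []) (yw₁ , m≡ , tt)

      module Third {x₃ y₃} (x₃≡ : x₃ ≡ m * m - ι# A - x₁ - x₂) (y₃≡ : y₃ ≡ - (y₁ + m * (x₃ - x₁))) where

        product : y₁ * y₂ * y₃ ≡ - (b * b * b * γ)
        product = ring 9 (λ A B x₁ y₁ y₂ m α x₃ y₃ → let b = y₁ :- m :* x₁ in
          y₁ :* y₂ :* y₃ := :- (b :* b :* b :* (♯ 1 :+ A :* α :+ B :* α :* α :* α)) from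
          (y₁ :* y₂ · y₃ ≈ :- (y₁ :+ m :* (x₃ :- x₁))
          ∷ :- ♯ 1 · y₁ :* y₂ :* (m :* x₃ :+ b) ≈ b :* b :* b :- A :* m :* b :* b :- B :* m :* m :* m
          ∷ A :* b :* b :+ B :* (m :* m :- m :* b :* α :+ b :* b :* α :* α) · m ≈ :- (b :* α) ∷ []))
          refl (ι# A ∷ ι# B ∷ x₁ ∷ y₁ ∷ y₂ ∷ m ∷ α ∷ x₃ ∷ y₃ ∷ []) (y₃≡ , polynomial-product x₃ x₃≡ , m≡ , tt)

        y₃≢0 : y₃ ≢ ι# (+ 0)
        y₃≢0 h = near-unit-nonzero e∤1 γ-unit (ring 6 (λ b β γ y₁ y₂ y₃ → γ := ♯ 0 from
          (:- γ :* (b :* β :* (b :* β) :+ b :* β :+ ♯ 1) · b :* β ≈ ♯ 1 ∷ β :* β :* β · y₁ :* y₂ :* y₃ ≈ :- (b :* b :* b :* γ)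
          ∷ :- (β :* β :* β) :* y₁ :* y₂ · y₃ ≈ ♯ 0 ∷ [])) refl (b ∷ β ∷ γ ∷ y₁ ∷ y₂ ∷ y₃ ∷ []) (bβ , product , h , tt))

        w₃ = proj₁ (inverse y₃ y₃≢0)
        yw₃ : y₃ * w₃ ≡ ι# (+ 1)
        yw₃ = proj₂ (inverse y₃ y₃≢0)

        difference : Carrier
        difference = x₃ * w₃ - t₁ - t₂

        difference-equation : difference * γ ≡ (ι# A + ι# (+ 3) * ι# B * α * α) * β
        difference-equation = cancelˡ b³≢0 (begin
          b * b * b * (difference * γ) ≡⟨ ring 11 (λ b γ x₁ y₁ w₁ x₂ y₂ w₂ x₃ y₃ w₃ →
              b :* b :* b :* ((x₃ :* w₃ :- x₁ :* w₁ :- x₂ :* w₂) :* γ) :=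
              :- (x₃ :* y₁ :* y₂ :- x₁ :* y₂ :* y₃ :- x₂ :* y₁ :* y₃) from
              (x₃ :* w₃ :- x₁ :* w₁ :- x₂ :* w₂ · y₁ :* y₂ :* y₃ ≈ :- (b :* b :* b :* γ) ∷ :- (x₃ :* y₁ :* y₂) · y₃ :* w₃ ≈ ♯ 1
              ∷ x₁ :* y₂ :* y₃ · y₁ :* w₁ ≈ ♯ 1 ∷ x₂ :* y₁ :* y₃ · y₂ :* w₂ ≈ ♯ 1 ∷ []))
              refl (b ∷ γ ∷ x₁ ∷ y₁ ∷ w₁ ∷ x₂ ∷ y₂ ∷ w₂ ∷ x₃ ∷ y₃ ∷ w₃ ∷ []) (product , yw₃ , yw₁ , yw₂ , tt) ⟩
          - (x₃ * y₁ * y₂ - x₁ * y₂ * y₃ - x₂ * y₁ * y₃) ≡⟨ ring 9 (λ A B m x₁ y₁ x₂ y₂ x₃ y₃ → let b = y₁ :- m :* x₁; z = m :* x₃ :+ b in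
              :- (x₃ :* y₁ :* y₂ :- x₁ :* y₂ :* y₃ :- x₂ :* y₁ :* y₃) := ♯ 3 :* m :* m :* B :+ A :* b :* b from
              (:- ♯ 1 · x₁ :* y₂ :* z :+ x₂ :* y₁ :* z :+ x₃ :* y₁ :* y₂ ≈ :- (♯ 3 :* m :* m :* B :+ A :* b :* b)
              ∷ x₁ :* y₂ :+ x₂ :* y₁ · y₃ ≈ :- (y₁ :+ m :* (x₃ :- x₁)) ∷ []))
              refl (ι# A ∷ ι# B ∷ m ∷ x₁ ∷ y₁ ∷ x₂ ∷ y₂ ∷ x₃ ∷ y₃ ∷ []) (polynomial-sum x₃ x₃≡ , y₃≡ , tt) ⟩
          ι# (+ 3) * m * m * ι# B + ι# A * b * b ≡⟨ ring 6 (λ A B b β α m →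
              ♯ 3 :* m :* m :* B :+ A :* b :* b := b :* b :* b :* ((A :+ ♯ 3 :* B :* α :* α) :* β) from
              (♯ 3 :* B :* (m :- b :* α) · m ≈ :- (b :* α) ∷ :- (b :* b :* (A :+ ♯ 3 :* B :* α :* α)) · b :* β ≈ ♯ 1 ∷ []))
              refl (ι# A ∷ ι# B ∷ b ∷ β ∷ α ∷ m ∷ []) (m≡ , bβ , tt) ⟩
          b * b * b * ((ι# A + ι# (+ 3) * ι# B * α * α) * β) ∎)
          where
          open ≡-Reasoning
          b≢0 : b ≢ ι# (+ 0)
          b≢0 h = ι-nonzero {+ 1} (λ ()) (trans (sym bβ) (ring 2 (λ b β → b :* β := ♯ 0 from (β · b ≈ ♯ 0 ∷ [])) refl (b ∷ β ∷ []) (h , tt)))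
          b³≢0 : b * b * b ≢ ι# (+ 0)
          b³≢0 = product-nonzero (product-nonzero b≢0 b≢0) b≢0

        difference-near : Near 3 difference
        difference-near = near-divide e∤1 {3} γ-unit difference-equation
          (near-* {0} {3} (near-+ A# (near-weaken 4 {0} (near-* {2} {2} (near-* {0} {2} (near-* {0} {0} (near-ι (+ 3)) B#) α-near) α-near))) β-near)

        t₃-near : Near 1 (x₃ * w₃)
        t₃-near = subst (Near 1) (ring 3 (λ t₁ t₂ t₃ → (t₃ :- t₁ :- t₂) :+ (t₁ :+ t₂) := t₃ from []) refl (t₁ ∷ t₂ ∷ x₃ * w₃ ∷ []) tt)
          (near-+ (near-weaken 2 {1} difference-near) (near-+ n₁ n₂))

        w₃≡ : α * (x₃ * w₃) + - β ≡ w₃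
        w₃≡ = ring 8 (λ b β α m y₃ w₃ x₃ _ → α :* (x₃ :* w₃) :+ :- β := w₃ from
          (w₃ :- α :* x₃ :* w₃ · b :* β ≈ ♯ 1 ∷ β · y₃ :* w₃ ≈ ♯ 1 ∷ :- β :* w₃ · y₃ ≈ :- (m :* x₃ :+ b)
          ∷ β :* x₃ :* w₃ · m ≈ :- (b :* α) ∷ []))
          refl (b ∷ β ∷ α ∷ m ∷ y₃ ∷ w₃ ∷ x₃ ∷ x₃ ∷ [])
          (bβ , yw₃ , trans y₃≡ (ring 4 (λ x₁ y₁ m x₃ → :- (y₁ :+ m :* (x₃ :- x₁)) := :- (m :* x₃ :+ (y₁ :- m :* x₁)) from [])
            refl (x₁ ∷ y₁ ∷ m ∷ x₃ ∷ []) tt) , m≡ , tt)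

        w₃-near : Near 3 w₃
        w₃-near = subst (Near 3) w₃≡ (near-+ (near-* {2} {1} α-near t₃-near) (near-neg β-near))

  -- Addition of points is addition of t up to an error (A + 3Bα²)β/γ. It is divisible by e³ because
  -- β is, and γ is a unit at e.
  close-add : ∀ {P Q R t u} → Close P t → Close Q u → Add P Q R → ∃[ v ] (Close R v × Near 3 (v - t - u))
  close-add {u = u} close-O c (O-l _) = u , c , near-0 {3} (ring 1 (λ u → u :- ♯ 0 :- u := ♯ 0 from []) refl (u ∷ []) tt)
  close-add {t = t} c close-O O-r = t , c , near-0 {3} (ring 1 (λ t → t :- t :- ♯ 0 := ♯ 0 from []) refl (t ∷ []) tt)
  close-add (close-aff {x} {y} w yw _ _) (close-aff {y = y′} w′ yw′ _ _) (opposite (refl , h)) =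
    ι# (+ 0) , close-O , near-0 {3} (ring 5 (λ x y w y′ w′ → ♯ 0 :- x :* w :- x :* w′ := ♯ 0 from
      (x :* w′ · y :* w ≈ ♯ 1 ∷ x :* w · y′ :* w′ ≈ ♯ 1 ∷ :- (x :* w :* w′) · y :+ y′ ≈ ♯ 0 ∷ []))
      refl (x ∷ y ∷ w ∷ y′ ∷ w′ ∷ []) (yw , yw′ , h , tt))
  close-add (close-aff {p = p} w yw n₁ n₃) (close-aff {p = q} w′ yw′ n₂ n₄) (line {x₃ = x₃} m _ s x₃≡ y₃≡) =
    x₃ * w₃ , close-aff w₃ yw₃ t₃-near w₃-near , difference-near
    where open Chord.Third p q s yw yw′ n₁ n₂ n₃ n₄ x₃≡ y₃≡

module NagellLutz (K : FractionField) (A B : ℤ)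
  (nonsingular : EllipticCurve.Nonsingular K (FractionField.ι# K A) (FractionField.ι# K B)) where
  open FractionField K
  open FieldProperties K
  open Integrality K public
  open EllipticCurve K (ι# A) (ι# B) public
  open Group nonsingular public

  data Mul : ℕ → Point → Point → Set where
    mul-0 : ∀ {P} → Mul 0 P O
    mul-suc : ∀ {n P S R} → Mul n P S → Add S P R → Mul (suc n) P R

  mul-total : ∀ n P → ∃[ R ] Mul n P R
  mul-total zero P = O , mul-0
  mul-total (suc n) P with mul-total n P
  ... | S , s with add-total S P
  ...   | R , r = R , mul-suc s r

  mul-functional : ∀ {n P R R′} → Mul n P R → Mul n P R′ → R ≡ R′
  mul-functional mul-0 mul-0 = refl
  mul-functional (mul-suc s r) (mul-suc s′ r′) with mul-functional s s′
  ... | refl = add-functional r r′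

  mul-+ : ∀ m {n P S T U} → Mul m P S → Mul n P T → Add S T U → Mul (m ℕ.+ n) P U
  mul-+ zero {n} {P} mul-0 t (O-l _) = t
  mul-+ (suc m) {n} {P} {T = T} {U} (mul-suc s a) t u with add-total T P
  ... | V , v with add-total P T
  ...   | V′ , v′ with add-functional v (add-comm v′)
  ...     | refl = subst (λ k → Mul k P U) (ℕₚ.+-suc m n) (mul-+ m s (mul-suc t v) (add-assoc a v′ u))

  mul-* : ∀ n {m P S T} → Mul m P S → Mul n S T → Mul (n ℕ.* m) P T
  mul-* zero s mul-0 = mul-0
  mul-* (suc n) {m} {P} {T = T} s (mul-suc t a) = mul-+ m s (mul-* n s t) (add-comm a)

  mul-O : ∀ n → Mul n O O
  mul-O zero = mul-0
  mul-O (suc n) = mul-suc (mul-O n) (O-l O)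

  Torsion : Point → Set
  Torsion P = ∃[ n ] Mul (suc n) P O

  torsion-mul : ∀ {m P R} → Torsion P → Mul m P R → Torsion R
  torsion-mul {m} {P} {R} (n , h) r with mul-total (suc n) R
  ... | S , s with mul-functional (mul-* (suc n) r s)
      (subst (λ k → Mul k P O) (ℕₚ.*-comm m (suc n)) (mul-* m h (mul-O m)))
  ...   | refl = n , s

  module _ (e : ℤ) (e∤1 : ¬ e ∣ + 1) where
    open Localisation K e
    open FormalGroup K A B e e∤1

    close-mul : ∀ {P t n R} → Close P t → Mul n P R → ∃[ u ] (Close R u × Near 3 (u - ι# (+ n) * t))
    close-mul {t = t} c mul-0 = ι# (+ 0) , close-O , near-0 {3}
      (ring 1 (λ t → ♯ 0 :- ♯ 0 :* t := ♯ 0 from []) refl (t ∷ []) tt)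
    close-mul {t = t} c (mul-suc {n} s a) with close-mul c s
    ... | u , cu , nu with close-add cu c a
    ...   | v , cv , nv = v , cv , subst (Near 3)
      (ring 5 (λ t u v k k′ → (u :- k :* t) :+ (v :- u :- t) := v :- k′ :* t from (t · k′ ≈ ♯ 1 :+ k ∷ []))
        refl (t ∷ u ∷ v ∷ ι# (+ n) ∷ ι# (+ suc n) ∷ []) (ι-+ (+ 1) (+ n) , tt)) (near-+ nu nv)

    close-not-integral : ∀ {x y p t} → Close (aff x y p) t → ¬ Integral y
    close-not-integral (close-aff {y = y} w yw _ n₃) (k , refl) = e∤1 (subst (_∣ + 1) (ℤₚ.*-identityʳ e)
      (near-integer {1} (near-weaken 2 {1} (subst (Near 3) yw (near-scale {3} k n₃)))))

  square-divides : ∀ e f n → e ≢ + 0 → e ℤ.^ 3 ∣ + n ℤ.* (e ℤ.* f) → Comaximal e f → e ℤ.* e ∣ + n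
  square-divides e f n e≢0 (divides q h) c = divides-cancelˡ {e ℤ.* e} {f} {+ n}
    (comaximal-*ˡ {e} {e} {f} c c) (divides q (cancelℤ {c = e} e≢0 (ringℤ 4 (λ e f n q → e :* (f :* n) := e :* (q :* (e :* e)) from
      (♯ 1 · n :* (e :* f) ≈ q :* (e :* (e :* (e :* ♯ 1))) ∷ [])) refl (e ∷ f ∷ + n ∷ q ∷ []) (h , tt))))

  record Denominator (x y : Carrier) : Set where
    constructor denominator
    field
      E : ℕ
      a b : ℤ
      E≢0 : + E ≢ + 0
      E⊥a : Comaximal (+ E) a
      E⊥b : Comaximal (+ E) b
      x≡ : x * ι# (+ E ℤ.* + E) ≡ ι# a
      y≡ : y * ι# (+ E ℤ.* (+ E ℤ.* + E)) ≡ ι# b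

  -- With x = n/d and y = b/f in lowest terms, the equation of the curve makes f² and d³ divide each
  -- other. So f/d has square d up to a unit, hence is an integer k by the root theorem, and d and f
  -- are k² and k³ up to sign.
  denominators : ∀ {x y} → OnCurve x y → Denominator x y
  denominators {x} {y} p with lowest-terms x | lowest-terms y
  ... | lowest n d d≢0 x≡ d⊥n | lowest b f f≢0 y≡ f⊥b = assemble (cleared .proj₁) (cleared .proj₂)
    where
    equation : b ℤ.* b ℤ.* (d ℤ.* d ℤ.* d) ≡ f ℤ.* f ℤ.* (n ℤ.* n ℤ.* n ℤ.+ A ℤ.* n ℤ.* n ℤ.* d ℤ.+ B ℤ.* d ℤ.* d ℤ.* d)
    equation = ι-injective (begin
      ι# (b ℤ.* b ℤ.* (d ℤ.* d ℤ.* d)) ≡⟨ trans (ι-* (b ℤ.* b) _) (cong₂ _*_ (ι-* b b) (trans (ι-* (d ℤ.* d) d) (cong (_* ι# d) (ι-* d d)))) ⟩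
      ι# b * ι# b * (ι# d * ι# d * ι# d) ≡⟨ ring 8 (λ A B x y n d b f → b :* b :* (d :* d :* d) :=
          f :* f :* (n :* n :* n :+ A :* n :* n :* d :+ B :* d :* d :* d) from
          (:- d :* d :* d :* (b :+ y :* f) · y :* f ≈ b
          ∷ f :* f :* (n :* n :+ n :* x :* d :+ x :* d :* x :* d :+ A :* d :* (n :+ x :* d)) · x :* d ≈ n
          ∷ f :* f :* d :* d :* d · y :* y ≈ x :* x :* x :+ A :* x :* x :+ B ∷ [])) refl
          (ι# A ∷ ι# B ∷ x ∷ y ∷ ι# n ∷ ι# d ∷ ι# b ∷ ι# f ∷ []) (y≡ , x≡ , p , tt) ⟩
      ι# f * ι# f * (ι# n * ι# n * ι# n + ι# A * ι# n * ι# n * ι# d + ι# B * ι# d * ι# d * ι# d)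
        ≡⟨ sym (trans (ι-* (f ℤ.* f) _) (cong₂ _*_ (ι-* f f) (trans (ι-+ (n ℤ.* n ℤ.* n ℤ.+ A ℤ.* n ℤ.* n ℤ.* d) (B ℤ.* d ℤ.* d ℤ.* d))
          (cong₂ _+_ (trans (ι-+ (n ℤ.* n ℤ.* n) (A ℤ.* n ℤ.* n ℤ.* d)) (cong₂ _+_ (ι-** n n n) (trans (ι-* (A ℤ.* n ℤ.* n) d) (cong (_* ι# d) (ι-** A n n)))))
            (trans (ι-* (B ℤ.* d ℤ.* d) d) (cong (_* ι# d) (ι-** B d d))))))) ⟩
      ι# (f ℤ.* f ℤ.* (n ℤ.* n ℤ.* n ℤ.+ A ℤ.* n ℤ.* n ℤ.* d ℤ.+ B ℤ.* d ℤ.* d ℤ.* d)) ∎)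
      where
      open ≡-Reasoning
      ι-** : ∀ a b c → ι# (a ℤ.* b ℤ.* c) ≡ ι# a * ι# b * ι# c
      ι-** a b c = trans (ι-* (a ℤ.* b) c) (cong (_* ι# c) (ι-* a b))

    f² = f ℤ.* f
    d³ = d ℤ.* d ℤ.* d
    numerator = n ℤ.* n ℤ.* n ℤ.+ A ℤ.* n ℤ.* n ℤ.* d ℤ.+ B ℤ.* d ℤ.* d ℤ.* d

    d⊥numerator : Comaximal d numerator
    d⊥numerator = subst (Comaximal d)
      (ringℤ 4 (λ A B n d → n :* n :* n :+ d :* (A :* n :* n :+ B :* d :* d) := n :* n :* n :+ A :* n :* n :* d :+ B :* d :* d :* d from [])
        refl (A ∷ B ∷ n ∷ d ∷ []) tt)
      (comaximal-shift {d} {n ℤ.* n ℤ.* n} (A ℤ.* n ℤ.* n ℤ.+ B ℤ.* d ℤ.* d) (comaximal-*ʳ {d} {n ℤ.* n} {n} (comaximal-*ʳ {d} {n} {n} d⊥n d⊥n) d⊥n))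

    cleared : f² ∣ d³ × d³ ∣ f²
    cleared = divides-cancelˡ {f²} {b ℤ.* b} {d³} (comaximal-*ˡ {f} {f} {b ℤ.* b} (comaximal-*ʳ f⊥b f⊥b) (comaximal-*ʳ f⊥b f⊥b))
        (divides numerator (trans equation (ℤₚ.*-comm f² numerator))) ,
      divides-cancelˡ {d³} {numerator} {f²} (comaximal-*ˡ {d ℤ.* d} {d} {numerator} (comaximal-*ˡ {d} {d} {numerator} d⊥numerator d⊥numerator) d⊥numerator)
        (divides (b ℤ.* b) (trans (ℤₚ.*-comm numerator f²) (sym equation)))

    assemble : f² ∣ d³ → d³ ∣ f² → Denominator x y
    assemble (divides u d³≡) (divides v f²≡) = finish root
      where
      f²≢0 : f² ≢ + 0
      f²≢0 = product-nonzeroℤ f≢0 f≢0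
      uv : u ℤ.* v ≡ + 1
      uv = cancelℤ {c = f²} f²≢0 (ringℤ 4 (λ u v f d → f :* (u :* v) := f :* ♯ 1 from
        (:- v · d ≈ u :* f ∷ :- ♯ 1 · f ≈ v :* d ∷ [])) refl (u ∷ v ∷ f² ∷ d³ ∷ []) (d³≡ , f²≡ , tt))
      inv = inverse (ι# d) (ι-nonzero d≢0)
      r = ι# f * proj₁ inv
      root : Integral r
      root = monic-root (ℤ.- (v ℤ.* d) ∷ + 0 ∷ []) (begin
        ι# (ℤ.- (v ℤ.* d)) + r * (ι# (+ 0) + r * ι# (+ 1)) ≡⟨ cong (_+ (r * (ι# (+ 0) + r * ι# (+ 1)))) (trans (ι-neg (v ℤ.* d)) (cong -_ (ι-* v d))) ⟩
        - (ι# v * ι# d) + r * (ι# (+ 0) + r * ι# (+ 1)) ≡⟨ ring 4 (λ v d f i →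
            :- (v :* d) :+ f :* i :* (♯ 0 :+ f :* i :* ♯ 1) := ♯ 0 from
            (v :* d :* (d :* i :+ ♯ 1) · d :* i ≈ ♯ 1 ∷ i :* i · f :* f ≈ v :* (d :* d :* d) ∷ []))
            refl (ι# v ∷ ι# d ∷ ι# f ∷ proj₁ inv ∷ [])
            (proj₂ inv , trans (sym (ι-* f f)) (trans (cong ι# f²≡) (trans (ι-* v d³)
              (cong (ι# v *_) (trans (ι-* (d ℤ.* d) d) (cong (_* ι# d) (ι-* d d)))))) , tt) ⟩
        ι# (+ 0) ∎)
        where open ≡-Reasoning
      finish : Integral r → Denominator x y
      finish (k , r≡) with sign-split k
      ... | s , ss , k≡ = denominator E (n ℤ.* v) (b ℤ.* (v ℤ.* s)) E≢0
          (comaximal-*ʳ {e} {n} {v} (comaximal-sym (comaximal-divisor {n} {d} {e} (divides (u ℤ.* e) (trans d≡ (sym (ℤₚ.*-assoc u e e)))) (comaximal-sym d⊥n))) e⊥v)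
          (comaximal-*ʳ {e} {b} {v ℤ.* s} (comaximal-sym (comaximal-divisor {b} {f} {e} (divides (d ℤ.* s) f≡) (comaximal-sym f⊥b))) (comaximal-*ʳ {e} {v} {s} e⊥v e⊥s))
          (scaled {x} {d} {n} {v} x≡ (ringℤ 4 (λ u v e d → e :* e := d :* v from (:- (e :* e) · u :* v ≈ ♯ 1 ∷ :- v · d ≈ u :* (e :* e) ∷ []))
            refl (u ∷ v ∷ e ∷ d ∷ []) (uv , d≡ , tt)))
          (scaled {y} {f} {b} {v ℤ.* s} y≡ (ringℤ 6 (λ u v s e d f → e :* (e :* e) := f :* (v :* s) from
            (:- (e :* e :* e) · u :* v ≈ ♯ 1 ∷ :- (u :* v :* e :* e :* e) · s :* s ≈ ♯ 1 ∷ :- (v :* s) · f ≈ d :* s :* e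
            ∷ :- (v :* s :* s :* e) · d ≈ u :* (e :* e) ∷ [])) refl (u ∷ v ∷ s ∷ e ∷ d ∷ f ∷ []) (uv , ss , f≡ , d≡ , tt)))
        where
        E = ℤ.∣ k ∣
        e = + E
        f≡ : f ≡ d ℤ.* s ℤ.* e
        f≡ = ι-injective (trans (ring 3 (λ f d i → f := d :* (f :* i) from (:- f · d :* i ≈ ♯ 1 ∷ [])) refl (ι# f ∷ ι# d ∷ proj₁ inv ∷ []) (proj₂ inv , tt))
          (trans (cong (ι# d *_) (trans r≡ (cong ι# k≡))) (trans (sym (ι-* d (s ℤ.* e))) (cong ι# (sym (ℤₚ.*-assoc d s e))))))
        d≡ : d ≡ u ℤ.* (e ℤ.* e)
        d≡ = cancelℤ {c = d ℤ.* d} (product-nonzeroℤ d≢0 d≢0) (ringℤ 6 (λ u v s e d f →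
          d :* d :* d := d :* d :* (u :* (e :* e)) from
          (:- (d :* d :* d) · u :* v ≈ ♯ 1 ∷ :- u · f :* f ≈ v :* (d :* d :* d)
          ∷ u :* (f :+ d :* s :* e) · f ≈ d :* s :* e ∷ u :* d :* d :* e :* e · s :* s ≈ ♯ 1 ∷ []))
          refl (u ∷ v ∷ s ∷ e ∷ d ∷ f ∷ []) (uv , f²≡ , f≡ , ss , tt))
        E≢0 : e ≢ + 0
        E≢0 h = d≢0 (trans d≡ (trans (cong (λ z → u ℤ.* (z ℤ.* z)) h) (ℤₚ.*-zeroʳ u)))
        e⊥v : Comaximal e v
        e⊥v = bezout (+ 0) u (trans (ℤₚ.+-identityˡ (u ℤ.* v)) uv)
        e⊥s : Comaximal e s
        e⊥s = bezout (+ 0) s (trans (ℤₚ.+-identityˡ (s ℤ.* s)) ss)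
        scaled : ∀ {z d m w D} → z * ι# d ≡ ι# m → D ≡ d ℤ.* w → z * ι# D ≡ ι# (m ℤ.* w)
        scaled {z} {d} {m} {w} h refl = trans (cong (z *_) (ι-* d w))
          (trans (sym (*-assoc z (ι# d) (ι# w))) (trans (cong (_* ι# w) h) (sym (ι-* m w))))

  x-integral : ∀ {x y} → OnCurve x y → Integral y → Integral x
  x-integral {x} {y} p (k , refl) = monic-root (B ℤ.- k ℤ.* k ∷ + 0 ∷ A ∷ []) (begin
    ι# (B ℤ.- k ℤ.* k) + x * (ι# (+ 0) + x * (ι# A + x * ι# (+ 1)))
      ≡⟨ cong (_+ (x * (ι# (+ 0) + x * (ι# A + x * ι# (+ 1))))) (trans (ι-+ B (ℤ.- (k ℤ.* k)))
        (cong (_+_ (ι# B)) (trans (ι-neg (k ℤ.* k)) (cong -_ (ι-* k k))))) ⟩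
    ι# B - ι# k * ι# k + x * (ι# (+ 0) + x * (ι# A + x * ι# (+ 1))) ≡⟨ ring 4 (λ A B x k →
        B :- k :* k :+ x :* (♯ 0 :+ x :* (A :+ x :* ♯ 1)) := ♯ 0 from
        (:- ♯ 1 · k :* k ≈ x :* x :* x :+ A :* x :* x :+ B ∷ [])) refl (ι# A ∷ ι# B ∷ x ∷ ι# k ∷ []) (p , tt) ⟩
    ι# (+ 0) ∎)
    where open ≡-Reasoning

  module Reduction {x y} (p : OnCurve x y) (D : Denominator x y)
    (E∤1 : ¬ + Denominator.E D ∣ + 1) (y≢0 : y ≢ ι# (+ 0)) where
    open Denominator D
    open Localisation K (+ E)
    open FormalGroup K A B (+ E) E∤1

    private
      e = + E
      w = proj₁ (inverse y y≢0)
      yw = proj₂ (inverse y y≢0)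

      wb : w * ι# b ≡ ι# (e ℤ.* (e ℤ.* e))
      wb = ring 4 (λ y w b e → w :* b := e from (:- w · y :* e ≈ b ∷ e · y :* w ≈ ♯ 1 ∷ []))
        refl (y ∷ w ∷ ι# b ∷ ι# (e ℤ.* (e ℤ.* e)) ∷ []) (y≡ , yw , tt)

      tb : x * w * ι# b ≡ ι# (e ℤ.* a)
      tb = trans (ring 5 (λ x w b e a → x :* w :* b := e :* a from (x · w :* b ≈ e :* (e :* e) ∷ e · x :* (e :* e) ≈ a ∷ []))
        refl (x ∷ w ∷ ι# b ∷ ι# e ∷ ι# a ∷ [])
        (trans wb (trans (ι-* e (e ℤ.* e)) (cong (ι# e *_) (ι-* e e))) , trans (cong (x *_) (sym (ι-* e e))) x≡ , tt)) (sym (ι-* e a))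

    close : Close (aff x y p) (x * w)
    close = close-aff w yw (near b a E⊥b (trans tb (cong (λ z → ι# (z ℤ.* a)) (sym (ℤₚ.*-identityʳ e)))))
      (near b (+ 1) E⊥b (trans wb (cong ι# (ringℤ 1 (λ e → e :* (e :* e) := e :* (e :* (e :* ♯ 1)) :* ♯ 1 from []) refl (e ∷ []) tt))))

    -- Here t = ea/b with a and b prime to e, while 0 = t(NP) agrees with Nt modulo e³. So e³
    -- divides N ea, and e² divides N.
    order-divisible : ∀ {N} → Mul N (aff x y p) O → e ℤ.* e ∣ + N
    order-divisible {N} NP = conclude (close-mul e E∤1 close NP)
      where
      N-ea : - (ι# b * (ι# (+ 0) - ι# (+ N) * (x * w))) ≡ ι# (+ N ℤ.* (e ℤ.* a))
      N-ea = trans (ring 4 (λ b N t ea → :- (b :* (♯ 0 :- N :* t)) := N :* ea from (N · t :* b ≈ ea ∷ []))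
        refl (ι# b ∷ ι# (+ N) ∷ x * w ∷ ι# (e ℤ.* a) ∷ []) (tb , tt)) (sym (ι-* (+ N) (e ℤ.* a)))
      conclude : ∃[ u ] (Close O u × Near 3 (u - ι# (+ N) * (x * w))) → e ℤ.* e ∣ + N
      conclude (_ , close-O , n₃) = square-divides e a N E≢0
        (near-integer {3} {+ N ℤ.* (e ℤ.* a)} (subst (Near 3) N-ea (near-neg (near-scale {3} b n₃)))) E⊥a

    multiple-not-integral : ∀ {n x′ y′ p′} → Mul n (aff x y p) (aff x′ y′ p′) → ¬ Integral y′
    multiple-not-integral h = close-not-integral e E∤1 (proj₁ (proj₂ (close-mul e E∤1 close h)))

  TorsionIntegral : ℕ → Set
  TorsionIntegral N = ∀ {x y p} → N ≢ 0 → Mul N (aff x y p) O → Integral y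

  record Splitting (E N : ℕ) : Set where
    field
      cofactor : ℕ
      N≡ : N ≡ E ℕ.* cofactor
      E≢0 : E ≢ 0
      cofactor≢0 : cofactor ≢ 0
      E<N : E ℕ.< N
      cofactor<N : cofactor ℕ.< N

  splitting : ∀ E N → ¬ + E ∣ + 1 → + E ≢ + 0 → N ≢ 0 → E ℕ.* E ℕDiv.∣ N → Splitting E N
  splitting E N E∤1 +E≢0 N≢0 (ℕDiv.divides q N≡) = record
    { cofactor = E ℕ.* q ; N≡ = N≡′ ; E≢0 = E≢0 ; cofactor≢0 = Eq≢0
    ; E<N = subst (E ℕ.<_) (sym N≡′) (ℕₚ.m<m*n E (E ℕ.* q) {{ℕ.≢-nonZero E≢0}} (ℕₚ.<-≤-trans 1<E (ℕₚ.m≤m*n E q {{ℕ.≢-nonZero q≢0}})))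
    ; cofactor<N = subst (E ℕ.* q ℕ.<_) (trans (ℕₚ.*-comm (E ℕ.* q) E) (sym N≡′)) (ℕₚ.m<m*n (E ℕ.* q) E {{ℕ.≢-nonZero Eq≢0}} 1<E)
    }
    where
    N≡′ : N ≡ E ℕ.* (E ℕ.* q)
    N≡′ = trans N≡ (trans (ℕₚ.*-comm q (E ℕ.* E)) (ℕₚ.*-assoc E E q))
    q≢0 : q ≢ 0
    q≢0 refl = N≢0 N≡
    E≢0 : E ≢ 0
    E≢0 h = +E≢0 (cong +_ h)
    1<E : 1 ℕ.< E
    1<E = ℕₚ.≤∧≢⇒< (ℕₚ.n≢0⇒n>0 E≢0) (λ h → E∤1 (subst (λ k → + k ∣ + 1) h (divides (+ 1) refl)))
    Eq≢0 : E ℕ.* q ≢ 0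
    Eq≢0 h = N≢0 (trans N≡′ (trans (cong (E ℕ.*_) h) (ℕₚ.*-zeroʳ E)))

  -- A point with denominator e > 1 has order divisible by e², hence a proper multiple
  -- of order e that is not integral either.
  torsion-y-integral : ∀ N → TorsionIntegral N
  torsion-y-integral = <-rec TorsionIntegral step
    where
    step : ∀ N → (∀ {M} → M ℕ.< N → TorsionIntegral M) → TorsionIntegral N
    step N ih {x} {y} {p} N≢0 NP = by-cases (denominators p) (y ≟ ι# (+ 0))
      where
      descend : (D : Denominator x y) → let E = Denominator.E D in (E∤1 : ¬ + E ∣ + 1) → y ≢ ι# (+ 0) → Splitting E N → Integral y
      descend D E∤1 y≢0 S = multiple (mul-total cofactor (aff x y p))
        where
        open Splitting S
        E = Denominator.E D
        finish : ∀ {R} → Mul cofactor (aff x y p) R → ∃[ T ] Mul E R T → Mul E R O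
        finish {R} h (T , ER) = subst (Mul E R)
          (mul-functional (mul-* E h ER) (subst (λ k → Mul k (aff x y p) O) N≡ NP)) ER
        multiple : ∃[ R ] Mul cofactor (aff x y p) R → Integral y
        multiple (O , h) = ih cofactor<N cofactor≢0 h
        multiple (aff x′ y′ p′ , h) = ⊥-elim (Reduction.multiple-not-integral p D E∤1 y≢0 h
          (ih E<N E≢0 (finish h (mul-total E (aff x′ y′ p′)))))

      by-cases : Denominator x y → Dec (y ≡ ι# (+ 0)) → Integral y
      by-cases D (yes y≡0) = + 0 , y≡0
      by-cases D@(denominator E a b E≢0 E⊥a E⊥b x≡ y≡) (no y≢0) = unit? (+ E ∣? + 1)
        where
        unit? : Dec (+ E ∣ + 1) → Integral y
        unit? (yes (divides q h)) = unit-denominator (q ℤ.* (q ℤ.* q)) y≡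
          (ringℤ 2 (λ e q → e :* (e :* e) :* (q :* (q :* q)) := ♯ 1 from
            (:- (q :* e :* (q :* e) :+ q :* e :+ ♯ 1) · ♯ 1 ≈ q :* e ∷ [])) refl (+ E ∷ q ∷ []) (h , tt))
        unit? (no E∤1) = descend D E∤1 y≢0 (splitting E N E∤1 E≢0 N≢0
          (subst (ℕDiv._∣ N) (ℤₚ.abs-* (+ E) (+ E)) (∣⇒∣ᵤ (Reduction.order-divisible p D E∤1 y≢0 {N} NP))))

  torsion-integral : ∀ {x y p} → Torsion (aff x y p) → Integral x × Integral y
  torsion-integral {p = p} (n , h) = x-integral p y-int , y-int
    where y-int = torsion-y-integral (suc n) (λ ()) h

-- Integral torsion points and the slopes between their multiples.

module Embedding (K : FractionField) where
  open FractionField K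
  open FieldProperties K
  private module ℤR = RingSolver ℤ-algebra

  ι-hom : ∀ {n} (e : Expr n) ρ → ι# (ℤR.⟦ e ⟧ ρ) ≡ ⟦ e ⟧ (Data.Vec.map ι# ρ)
  ι-hom (var zero) (x ∷ ρ) = refl
  ι-hom (var (suc i)) (x ∷ ρ) = ι-hom (var i) ρ
  ι-hom (# c) ρ = refl
  ι-hom (e :+ f) ρ = trans (ι-+ (ℤR.⟦ e ⟧ ρ) (ℤR.⟦ f ⟧ ρ)) (cong₂ _+_ (ι-hom e ρ) (ι-hom f ρ))
  ι-hom (e :- f) ρ = trans (ι-+ (ℤR.⟦ e ⟧ ρ) (ℤ.- ℤR.⟦ f ⟧ ρ))
    (cong₂ _+_ (ι-hom e ρ) (trans (ι-neg (ℤR.⟦ f ⟧ ρ)) (cong -_ (ι-hom f ρ))))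
  ι-hom (e :* f) ρ = trans (ι-* (ℤR.⟦ e ⟧ ρ) (ℤR.⟦ f ⟧ ρ)) (cong₂ _*_ (ι-hom e ρ) (ι-hom f ρ))
  ι-hom (:- e) ρ = trans (ι-neg (ℤR.⟦ e ⟧ ρ)) (cong -_ (ι-hom e ρ))

  ι-expand : ∀ n (f : Fun n (Expr n) (Expr n)) (ρ : Vec ℤ n) → let e = apply f (vars n) in
    ι# (ℤR.⟦ e ⟧ ρ) ≡ ⟦ e ⟧ (Data.Vec.map ι# ρ)
  ι-expand n f = ι-hom (apply f (vars n))

  push : ∀ n (f : Fun n (Expr n) (Expr n × Expr n)) (ρ : Vec ℤ n) → let e = apply f (vars n) in
    ℤR.⟦ proj₁ e ⟧ ρ ≡ ℤR.⟦ proj₂ e ⟧ ρ → ⟦ proj₁ e ⟧ (Data.Vec.map ι# ρ) ≡ ⟦ proj₂ e ⟧ (Data.Vec.map ι# ρ)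
  push n f ρ h = trans (sym (ι-hom (proj₁ (apply f (vars n))) ρ)) (trans (cong ι# h) (ι-hom (proj₂ (apply f (vars n))) ρ))

  pull : ∀ n (f : Fun n (Expr n) (Expr n × Expr n)) (ρ : Vec ℤ n) → let e = apply f (vars n) in
    ⟦ proj₁ e ⟧ (Data.Vec.map ι# ρ) ≡ ⟦ proj₂ e ⟧ (Data.Vec.map ι# ρ) → ℤR.⟦ proj₁ e ⟧ ρ ≡ ℤR.⟦ proj₂ e ⟧ ρ
  pull n f ρ h = ι-injective (trans (ι-hom (proj₁ (apply f (vars n))) ρ) (trans h (sym (ι-hom (proj₂ (apply f (vars n))) ρ))))

module TorsionPoints (K : FractionField) (A B : ℤ)
  (nonsingular : EllipticCurve.Nonsingular K (FractionField.ι# K A) (FractionField.ι# K B)) where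
  open FractionField K
  open FieldProperties K
  open Embedding K
  open NagellLutz K A B nonsingular

  OnℤCurve : ℤ → ℤ → Set
  OnℤCurve X Y = Y ℤ.* Y ≡ X ℤ.* X ℤ.* X ℤ.+ A ℤ.* X ℤ.* X ℤ.+ B

  embed : ∀ {X Y} → OnℤCurve X Y → OnCurve (ι# X) (ι# Y)
  embed {X} {Y} = push 4 (λ A B X Y → Y :* Y , X :* X :* X :+ A :* X :* X :+ B) (A ∷ B ∷ X ∷ Y ∷ [])

  record TorsionPoint (X Y : ℤ) : Set where
    constructor torsionPoint
    field
      on : OnℤCurve X Y
      torsion : Torsion (aff (ι# X) (ι# Y) (embed on))

  torsion-point : ∀ {x y p} X Y → x ≡ ι# X → y ≡ ι# Y → Torsion (aff x y p) → TorsionPoint X Y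
  torsion-point {p = p} X Y refl refl t = torsionPoint
    (pull 4 (λ A B X Y → Y :* Y , X :* X :* X :+ A :* X :* X :+ B) (A ∷ B ∷ X ∷ Y ∷ []) p) (subst Torsion (aff-cong refl refl) t)

  square-root-integral : ∀ {m} n → m * m ≡ ι# n → ∃[ k ] m ≡ ι# k
  square-root-integral {m} n h = monic-root (ℤ.- n ∷ + 0 ∷ []) (trans (cong (_+ (m * (ι# (+ 0) + m * ι# (+ 1)))) (ι-neg n))
    (ring 2 (λ m n → :- n :+ m :* (♯ 0 :+ m :* ♯ 1) := ♯ 0 from (♯ 1 · m :* m ≈ n ∷ [])) refl (m ∷ ι# n ∷ []) (h , tt)))

  doubleX : ℤ → ℤ → ℤ
  doubleX X M = M ℤ.* M ℤ.- A ℤ.- X ℤ.- X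

  -- The difference X(2P) - X(P) when M is the tangent slope at P. It vanishes when 3P = O.
  shift : ℤ → ℤ → ℤ
  shift X M = M ℤ.* M ℤ.- A ℤ.- + 3 ℤ.* X

  doubleY : ℤ → ℤ → ℤ → ℤ
  doubleY X Y M = ℤ.- (Y ℤ.+ M ℤ.* shift X M)

  private
    doubleXₑ : ∀ {n} → Expr n → Expr n → Expr n → Expr n
    doubleXₑ A X M = M :* M :- A :- X :- X
    shiftₑ : ∀ {n} → Expr n → Expr n → Expr n → Expr n
    shiftₑ A X M = M :* M :- A :- ♯ 3 :* X
    doubleYₑ : ∀ {n} → Expr n → Expr n → Expr n → Expr n → Expr n
    doubleYₑ A X Y M = :- (Y :+ M :* shiftₑ A X M)

  record Multiple (n : ℕ) (P : Point) (X Y : ℤ) : Set where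
    constructor multiple
    field
      on : OnCurve (ι# X) (ι# Y)
      mul : Mul n P (aff (ι# X) (ι# Y) on)

  relabel : ∀ {n P x y p} X Y → x ≡ ι# X → y ≡ ι# Y → Mul n P (aff x y p) → Multiple n P X Y
  relabel {p = p} X Y refl refl h = multiple p h

  multiple-torsion : ∀ {n P X Y} → Torsion P → Multiple n P X Y → TorsionPoint X Y
  multiple-torsion {X = X} {Y} t (multiple p h) = torsion-point {p = p} X Y refl refl (torsion-mul t h)

  -- The new abscissa m² - A - X₁ - X₂ is an integer because the sum is again torsion. So m² is an
  -- integer, and the rational m is a root of a monic integral polynomial.
  integral-slope : ∀ {P n X₁ X₂ m y p} → Torsion P → Mul n P (aff (m * m - ι# A - ι# X₁ - ι# X₂) y p) → ∃[ M ] m ≡ ι# M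
  integral-slope {X₁ = X₁} {X₂} {m} t h = from-integral (torsion-integral (torsion-mul t h))
    where
    from-integral : ∀ {y} → Integral (m * m - ι# A - ι# X₁ - ι# X₂) × Integral y → ∃[ M ] m ≡ ι# M
    from-integral ((k , k≡) , _) = square-root-integral (k ℤ.+ A ℤ.+ X₁ ℤ.+ X₂) (trans
      (ring 5 (λ m A x₁ x₂ k → m :* m := k :+ A :+ x₁ :+ x₂ from (♯ 1 · m :* m :- A :- x₁ :- x₂ ≈ k ∷ []))
        refl (m ∷ ι# A ∷ ι# X₁ ∷ ι# X₂ ∷ ι# k ∷ []) (k≡ , tt))
      (sym (ι-expand 4 (λ k A X₁ X₂ → k :+ A :+ X₁ :+ X₂) (k ∷ A ∷ X₁ ∷ X₂ ∷ []))))

  TangentSlope : ℤ → ℤ → ℤ → Set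
  TangentSlope X Y M = + 2 ℤ.* Y ℤ.* M ≡ + 3 ℤ.* X ℤ.* X ℤ.+ + 2 ℤ.* A ℤ.* X

  tangent-slope : ∀ X Y M → Slope (ι# X) (ι# Y) (ι# X) (ι# Y) (ι# M) → TangentSlope X Y M
  tangent-slope X Y M s = pull 4 (λ A X Y M → ♯ 2 :* Y :* M , ♯ 3 :* X :* X :+ ♯ 2 :* A :* X) (A ∷ X ∷ Y ∷ M ∷ [])
    (ring 4 (λ A X Y M → ♯ 2 :* Y :* M := ♯ 3 :* X :* X :+ ♯ 2 :* A :* X from
      (♯ 1 · M :* (Y :+ Y) ≈ X :* X :+ X :* X :+ X :* X :+ A :* (X :+ X) ∷ []))
      refl (ι# A ∷ ι# X ∷ ι# Y ∷ ι# M ∷ []) (Slope.tangent s , tt))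

  doubleX≡ : ∀ X M → ι# M * ι# M - ι# A - ι# X - ι# X ≡ ι# (doubleX X M)
  doubleX≡ X M = sym (ι-expand 3 (λ A X M → doubleXₑ A X M) (A ∷ X ∷ M ∷ []))

  doubleY≡ : ∀ X Y M → - (ι# Y + ι# M * (ι# M * ι# M - ι# A - ι# X - ι# X - ι# X)) ≡ ι# (doubleY X Y M)
  doubleY≡ X Y M = trans (ring 4 (λ A x y m → :- (y :+ m :* (m :* m :- A :- x :- x :- x)) := doubleYₑ A x y m from [])
    refl (ι# A ∷ ι# X ∷ ι# Y ∷ ι# M ∷ []) tt) (sym (ι-expand 4 (λ A X Y M → doubleYₑ A X Y M) (A ∷ X ∷ Y ∷ M ∷ [])))

  nonzero-not-opposite : ∀ X Y → Y ≢ + 0 → ¬ Opposite (ι# X) (ι# Y) (ι# X) (ι# Y)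
  nonzero-not-opposite X Y Y≢0 (_ , h) = Y≢0 (zero-productℤ {+ 2} {Y} (λ ()) (pull 1 (λ Y → ♯ 2 :* Y , ♯ 0) (Y ∷ [])
    (ring 1 (λ y → ♯ 2 :* y := ♯ 0 from (♯ 1 · y :+ y ≈ ♯ 0 ∷ [])) refl (ι# Y ∷ []) (h , tt))))

  doubling : ∀ X Y p → Y ≢ + 0 → Torsion (aff (ι# X) (ι# Y) p) →
    ∃[ M ] (TangentSlope X Y M × Multiple 2 (aff (ι# X) (ι# Y) p) (doubleX X M) (doubleY X Y M))
  doubling X Y p Y≢0 t = from-slope (slope-exists p p (nonzero-not-opposite X Y Y≢0))
    where
    Goal = ∃[ M ] (TangentSlope X Y M × Multiple 2 (aff (ι# X) (ι# Y) p) (doubleX X M) (doubleY X Y M))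
    from-slope : ∃[ m ] Slope (ι# X) (ι# Y) (ι# X) (ι# Y) m → Goal
    from-slope (m , s) = from-integral (integral-slope {aff (ι# X) (ι# Y) p} {2} {X} {X} {m} t 2P) s 2P
      where
      2P : Mul 2 (aff (ι# X) (ι# Y) p) (aff (m * m - ι# A - ι# X - ι# X) (- (ι# Y + m * (m * m - ι# A - ι# X - ι# X - ι# X))) (third-on-curve p p s))
      2P = mul-suc (mul-suc mul-0 (O-l _)) (line m (nonzero-not-opposite X Y Y≢0) s refl refl)
      from-integral : ∃[ M ] m ≡ ι# M → Slope (ι# X) (ι# Y) (ι# X) (ι# Y) m → ∀ {q} →
        Mul 2 (aff (ι# X) (ι# Y) p) (aff (m * m - ι# A - ι# X - ι# X) (- (ι# Y + m * (m * m - ι# A - ι# X - ι# X - ι# X))) q) → Goal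
      from-integral (M , refl) s h = M , tangent-slope X Y M s , relabel (doubleX X M) (doubleY X Y M) (doubleX≡ X M) (doubleY≡ X Y M) h

  double : ∀ X Y → TorsionPoint X Y → Y ≢ + 0 → ∃[ M ] (TangentSlope X Y M × TorsionPoint (doubleX X M) (doubleY X Y M))
  double X Y P Y≢0 = result (doubling X Y (embed on) Y≢0 torsion)
    where
    open TorsionPoint P
    result : ∃[ M ] (TangentSlope X Y M × Multiple 2 (aff (ι# X) (ι# Y) (embed on)) (doubleX X M) (doubleY X Y M)) →
      ∃[ M ] (TangentSlope X Y M × TorsionPoint (doubleX X M) (doubleY X Y M))
    result (M , s , h) = M , s , multiple-torsion {2} {_} {doubleX X M} {doubleY X Y M} torsion h

  -- The formulas for 3P use N = 2Y / (X(2P) - X(P)) in place of the slope of the chord through P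
  -- and 2P: it is the divisibility of 2Y that the congruences exploit.
  tripleX : ℤ → ℤ → ℤ → ℤ
  tripleX X M N = (M ℤ.+ N) ℤ.* (M ℤ.+ N) ℤ.- A ℤ.- doubleX X M ℤ.- X

  tripleY : ℤ → ℤ → ℤ → ℤ → ℤ
  tripleY X Y M N = (M ℤ.+ N) ℤ.* (tripleX X M N ℤ.- X) ℤ.- Y

  private
    tripleXₑ : ∀ {n} → Expr n → Expr n → Expr n → Expr n → Expr n
    tripleXₑ A X M N = (M :+ N) :* (M :+ N) :- A :- doubleXₑ A X M :- X

    record Triple (n : ℕ) (P : Point) (X Y M : ℤ) : Set where
      field
        N : ℤ
        N≡ : N ℤ.* shift X M ≡ + 2 ℤ.* Y
        point : Multiple n P (tripleX X M N) (tripleY X Y M N)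

  -- The chord through P and 2P has slope -(M + N).
  triple-slope : ∀ X Y M n → n ℤ.* (X ℤ.- doubleX X M) ≡ Y ℤ.- doubleY X Y M → ℤ.- (M ℤ.+ n) ℤ.* shift X M ≡ + 2 ℤ.* Y
  triple-slope X Y M n h = ringℤ 5 (λ A X Y M n → (:- (M :+ n)) :* shiftₑ A X M := ♯ 2 :* Y from
    (♯ 1 · n :* (X :- doubleXₑ A X M) ≈ Y :- doubleYₑ A X Y M ∷ [])) refl (A ∷ X ∷ Y ∷ M ∷ n ∷ []) (h , tt)

  tripleX≡ : ∀ X M n → ι# n * ι# n - ι# A - ι# (doubleX X M) - ι# X ≡ ι# (tripleX X M (ℤ.- (M ℤ.+ n)))
  tripleX≡ X M n = trans (sym (ι-expand 4 (λ A X X₂ n → n :* n :- A :- X₂ :- X) (A ∷ X ∷ doubleX X M ∷ n ∷ [])))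
    (cong ι# (ringℤ 4 (λ A X M n → n :* n :- A :- doubleXₑ A X M :- X := tripleXₑ A X M (:- (M :+ n)) from []) refl (A ∷ X ∷ M ∷ n ∷ []) tt))

  tripleY≡ : ∀ X Y M n → n ℤ.* (X ℤ.- doubleX X M) ≡ Y ℤ.- doubleY X Y M →
    - (ι# (doubleY X Y M) + ι# n * (ι# n * ι# n - ι# A - ι# (doubleX X M) - ι# X - ι# (doubleX X M))) ≡ ι# (tripleY X Y M (ℤ.- (M ℤ.+ n)))
  tripleY≡ X Y M n h = trans (sym (ι-expand 5 (λ A X X₂ Y₂ n → :- (Y₂ :+ n :* (n :* n :- A :- X₂ :- X :- X₂))) (A ∷ X ∷ doubleX X M ∷ doubleY X Y M ∷ n ∷ [])))
    (cong ι# (ringℤ 5 (λ A X Y M n → let N = :- (M :+ n); X₂ = doubleXₑ A X M in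
      :- (doubleYₑ A X Y M :+ n :* (n :* n :- A :- X₂ :- X :- X₂)) := (M :+ N) :* (tripleXₑ A X M N :- X) :- Y from
      (:- ♯ 1 · n :* (X :- X₂) ≈ Y :- doubleYₑ A X Y M ∷ [])) refl (A ∷ X ∷ Y ∷ M ∷ n ∷ []) (h , tt)))

  tripling : ∀ X Y M p → shift X M ≢ + 0 → Torsion (aff (ι# X) (ι# Y) p) →
    Multiple 2 (aff (ι# X) (ι# Y) p) (doubleX X M) (doubleY X Y M) → Triple 3 (aff (ι# X) (ι# Y) p) X Y M
  tripling X Y M p W≢0 t (multiple q 2P) = from-slope (slope-exists q p ¬opp)
    where
    P = aff (ι# X) (ι# Y) p
    X₂ = doubleX X M
    Y₂ = doubleY X Y M
    ¬opp : ¬ Opposite (ι# X₂) (ι# Y₂) (ι# X) (ι# Y)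
    ¬opp (h , _) = W≢0 (ringℤ 3 (λ A X M → shiftₑ A X M := ♯ 0 from (♯ 1 · doubleXₑ A X M ≈ X ∷ []))
      refl (A ∷ X ∷ M ∷ []) (ι-injective h , tt))
    from-slope : ∃[ n ] Slope (ι# X₂) (ι# Y₂) (ι# X) (ι# Y) n → Triple 3 P X Y M
    from-slope (n , s) = from-integral (integral-slope {P} {3} {X₂} {X} {n} t 3P) s 3P
      where
      3P : Mul 3 P (aff (n * n - ι# A - ι# X₂ - ι# X) (- (ι# Y₂ + n * (n * n - ι# A - ι# X₂ - ι# X - ι# X₂))) (third-on-curve q p s))
      3P = mul-suc 2P (line n ¬opp s refl refl)
      from-integral : ∃[ k ] n ≡ ι# k → Slope (ι# X₂) (ι# Y₂) (ι# X) (ι# Y) n → ∀ {r} →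
        Mul 3 P (aff (n * n - ι# A - ι# X₂ - ι# X) (- (ι# Y₂ + n * (n * n - ι# A - ι# X₂ - ι# X - ι# X₂))) r) → Triple 3 P X Y M
      from-integral (k , refl) s h = record
        { N = ℤ.- (M ℤ.+ k) ; N≡ = triple-slope X Y M k chord
        ; point = relabel (tripleX X M (ℤ.- (M ℤ.+ k))) (tripleY X Y M (ℤ.- (M ℤ.+ k))) (tripleX≡ X M k) (tripleY≡ X Y M k chord) h }
        where
        chord : k ℤ.* (X ℤ.- X₂) ≡ Y ℤ.- Y₂
        chord = pull 5 (λ X Y X₂ Y₂ n → n :* (X :- X₂) , Y :- Y₂) (X ∷ Y ∷ X₂ ∷ Y₂ ∷ k ∷ []) (Slope.chord s)

  triple : ∀ X Y M → TorsionPoint X Y → Y ≢ + 0 → TangentSlope X Y M → shift X M ≢ + 0 →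
    ∃[ N ] (N ℤ.* shift X M ≡ + 2 ℤ.* Y × TorsionPoint (tripleX X M N) (tripleY X Y M N))
  triple X Y M P Y≢0 s W≢0 = start (doubling X Y (embed on) Y≢0 torsion)
    where
    open TorsionPoint P
    ⟨P⟩ = aff (ι# X) (ι# Y) (embed on)
    Goal = ∃[ N ] (N ℤ.* shift X M ≡ + 2 ℤ.* Y × TorsionPoint (tripleX X M N) (tripleY X Y M N))
    result : Triple 3 ⟨P⟩ X Y M → Goal
    result r = N , N≡ , multiple-torsion {3} {⟨P⟩} {tripleX X M N} {tripleY X Y M N} torsion point
      where open Triple r
    start : ∃[ M′ ] (TangentSlope X Y M′ × Multiple 2 ⟨P⟩ (doubleX X M′) (doubleY X Y M′)) → Goal
    start (M′ , s′ , h) = result (tripling X Y M (embed on) W≢0 torsion (subst (λ M → Multiple 2 ⟨P⟩ (doubleX X M) (doubleY X Y M)) M′≡M h))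
      where
      M′≡M : M′ ≡ M
      M′≡M = cancelℤ {M′} {M} {+ 2 ℤ.* Y} (product-nonzeroℤ {+ 2} {Y} (λ ()) Y≢0) (trans s′ (sym s))

-- Positivity certificates, finite searches and residues.

module Positivity where
  open RingSolver ℤ-algebra
  open Soundness
  open Horner

  nonnegative? : ∀ {n} → Poly n → Bool
  nonnegative? {zero} (+ _) = true
  nonnegative? {zero} -[1+ _ ] = false
  nonnegative? {suc n} [] = true
  nonnegative? {suc n} (a ∷ p) = nonnegative? a ∧ nonnegative? p

  positive? : ∀ {n} → Poly n → Bool
  positive? {zero} (+ suc _) = true
  positive? {zero} _ = false
  positive? {suc n} [] = false
  positive? {suc n} (a ∷ p) = positive? a ∧ nonnegative? p

  private
    naturals : ∀ {n} → Vec ℕ n → Vec ℤ n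
    naturals = Data.Vec.map +_

    ∧-split : ∀ {a b} → a ∧ b ≡ true → a ≡ true × b ≡ true
    ∧-split {true} {true} refl = refl , refl

    product-natural : ∀ x {v j} → v ≡ + j → + x ℤ.* v ≡ + (x ℕ.* j)
    product-natural x {j = j} refl = sym (ℤₚ.pos-* x j)

    ev-nonnegative : ∀ {n} (p : Poly n) → nonnegative? p ≡ true → ∀ ρ → ∃[ k ] ev p (naturals ρ) ≡ + k
    ev-nonnegative {zero} (+ k) h [] = k , refl
    ev-nonnegative {suc n} [] h ρ = 0 , refl
    ev-nonnegative {suc n} (a ∷ p) h (x ∷ ρ) with ∧-split h
    ... | ha , hp with ev-nonnegative a ha ρ | ev-nonnegative p hp (x ∷ ρ)
    ...   | i , i≡ | j , j≡ = i ℕ.+ x ℕ.* j , cong₂ ℤ._+_ i≡ (product-natural x j≡)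

    ev-positive : ∀ {n} (p : Poly n) → positive? p ≡ true → ∀ ρ → ∃[ k ] ev p (naturals ρ) ≡ + suc k
    ev-positive {zero} (+ suc k) h [] = k , refl
    ev-positive {suc n} (a ∷ p) h (x ∷ ρ) with ∧-split h
    ... | ha , hp with ev-positive a ha ρ | ev-nonnegative p hp (x ∷ ρ)
    ...   | i , i≡ | j , j≡ = i ℕ.+ x ℕ.* j , cong₂ ℤ._+_ i≡ (product-natural x j≡)

  -- A polynomial with nonnegative coefficients and positive constant term has no zero in natural
  -- numbers. Inequalities between variables are brought into this form by substituting a bound plus
  -- a new natural variable.
  impossible : ∀ n (f : Fun n (Expr n) (Expr n)) → let e = apply f (vars n) in positive? ⟦ e ⟧ₚ ≡ true →
    ∀ (ρ : Vec ℕ n) → ⟦ e ⟧ (Data.Vec.map +_ ρ) ≢ + 0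
  impossible n f ok ρ h with ev-positive ⟦ apply f (vars n) ⟧ₚ ok ρ
  ... | k , k≡ with trans (sym k≡) (trans (ev-⟦⟧ (apply f (vars n)) (naturals ρ)) h)
  ...   | ()

  Natural : ℤ → Set
  Natural z = ∃[ k ] z ≡ + k

  natural : ∀ n (f : Fun n (Expr n) (Expr n)) → let e = apply f (vars n) in nonnegative? ⟦ e ⟧ₚ ≡ true →
    ∀ (ρ : Vec ℕ n) → Natural (⟦ e ⟧ (Data.Vec.map +_ ρ))
  natural n f ok ρ = let k , h = ev-nonnegative ⟦ apply f (vars n) ⟧ₚ ok ρ in
    k , trans (sym (ev-⟦⟧ (apply f (vars n)) (Data.Vec.map +_ ρ))) h

  natural-+ : ∀ z → Natural z → ∀ n (f : Fun n (Expr n) (Expr n)) → let e = apply f (vars n) in nonnegative? ⟦ e ⟧ₚ ≡ true →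
    ∀ (ρ : Vec ℕ n) → Natural (z ℤ.+ ⟦ e ⟧ (Data.Vec.map +_ ρ))
  natural-+ z (a , a≡) n f ok ρ = let b , b≡ = natural n f ok ρ in a ℕ.+ b , cong₂ ℤ._+_ a≡ b≡

open Positivity public using (impossible; Natural; natural; natural-+)

module FiniteSearch where

  infix 4 _==_
  infixr 3 _⇒ᵇ_

  _==_ : ℤ → ℤ → Bool
  a == b = does (a ℤ.≟ b)

  _⇒ᵇ_ : Bool → Bool → Bool
  a ⇒ᵇ b = not a ∨ b

  ==-complete : ∀ {a b} → a ≡ b → (a == b) ≡ true
  ==-complete {a} {b} = dec-true (a ℤ.≟ b)

  ==-sound : ∀ {a b} → (a == b) ≡ true → a ≡ b
  ==-sound {a} {b} h with a ℤ.≟ b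
  ... | yes a≡b = a≡b

  ⇒ᵇ-elim : ∀ {a b} → (a ⇒ᵇ b) ≡ true → a ≡ true → b ≡ true
  ⇒ᵇ-elim {true} h refl = h

  ∧-elim : ∀ {a b} → a ∧ b ≡ true → a ≡ true × b ≡ true
  ∧-elim {true} {true} refl = refl , refl

  ∨-elim : ∀ {a b} → a ∨ b ≡ true → a ≡ true ⊎ b ≡ true
  ∨-elim {true} h = inj₁ refl
  ∨-elim {false} h = inj₂ h

  range-check : ℕ → (ℤ → Bool) → Bool
  range-check zero p = p (+ 0)
  range-check (suc N) p = p (+ suc N) ∧ p -[1+ N ] ∧ range-check N p

  range-search : ∀ N (p : ℤ → Bool) → range-check N p ≡ true → ∀ n → ℤ.∣ n ∣ ℕ.≤ N → p n ≡ true
  range-search zero p ok (+ .0) ℕ.z≤n = ok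
  range-search (suc N) p ok n n≤ with ∧-elim {p (+ suc N)} ok
  ... | ok₁ , rest with ∧-elim {p -[1+ N ]} rest
  ...   | ok₂ , ok₃ with ℕₚ.m≤n⇒m<n∨m≡n n≤
  ...     | inj₁ n< = range-search N p ok₃ n (ℕₚ.≤-pred n<)
  range-search (suc N) p ok (+ _) n≤ | ok₁ , rest | ok₂ , ok₃ | inj₂ refl = ok₁
  range-search (suc N) p ok -[1+ _ ] n≤ | ok₁ , rest | ok₂ , ok₃ | inj₂ refl = ok₂

open FiniteSearch public

module Congruences where
  open import Data.Integer using (_+_; _*_; -_; _-_; ∣_∣)

  data Residues₂ (n : ℤ) : Set where
    even : + 2 ∣ n → Residues₂ n
    odd : Comaximal (+ 2) n → Residues₂ n

  data Residues₃ (n : ℤ) : Set where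
    multiple₃ : + 3 ∣ n → Residues₃ n
    prime-to-3 : Comaximal (+ 3) n → Residues₃ n

  mod-2 : ∀ n → Residues₂ n
  mod-2 n = from-remainder (n IntDM.%ℕ 2) (n IntDM./ℕ 2) (IntDM.a≡a%ℕn+[a/ℕn]*n n 2) (IntDM.n%ℕd<d n 2)
    where
    from-remainder : ∀ r q → n ≡ + r + q * + 2 → r ℕ.< 2 → Residues₂ n
    from-remainder 0 q h _ = even (divides q (trans h (ℤₚ.+-identityˡ (q * + 2))))
    from-remainder 1 q h _ = odd (bezout (- q) (+ 1) (ringℤ 2 (λ n q → (:- q) :* ♯ 2 :+ ♯ 1 :* n := ♯ 1 from
      (♯ 1 · n ≈ ♯ 1 :+ q :* ♯ 2 ∷ [])) refl (n ∷ q ∷ []) (h , tt)))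
    from-remainder (suc (suc _)) q h (ℕ.s≤s (ℕ.s≤s ()))

  mod-3 : ∀ n → Residues₃ n
  mod-3 n = from-remainder (n IntDM.%ℕ 3) (n IntDM./ℕ 3) (IntDM.a≡a%ℕn+[a/ℕn]*n n 3) (IntDM.n%ℕd<d n 3)
    where
    from-remainder : ∀ r q → n ≡ + r + q * + 3 → r ℕ.< 3 → Residues₃ n
    from-remainder 0 q h _ = multiple₃ (divides q (trans h (ℤₚ.+-identityˡ (q * + 3))))
    from-remainder 1 q h _ = prime-to-3 (bezout (- q) (+ 1) (ringℤ 2 (λ n q → (:- q) :* ♯ 3 :+ ♯ 1 :* n := ♯ 1 from
      (♯ 1 · n ≈ ♯ 1 :+ q :* ♯ 3 ∷ [])) refl (n ∷ q ∷ []) (h , tt)))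
    from-remainder 2 q h _ = prime-to-3 (bezout (q + + 1) -[1+ 0 ] (ringℤ 2 (λ n q → (q :+ ♯ 1) :* ♯ 3 :+ # -[1+ 0 ] :* n := ♯ 1 from
      (:- ♯ 1 · n ≈ ♯ 2 :+ q :* ♯ 3 ∷ [])) refl (n ∷ q ∷ []) (h , tt)))
    from-remainder (suc (suc (suc _))) q h (ℕ.s≤s (ℕ.s≤s (ℕ.s≤s ())))

  3∣cube-difference : ∀ s → + 3 ∣ s * ((s + + 1) * (s - + 1))
  3∣cube-difference s = by (s IntDM.%ℕ 3) (s IntDM./ℕ 3) (IntDM.a≡a%ℕn+[a/ℕn]*n s 3) (IntDM.n%ℕd<d s 3)
    where
    by : ∀ r q → s ≡ + r + q * + 3 → r ℕ.< 3 → + 3 ∣ s * ((s + + 1) * (s - + 1))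
    by 0 q h _ = divides (q * ((s + + 1) * (s - + 1))) (ringℤ 2 (λ s q → s :* ((s :+ ♯ 1) :* (s :- ♯ 1)) := q :* ((s :+ ♯ 1) :* (s :- ♯ 1)) :* ♯ 3 from
      ((s :+ ♯ 1) :* (s :- ♯ 1) · s ≈ ♯ 0 :+ q :* ♯ 3 ∷ [])) refl (s ∷ q ∷ []) (h , tt))
    by 1 q h _ = divides (q * (s * (s + + 1))) (ringℤ 2 (λ s q → s :* ((s :+ ♯ 1) :* (s :- ♯ 1)) := q :* (s :* (s :+ ♯ 1)) :* ♯ 3 from
      (s :* (s :+ ♯ 1) · s ≈ ♯ 1 :+ q :* ♯ 3 ∷ [])) refl (s ∷ q ∷ []) (h , tt))
    by 2 q h _ = divides ((q + + 1) * (s * (s - + 1))) (ringℤ 2 (λ s q → s :* ((s :+ ♯ 1) :* (s :- ♯ 1)) := (q :+ ♯ 1) :* (s :* (s :- ♯ 1)) :* ♯ 3 from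
      (s :* (s :- ♯ 1) · s ≈ ♯ 2 :+ q :* ♯ 3 ∷ [])) refl (s ∷ q ∷ []) (h , tt))
    by (suc (suc (suc _))) q h (ℕ.s≤s (ℕ.s≤s (ℕ.s≤s ())))

  comaximal-not-divides : ∀ {p n} → ¬ p ∣ + 1 → Comaximal p n → ¬ p ∣ n
  comaximal-not-divides {p} {n} p∤1 c (divides q h) = p∤1 (divides-cancelˡ {p} {n} {+ 1} c (divides q (trans (ℤₚ.*-identityʳ n) h)))

  2∤1 : ¬ + 2 ∣ + 1
  2∤1 = from-no (+ 2 ∣? + 1)

  3∤1 : ¬ + 3 ∣ + 1
  3∤1 = from-no (+ 3 ∣? + 1)

  odd-not-even : ∀ n → Comaximal (+ 2) n → ¬ + 2 ∣ n
  odd-not-even n = comaximal-not-divides {+ 2} {n} 2∤1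

  prime-to-3-not-multiple : ∀ n → Comaximal (+ 3) n → ¬ + 3 ∣ n
  prime-to-3-not-multiple n = comaximal-not-divides {+ 3} {n} 3∤1

  divisor-bound : ∀ {d n} → n ≢ + 0 → d ∣ n → ∣ d ∣ ℕ.≤ ∣ n ∣
  divisor-bound {d} {n} n≢0 h = ℕDivₚ.∣⇒≤ {{ℕ.≢-nonZero (λ e → n≢0 (ℤₚ.∣i∣≡0⇒i≡0 e))}} (∣⇒∣ᵤ h)

open Congruences public

module _ (K : FractionField) where
  open FractionField K
  open FieldProperties K
  open Embedding K

  -- The discriminant of X³ + AX² + B is -B(4A³ + 27B). The cofactors express B(4A³ + 27B) through
  -- the cubic and its derivative.
  nonsingular-criterion : ∀ A B → B ≢ + 0 → + 4 ℤ.* A ℤ.* A ℤ.* A ℤ.+ + 27 ℤ.* B ≢ + 0 →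
    EllipticCurve.Nonsingular K (ι# A) (ι# B)
  nonsingular-criterion A B B≢0 D≢0 x f g = D≢0 (zero-productℤ B≢0
    (pull 2 (λ A B → B :* (♯ 4 :* A :* A :* A :+ ♯ 27 :* B) , ♯ 0) (A ∷ B ∷ [])
      (ring 3 (λ A B x → B :* (♯ 4 :* A :* A :* A :+ ♯ 27 :* B) := ♯ 0 from
        (♯ 4 :* A :* A :* A :+ ♯ 27 :* B :+ ♯ 6 :* x :* x :* x :- ♯ 2 :* A :* x :* x :+ ♯ 2 :* A :* A :* x
          · x :* x :* x :+ A :* x :* x :+ B ≈ ♯ 0
        ∷ :- ♯ 2 :* x :* x :* x :* x :- A :* B :- ♯ 2 :* A :* A :* A :* x :- ♯ 11 :* B :* x
          · ♯ 3 :* x :* x :+ ♯ 2 :* A :* x ≈ ♯ 0 ∷ [])) refl (ι# A ∷ ι# B ∷ x ∷ []) (f , g , tt))))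

-- The affine quartic and the points to be found on it.

data Exceptional : ℤ → ℤ → ℤ → Set where
  [-1,0] : Exceptional -[1+ 0 ] -[1+ 0 ] (+ 0)
  [0,-1] : Exceptional -[1+ 0 ] (+ 0) -[1+ 0 ]
  [-6,3] : Exceptional (+ 135) -[1+ 5 ] (+ 3)
  [3,-6] : Exceptional (+ 135) (+ 3) -[1+ 5 ]

module Points (K : FractionField) (k : ℤ) where
  open FractionField K
  open FieldProperties K

  OnQuartic : Carrier → Carrier → Set
  OnQuartic x y = x * x * x + x * x * y * y + y * y * y ≡ ι# k

  data Listed (x y : Carrier) : Set where
    diagonal : ∀ a → x ≡ ι# a → y ≡ ι# a → Listed x y
    exceptional : ∀ a b → Exceptional k a b → x ≡ ι# a → y ≡ ι# b → Listed x y

  quartic-symmetric : ∀ {x y} → OnQuartic x y → OnQuartic y x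
  quartic-symmetric {x} {y} h = trans (ring 2 (λ x y → y :* y :* y :+ y :* y :* x :* x :+ x :* x :* x :=
    x :* x :* x :+ x :* x :* y :* y :+ y :* y :* y from []) refl (x ∷ y ∷ []) tt) h

cube-root-integral : ∀ K → let open FractionField K in ∀ {x} c → x * x * x ≡ ι# c → ∃[ n ] x ≡ ι# n
cube-root-integral K {x} c h = Integrality.monic-root K (ℤ.- c ∷ + 0 ∷ + 0 ∷ [])
  (trans (cong (_+ (x * (ι# (+ 0) + x * (ι# (+ 0) + x * ι# (+ 1))))) (ι-neg c))
    (ring 2 (λ x c → :- c :+ x :* (♯ 0 :+ x :* (♯ 0 :+ x :* ♯ 1)) := ♯ 0 from (♯ 1 · x :* x :* x ≈ c ∷ []))
      refl (x ∷ ι# c ∷ []) (h , tt)))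
  where
  open FractionField K
  open FieldProperties K

-- Rank zero of E₂.

-- The equation satisfied by 2 / x and 2 / y for a point of the quartic with k = - 1 or k = - 2.
module ReciprocalPoints where
  open import Data.Integer using (_+_; _*_; -_; _-_; ∣_∣)

  Reciprocal : ℤ → ℤ → ℤ → Set
  Reciprocal k n m = + 8 * m * m * m + + 16 * n * m + + 8 * n * n * n ≡ k * (n * n * n * (m * m * m))

  reciprocal-swap : ∀ k n m → Reciprocal k n m → Reciprocal k m n
  reciprocal-swap k n m h = ringℤ 3 (λ k n m → ♯ 8 :* n :* n :* n :+ ♯ 16 :* m :* n :+ ♯ 8 :* m :* m :* m := k :* (m :* m :* m :* (n :* n :* n)) from
    (♯ 1 · ♯ 8 :* m :* m :* m :+ ♯ 16 :* n :* m :+ ♯ 8 :* n :* n :* n ≈ k :* (n :* n :* n :* (m :* m :* m)) ∷ []))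
    refl (k ∷ n ∷ m ∷ []) (h , tt)

  private
    defect : Expr 3 → Expr 3 → Expr 3 → Expr 3
    defect κ n m = ♯ 8 :* m :* m :* m :+ ♯ 16 :* n :* m :+ ♯ 8 :* n :* n :* n :- (:- (♯ 1 :+ κ)) :* (n :* n :* n :* (m :* m :* m))

    negated : ∀ {a b} → a ≡ b → - (a - b) ≡ + 0
    negated {a} refl = cong -_ (ℤₚ.+-inverseʳ a)

  -- If both absolute values are at least 3, the term k n³ m³ outweighs the other three. For each
  -- choice of signs the defect, up to sign, is a positive polynomial in the excesses over 3.
  small : ∀ κ n m → Reciprocal -[1+ κ ] n m → ∣ n ∣ ℕ.≤ 2 ⊎ ∣ m ∣ ℕ.≤ 2
  small κ (+ 0) m h = inj₁ ℕ.z≤n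
  small κ (+ 1) m h = inj₁ (ℕ.s≤s ℕ.z≤n)
  small κ (+ 2) m h = inj₁ (ℕ.s≤s (ℕ.s≤s ℕ.z≤n))
  small κ -[1+ 0 ] m h = inj₁ (ℕ.s≤s ℕ.z≤n)
  small κ -[1+ 1 ] m h = inj₁ (ℕ.s≤s (ℕ.s≤s ℕ.z≤n))
  small κ n (+ 0) h = inj₂ ℕ.z≤n
  small κ n (+ 1) h = inj₂ (ℕ.s≤s ℕ.z≤n)
  small κ n (+ 2) h = inj₂ (ℕ.s≤s (ℕ.s≤s ℕ.z≤n))
  small κ n -[1+ 0 ] h = inj₂ (ℕ.s≤s ℕ.z≤n)
  small κ n -[1+ 1 ] h = inj₂ (ℕ.s≤s (ℕ.s≤s ℕ.z≤n))
  small κ (+ suc (suc (suc i))) (+ suc (suc (suc j))) h = ⊥-elim (impossible 3 (λ κ i j → defect κ (♯ 3 :+ i) (♯ 3 :+ j))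
    refl (κ ∷ i ∷ j ∷ []) (ℤₚ.i≡j⇒i-j≡0 h))
  small κ (+ suc (suc (suc i))) -[1+ suc (suc j) ] h = ⊥-elim (impossible 3 (λ κ i j → :- defect κ (♯ 3 :+ i) (:- (♯ 3 :+ j)))
    refl (κ ∷ i ∷ j ∷ []) (negated h))
  small κ -[1+ suc (suc i) ] (+ suc (suc (suc j))) h = ⊥-elim (impossible 3 (λ κ i j → :- defect κ (:- (♯ 3 :+ i)) (♯ 3 :+ j))
    refl (κ ∷ i ∷ j ∷ []) (negated h))
  small κ -[1+ suc (suc i) ] -[1+ suc (suc j) ] h = ⊥-elim (impossible 3 (λ κ i j → defect κ (:- (♯ 3 :+ i)) (:- (♯ 3 :+ j)))
    refl (κ ∷ i ∷ j ∷ []) (ℤₚ.i≡j⇒i-j≡0 h))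

  test : ℤ → ℤ → ℤ → Bool
  test k n m = (+ 8 * m * m * m + + 16 * n * m + + 8 * n * n * n == k * (n * n * n * (m * m * m)))
    ⇒ᵇ ((n == + 0) ∨ (m == + 0) ∨ ((n == -[1+ 1 ]) ∧ (m == -[1+ 1 ]) ∧ (k == -[1+ 0 ])))

  -- The outcome of the search is wrapped and passed as an argument, so that the search is evaluated
  -- where `verified refl` is checked and remains opaque in the arguments that consume it.
  record Verified (k : ℤ) : Set where
    constructor verified
    field check : range-check 2 (λ n → range-check 64 (test k n)) ≡ true

  -- m divides 8 n³, which bounds m as soon as n is small.
  search : ∀ k → Verified k → ∀ n m → n ≢ + 0 → m ≢ + 0 →
    Reciprocal k n m → ∣ n ∣ ℕ.≤ 2 → n ≡ -[1+ 1 ] × m ≡ -[1+ 1 ] × k ≡ -[1+ 0 ]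
  search k (verified ok) n m n≢0 m≢0 h n≤2 = conclude (∨-elim {n == + 0} (⇒ᵇ-elim {+ 8 * m * m * m + + 16 * n * m + + 8 * n * n * n == k * (n * n * n * (m * m * m))}
      (range-search 64 (test k n) (range-search 2 (λ n → range-check 64 (test k n)) ok n n≤2) m m≤64) (==-complete h)))
    where
    conclude : (n == + 0) ≡ true ⊎ (m == + 0) ∨ ((n == -[1+ 1 ]) ∧ (m == -[1+ 1 ]) ∧ (k == -[1+ 0 ])) ≡ true → n ≡ -[1+ 1 ] × m ≡ -[1+ 1 ] × k ≡ -[1+ 0 ]
    conclude (inj₁ e) = ⊥-elim (n≢0 (==-sound e))
    conclude (inj₂ e) with ∨-elim {m == + 0} e
    ... | inj₁ e′ = ⊥-elim (m≢0 (==-sound e′))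
    ... | inj₂ e′ with ∧-elim {n == -[1+ 1 ]} e′
    ...   | a , e″ with ∧-elim {m == -[1+ 1 ]} e″
    ...     | b , c = ==-sound a , ==-sound b , ==-sound c
    8n³≤64 : ∣ + 8 * n * n * n ∣ ℕ.≤ 64
    8n³≤64 = ℕₚ.≤ᵇ⇒≤ ∣ + 8 * n * n * n ∣ 64 (subst T (sym (range-search 2 (λ n → ∣ + 8 * n * n * n ∣ ℕ.≤ᵇ 64) refl n n≤2)) tt)
    m≤64 : ∣ m ∣ ℕ.≤ 64
    m≤64 = ℕₚ.≤-trans (divisor-bound {m} {+ 8 * n * n * n}
      (product-nonzeroℤ {+ 8 * n * n} {n} (product-nonzeroℤ {+ 8 * n} {n} (product-nonzeroℤ {+ 8} {n} (λ ()) n≢0) n≢0) n≢0)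
      (divides (k * (n * n * n * m * m) - + 8 * m * m - + 16 * n)
        (ringℤ 3 (λ k n m → ♯ 8 :* n :* n :* n := (k :* (n :* n :* n :* m :* m) :- ♯ 8 :* m :* m :- ♯ 16 :* n) :* m from
          (♯ 1 · ♯ 8 :* m :* m :* m :+ ♯ 16 :* n :* m :+ ♯ 8 :* n :* n :* n ≈ k :* (n :* n :* n :* (m :* m :* m)) ∷ []))
          refl (k ∷ n ∷ m ∷ []) (h , tt)))) 8n³≤64

  solve : ∀ κ → Verified -[1+ κ ] → ∀ n m → n ≢ + 0 → m ≢ + 0 →
    Reciprocal -[1+ κ ] n m → n ≡ -[1+ 1 ] × m ≡ -[1+ 1 ] × -[1+ κ ] ≡ -[1+ 0 ]
  solve κ ok n m n≢0 m≢0 h = cases (small κ n m h)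
    where
    cases : ∣ n ∣ ℕ.≤ 2 ⊎ ∣ m ∣ ℕ.≤ 2 → n ≡ -[1+ 1 ] × m ≡ -[1+ 1 ] × -[1+ κ ] ≡ -[1+ 0 ]
    cases (inj₁ n≤2) = search -[1+ κ ] ok n m n≢0 m≢0 h n≤2
    cases (inj₂ m≤2) = let a , b , c = search -[1+ κ ] ok m n m≢0 n≢0 (reciprocal-swap -[1+ κ ] n m h) m≤2 in b , a , c

  reciprocal-solutions : ∀ k → k ≡ -[1+ 0 ] ⊎ k ≡ -[1+ 1 ] → ∀ n m → n ≢ + 0 → m ≢ + 0 → Reciprocal k n m →
    n ≡ -[1+ 1 ] × m ≡ -[1+ 1 ] × k ≡ -[1+ 0 ]
  reciprocal-solutions _ (inj₁ refl) = solve 0 (verified refl)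
  reciprocal-solutions _ (inj₂ refl) = solve 1 (verified refl)

  cube-solutions : ∀ k → k ≡ -[1+ 0 ] ⊎ k ≡ -[1+ 1 ] → ∀ b → b * b * b ≡ k → b ≡ -[1+ 0 ] × k ≡ -[1+ 0 ]
  cube-solutions k k≡ b h = bound k≡
    where
    p : ℤ → ℤ → Bool
    p k b = (b * b * b == k) ⇒ᵇ ((b == -[1+ 0 ]) ∧ (k == -[1+ 0 ]))
    b∣k : b ∣ k
    b∣k = divides (b * b) (sym h)
    conclude : ∀ k → b * b * b ≡ k → p k b ≡ true → b ≡ -[1+ 0 ] × k ≡ -[1+ 0 ]
    conclude k h e = let u , v = ∧-elim {b == -[1+ 0 ]} (⇒ᵇ-elim {b * b * b == k} e (==-complete h)) in ==-sound u , ==-sound v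
    bound : k ≡ -[1+ 0 ] ⊎ k ≡ -[1+ 1 ] → b ≡ -[1+ 0 ] × k ≡ -[1+ 0 ]
    bound (inj₁ e) = conclude k h (subst (λ k → p k b ≡ true) (sym e) (range-search 2 (p -[1+ 0 ]) refl b
      (ℕₚ.≤-trans (divisor-bound {b} { -[1+ 0 ]} (λ ()) (subst (b ∣_) e b∣k)) (ℕ.s≤s ℕ.z≤n))))
    bound (inj₂ e) = conclude k h (subst (λ k → p k b ≡ true) (sym e) (range-search 2 (p -[1+ 1 ]) refl b
      (divisor-bound {b} { -[1+ 1 ]} (λ ()) (subst (b ∣_) e b∣k))))

module RankZeroE₂ (K : FractionField) (k : ℤ) (k≢0 : k ≢ + 0) where
  open FractionField K
  open FieldProperties K
  open Embedding K
  open Points K k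
  open ReciprocalPoints using (Reciprocal; reciprocal-solutions; cube-solutions)

  A₂ B₂ : ℤ
  A₂ = + 4 ℤ.* k
  B₂ = + 16 ℤ.* (k ℤ.* k)

  nonsingular₂ : EllipticCurve.Nonsingular K (ι# A₂) (ι# B₂)
  nonsingular₂ = nonsingular-criterion K A₂ B₂ B₂≢0 (λ h → discriminant≢0 (trans (sym factor) h))
    where
    B₂≢0 : B₂ ≢ + 0
    B₂≢0 = product-nonzeroℤ {+ 16} {k ℤ.* k} (λ ()) (product-nonzeroℤ {k} {k} k≢0 k≢0)
    27+16k≢0 : + 16 ℤ.* k ℤ.+ + 27 ≢ + 0
    27+16k≢0 h = 2∤1 (divides (+ 14 ℤ.+ + 8 ℤ.* k) (ringℤ 1 (λ k → ♯ 1 := (♯ 14 :+ ♯ 8 :* k) :* ♯ 2 from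
      (:- ♯ 1 · ♯ 16 :* k :+ ♯ 27 ≈ ♯ 0 ∷ [])) refl (k ∷ []) (h , tt)))
    discriminant≢0 : B₂ ℤ.* (+ 16 ℤ.* k ℤ.+ + 27) ≢ + 0
    discriminant≢0 = product-nonzeroℤ {B₂} {+ 16 ℤ.* k ℤ.+ + 27} B₂≢0 27+16k≢0
    factor : + 4 ℤ.* A₂ ℤ.* A₂ ℤ.* A₂ ℤ.+ + 27 ℤ.* B₂ ≡ B₂ ℤ.* (+ 16 ℤ.* k ℤ.+ + 27)
    factor = ringℤ 1 (λ k → let A = ♯ 4 :* k; B = ♯ 16 :* (k :* k) in
      ♯ 4 :* A :* A :* A :+ ♯ 27 :* B := B :* (♯ 16 :* k :+ ♯ 27) from []) refl (k ∷ []) tt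

  open NagellLutz K A₂ B₂ nonsingular₂
  open TorsionPoints K A₂ B₂ nonsingular₂

  module _ (all-torsion : ∀ P → Torsion P) where

    private
      integer-point : ∀ X Y → OnℤCurve X Y → TorsionPoint X Y
      integer-point X Y on = torsionPoint on (all-torsion (aff (ι# X) (ι# Y) (embed {X} {Y} on)))

      with-tangent : ∀ {R : Set} X Y → OnℤCurve X Y → Y ≢ + 0 → (∀ M → TangentSlope X Y M → R) → R
      with-tangent X Y on Y≢0 f = let M , s , _ = double X Y (integer-point X Y on) Y≢0 in f M s

      -- The point (40, 212) is six times (0, 4k); its tangent slope 3840/424 is not an integer. In
      -- the same way (33, 137) is six times (0, 4k) for k = -4, with slope 2211/274.
      k≢-3 : k ≢ -[1+ 2 ]
      k≢-3 h = with-tangent (+ 40) (+ 212) (ringℤ 1 (λ k → # (+ 212 ℤ.* + 212) :=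
          # (+ 40 ℤ.* + 40 ℤ.* + 40) :+ ♯ 4 :* k :* ♯ 40 :* ♯ 40 :+ ♯ 16 :* (k :* k) from
          (:- (♯ 16 :* k :+ ♯ 6352) · k ≈ # -[1+ 2 ] ∷ [])) refl (k ∷ []) (h , tt)) (λ ())
        λ M s → from-no (+ 424 ∣? + 3840) (divides M (ringℤ 2 (λ k M → ♯ 3840 := M :* ♯ 424 from
          (:- ♯ 1 · ♯ 424 :* M ≈ ♯ 4800 :+ ♯ 2 :* (♯ 4 :* k) :* ♯ 40 ∷ :- ♯ 320 · k ≈ # -[1+ 2 ] ∷ []))
          refl (k ∷ M ∷ []) (s , h , tt)))

      k≢-4 : k ≢ -[1+ 3 ]
      k≢-4 h = with-tangent (+ 33) (+ 137) (ringℤ 1 (λ k → # (+ 137 ℤ.* + 137) :=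
          # (+ 33 ℤ.* + 33 ℤ.* + 33) :+ ♯ 4 :* k :* ♯ 33 :* ♯ 33 :+ ♯ 16 :* (k :* k) from
          (:- (♯ 16 :* k :+ ♯ 4292) · k ≈ # -[1+ 3 ] ∷ [])) refl (k ∷ []) (h , tt)) (λ ())
        λ M s → from-no (+ 274 ∣? + 2211) (divides M (ringℤ 2 (λ k M → ♯ 2211 := M :* ♯ 274 from
          (:- ♯ 1 · ♯ 274 :* M ≈ ♯ 3267 :+ ♯ 2 :* (♯ 4 :* k) :* ♯ 33 ∷ :- ♯ 264 · k ≈ # -[1+ 3 ] ∷ []))
          refl (k ∷ M ∷ []) (s , h , tt)))

      -- (0, 4k) lies on the curve, and three times it is (4, - 4 (k + 2)).
      k-values : k ≡ -[1+ 0 ] ⊎ k ≡ -[1+ 1 ]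
      k-values = cases (k ℤ.+ + 2 ℤ.≟ + 0)
        where
        j = k ℤ.+ + 2
        k≡ : ∀ c → j ≡ c → k ≡ c ℤ.+ -[1+ 1 ]
        k≡ c h = ringℤ 2 (λ k c → k := c :+ # -[1+ 1 ] from (♯ 1 · k :+ ♯ 2 ≈ c ∷ [])) refl (k ∷ c ∷ []) (h , tt)
        values : ∀ c → j ≡ c → ℤ.∣ c ∣ ℕ.≤ 2 → c ≢ + 0 → k ≡ -[1+ 0 ] ⊎ k ≡ -[1+ 1 ]
        values (+ 0) h _ c≢0 = ⊥-elim (c≢0 refl)
        values (+ 1) h _ _ = inj₁ (k≡ (+ 1) h)
        values (+ 2) h _ _ = ⊥-elim (k≢0 (k≡ (+ 2) h))
        values -[1+ 0 ] h _ _ = ⊥-elim (k≢-3 (k≡ -[1+ 0 ] h))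
        values -[1+ 1 ] h _ _ = ⊥-elim (k≢-4 (k≡ -[1+ 1 ] h))
        values (+ suc (suc (suc _))) h (ℕ.s≤s (ℕ.s≤s ())) _
        values -[1+ suc (suc _) ] h (ℕ.s≤s (ℕ.s≤s ())) _
        cases : Dec (j ≡ + 0) → k ≡ -[1+ 0 ] ⊎ k ≡ -[1+ 1 ]
        cases (yes h) = inj₂ (k≡ (+ 0) h)
        -- The tangent slope at (4, 4j) is 4 - 2/j, so j = k + 2 divides 2.
        cases (no j≢0) = with-tangent (+ 4) (+ 4 ℤ.* j)
          (ringℤ 1 (λ k → ♯ 4 :* (k :+ ♯ 2) :* (♯ 4 :* (k :+ ♯ 2)) :=
            # (+ 4 ℤ.* + 4 ℤ.* + 4) :+ ♯ 4 :* k :* ♯ 4 :* ♯ 4 :+ ♯ 16 :* (k :* k) from []) refl (k ∷ []) tt)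
          (product-nonzeroℤ {+ 4} {j} (λ ()) j≢0)
          λ M s → values j refl (divisor-bound {j} {+ 2} (λ ()) (divides (+ 4 ℤ.- M) (cancelℤ {+ 2} {(+ 4 ℤ.- M) ℤ.* j} {+ 8} (λ ())
          (ringℤ 2 (λ k M → ♯ 8 :* ♯ 2 := ♯ 8 :* ((♯ 4 :- M) :* (k :+ ♯ 2)) from
            (♯ 1 · ♯ 2 :* (♯ 4 :* (k :+ ♯ 2)) :* M ≈ # (+ 3 ℤ.* + 4 ℤ.* + 4) :+ ♯ 2 :* (♯ 4 :* k) :* ♯ 4 ∷ []))
            refl (k ∷ M ∷ []) (s , tt))))) j≢0

      -- Dividing the quartic by x³ exhibits the morphism to E₂: X = 4ky/x² and Y = 4k(2k/x³ - 1).
      -- Only the integrality of Y is used.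
      reciprocal-cube : ∀ {x y u} → OnQuartic x y → x * u ≡ ι# (+ 1) → ∃[ a ] ι# (+ 8) * ι# k * ι# k * u * u * u ≡ ι# a + ι# (+ 4) * ι# k
      reciprocal-cube {x} {y} {u} q xu = from-integral (torsion-integral (all-torsion (aff X Y on)))
        where
        X = ι# (+ 4) * ι# k * y * u * u
        Y = ι# (+ 4) * ι# k * (ι# (+ 2) * ι# k * u * u * u - ι# (+ 1))
        on : OnCurve X Y
        on = trans (ring 4 (λ k x y u → let X = ♯ 4 :* k :* y :* u :* u; Y = ♯ 4 :* k :* (♯ 2 :* k :* u :* u :* u :- ♯ 1) in
            Y :* Y := X :* X :* X :+ ♯ 4 :* k :* X :* X :+ ♯ 16 :* (k :* k) from
            (:- ♯ 64 :* k :* k :* k :* u :* u :* u :* u :* u :* u · x :* x :* x :+ x :* x :* y :* y :+ y :* y :* y ≈ k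
            ∷ ♯ 64 :* k :* k :* k :* (u :* u :* u :* (x :* u :* x :* u :+ x :* u :+ ♯ 1) :+ y :* y :* u :* u :* u :* u :* (x :* u :+ ♯ 1)) · x :* u ≈ ♯ 1 ∷ []))
            refl (ι# k ∷ x ∷ y ∷ u ∷ []) (q , xu , tt))
          (cong₂ (λ a b → X * X * X + a * X * X + b) (sym (ι-* (+ 4) k)) (sym (ι-expand 1 (λ k → ♯ 16 :* (k :* k)) (k ∷ []))))
        from-integral : Integral X × Integral Y → ∃[ a ] ι# (+ 8) * ι# k * ι# k * u * u * u ≡ ι# a + ι# (+ 4) * ι# k
        from-integral (_ , a , Y≡) = a , ring 3 (λ k u a → ♯ 8 :* k :* k :* u :* u :* u := a :+ ♯ 4 :* k from
          (♯ 1 · ♯ 4 :* k :* (♯ 2 :* k :* u :* u :* u :- ♯ 1) ≈ a ∷ [])) refl (ι# k ∷ u ∷ ι# a ∷ []) (Y≡ , tt)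

      reciprocal-integral : ∀ {x y u} → OnQuartic x y → x * u ≡ ι# (+ 1) → ∃[ n ] ι# (+ 2) * u ≡ ι# n
      reciprocal-integral {x} {y} {u} q xu = cases k-values (reciprocal-cube q xu)
        where
        cases : k ≡ -[1+ 0 ] ⊎ k ≡ -[1+ 1 ] → ∃[ a ] ι# (+ 8) * ι# k * ι# k * u * u * u ≡ ι# a + ι# (+ 4) * ι# k → ∃[ n ] ι# (+ 2) * u ≡ ι# n
        cases (inj₁ k≡) (a , h) = cube-root-integral K (a ℤ.- + 4) (trans (ring 3 (λ k u a →
          ♯ 2 :* u :* (♯ 2 :* u) :* (♯ 2 :* u) := a :- ♯ 4 from
          (♯ 1 · ♯ 8 :* k :* k :* u :* u :* u ≈ a :+ ♯ 4 :* k ∷ ♯ 4 :+ ♯ 8 :* (♯ 1 :- k) :* u :* u :* u · k ≈ # -[1+ 0 ] ∷ []))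
          refl (ι# k ∷ u ∷ ι# a ∷ []) (h , cong ι# k≡ , tt)) (sym (ι-expand 1 (λ a → a :- ♯ 4) (a ∷ []))))
        -- For k = -2 only 32/x³ is known to be an integer. So (4/x)³ is an even integer, and 4/x is
        -- an integer that has to be even.
        cases (inj₂ k≡) (a , h) = halve (cube-root-integral K (+ 2 ℤ.* (a ℤ.- + 8)) (trans (ring 3 (λ k u a →
          ♯ 4 :* u :* (♯ 4 :* u) :* (♯ 4 :* u) := ♯ 2 :* (a :- ♯ 8) from
          (♯ 2 · ♯ 8 :* k :* k :* u :* u :* u ≈ a :+ ♯ 4 :* k ∷ ♯ 8 :+ ♯ 16 :* (♯ 2 :- k) :* u :* u :* u · k ≈ # -[1+ 1 ] ∷ []))
          refl (ι# k ∷ u ∷ ι# a ∷ []) (h , cong ι# k≡ , tt)) (sym (ι-expand 1 (λ a → ♯ 2 :* (a :- ♯ 8)) (a ∷ [])))))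
          where
          halve : ∃[ n ] ι# (+ 4) * u ≡ ι# n → ∃[ n ] ι# (+ 2) * u ≡ ι# n
          halve (n , n≡) = parity (mod-2 n)
            where
            n³ : n ℤ.* (n ℤ.* n) ≡ (a ℤ.- + 8) ℤ.* + 2
            n³ = pull 2 (λ n a → n :* (n :* n) , (a :- ♯ 8) :* ♯ 2) (n ∷ a ∷ []) (ring 4 (λ k u n a →
              n :* (n :* n) := (a :- ♯ 8) :* ♯ 2 from
              (:- (n :* n :+ n :* ♯ 4 :* u :+ ♯ 16 :* u :* u) · ♯ 4 :* u ≈ n
              ∷ ♯ 2 · ♯ 8 :* k :* k :* u :* u :* u ≈ a :+ ♯ 4 :* k
              ∷ ♯ 8 :+ ♯ 16 :* (♯ 2 :- k) :* u :* u :* u · k ≈ # -[1+ 1 ] ∷ []))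
              refl (ι# k ∷ u ∷ ι# n ∷ ι# a ∷ []) (n≡ , h , cong ι# k≡ , tt))
            parity : Residues₂ n → ∃[ n ] ι# (+ 2) * u ≡ ι# n
            parity (odd c) = ⊥-elim (odd-not-even (n ℤ.* (n ℤ.* n)) (comaximal-*ʳ {+ 2} {n} {n ℤ.* n} c (comaximal-*ʳ {+ 2} {n} {n} c c)) (divides (a ℤ.- + 8) n³))
            parity (even (divides m m≡)) = m , cancelˡ (ι-nonzero {+ 2} (λ ())) (ring 3 (λ u n m → ♯ 2 :* (♯ 2 :* u) := ♯ 2 :* m from
              (♯ 1 · ♯ 4 :* u ≈ n ∷ ♯ 1 · n ≈ m :* ♯ 2 ∷ [])) refl (u ∷ ι# n ∷ ι# m ∷ [])
              (n≡ , trans (cong ι# m≡) (ι-* m (+ 2)) , tt))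

      unit-times : ∀ {x u} c → x * u ≡ ι# (+ 1) → ι# (+ 2) * u ≡ ι# c → ι# c * x ≡ ι# (+ 2)
      unit-times {x} {u} c xu h = ring 3 (λ x u c → c :* x := ♯ 2 from (:- x · ♯ 2 :* u ≈ c ∷ ♯ 2 · x :* u ≈ ♯ 1 ∷ []))
        refl (x ∷ u ∷ ι# c ∷ []) (h , xu , tt)

      unit-nonzero : ∀ {x} c → ι# c * x ≡ ι# (+ 2) → c ≢ + 0
      unit-nonzero {x} c h refl = ι-nonzero {+ 2} (λ ()) (trans (sym h) (ring 1 (λ x → ♯ 0 :* x := ♯ 0 from []) refl (x ∷ []) tt))

      minus-one : ∀ {x} n → n ≡ -[1+ 1 ] → ι# n * x ≡ ι# (+ 2) → x ≡ ι# -[1+ 0 ]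
      minus-one {x} _ refl h = cancelˡ (ι-nonzero { -[1+ 1 ]} (λ ())) (trans h (ι-* -[1+ 1 ] -[1+ 0 ]))

      reciprocals : ∀ {x y} n m → OnQuartic x y → ι# n * x ≡ ι# (+ 2) → ι# m * y ≡ ι# (+ 2) → Reciprocal k n m
      reciprocals {x} {y} n m q nx my = pull 3 (λ k n m → ♯ 8 :* m :* m :* m :+ ♯ 16 :* n :* m :+ ♯ 8 :* n :* n :* n , k :* (n :* n :* n :* (m :* m :* m)))
        (k ∷ n ∷ m ∷ []) (ring 5 (λ k n m x y → ♯ 8 :* m :* m :* m :+ ♯ 16 :* n :* m :+ ♯ 8 :* n :* n :* n := k :* (n :* n :* n :* (m :* m :* m)) from
          (n :* n :* n :* m :* m :* m · x :* x :* x :+ x :* x :* y :* y :+ y :* y :* y ≈ k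
          ∷ :- m :* m :* m :* (n :* x :* n :* x :+ ♯ 2 :* n :* x :+ ♯ 4) :- n :* m :* m :* y :* m :* y :* (n :* x :+ ♯ 2) · n :* x ≈ ♯ 2
          ∷ :- n :* n :* n :* (m :* y :* m :* y :+ ♯ 2 :* m :* y :+ ♯ 4) :- ♯ 4 :* n :* m :* (m :* y :+ ♯ 2) · m :* y ≈ ♯ 2 ∷ []))
          refl (ι# k ∷ ι# n ∷ ι# m ∷ x ∷ y ∷ []) (q , nx , my , tt))

      on-axis : ∀ {x y} → OnQuartic x y → x ≡ ι# (+ 0) → y ≡ ι# -[1+ 0 ] × k ≡ -[1+ 0 ]
      on-axis {x} {y} q x≡0 = from-root (cube-root-integral K k y³)
        where
        y³ : y * y * y ≡ ι# k
        y³ = ring 3 (λ k x y → y :* y :* y := k from (♯ 1 · x :* x :* x :+ x :* x :* y :* y :+ y :* y :* y ≈ k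
          ∷ :- (x :* x :+ x :* y :* y) · x ≈ ♯ 0 ∷ [])) refl (ι# k ∷ x ∷ y ∷ []) (q , x≡0 , tt)
        from-root : ∃[ b ] y ≡ ι# b → y ≡ ι# -[1+ 0 ] × k ≡ -[1+ 0 ]
        from-root (b , y≡) = let b≡ , k≡ = cube-solutions k k-values b (pull 2 (λ k b → b :* b :* b , k) (k ∷ b ∷ []) (subst (λ y → y * y * y ≡ ι# k) y≡ y³))
          in trans y≡ (cong ι# b≡) , k≡

    E₂-points : ∀ {x y} → OnQuartic x y → Listed x y
    E₂-points {x} {y} q = cases (x ≟ ι# (+ 0)) (y ≟ ι# (+ 0))
      where
      [0,-1]∈ : ∀ {x y} → k ≡ -[1+ 0 ] → x ≡ ι# (+ 0) → y ≡ ι# -[1+ 0 ] → Listed x y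
      [0,-1]∈ h = exceptional (+ 0) -[1+ 0 ] (subst (λ k → Exceptional k (+ 0) -[1+ 0 ]) (sym h) [0,-1])
      [-1,0]∈ : ∀ {x y} → k ≡ -[1+ 0 ] → x ≡ ι# -[1+ 0 ] → y ≡ ι# (+ 0) → Listed x y
      [-1,0]∈ h = exceptional -[1+ 0 ] (+ 0) (subst (λ k → Exceptional k -[1+ 0 ] (+ 0)) (sym h) [-1,0])
      generic : ∃[ u ] x * u ≡ ι# (+ 1) → ∃[ v ] y * v ≡ ι# (+ 1) → Listed x y
      generic (u , xu) (v , yv) = finish (reciprocal-integral q xu) (reciprocal-integral (quartic-symmetric q) yv)
        where
        finish : ∃[ n ] ι# (+ 2) * u ≡ ι# n → ∃[ m ] ι# (+ 2) * v ≡ ι# m → Listed x y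
        finish (n , n≡) (m , m≡) = conclude (reciprocal-solutions k k-values n m (unit-nonzero n nx) (unit-nonzero m my) (reciprocals n m q nx my))
          where
          nx = unit-times n xu n≡
          my = unit-times m yv m≡
          conclude : n ≡ -[1+ 1 ] × m ≡ -[1+ 1 ] × k ≡ -[1+ 0 ] → Listed x y
          conclude (n≡ , m≡ , _) = diagonal -[1+ 0 ] (minus-one n n≡ nx) (minus-one m m≡ my)
      cases : Dec (x ≡ ι# (+ 0)) → Dec (y ≡ ι# (+ 0)) → Listed x y
      cases (yes x≡0) _ = let y≡ , k≡ = on-axis q x≡0 in [0,-1]∈ k≡ x≡0 y≡
      cases (no _) (yes y≡0) = let x≡ , k≡ = on-axis (quartic-symmetric q) y≡0 in [-1,0]∈ k≡ x≡ y≡0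
      cases (no x≢0) (no y≢0) = generic (inverse x x≢0) (inverse y y≢0)

-- Points of the quartic with denominators 4 and 24.

module Quarters where
  open import Data.Integer using (_+_; _*_; -_; _-_)

  2∤⇒ : ∀ n → ¬ + 2 ∣ n → Comaximal (+ 2) n
  2∤⇒ n h = cases (mod-2 n)
    where
    cases : Residues₂ n → Comaximal (+ 2) n
    cases (even e) = ⊥-elim (h e)
    cases (odd c) = c

  even-factor : ∀ a b → + 2 ∣ a * b → + 2 ∣ a ⊎ + 2 ∣ b
  even-factor a b h = cases (mod-2 a)
    where
    cases : Residues₂ a → + 2 ∣ a ⊎ + 2 ∣ b
    cases (even e) = inj₁ e
    cases (odd c) = inj₂ (divides-cancelˡ {+ 2} {a} {b} c h)

  factor-3 : ∀ a b → + 3 ∣ a * b → + 3 ∣ a ⊎ + 3 ∣ b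
  factor-3 a b h = cases (mod-3 a)
    where
    cases : Residues₃ a → + 3 ∣ a ⊎ + 3 ∣ b
    cases (multiple₃ e) = inj₁ e
    cases (prime-to-3 c) = inj₂ (divides-cancelˡ {+ 3} {a} {b} c h)

  either : ∀ {A : Set} → A ⊎ A → A
  either (inj₁ a) = a
  either (inj₂ a) = a

  even-cube : ∀ a → + 2 ∣ a * (a * a) → + 2 ∣ a
  even-cube a h = [ (λ e → e) , (λ e → either (even-factor a a e)) ]′ (even-factor a (a * a) h)

  3-cube : ∀ a → + 3 ∣ a * (a * a) → + 3 ∣ a
  3-cube a h = [ (λ e → e) , (λ e → either (factor-3 a a e)) ]′ (factor-3 a (a * a) h)

  odd-sum : ∀ a b → + 2 ∣ a → Comaximal (+ 2) b → Comaximal (+ 2) (a + b)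
  odd-sum a b (divides q refl) c = subst (Comaximal (+ 2)) (ringℤ 2 (λ q b → b :+ ♯ 2 :* q := q :* ♯ 2 :+ b from []) refl (q ∷ b ∷ []) tt)
    (comaximal-shift {+ 2} {b} q c)

  -- The quartic at (u/4, v/4), multiplied by 256.
  Quarter : ℤ → ℤ → ℤ → Set
  Quarter k u v = + 4 * u * u * u + u * u * v * v + + 4 * v * v * v ≡ + 256 * k

  data Shape (u v : ℤ) : Set where
    integral : ∀ a b → u ≡ + 4 * a → v ≡ + 4 * b → Shape u v
    mixed : + 2 ∣ u * v → Comaximal (+ 2) (u + v) → Shape u v

  private
    shape-swap : ∀ {u v} → Shape v u → Shape u v
    shape-swap (integral a b p q) = integral b a q p
    shape-swap {u} {v} (mixed e c) = mixed (subst (+ 2 ∣_) (ℤₚ.*-comm v u) e) (subst (Comaximal (+ 2)) (ℤₚ.+-comm v u) c)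

    second-even : ∀ k c b → + 2 * (+ 2 * c) * (+ 2 * c) * (+ 2 * c) + + 2 * c * (+ 2 * c) * b * b + + 2 * b * b * b ≡ + 16 * k → + 2 ∣ b
    second-even k c b h = even-cube b (divides (+ 4 * k - + 4 * c * c * c - c * c * b * b) (cancelℤ {c = + 2} (λ ()) (ringℤ 3 (λ k c b →
      ♯ 2 :* (b :* (b :* b)) := ♯ 2 :* ((♯ 4 :* k :- ♯ 4 :* c :* c :* c :- c :* c :* b :* b) :* ♯ 2) from
      (♯ 1 · ♯ 2 :* (♯ 2 :* c) :* (♯ 2 :* c) :* (♯ 2 :* c) :+ ♯ 2 :* c :* (♯ 2 :* c) :* b :* b :+ ♯ 2 :* b :* b :* b ≈ ♯ 16 :* k ∷ []))
      refl (k ∷ c ∷ b ∷ []) (h , tt))))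

    double-even : ∀ k a b → + 2 * a * a * a + a * a * b * b + + 2 * b * b * b ≡ + 16 * k → Shape (+ 2 * a) (+ 2 * b)
    double-even k a b h = cases (even-factor (a * a) (b * b) (divides (+ 8 * k - a * a * a - b * b * b) (ringℤ 3 (λ k a b →
        a :* a :* (b :* b) := (♯ 8 :* k :- a :* a :* a :- b :* b :* b) :* ♯ 2 from
        (♯ 1 · ♯ 2 :* a :* a :* a :+ a :* a :* b :* b :+ ♯ 2 :* b :* b :* b ≈ ♯ 16 :* k ∷ [])) refl (k ∷ a ∷ b ∷ []) (h , tt))))
      where
      four : ∀ a c → a ≡ c * + 2 → + 2 * a ≡ + 4 * c
      four a c e = ringℤ 2 (λ a c → ♯ 2 :* a := ♯ 4 :* c from (♯ 2 · a ≈ c :* ♯ 2 ∷ [])) refl (a ∷ c ∷ []) (e , tt)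
      first : ∀ a b → + 2 * a * a * a + a * a * b * b + + 2 * b * b * b ≡ + 16 * k → + 2 ∣ a → Shape (+ 2 * a) (+ 2 * b)
      first a b h (divides c e) = done (second-even k c b (subst (λ a → + 2 * a * a * a + a * a * b * b + + 2 * b * b * b ≡ + 16 * k) (trans e (ℤₚ.*-comm c (+ 2))) h))
        where
        done : + 2 ∣ b → Shape (+ 2 * a) (+ 2 * b)
        done (divides d f) = integral c d (four a c e) (four b d f)
      cases : + 2 ∣ a * a ⊎ + 2 ∣ b * b → Shape (+ 2 * a) (+ 2 * b)
      cases (inj₁ e) = first a b h (either (even-factor a a e))
      cases (inj₂ e) = shape-swap (first b a (trans (ringℤ 2 (λ a b → ♯ 2 :* b :* b :* b :+ b :* b :* a :* a :+ ♯ 2 :* a :* a :* a :=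
        ♯ 2 :* a :* a :* a :+ a :* a :* b :* b :+ ♯ 2 :* b :* b :* b from []) refl (a ∷ b ∷ []) tt) h) (either (even-factor b b e)))

  -- The equation makes u²v² even, so u and v are not both odd. If both are even, dividing by 16
  -- repeats the argument and makes both divisible by 4; what is left is one even and one odd
  -- number.
  shape : ∀ k u v → Quarter k u v → Shape u v
  shape k u v h = cases (mod-2 u) (mod-2 v)
    where
    product-even : + 2 ∣ u * u * (v * v)
    product-even = divides (+ 128 * k - + 2 * u * u * u - + 2 * v * v * v) (ringℤ 3 (λ k u v →
      u :* u :* (v :* v) := (♯ 128 :* k :- ♯ 2 :* u :* u :* u :- ♯ 2 :* v :* v :* v) :* ♯ 2 from
      (♯ 1 · ♯ 4 :* u :* u :* u :+ u :* u :* v :* v :+ ♯ 4 :* v :* v :* v ≈ ♯ 256 :* k ∷ [])) refl (k ∷ u ∷ v ∷ []) (h , tt))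
    half : ∀ {a u} → u ≡ a * + 2 → u ≡ + 2 * a
    half {a} e = trans e (ℤₚ.*-comm a (+ 2))
    cases : Residues₂ u → Residues₂ v → Shape u v
    cases (even (divides a p)) (even (divides b q)) = subst₂ Shape (sym (half p)) (sym (half q)) (double-even k a b
      (cancelℤ {c = + 16} (λ ()) (ringℤ 5 (λ k u v a b → ♯ 16 :* (♯ 2 :* a :* a :* a :+ a :* a :* b :* b :+ ♯ 2 :* b :* b :* b) := ♯ 16 :* (♯ 16 :* k) from
        (♯ 1 · ♯ 4 :* u :* u :* u :+ u :* u :* v :* v :+ ♯ 4 :* v :* v :* v ≈ ♯ 256 :* k
        ∷ :- ♯ 4 :* (u :* u :+ u :* (a :* ♯ 2) :+ a :* ♯ 2 :* (a :* ♯ 2)) :- (u :+ a :* ♯ 2) :* v :* v · u ≈ a :* ♯ 2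
        ∷ :- ♯ 4 :* (v :* v :+ v :* (b :* ♯ 2) :+ b :* ♯ 2 :* (b :* ♯ 2)) :- a :* ♯ 2 :* (a :* ♯ 2) :* (v :+ b :* ♯ 2) · v ≈ b :* ♯ 2 ∷ []))
        refl (k ∷ u ∷ v ∷ a ∷ b ∷ []) (h , p , q , tt))))
    cases (even e@(divides a p)) (odd c) = mixed (divides (a * v) (trans (cong (_* v) p) (ringℤ 2 (λ a v → a :* ♯ 2 :* v := a :* v :* ♯ 2 from []) refl (a ∷ v ∷ []) tt)))
      (odd-sum u v e c)
    cases (odd c) (even e@(divides b q)) = mixed (divides (u * b) (trans (cong (u *_) q) (sym (ℤₚ.*-assoc u b (+ 2)))))
      (subst (Comaximal (+ 2)) (ℤₚ.+-comm v u) (odd-sum v u e c))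
    cases (odd c) (odd c′) = ⊥-elim (odd-not-even (u * u * (v * v)) (comaximal-*ʳ {+ 2} {u * u} {v * v}
      (comaximal-*ʳ {+ 2} {u} {u} c c) (comaximal-*ʳ {+ 2} {v} {v} c′ c′)) product-even)

  record Sixths (a b : ℤ) : Set where
    constructor sixths
    field
      u v : ℤ
      a≡ : a ≡ + 6 * u
      b≡ : b ≡ + 6 * v

  private
    3∣second : ∀ k c b → + 24 * (+ 3 * c) * (+ 3 * c) * (+ 3 * c) + + 3 * c * (+ 3 * c) * b * b + + 24 * b * b * b ≡ + 331776 * k → + 3 ∣ b
    3∣second k c b h = 3-cube b (divides-cancelˡ {+ 3} {+ 8} {b * (b * b)} (bezout (+ 3) -[1+ 0 ] refl)
      (divides (+ 36864 * k - + 72 * c * c * c - c * c * b * b) (cancelℤ {c = + 3} (λ ()) (ringℤ 3 (λ k c b →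
        ♯ 3 :* (♯ 8 :* (b :* (b :* b))) := ♯ 3 :* ((♯ 36864 :* k :- ♯ 72 :* c :* c :* c :- c :* c :* b :* b) :* ♯ 3) from
        (♯ 1 · ♯ 24 :* (♯ 3 :* c) :* (♯ 3 :* c) :* (♯ 3 :* c) :+ ♯ 3 :* c :* (♯ 3 :* c) :* b :* b :+ ♯ 24 :* b :* b :* b ≈ ♯ 331776 :* k ∷ []))
        refl (k ∷ c ∷ b ∷ []) (h , tt)))))

    eighths : ∀ k a b e → + 8 * a * a * a + a * a * b * b + + 8 * b * b * b ≡ + 4096 * k → a + b ≡ e * + 2 → + 2 ∣ a × + 2 ∣ b
    eighths k a b e h s = cases (mod-2 a) (mod-2 b)
      where
      ab-even : + 2 ∣ a * a * (b * b)
      ab-even = divides (+ 2048 * k - + 4 * a * a * a - + 4 * b * b * b) (ringℤ 3 (λ k a b →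
        a :* a :* (b :* b) := (♯ 2048 :* k :- ♯ 4 :* a :* a :* a :- ♯ 4 :* b :* b :* b) :* ♯ 2 from
        (♯ 1 · ♯ 8 :* a :* a :* a :+ a :* a :* b :* b :+ ♯ 8 :* b :* b :* b ≈ ♯ 4096 :* k ∷ [])) refl (k ∷ a ∷ b ∷ []) (h , tt))
      cases : Residues₂ a → Residues₂ b → + 2 ∣ a × + 2 ∣ b
      cases (even p) (even q) = p , q
      cases (even p) (odd c) = ⊥-elim (odd-not-even (a + b) (odd-sum a b p c) (divides e s))
      cases (odd c) (even q) = ⊥-elim (odd-not-even (b + a) (odd-sum b a q c) (divides e (trans (ℤₚ.+-comm b a) s)))
      cases (odd c) (odd c′) = ⊥-elim (odd-not-even (a * a * (b * b)) (comaximal-*ʳ {+ 2} {a * a} {b * b}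
        (comaximal-*ʳ {+ 2} {a} {a} c c) (comaximal-*ʳ {+ 2} {b} {b} c′ c′)) ab-even)

  -- The equation is the quartic at (a/24, b/24), and 24⁴ = 331776. Modulo 3 one of a, b is
  -- divisible by 3, then both. After division by 3 the product is even, and the even sum rules out
  -- different parities.
  sixths-from : ∀ k a b e → + 24 * a * a * a + a * a * b * b + + 24 * b * b * b ≡ + 331776 * k → a + b ≡ e * + 2 → Sixths a b
  sixths-from k a b e h s = third (cases (factor-3 (a * a) (b * b) 3∣a²b²))
    where
    Eq : ℤ → ℤ → Set
    Eq a b = + 24 * a * a * a + a * a * b * b + + 24 * b * b * b ≡ + 331776 * k
    3∣a²b² : + 3 ∣ a * a * (b * b)
    3∣a²b² = divides (+ 110592 * k - + 8 * a * a * a - + 8 * b * b * b) (ringℤ 3 (λ k a b →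
      a :* a :* (b :* b) := (♯ 110592 :* k :- ♯ 8 :* a :* a :* a :- ♯ 8 :* b :* b :* b) :* ♯ 3 from
      (♯ 1 · ♯ 24 :* a :* a :* a :+ a :* a :* b :* b :+ ♯ 24 :* b :* b :* b ≈ ♯ 331776 :* k ∷ [])) refl (k ∷ a ∷ b ∷ []) (h , tt))
    first : ∀ a b → Eq a b → + 3 ∣ a → + 3 ∣ b
    first a b h (divides c p) = 3∣second k c b (subst (λ a → Eq a b) (trans p (ℤₚ.*-comm c (+ 3))) h)
    swapped : Eq b a
    swapped = trans (ringℤ 2 (λ a b → ♯ 24 :* b :* b :* b :+ b :* b :* a :* a :+ ♯ 24 :* a :* a :* a :=
      ♯ 24 :* a :* a :* a :+ a :* a :* b :* b :+ ♯ 24 :* b :* b :* b from []) refl (a ∷ b ∷ []) tt) h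
    cases : + 3 ∣ a * a ⊎ + 3 ∣ b * b → + 3 ∣ a × + 3 ∣ b
    cases (inj₁ p) = let q = either (factor-3 a a p) in q , first a b h q
    cases (inj₂ p) = let q = either (factor-3 b b p) in first b a swapped q , q
    third : + 3 ∣ a × + 3 ∣ b → Sixths a b
    third (divides c p , divides d q) = halves (eighths k c d (e - c - d)
        (cancelℤ {c = + 81} (λ ()) (ringℤ 5 (λ k a b c d → ♯ 81 :* (♯ 8 :* c :* c :* c :+ c :* c :* d :* d :+ ♯ 8 :* d :* d :* d) := ♯ 81 :* (♯ 4096 :* k) from
          (♯ 1 · ♯ 24 :* a :* a :* a :+ a :* a :* b :* b :+ ♯ 24 :* b :* b :* b ≈ ♯ 331776 :* k
          ∷ :- ♯ 24 :* (a :* a :+ a :* (c :* ♯ 3) :+ c :* ♯ 3 :* (c :* ♯ 3)) :- (a :+ c :* ♯ 3) :* b :* b · a ≈ c :* ♯ 3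
          ∷ :- ♯ 24 :* (b :* b :+ b :* (d :* ♯ 3) :+ d :* ♯ 3 :* (d :* ♯ 3)) :- c :* ♯ 3 :* (c :* ♯ 3) :* (b :+ d :* ♯ 3) · b ≈ d :* ♯ 3 ∷ []))
          refl (k ∷ a ∷ b ∷ c ∷ d ∷ []) (h , p , q , tt)))
        (ringℤ 5 (λ a b c d e → c :+ d := (e :- c :- d) :* ♯ 2 from
          (♯ 1 · a :+ b ≈ e :* ♯ 2 ∷ :- ♯ 1 · a ≈ c :* ♯ 3 ∷ :- ♯ 1 · b ≈ d :* ♯ 3 ∷ [])) refl (a ∷ b ∷ c ∷ d ∷ e ∷ []) (s , p , q , tt)))
      where
      halves : + 2 ∣ c × + 2 ∣ d → Sixths a b
      halves (divides u p′ , divides v q′) = sixths u v (six a c u p p′) (six b d v q q′)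
        where
        six : ∀ a c u → a ≡ c * + 3 → c ≡ u * + 2 → a ≡ + 6 * u
        six a c u p p′ = ringℤ 3 (λ a c u → a := ♯ 6 :* u from (♯ 1 · a ≈ c :* ♯ 3 ∷ ♯ 3 · c ≈ u :* ♯ 2 ∷ []))
          refl (a ∷ c ∷ u ∷ []) (p , p′ , tt)

open Quarters public

-- Points whose image on E₃ has order two.

module TwoTorsionE₃ where
  open import Data.Integer using (_+_; _*_; -_; _-_; ∣_∣)

  private
    g : ∀ {n} → Expr n → Expr n
    g n = ♯ 2 :* n :* n :* n :+ ♯ 3 :* n

    h : ∀ {n} → Expr n → Expr n
    h n = ♯ 45 :* n :* n :- ♯ 36

    1+_ : ∀ {n} → Expr n → Expr n
    1+ i = ♯ 1 :+ i

    test : ℤ → ℤ → Bool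
    test n c = (c * (+ 2 * (+ 2 * n * n * n + + 3 * n) - c) == + 45 * n * n - + 36) ⇒ᵇ ((n == + 0) ∨ (n == + 1) ∨ (n == + 3) ∨ (c == + 0) ∨ (n == - (+ ∣ n ∣)))

  record Verified : Set where
    constructor verified
    field check : range-check 22 (λ n → range-check 12 (test n)) ≡ true

  -- With g = 2n³ + 3n and c = g - Z, an equation Z² = g² - (45n² - 36) becomes c (2g - c) = 45n² - 36, which bounds c and n.
  search : Verified → ∀ i c → let n = + suc i in c ≢ + 0 → ∣ n ∣ ℕ.≤ 22 → ∣ c ∣ ℕ.≤ 12 →
    c * (+ 2 * (+ 2 * n * n * n + + 3 * n) - c) ≡ + 45 * n * n - + 36 → n ≡ + 1 ⊎ n ≡ + 3
  search (verified ok) i c c≢0 n≤ c≤ eq = conclude (∨-elim {n == + 0} (⇒ᵇ-elim {c * (+ 2 * (+ 2 * n * n * n + + 3 * n) - c) == + 45 * n * n - + 36}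
      (range-search 12 (test n) (range-search 22 (λ n → range-check 12 (test n)) ok n n≤) c c≤) (==-complete eq)))
    where
    n = + suc i
    absurd : + suc i ≡ -[1+ i ] → ⊥
    absurd ()
    degenerate : (c == + 0) ≡ true ⊎ (n == - (+ ∣ n ∣)) ≡ true → n ≡ + 1 ⊎ n ≡ + 3
    degenerate (inj₁ e) = ⊥-elim (c≢0 (==-sound e))
    degenerate (inj₂ e) = ⊥-elim (absurd (==-sound e))
    last : (n == + 3) ≡ true ⊎ (c == + 0) ∨ (n == - (+ ∣ n ∣)) ≡ true → n ≡ + 1 ⊎ n ≡ + 3
    last (inj₁ e) = inj₂ (==-sound e)
    last (inj₂ e) = degenerate (∨-elim {c == + 0} e)
    middle : (n == + 1) ≡ true ⊎ (n == + 3) ∨ (c == + 0) ∨ (n == - (+ ∣ n ∣)) ≡ true → n ≡ + 1 ⊎ n ≡ + 3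
    middle (inj₁ e) = inj₁ (==-sound e)
    middle (inj₂ e) = last (∨-elim {n == + 3} e)
    conclude : (n == + 0) ≡ true ⊎ (n == + 1) ∨ (n == + 3) ∨ (c == + 0) ∨ (n == - (+ ∣ n ∣)) ≡ true → n ≡ + 1 ⊎ n ≡ + 3
    conclude (inj₁ e) = ⊥-elim (nonzero (==-sound e))
      where
      nonzero : + suc i ≢ + 0
      nonzero ()
    conclude (inj₂ e) = middle (∨-elim {n == + 1} e)

  private
    le : ∀ n b → ¬ suc b ℕ.≤ n → n ℕ.≤ b
    le n b ¬h = ℕₚ.≤-pred (ℕₚ.≰⇒> ¬h)

    bounded : ∀ N i j Z → + N ≡ + suc i → (+ suc j) * (+ 2 * (+ 2 * + N * + N * + N + + 3 * + N) - + suc j) ≡ + 45 * + N * + N - + 36 →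
      + Z + + suc j ≡ + 2 * + N * + N * + N + + 3 * + N → N ℕ.≤ 22 × suc j ℕ.≤ 12
    bounded N i j Z N≡ eq sum = le N 22 n-bound , le (suc j) 12 c-bound
      where
      -- From n = 23 on, g exceeds h = 45n² - 36, whereas h = c(g + Z) is at least g. The bound on c
      -- comes likewise from 13g > h for all n ≥ 1.
      n-bound : ¬ 23 ℕ.≤ N
      n-bound 23≤N = impossible 3 (λ i j Z → let n = ♯ 23 :+ i in (1+ j) :* j :+ (j :+ 1+ j) :* Z :+ (g n :- h n)) refl (N ℕ.∸ 23 ∷ j ∷ Z ∷ [])
        (ringℤ 4 (λ N i j Z → let n = ♯ 23 :+ i in (1+ j) :* j :+ (j :+ 1+ j) :* Z :+ (g n :- h n) := ♯ 0 from
          (♯ 1 · (1+ j) :* (♯ 2 :* g N :- (1+ j)) ≈ h N ∷ ♯ 1 :+ ♯ 2 :* j · Z :+ 1+ j ≈ g N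
          ∷ :- ♯ 2 :* (N :* N :+ N :* n :+ n :* n) :- ♯ 3 :+ ♯ 45 :* (N :+ n) · N ≈ n ∷ []))
          refl (+ N ∷ + (N ℕ.∸ 23) ∷ + j ∷ + Z ∷ []) (eq , sum , cong +_ (sym (ℕₚ.m+[n∸m]≡n 23≤N)) , tt))
      c-bound : ¬ 13 ℕ.≤ suc j
      c-bound 13≤c = impossible 3 (λ i l Z → let n = 1+ i in (♯ 13 :* g n :- h n) :+ l :* g n :+ (♯ 13 :+ l) :* Z) refl (i ∷ suc j ℕ.∸ 13 ∷ Z ∷ [])
        (ringℤ 5 (λ N i c l Z → let n = 1+ i in (♯ 13 :* g n :- h n) :+ l :* g n :+ (♯ 13 :+ l) :* Z := ♯ 0 from
          (♯ 1 · c :* (♯ 2 :* g N :- c) ≈ h N ∷ c · Z :+ c ≈ g N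
          ∷ :- (c :* (♯ 2 :* (N :* N :+ N :* n :+ n :* n) :+ ♯ 3)) :+ ♯ 45 :* (N :+ n) · N ≈ n
          ∷ :- g n :- Z · c ≈ ♯ 13 :+ l ∷ []))
          refl (+ N ∷ + i ∷ + suc j ∷ + (suc j ℕ.∸ 13) ∷ + Z ∷ []) (eq , sum , N≡ , cong +_ (sym (ℕₚ.m+[n∸m]≡n 13≤c)) , tt))

  square-values : ∀ N z → N ≢ 0 → let n = + N in z * z ≡ + 4 * (n * n * n * n * n * n) + + 12 * (n * n * n * n) - + 36 * n * n + + 36 → n ≡ + 1 ⊎ n ≡ + 3
  square-values zero z N≢0 _ = ⊥-elim (N≢0 refl)
  square-values (suc i) z _ eq = from-sign (sign-split z)
    where
    n = + suc i
    G = + 2 * n * n * n + + 3 * n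
    Z = + ∣ z ∣
    from-sign : ∃[ s ] (s * s ≡ + 1 × z ≡ s * Z) → n ≡ + 1 ⊎ n ≡ + 3
    from-sign (s , ss , z≡) = difference (G - Z) refl
      where
      ZZ : Z * Z ≡ G * G - (+ 45 * n * n - + 36)
      ZZ = ringℤ 4 (λ n s z Z → Z :* Z := g n :* g n :- h n from
        (♯ 1 · z :* z ≈ ♯ 4 :* (n :* n :* n :* n :* n :* n) :+ ♯ 12 :* (n :* n :* n :* n) :- ♯ 36 :* n :* n :+ ♯ 36
        ∷ :- (Z :* Z) · s :* s ≈ ♯ 1 ∷ :- (z :+ s :* Z) · z ≈ s :* Z ∷ [])) refl (n ∷ s ∷ z ∷ Z ∷ []) (eq , ss , z≡ , tt)
      too-large : ∀ m → G - Z ≡ - (+ m) → ⊥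
      too-large m e = impossible 2 (λ i m → let n = 1+ i in ♯ 2 :* g n :* m :+ m :* m :+ h n) refl (i ∷ m ∷ [])
        (ringℤ 3 (λ n Z m → ♯ 2 :* g n :* m :+ m :* m :+ h n := ♯ 0 from
          (♯ 1 · Z :* Z ≈ g n :* g n :- h n ∷ Z :+ g n :+ m · g n :- Z ≈ :- m ∷ [])) refl (n ∷ Z ∷ + m ∷ []) (ZZ , e , tt))
      difference : ∀ c → G - Z ≡ c → n ≡ + 1 ⊎ n ≡ + 3
      difference (+ 0) e = ⊥-elim (too-large 0 e)
      difference -[1+ m ] e = ⊥-elim (too-large (suc m) e)
      difference (+ suc j) e = let n≤ , c≤ = bounded (suc i) i j ∣ z ∣ refl eq′ sum in search (verified refl) i (+ suc j) (λ ()) n≤ c≤ eq′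
        where
        eq′ : (+ suc j) * (+ 2 * G - + suc j) ≡ + 45 * n * n - + 36
        eq′ = ringℤ 3 (λ n Z c → c :* (♯ 2 :* g n :- c) := h n from
          (:- ♯ 1 · Z :* Z ≈ g n :* g n :- h n ∷ :- g n :+ c :- Z · g n :- Z ≈ c ∷ [])) refl (n ∷ Z ∷ + suc j ∷ []) (ZZ , e , tt)
        sum : Z + + suc j ≡ G
        sum = ringℤ 3 (λ n Z c → Z :+ c := g n from (:- ♯ 1 · g n :- Z ≈ c ∷ [])) refl (n ∷ Z ∷ + suc j ∷ []) (e , tt)

  square-one : ∀ n → ∣ n ∣ ≡ 1 → n ≡ + 1 ⊎ n ≡ -[1+ 0 ]
  square-one (+ _) refl = inj₁ refl
  square-one -[1+ 0 ] refl = inj₂ refl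

  abs-three : ∀ n → ∣ n ∣ ≡ 3 → n ≡ + 3 ⊎ n ≡ -[1+ 2 ]
  abs-three (+ _) refl = inj₁ refl
  abs-three -[1+ 2 ] refl = inj₂ refl

  -- With u = 4x, v = 4y and t = 3τ, the equation `Δ≡` is Y = 0 on E₃ divided by 27, and `slope≡` is
  -- the definition of t.
  record System (k u v τ : ℤ) : Set where
    field
      k≢0 : k ≢ + 0
      u≢v : u ≢ v
      quarter : Quarter k u v
      Δ≡ : u - v ≡ - (τ * (+ 2 * τ * τ + + 6 + (u + v)))
      slope≡ : + 3 * τ * (u - v) ≡ u * v + + 3 * (u + v)

  module _ {k u v τ : ℤ} (S : System k u v τ) where
    open System S

    V : ℤ
    V = + 2 * τ * τ + + 2 + (u + v)

    -- Eliminating u - v leaves a quadratic equation for V. Completing the square gives ((τ² - 1)V -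
    -- 4)² = 4τ⁶ + 12τ⁴ - 36τ² + 36, which `square-values` solves for τ.
    V-equation : (τ * τ - + 1) * (V * V - + 4 * (τ * τ + + 5)) ≡ + 8 * V
    V-equation = ringℤ 3 (λ u v τ → let T = τ :* τ; V = ♯ 2 :* τ :* τ :+ ♯ 2 :+ (u :+ v) in
      (T :- ♯ 1) :* (V :* V :- ♯ 4 :* (T :+ ♯ 5)) := ♯ 8 :* V from
      (:- (u :- v) :- ♯ 6 :* τ :+ ♯ 2 :* τ :* τ :* τ :+ (u :+ v) :* τ · u :- v ≈ :- (τ :* (♯ 2 :* τ :* τ :+ ♯ 6 :+ (u :+ v)))
      ∷ ♯ 4 · ♯ 3 :* τ :* (u :- v) ≈ u :* v :+ ♯ 3 :* (u :+ v) ∷ []))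
      refl (u ∷ v ∷ τ ∷ []) (Δ≡ , slope≡ , tt)

    τ≢0 : τ ≢ + 0
    τ≢0 h = u≢v (ringℤ 3 (λ u v τ → u := v from (♯ 1 · u :- v ≈ :- (τ :* (♯ 2 :* τ :* τ :+ ♯ 6 :+ (u :+ v)))
      ∷ :- (♯ 2 :* τ :* τ :+ ♯ 6 :+ (u :+ v)) · τ ≈ ♯ 0 ∷ [])) refl (u ∷ v ∷ τ ∷ []) (Δ≡ , h , tt))

    private
      τ-values : ∣ τ ∣ ≡ 1 ⊎ ∣ τ ∣ ≡ 3
      τ-values = from-sign (sign-split τ)
        where
        from-sign : ∃[ s ] (s * s ≡ + 1 × τ ≡ s * + ∣ τ ∣) → ∣ τ ∣ ≡ 1 ⊎ ∣ τ ∣ ≡ 3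
        from-sign (s , ss , τ≡) = convert (square-values ∣ τ ∣ ((τ * τ - + 1) * V - + 4) (λ e → τ≢0 (ℤₚ.∣i∣≡0⇒i≡0 e))
          (trans (ringℤ 2 (λ τ V → let T = τ :* τ; z = (T :- ♯ 1) :* V :- ♯ 4 in
              z :* z := ♯ 4 :* (T :* T :* T) :+ ♯ 12 :* (T :* T) :- ♯ 36 :* T :+ ♯ 36 from
              (T :- ♯ 1 · (T :- ♯ 1) :* (V :* V :- ♯ 4 :* (T :+ ♯ 5)) ≈ ♯ 8 :* V ∷ [])) refl (τ ∷ V ∷ []) (V-equation , tt))
            (trans (cong (λ T → + 4 * (T * T * T) + + 12 * (T * T) - + 36 * T + + 36) ττ)
              (ringℤ 1 (λ n → let T = n :* n in ♯ 4 :* (T :* T :* T) :+ ♯ 12 :* (T :* T) :- ♯ 36 :* T :+ ♯ 36 :=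
                ♯ 4 :* (n :* n :* n :* n :* n :* n) :+ ♯ 12 :* (n :* n :* n :* n) :- ♯ 36 :* n :* n :+ ♯ 36 from []) refl (+ ∣ τ ∣ ∷ []) tt))))
          where
          ττ : τ * τ ≡ + ∣ τ ∣ * + ∣ τ ∣
          ττ = ringℤ 3 (λ τ s n → τ :* τ := n :* n from (τ :+ s :* n · τ ≈ s :* n ∷ n :* n · s :* s ≈ ♯ 1 ∷ []))
            refl (τ ∷ s ∷ + ∣ τ ∣ ∷ []) (τ≡ , ss , tt)
          convert : + ∣ τ ∣ ≡ + 1 ⊎ + ∣ τ ∣ ≡ + 3 → ∣ τ ∣ ≡ 1 ⊎ ∣ τ ∣ ≡ 3
          convert (inj₁ e) = inj₁ (ℤₚ.+-injective e)
          convert (inj₂ e) = inj₂ (ℤₚ.+-injective e)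

      u-from : ∀ c w → τ ≡ c → V ≡ w → + 2 * u ≡ w - + 2 * c * c - + 2 - c * (w + + 4)
      u-from c w p q = ringℤ 5 (λ u v τ c w → ♯ 2 :* u := w :- ♯ 2 :* c :* c :- ♯ 2 :- c :* (w :+ ♯ 4) from
        (♯ 1 · u :- v ≈ :- (τ :* (♯ 2 :* τ :* τ :+ ♯ 6 :+ (u :+ v)))
        ∷ ♯ 1 :- c · ♯ 2 :* τ :* τ :+ ♯ 2 :+ (u :+ v) ≈ w
        ∷ :- (♯ 2 :* (τ :+ c)) :- (♯ 2 :* τ :* τ :+ ♯ 6 :+ (u :+ v)) · τ ≈ c ∷ [])) refl (u ∷ v ∷ τ ∷ c ∷ w ∷ []) (Δ≡ , q , p , tt)

      v-from : ∀ c w → τ ≡ c → V ≡ w → + 2 * v ≡ w - + 2 * c * c - + 2 + c * (w + + 4)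
      v-from c w p q = ringℤ 5 (λ u v τ c w → ♯ 2 :* v := w :- ♯ 2 :* c :* c :- ♯ 2 :+ c :* (w :+ ♯ 4) from
        (:- ♯ 1 · u :- v ≈ :- (τ :* (♯ 2 :* τ :* τ :+ ♯ 6 :+ (u :+ v)))
        ∷ ♯ 1 :+ c · ♯ 2 :* τ :* τ :+ ♯ 2 :+ (u :+ v) ≈ w
        ∷ :- (♯ 2 :* (τ :+ c)) :+ (♯ 2 :* τ :* τ :+ ♯ 6 :+ (u :+ v)) · τ ≈ c ∷ [])) refl (u ∷ v ∷ τ ∷ c ∷ w ∷ []) (Δ≡ , q , p , tt)

      k-from : ∀ a b c → u ≡ a → v ≡ b → + 4 * a * a * a + a * a * b * b + + 4 * b * b * b ≡ + 256 * c → k ≡ c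
      k-from _ _ c refl refl e = cancelℤ {k} {c} {+ 256} (λ ()) (trans (sym quarter) e)

    Solution : Set
    Solution = ∃[ a ] ∃[ b ] (Exceptional k a b × u ≡ + 4 * a × v ≡ + 4 * b)

    private
      halve : ∀ {a b} → + 2 * a ≡ + 2 * b → a ≡ b
      halve {a} {b} = cancelℤ {a} {b} {+ 2} (λ ())

      solution : ∀ {c} a b → Exceptional c a b → + 2 * u ≡ + 2 * (+ 4 * a) → + 2 * v ≡ + 2 * (+ 4 * b) →
        + 4 * (+ 4 * a) * (+ 4 * a) * (+ 4 * a) + + 4 * a * (+ 4 * a) * (+ 4 * b) * (+ 4 * b) + + 4 * (+ 4 * b) * (+ 4 * b) * (+ 4 * b) ≡ + 256 * c → Solution
      solution {c} a b x p q e = a , b , subst (λ k → Exceptional k a b) (sym (k-from (+ 4 * a) (+ 4 * b) c (halve p) (halve q) e)) x , halve p , halve q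

      V-one : τ * τ ≡ + 1 → V ≡ + 0
      V-one h = zero-productℤ {+ 8} (λ ()) (ringℤ 2 (λ τ V → let T = τ :* τ in ♯ 8 :* V := ♯ 0 from
        (:- ♯ 1 · (T :- ♯ 1) :* (V :* V :- ♯ 4 :* (T :+ ♯ 5)) ≈ ♯ 8 :* V
        ∷ V :* V :- ♯ 4 :* (T :+ ♯ 5) · T ≈ ♯ 1 ∷ [])) refl (τ ∷ V ∷ []) (V-equation , h , tt))

      V-nine : τ * τ ≡ + 9 → V ≡ + 8 ⊎ V ≡ -[1+ 6 ]
      V-nine h = cases (V ℤ.≟ + 8)
        where
        factored : (V - + 8) * (V + + 7) ≡ + 0
        factored = zero-productℤ {+ 8} (λ ()) (ringℤ 2 (λ τ V → let T = τ :* τ in ♯ 8 :* ((V :- ♯ 8) :* (V :+ ♯ 7)) := ♯ 0 from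
          (♯ 1 · (T :- ♯ 1) :* (V :* V :- ♯ 4 :* (T :+ ♯ 5)) ≈ ♯ 8 :* V
          ∷ :- (V :* V) :+ ♯ 4 :* T :+ ♯ 52 · T ≈ ♯ 9 ∷ [])) refl (τ ∷ V ∷ []) (V-equation , h , tt))
        cases : Dec (V ≡ + 8) → V ≡ + 8 ⊎ V ≡ -[1+ 6 ]
        cases (yes e) = inj₁ e
        cases (no V≢8) = inj₂ (ringℤ 1 (λ V → V := # -[1+ 6 ] from (♯ 1 · V :+ ♯ 7 ≈ ♯ 0 ∷ [])) refl (V ∷ [])
          (zero-productℤ {V - + 8} {V + + 7} (λ e → V≢8 (ℤₚ.i-j≡0⇒i≡j V (+ 8) e)) factored , tt))

    solutions : Solution
    solutions = cases τ-values
      where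
      one : τ ≡ + 1 ⊎ τ ≡ -[1+ 0 ] → Solution
      one (inj₁ e) = let w = V-one (cong (λ t → t * t) e) in
        solution -[1+ 0 ] (+ 0) [-1,0] (u-from (+ 1) (+ 0) e w) (v-from (+ 1) (+ 0) e w) refl
      one (inj₂ e) = let w = V-one (cong (λ t → t * t) e) in
        solution (+ 0) -[1+ 0 ] [0,-1] (u-from -[1+ 0 ] (+ 0) e w) (v-from -[1+ 0 ] (+ 0) e w) refl
      three⁺ : τ ≡ + 3 → V ≡ + 8 ⊎ V ≡ -[1+ 6 ] → Solution
      three⁺ e (inj₁ w) = solution -[1+ 5 ] (+ 3) [-6,3] (u-from (+ 3) (+ 8) e w) (v-from (+ 3) (+ 8) e w) refl
      -- This root belongs to u = -9 and v = -18, a point of the quartic with k = 0.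
      three⁺ e (inj₂ w) = ⊥-elim (k≢0 (k-from -[1+ 8 ] -[1+ 17 ] (+ 0) (halve (u-from (+ 3) -[1+ 6 ] e w)) (halve (v-from (+ 3) -[1+ 6 ] e w)) refl))
      three⁻ : τ ≡ -[1+ 2 ] → V ≡ + 8 ⊎ V ≡ -[1+ 6 ] → Solution
      three⁻ e (inj₁ w) = solution (+ 3) -[1+ 5 ] [3,-6] (u-from -[1+ 2 ] (+ 8) e w) (v-from -[1+ 2 ] (+ 8) e w) refl
      three⁻ e (inj₂ w) = ⊥-elim (k≢0 (k-from -[1+ 17 ] -[1+ 8 ] (+ 0) (halve (u-from -[1+ 2 ] -[1+ 6 ] e w)) (halve (v-from -[1+ 2 ] -[1+ 6 ] e w)) refl))
      three : τ ≡ + 3 ⊎ τ ≡ -[1+ 2 ] → Solution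
      three (inj₁ e) = three⁺ e (V-nine (cong (λ t → t * t) e))
      three (inj₂ e) = three⁻ e (V-nine (cong (λ t → t * t) e))
      cases : ∣ τ ∣ ≡ 1 ⊎ ∣ τ ∣ ≡ 3 → Solution
      cases (inj₁ e) = one (square-one τ e)
      cases (inj₂ e) = three (abs-three τ e)

module TorsionCongruences (K : FractionField) (A B : ℤ)
  (nonsingular : EllipticCurve.Nonsingular K (FractionField.ι# K A) (FractionField.ι# K B)) where
  open TorsionPoints K A B nonsingular

  -- The tangent slope (3X² + 2AX) / 2Y has to be an integer.
  odd-abscissa : ∀ X Y → TorsionPoint X Y → Comaximal (+ 2) X → Y ≡ + 0
  odd-abscissa X Y P c = cases (Y ℤ.≟ + 0)
    where
    cases : Dec (Y ≡ + 0) → Y ≡ + 0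
    cases (yes e) = e
    cases (no Y≢0) = ⊥-elim (odd-not-even (X ℤ.* X) (comaximal-*ʳ {+ 2} {X} {X} c c) (use (double X Y P Y≢0)))
      where
      use : ∃[ M ] (TangentSlope X Y M × TorsionPoint (doubleX X M) (doubleY X Y M)) → + 2 ∣ X ℤ.* X
      use (M , s , _) = divides (Y ℤ.* M ℤ.- A ℤ.* X ℤ.- X ℤ.* X)
        (ringℤ 4 (λ A X Y M → X :* X := (Y :* M :- A :* X :- X :* X) :* ♯ 2 from
          (:- ♯ 1 · ♯ 2 :* Y :* M ≈ ♯ 3 :* X :* X :+ ♯ 2 :* A :* X ∷ [])) refl (A ∷ X ∷ Y ∷ M ∷ []) (s , tt))

-- The curve E₃ rescaled by 3.

-- If x = 3a and y = 3b, the value of the quartic is 27k with k = a³ + 3a²b² + b³. Then E₃ has a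
-- smaller integral model: -27/9 = -3 and -1728 (27k)/729 = -64k. Torsion points are integral on it
-- too, which is stronger than integrality on E₃.
module ScaledE₃ (K : FractionField) (k : ℤ) (k≢0 : k ≢ + 0) where
  open FractionField K

  A B : ℤ
  A = -[1+ 2 ]
  B = ℤ.- (+ 64 ℤ.* k)

  nonsingular : EllipticCurve.Nonsingular K (ι# A) (ι# B)
  nonsingular = nonsingular-criterion K A B
    (λ h → product-nonzeroℤ {+ 64} {k} (λ ()) k≢0 (ringℤ 1 (λ k → ♯ 64 :* k := ♯ 0 from (:- ♯ 1 · :- (♯ 64 :* k) ≈ ♯ 0 ∷ [])) refl (k ∷ []) (h , tt)))
    (λ h → from-no (+ 16 ∣? + 1) (divides (ℤ.- k) (cancelℤ {+ 1} {ℤ.- k ℤ.* + 16} {+ 108} (λ ()) (ringℤ 1 (λ k → ♯ 108 :* ♯ 1 := ♯ 108 :* ((:- k) :* ♯ 16) from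
      (:- ♯ 1 · # (+ 4 ℤ.* A ℤ.* A ℤ.* A) :+ ♯ 27 :* (:- (♯ 64 :* k)) ≈ ♯ 0 ∷ [])) refl (k ∷ []) (h , tt)))))

  open NagellLutz K A B nonsingular using (Point; Torsion; aff)
  open TorsionPoints K A B nonsingular

  AllTorsion : Set
  AllTorsion = ∀ P → Torsion P

  -- If Y is prime to 3, then 2YM = 3X² - 6X gives 3 | M, so 3 divides M² + 3 - 3X, which in turn
  -- divides 2Y. The only escape is that this number is zero, that is 3P = O.
  3∣ordinate : ∀ X Y → TorsionPoint X Y → + 3 ∣ Y
  3∣ordinate X Y P = cases (mod-3 Y)
    where
    cases : Residues₃ Y → + 3 ∣ Y
    cases (multiple₃ h) = h
    cases (prime-to-3 c) = ⊥-elim (doubled (double X Y P Y≢0))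
      where
      Y≢0 : Y ≢ + 0
      Y≢0 e = prime-to-3-not-multiple Y c (divides (+ 0) e)
      doubled : ∃[ M ] (TangentSlope X Y M × TorsionPoint (doubleX X M) (doubleY X Y M)) → ⊥
      doubled (M , s , _) = divided (divides-cancelˡ {+ 3} {+ 2 ℤ.* Y} {M} (comaximal-*ʳ {+ 3} {+ 2} {Y} (bezout (+ 1) -[1+ 0 ] refl) c)
        (divides (X ℤ.* X ℤ.- + 2 ℤ.* X) (ringℤ 3 (λ X Y M → ♯ 2 :* Y :* M := (X :* X :- ♯ 2 :* X) :* ♯ 3 from
          (♯ 1 · ♯ 2 :* Y :* M ≈ ♯ 3 :* X :* X :+ ♯ 2 :* # -[1+ 2 ] :* X ∷ [])) refl (X ∷ Y ∷ M ∷ []) (s , tt))))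
        where
        divided : + 3 ∣ M → ⊥
        divided (divides m m≡) = shifted (shift X M ℤ.≟ + 0)
          where
          shifted : Dec (shift X M ≡ + 0) → ⊥
          shifted (no W≢0) = prime-to-3-not-multiple (+ 2 ℤ.* Y) (comaximal-*ʳ {+ 3} {+ 2} {Y} (bezout (+ 1) -[1+ 0 ] refl) c)
            (use (triple X Y M P Y≢0 s W≢0))
            where
            use : ∃[ N ] (N ℤ.* shift X M ≡ + 2 ℤ.* Y × TorsionPoint (tripleX X M N) (tripleY X Y M N)) → + 3 ∣ + 2 ℤ.* Y
            use (N , h , _) = (divides (N ℤ.* (+ 3 ℤ.* m ℤ.* m ℤ.+ + 1 ℤ.- X)) (ringℤ 5 (λ X Y M m N → ♯ 2 :* Y := N :* (♯ 3 :* m :* m :+ ♯ 1 :- X) :* ♯ 3 from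
                (:- ♯ 1 · N :* (M :* M :- # -[1+ 2 ] :- ♯ 3 :* X) ≈ ♯ 2 :* Y ∷ N :* (M :+ m :* ♯ 3) · M ≈ m :* ♯ 3 ∷ []))
                refl (X ∷ Y ∷ M ∷ m ∷ N ∷ []) (h , m≡ , tt)))
          -- With M = 3m the point has X = 3m² + 1 and 2Ym = 9m⁴ - 1. So m divides 1, the point is
          -- (4, 4) or (4, -4), and it lies on the curve with k = 0.
          shifted (yes W≡0) = k≢0 (cancelℤ {k} {+ 0} {+ 64} (λ ()) (ringℤ 5 (λ k X Y m e → ♯ 64 :* k := ♯ 64 :* ♯ 0 from
              (♯ 1 · Y :* Y ≈ X :* X :* X :+ # -[1+ 2 ] :* X :* X :+ (:- (♯ 64 :* k)) ∷ :- (Y :+ ♯ 4 :* m) · Y ≈ ♯ 4 :* m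
              ∷ :- ♯ 16 · m :* m ≈ ♯ 1 ∷ X :* X :+ X :+ ♯ 4 · X ≈ ♯ 4 ∷ []))
              refl (k ∷ X ∷ Y ∷ m ∷ m ∷ []) (TorsionPoint.on P , Y≡4m , mm , X≡4 , tt)))
            where
            X≡ : X ≡ + 3 ℤ.* m ℤ.* m ℤ.+ + 1
            X≡ = cancelℤ {X} {+ 3 ℤ.* m ℤ.* m ℤ.+ + 1} {+ 3} (λ ()) (ringℤ 3 (λ X M m → ♯ 3 :* X := ♯ 3 :* (♯ 3 :* m :* m :+ ♯ 1) from
              (:- ♯ 1 · M :* M :- # -[1+ 2 ] :- ♯ 3 :* X ≈ ♯ 0 ∷ M :+ m :* ♯ 3 · M ≈ m :* ♯ 3 ∷ []))
              refl (X ∷ M ∷ m ∷ []) (W≡0 , m≡ , tt))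
            2Ym : + 2 ℤ.* Y ℤ.* m ≡ + 9 ℤ.* m ℤ.* m ℤ.* m ℤ.* m ℤ.- + 1
            2Ym = cancelℤ {+ 2 ℤ.* Y ℤ.* m} {+ 9 ℤ.* m ℤ.* m ℤ.* m ℤ.* m ℤ.- + 1} {+ 3} (λ ()) (ringℤ 4 (λ X Y M m → ♯ 3 :* (♯ 2 :* Y :* m) := ♯ 3 :* (♯ 9 :* m :* m :* m :* m :- ♯ 1) from
              (♯ 1 · ♯ 2 :* Y :* M ≈ ♯ 3 :* X :* X :+ ♯ 2 :* # -[1+ 2 ] :* X ∷ :- ♯ 2 :* Y · M ≈ m :* ♯ 3
              ∷ ♯ 3 :* (X :+ ♯ 3 :* m :* m :- ♯ 1) · X ≈ ♯ 3 :* m :* m :+ ♯ 1 ∷ []))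
              refl (X ∷ Y ∷ M ∷ m ∷ []) (s , m≡ , X≡ , tt))
            mm : m ℤ.* m ≡ + 1
            mm = unit m (divisor-bound {m} {+ 1} (λ ()) (divides (+ 9 ℤ.* m ℤ.* m ℤ.* m ℤ.- + 2 ℤ.* Y)
              (ringℤ 2 (λ Y m → ♯ 1 := (♯ 9 :* m :* m :* m :- ♯ 2 :* Y) :* m from
                (♯ 1 · ♯ 2 :* Y :* m ≈ ♯ 9 :* m :* m :* m :* m :- ♯ 1 ∷ [])) refl (Y ∷ m ∷ []) (2Ym , tt)))) m≢0
              where
              m≢0 : m ≢ + 0
              m≢0 e = 2∤1 (divides (+ 0) (ringℤ 2 (λ Y m → ♯ 1 := ♯ 0 :* ♯ 2 from
                (♯ 1 · ♯ 2 :* Y :* m ≈ ♯ 9 :* m :* m :* m :* m :- ♯ 1 ∷ ♯ 9 :* m :* m :* m :- ♯ 2 :* Y · m ≈ ♯ 0 ∷ []))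
                refl (Y ∷ m ∷ []) (2Ym , e , tt)))
              unit : ∀ m → ℤ.∣ m ∣ ℕ.≤ 1 → m ≢ + 0 → m ℤ.* m ≡ + 1
              unit (+ 0) _ m≢0 = ⊥-elim (m≢0 refl)
              unit (+ 1) _ _ = refl
              unit -[1+ 0 ] _ _ = refl
              unit (+ suc (suc _)) (ℕ.s≤s ()) _
              unit -[1+ suc _ ] (ℕ.s≤s ()) _
            X≡4 : X ≡ + 4
            X≡4 = ringℤ 2 (λ X m → X := ♯ 4 from (♯ 1 · X ≈ ♯ 3 :* m :* m :+ ♯ 1 ∷ ♯ 3 · m :* m ≈ ♯ 1 ∷ [])) refl (X ∷ m ∷ []) (X≡ , mm , tt)
            Y≡4m : Y ≡ + 4 ℤ.* m
            Y≡4m = cancelℤ {Y} {+ 4 ℤ.* m} {+ 2} (λ ()) (ringℤ 2 (λ Y m → ♯ 2 :* Y := ♯ 2 :* (♯ 4 :* m) from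
              (m · ♯ 2 :* Y :* m ≈ ♯ 9 :* m :* m :* m :* m :- ♯ 1 ∷ :- ♯ 2 :* Y :+ ♯ 9 :* m :* (m :* m :+ ♯ 1) · m :* m ≈ ♯ 1 ∷ []))
              refl (Y ∷ m ∷ []) (2Ym , mm , tt))

  module Coordinates (x y t : ℤ) where
    s d X Y : ℤ
    s = x ℤ.+ y
    d = x ℤ.- y
    X = t ℤ.* t ℤ.+ + 3 ℤ.+ + 4 ℤ.* s
    Y = t ℤ.* t ℤ.* t ℤ.+ + 3 ℤ.* t ℤ.+ + 6 ℤ.* t ℤ.* s ℤ.+ + 6 ℤ.* d

  private
    sₑ dₑ : ∀ {n} → Expr n → Expr n → Expr n
    sₑ x y = x :+ y
    dₑ x y = x :- y
    Xₑ Yₑ : ∀ {n} → Expr n → Expr n → Expr n → Expr n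
    Xₑ x y t = t :* t :+ ♯ 3 :+ ♯ 4 :* sₑ x y
    Yₑ x y t = t :* t :* t :+ ♯ 3 :* t :+ ♯ 6 :* t :* sₑ x y :+ ♯ 6 :* dₑ x y

    quarticₑ : ∀ {n} → Expr n → Expr n → Expr n
    quarticₑ x y = x :* x :* x :+ ♯ 3 :* x :* x :* y :* y :+ y :* y :* y

  on-scaled : ∀ x y t → let open Coordinates x y t in k ≡ x ℤ.* x ℤ.* x ℤ.+ + 3 ℤ.* x ℤ.* x ℤ.* y ℤ.* y ℤ.+ y ℤ.* y ℤ.* y →
    t ℤ.* d ≡ + 4 ℤ.* x ℤ.* y ℤ.+ s → OnℤCurve X Y
  on-scaled x y t q h = ringℤ 4 (λ k x y t → let X = Xₑ x y t; Y = Yₑ x y t in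
    Y :* Y := X :* X :* X :+ # -[1+ 2 ] :* X :* X :+ (:- (♯ 64 :* k)) from
    (♯ 36 :+ ♯ 12 :* t :* t :+ ♯ 60 :* x :+ ♯ 60 :* y :- ♯ 12 :* t :* x :+ ♯ 12 :* t :* y :- ♯ 48 :* x :* y
      · t :* (x :- y) ≈ ♯ 4 :* x :* y :+ (x :+ y)
    ∷ ♯ 64 · k ≈ quarticₑ x y ∷ [])) refl (k ∷ x ∷ y ∷ t ∷ []) (h , q , tt)

  module _ (x y t : ℤ) (P : TorsionPoint (Coordinates.X x y t) (Coordinates.Y x y t))
    (td : t ℤ.* (x ℤ.- y) ≡ + 4 ℤ.* x ℤ.* y ℤ.+ (x ℤ.+ y)) where
    open Coordinates x y t

    private
      3∣Y = 3∣ordinate X Y P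

      -- Substitute 4xy = s² - d² into the equation for td.
      d-equation : d ℤ.* (t ℤ.+ d) ≡ s ℤ.* (s ℤ.+ + 1)
      d-equation = ringℤ 3 (λ x y t → dₑ x y :* (t :+ dₑ x y) := sₑ x y :* (sₑ x y :+ ♯ 1) from
        (♯ 1 · t :* (x :- y) ≈ ♯ 4 :* x :* y :+ (x :+ y) ∷ [])) refl (x ∷ y ∷ t ∷ []) (td , tt)

      3∣t : + 3 ∣ t
      3∣t = use 3∣Y
        where
        use : + 3 ∣ Y → + 3 ∣ t
        use (divides q h) = 3-cube t (divides (q ℤ.- t ℤ.- + 2 ℤ.* t ℤ.* s ℤ.- + 2 ℤ.* d) (ringℤ 4 (λ x y t q →
          t :* (t :* t) := (q :- t :- ♯ 2 :* t :* sₑ x y :- ♯ 2 :* dₑ x y) :* ♯ 3 from (♯ 1 · Yₑ x y t ≈ q :* ♯ 3 ∷ []))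
          refl (x ∷ y ∷ t ∷ q ∷ []) (h , tt)))

    -- s is 0 or - 1 modulo 9, so that 2 (Y / 9) M is 1 modulo 3.
    scaled-slope : ∀ M → TangentSlope X Y M → Comaximal (+ 3) M
    scaled-slope M tangent = cases (mod-3 s) (mod-3 (s ℤ.+ + 1))
      where
      3∣d : + 3 ∣ s ℤ.* (s ℤ.+ + 1) → + 3 ∣ d
      3∣d (divides q h) = use 3∣t
        where
        use : + 3 ∣ t → + 3 ∣ d
        use (divides τ t≡) = either (factor-3 d d (divides (q ℤ.- d ℤ.* τ) (ringℤ 5 (λ d t τ q r → d :* d := (q :- d :* τ) :* ♯ 3 from
          (♯ 1 · d :* (t :+ d) ≈ r ∷ ♯ 1 · r ≈ q :* ♯ 3 ∷ :- d · t ≈ τ :* ♯ 3 ∷ []))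
          refl (d ∷ t ∷ τ ∷ q ∷ s ℤ.* (s ℤ.+ + 1) ∷ []) (d-equation , h , t≡ , tt))))

      slope-unit : ∀ a → (∃[ y′ ] + 2 ℤ.* y′ ℤ.* M ≡ + 1 ℤ.+ + 3 ℤ.* a) → Comaximal (+ 3) M
      slope-unit a (y′ , h) = bezout (ℤ.- a) (+ 2 ℤ.* y′) (ringℤ 3 (λ a y M → (:- a) :* ♯ 3 :+ ♯ 2 :* y :* M := ♯ 1 from
        (♯ 1 · ♯ 2 :* y :* M ≈ ♯ 1 :+ ♯ 3 :* a ∷ [])) refl (a ∷ y′ ∷ M ∷ []) (h , tt))

      Y/9 : ∀ τ δ → t ≡ τ ℤ.* + 3 → d ≡ δ ℤ.* + 3 → Y ≡ + 9 ℤ.* (+ 3 ℤ.* τ ℤ.* τ ℤ.* τ ℤ.+ τ ℤ.+ + 2 ℤ.* τ ℤ.* s ℤ.+ + 2 ℤ.* δ)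
      Y/9 τ δ t≡ d≡ = ringℤ 5 (λ s d t τ δ → t :* t :* t :+ ♯ 3 :* t :+ ♯ 6 :* t :* s :+ ♯ 6 :* d :=
        ♯ 9 :* (♯ 3 :* τ :* τ :* τ :+ τ :+ ♯ 2 :* τ :* s :+ ♯ 2 :* δ) from
        (t :* t :+ t :* (τ :* ♯ 3) :+ τ :* ♯ 3 :* (τ :* ♯ 3) :+ ♯ 3 :+ ♯ 6 :* s · t ≈ τ :* ♯ 3 ∷ ♯ 6 · d ≈ δ :* ♯ 3 ∷ []))
        refl (s ∷ d ∷ t ∷ τ ∷ δ ∷ []) (t≡ , d≡ , tt)

      first : ∀ τ δ ρ → t ≡ τ ℤ.* + 3 → d ≡ δ ℤ.* + 3 → s ≡ + 9 ℤ.* ρ → Comaximal (+ 3) M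
      first τ δ ρ t≡ d≡ s≡ = slope-unit (a ℤ.+ b ℤ.+ + 3 ℤ.* a ℤ.* b) (y′ , cancelℤ {+ 2 ℤ.* y′ ℤ.* M} {_} {+ 9} (λ ()) (ringℤ 8 (λ s t τ ρ y M X Y →
          let a = τ :* τ :+ ♯ 4 :* ρ; b = ♯ 3 :* τ :* τ :+ ♯ 12 :* ρ in
          ♯ 9 :* (♯ 2 :* y :* M) := ♯ 9 :* (♯ 1 :+ ♯ 3 :* (a :+ b :+ ♯ 3 :* a :* b)) from
          (♯ 1 · ♯ 2 :* Y :* M ≈ ♯ 3 :* X :* X :+ ♯ 2 :* # -[1+ 2 ] :* X ∷ :- ♯ 2 :* M · Y ≈ ♯ 9 :* y
          ∷ ♯ 3 :* (X :+ ♯ 9 :* τ :* τ :+ ♯ 3 :+ ♯ 36 :* ρ) :- ♯ 6 · X ≈ ♯ 9 :* τ :* τ :+ ♯ 3 :+ ♯ 36 :* ρ ∷ []))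
          refl (s ∷ t ∷ τ ∷ ρ ∷ y′ ∷ M ∷ X ∷ Y ∷ []) (tangent , Y/9 τ δ t≡ d≡ , X≡ , tt)))
        where
        y′ = + 3 ℤ.* τ ℤ.* τ ℤ.* τ ℤ.+ τ ℤ.+ + 2 ℤ.* τ ℤ.* s ℤ.+ + 2 ℤ.* δ
        a = τ ℤ.* τ ℤ.+ + 4 ℤ.* ρ
        b = + 3 ℤ.* τ ℤ.* τ ℤ.+ + 12 ℤ.* ρ
        X≡ : X ≡ + 9 ℤ.* τ ℤ.* τ ℤ.+ + 3 ℤ.+ + 36 ℤ.* ρ
        X≡ = ringℤ 4 (λ s t τ ρ → t :* t :+ ♯ 3 :+ ♯ 4 :* s := ♯ 9 :* τ :* τ :+ ♯ 3 :+ ♯ 36 :* ρ from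
          (t :+ τ :* ♯ 3 · t ≈ τ :* ♯ 3 ∷ ♯ 4 · s ≈ ♯ 9 :* ρ ∷ [])) refl (s ∷ t ∷ τ ∷ ρ ∷ []) (t≡ , s≡ , tt)

      second : ∀ τ δ ρ → t ≡ τ ℤ.* + 3 → d ≡ δ ℤ.* + 3 → s ℤ.+ + 1 ≡ + 9 ℤ.* ρ → Comaximal (+ 3) M
      second τ δ ρ t≡ d≡ s≡ = slope-unit (+ 3 ℤ.* a ℤ.* b ℤ.- a ℤ.- b) (y′ , cancelℤ {+ 2 ℤ.* y′ ℤ.* M} {_} {+ 9} (λ ()) (ringℤ 8 (λ s t τ ρ y M X Y →
          let a = ♯ 3 :* τ :* τ :+ ♯ 12 :* ρ; b = τ :* τ :+ ♯ 4 :* ρ in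
          ♯ 9 :* (♯ 2 :* y :* M) := ♯ 9 :* (♯ 1 :+ ♯ 3 :* (♯ 3 :* a :* b :- a :- b)) from
          (♯ 1 · ♯ 2 :* Y :* M ≈ ♯ 3 :* X :* X :+ ♯ 2 :* # -[1+ 2 ] :* X ∷ :- ♯ 2 :* M · Y ≈ ♯ 9 :* y
          ∷ ♯ 3 :* (X :+ ♯ 9 :* τ :* τ :- ♯ 1 :+ ♯ 36 :* ρ) :- ♯ 6 · X ≈ ♯ 9 :* τ :* τ :- ♯ 1 :+ ♯ 36 :* ρ ∷ []))
          refl (s ∷ t ∷ τ ∷ ρ ∷ y′ ∷ M ∷ X ∷ Y ∷ []) (tangent , Y/9 τ δ t≡ d≡ , X≡ , tt)))
        where
        y′ = + 3 ℤ.* τ ℤ.* τ ℤ.* τ ℤ.+ τ ℤ.+ + 2 ℤ.* τ ℤ.* s ℤ.+ + 2 ℤ.* δ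
        a = + 3 ℤ.* τ ℤ.* τ ℤ.+ + 12 ℤ.* ρ
        b = τ ℤ.* τ ℤ.+ + 4 ℤ.* ρ
        X≡ : X ≡ + 9 ℤ.* τ ℤ.* τ ℤ.- + 1 ℤ.+ + 36 ℤ.* ρ
        X≡ = ringℤ 4 (λ s t τ ρ → t :* t :+ ♯ 3 :+ ♯ 4 :* s := ♯ 9 :* τ :* τ :- ♯ 1 :+ ♯ 36 :* ρ from
          (t :+ τ :* ♯ 3 · t ≈ τ :* ♯ 3 ∷ ♯ 4 · s :+ ♯ 1 ≈ ♯ 9 :* ρ ∷ [])) refl (s ∷ t ∷ τ ∷ ρ ∷ []) (t≡ , s≡ , tt)

      -- A factor σ of s (s + 1) divisible by 3 is divisible by 9, as the other factor is prime to 3.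
      nine : ∀ σ σ′ e → σ ℤ.* σ′ ≡ s ℤ.* (s ℤ.+ + 1) → σ′ ≡ σ ℤ.+ e → e ℤ.* e ≡ + 1 → ∀ τ δ → t ≡ τ ℤ.* + 3 → d ≡ δ ℤ.* + 3 → + 3 ∣ σ → ∃[ ρ ] σ ≡ + 9 ℤ.* ρ
      nine σ σ′ e σσ′ σ′≡ ee τ δ t≡ d≡ (divides r σ≡) = use (divides-cancelˡ {+ 3} {σ′} {r}
          (bezout (ℤ.- (r ℤ.* e)) e (ringℤ 4 (λ σ σ′ e r → (:- (r :* e)) :* ♯ 3 :+ e :* σ′ := ♯ 1 from
            (e · σ′ ≈ σ :+ e ∷ e · σ ≈ r :* ♯ 3 ∷ ♯ 1 · e :* e ≈ ♯ 1 ∷ [])) refl (σ ∷ σ′ ∷ e ∷ r ∷ []) (σ′≡ , σ≡ , ee , tt)))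
          (divides (δ ℤ.* (τ ℤ.+ δ)) (cancelℤ {σ′ ℤ.* r} {δ ℤ.* (τ ℤ.+ δ) ℤ.* + 3} {+ 3} (λ ()) (ringℤ 8 (λ d t τ δ r σ σ′ p → ♯ 3 :* (σ′ :* r) := ♯ 3 :* (δ :* (τ :+ δ) :* ♯ 3) from
            (:- ♯ 1 · d :* (t :+ d) ≈ p ∷ :- σ′ · σ ≈ r :* ♯ 3 ∷ ♯ 1 · σ :* σ′ ≈ p ∷ d · t ≈ τ :* ♯ 3
            ∷ (τ :* ♯ 3 :+ d :+ δ :* ♯ 3) · d ≈ δ :* ♯ 3 ∷ []))
            refl (d ∷ t ∷ τ ∷ δ ∷ r ∷ σ ∷ σ′ ∷ s ℤ.* (s ℤ.+ + 1) ∷ []) (d-equation , σ≡ , σσ′ , t≡ , d≡ , tt)))))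
        where
        use : + 3 ∣ r → ∃[ ρ ] σ ≡ + 9 ℤ.* ρ
        use (divides ρ r≡) = ρ , ringℤ 3 (λ σ r ρ → σ := ♯ 9 :* ρ from (♯ 1 · σ ≈ r :* ♯ 3 ∷ ♯ 3 · r ≈ ρ :* ♯ 3 ∷ []))
          refl (σ ∷ r ∷ ρ ∷ []) (σ≡ , r≡ , tt)

      with-multiples : + 3 ∣ s ⊎ + 3 ∣ s ℤ.+ + 1 → + 3 ∣ t → + 3 ∣ d → Comaximal (+ 3) M
      with-multiples (inj₁ h) (divides τ t≡) (divides δ d≡) =
        let ρ , s≡ = nine s (s ℤ.+ + 1) (+ 1) refl refl refl τ δ t≡ d≡ h in first τ δ ρ t≡ d≡ s≡
      with-multiples (inj₂ h) (divides τ t≡) (divides δ d≡) =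
        let ρ , s≡ = nine (s ℤ.+ + 1) s -[1+ 0 ] (ℤₚ.*-comm (s ℤ.+ + 1) s)
              (ringℤ 1 (λ s → s := s :+ ♯ 1 :+ # -[1+ 0 ] from []) refl (s ∷ []) tt) refl τ δ t≡ d≡ h in second τ δ ρ t≡ d≡ s≡

      cases : Residues₃ s → Residues₃ (s ℤ.+ + 1) → Comaximal (+ 3) M
      cases (multiple₃ h@(divides q e)) _ = with-multiples (inj₁ h) 3∣t (3∣d (divides (q ℤ.* (s ℤ.+ + 1))
        (trans (cong (ℤ._* (s ℤ.+ + 1)) e) (ringℤ 2 (λ q r → q :* ♯ 3 :* r := q :* r :* ♯ 3 from []) refl (q ∷ s ℤ.+ + 1 ∷ []) tt))))
      cases (prime-to-3 _) (multiple₃ h@(divides q e)) = with-multiples (inj₂ h) 3∣t (3∣d (divides (s ℤ.* q)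
        (trans (cong (s ℤ.*_) e) (sym (ℤₚ.*-assoc s q (+ 3))))))
      cases (prime-to-3 c) (prime-to-3 c′) = ⊥-elim (one-third (third c c′))
        where
        -- s = 1 modulo 3, and then d² = 2 modulo 3.
        third : Comaximal (+ 3) s → Comaximal (+ 3) (s ℤ.+ + 1) → + 3 ∣ s ℤ.- + 1
        third c c′ = use (mod-3 (s ℤ.- + 1))
          where
          use : Residues₃ (s ℤ.- + 1) → + 3 ∣ s ℤ.- + 1
          use (multiple₃ h) = h
          use (prime-to-3 c″) = ⊥-elim (prime-to-3-not-multiple (s ℤ.* ((s ℤ.+ + 1) ℤ.* (s ℤ.- + 1)))
            (comaximal-*ʳ {+ 3} {s} {(s ℤ.+ + 1) ℤ.* (s ℤ.- + 1)} c (comaximal-*ʳ {+ 3} {s ℤ.+ + 1} {s ℤ.- + 1} c′ c″)) (3∣cube-difference s))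
        one-third : + 3 ∣ s ℤ.- + 1 → ⊥
        one-third (divides σ e) = with-t 3∣t
          where
          with-t : + 3 ∣ t → ⊥
          with-t (divides τ t≡) = by (d IntDM.%ℕ 3) (d IntDM./ℕ 3) (IntDM.a≡a%ℕn+[a/ℕn]*n d 3) (IntDM.n%ℕd<d d 3)
            where
            dd : d ℤ.* d ≡ + 2 ℤ.+ + 3 ℤ.* (σ ℤ.* (s ℤ.+ + 2) ℤ.- d ℤ.* τ)
            dd = ringℤ 5 (λ s d t τ σ → d :* d := ♯ 2 :+ ♯ 3 :* (σ :* (s :+ ♯ 2) :- d :* τ) from
              (♯ 1 · d :* (t :+ d) ≈ s :* (s :+ ♯ 1) ∷ :- d · t ≈ τ :* ♯ 3 ∷ s :+ ♯ 2 · s :- ♯ 1 ≈ σ :* ♯ 3 ∷ []))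
              refl (s ∷ d ∷ t ∷ τ ∷ σ ∷ []) (d-equation , t≡ , e , tt)
            by : ∀ r q → d ≡ + r ℤ.+ q ℤ.* + 3 → r ℕ.< 3 → ⊥
            by 0 q h _ = 3∤1 (divides (+ 1 ℤ.+ (σ ℤ.* (s ℤ.+ + 2) ℤ.- d ℤ.* τ) ℤ.- d ℤ.* q) (ringℤ 3 (λ d q z → ♯ 1 := (♯ 1 :+ z :- d :* q) :* ♯ 3 from
              (♯ 1 · d :* d ≈ ♯ 2 :+ ♯ 3 :* z ∷ :- d · d ≈ ♯ 0 :+ q :* ♯ 3 ∷ [])) refl (d ∷ q ∷ σ ℤ.* (s ℤ.+ + 2) ℤ.- d ℤ.* τ ∷ []) (dd , h , tt)))
            by 1 q h _ = 3∤1 (divides (q ℤ.* (d ℤ.+ + 1) ℤ.- (σ ℤ.* (s ℤ.+ + 2) ℤ.- d ℤ.* τ)) (ringℤ 3 (λ d q z → ♯ 1 := (q :* (d :+ ♯ 1) :- z) :* ♯ 3 from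
              (:- ♯ 1 · d :* d ≈ ♯ 2 :+ ♯ 3 :* z ∷ (d :+ ♯ 1) · d ≈ ♯ 1 :+ q :* ♯ 3 ∷ [])) refl (d ∷ q ∷ σ ℤ.* (s ℤ.+ + 2) ℤ.- d ℤ.* τ ∷ []) (dd , h , tt)))
            by 2 q h _ = 3∤1 (divides ((q ℤ.+ + 1) ℤ.* (d ℤ.- + 1) ℤ.- (σ ℤ.* (s ℤ.+ + 2) ℤ.- d ℤ.* τ)) (ringℤ 3 (λ d q z → ♯ 1 := ((q :+ ♯ 1) :* (d :- ♯ 1) :- z) :* ♯ 3 from
              (:- ♯ 1 · d :* d ≈ ♯ 2 :+ ♯ 3 :* z ∷ (d :- ♯ 1) · d ≈ ♯ 2 :+ q :* ♯ 3 ∷ [])) refl (d ∷ q ∷ σ ℤ.* (s ℤ.+ + 2) ℤ.- d ℤ.* τ ∷ []) (dd , h , tt)))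
            by (suc (suc (suc _))) q h (ℕ.s≤s (ℕ.s≤s (ℕ.s≤s ())))

    scaled-two-torsion : Y ≡ + 0
    scaled-two-torsion = cases (Y ℤ.≟ + 0)
      where
      cases : Dec (Y ≡ + 0) → Y ≡ + 0
      cases (yes e) = e
      cases (no Y≢0) = ⊥-elim (doubled (double X Y P Y≢0))
        where
        doubled : ∃[ M ] (TangentSlope X Y M × TorsionPoint (doubleX X M) (doubleY X Y M)) → ⊥
        doubled (M , tangent , P₂) = combine 3∣Y (3∣ordinate (doubleX X M) (doubleY X Y M) P₂)
          where
          -- Modulo 3 the ordinate of 2P is -Y - M³. Since both ordinates are divisible by 3, so is
          -- M, against `scaled-slope`.
          combine : + 3 ∣ Y → + 3 ∣ doubleY X Y M → ⊥
          combine (divides q e) (divides q₂ e₂) = prime-to-3-not-multiple M (scaled-slope M tangent)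
            (3-cube M (divides (M ℤ.* X ℤ.- M ℤ.- q ℤ.- q₂) (ringℤ 5 (λ X Y M q q₂ → M :* (M :* M) := (M :* X :- M :- q :- q₂) :* ♯ 3 from
              (:- ♯ 1 · Y ≈ q :* ♯ 3 ∷ :- ♯ 1 · :- (Y :+ M :* (M :* M :- # -[1+ 2 ] :- ♯ 3 :* X)) ≈ q₂ :* ♯ 3 ∷ []))
              refl (X ∷ Y ∷ M ∷ q ∷ q₂ ∷ []) (e , e₂ , tt))))

  ordinate-zero : AllTorsion → ∀ x y t → let open Coordinates x y t in k ≡ x ℤ.* x ℤ.* x ℤ.+ + 3 ℤ.* x ℤ.* x ℤ.* y ℤ.* y ℤ.+ y ℤ.* y ℤ.* y →
    t ℤ.* d ≡ + 4 ℤ.* x ℤ.* y ℤ.+ s → Y ≡ + 0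
  ordinate-zero all-torsion x y t q h = scaled-two-torsion x y t (torsionPoint on (all-torsion (aff (ι# X) (ι# Y) (embed {X} {Y} on)))) h
    where
    open Coordinates x y t
    on = on-scaled x y t q h

odd-form : ∀ n → Comaximal (+ 2) n → ∃[ q ] n ≡ + 1 ℤ.+ q ℤ.* + 2
odd-form n c = use (n IntDM.%ℕ 2) (n IntDM./ℕ 2) (IntDM.a≡a%ℕn+[a/ℕn]*n n 2) (IntDM.n%ℕd<d n 2)
  where
  use : ∀ r q → n ≡ + r ℤ.+ q ℤ.* + 2 → r ℕ.< 2 → ∃[ q ] n ≡ + 1 ℤ.+ q ℤ.* + 2
  use 0 q h _ = ⊥-elim (odd-not-even n c (divides q (trans h (ℤₚ.+-identityˡ (q ℤ.* + 2)))))
  use 1 q h _ = q , h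
  use (suc (suc _)) q h (ℕ.s≤s (ℕ.s≤s ()))

-- Rank zero of E₃.

module RankZeroE₃ (K : FractionField) (k : ℤ) (k≢0 : k ≢ + 0) where
  open FractionField K
  open FieldProperties K
  open Embedding K
  open Points K k

  A₃ B₃ : ℤ
  A₃ = -[1+ 26 ]
  B₃ = ℤ.- (+ 1728 ℤ.* k)

  nonsingular₃ : EllipticCurve.Nonsingular K (ι# A₃) (ι# B₃)
  nonsingular₃ = nonsingular-criterion K A₃ B₃
    (λ h → product-nonzeroℤ {+ 1728} {k} (λ ()) k≢0 (ringℤ 1 (λ k → ♯ 1728 :* k := ♯ 0 from (:- ♯ 1 · :- (♯ 1728 :* k) ≈ ♯ 0 ∷ [])) refl (k ∷ []) (h , tt)))
    (λ h → 2∤1 (divides (+ 14 ℤ.+ + 8 ℤ.* k) (cancelℤ {+ 1} {(+ 14 ℤ.+ + 8 ℤ.* k) ℤ.* + 2} {+ 2916} (λ ()) (ringℤ 1 (λ k → ♯ 2916 :* ♯ 1 := ♯ 2916 :* ((♯ 14 :+ ♯ 8 :* k) :* ♯ 2) from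
      (♯ 1 · # (+ 4 ℤ.* A₃ ℤ.* A₃ ℤ.* A₃) :+ ♯ 27 :* (:- (♯ 1728 :* k)) ≈ ♯ 0 ∷ [])) refl (k ∷ []) (h , tt)))))

  open NagellLutz K A₃ B₃ nonsingular₃
  open TorsionPoints K A₃ B₃ nonsingular₃
  open TorsionCongruences K A₃ B₃ nonsingular₃

  -- As Y² is X³ modulo 3, an X prime to 3 makes 2Y prime to 3. Then 3 divides M and M² + 27 - 3X,
  -- while the latter divides 2Y unless it vanishes; and M² + 27 = 3X with 3 | M makes X divisible
  -- by 3 after all.
  3∣abscissa : ∀ X Y → TorsionPoint X Y → + 3 ∣ X
  3∣abscissa X Y P = cases (mod-3 X)
    where
    cases : Residues₃ X → + 3 ∣ X
    cases (multiple₃ h) = h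
    cases (prime-to-3 c) = ⊥-elim (doubled (double X Y P Y≢0))
      where
      YY-unit : Comaximal (+ 3) (Y ℤ.* Y)
      YY-unit = subst (Comaximal (+ 3)) (ringℤ 3 (λ k X Y → X :* X :* X :+ ♯ 3 :* (:- ♯ 9 :* X :* X :- ♯ 576 :* k) := Y :* Y from
          (:- ♯ 1 · Y :* Y ≈ X :* X :* X :+ # -[1+ 26 ] :* X :* X :+ (:- (♯ 1728 :* k)) ∷ [])) refl (k ∷ X ∷ Y ∷ []) (TorsionPoint.on P , tt))
        (comaximal-shift {+ 3} {X ℤ.* X ℤ.* X} (ℤ.- + 9 ℤ.* X ℤ.* X ℤ.- + 576 ℤ.* k)
          (comaximal-*ʳ {+ 3} {X ℤ.* X} {X} (comaximal-*ʳ {+ 3} {X} {X} c c) c))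
      2Y-unit : Comaximal (+ 3) (+ 2 ℤ.* Y)
      2Y-unit = comaximal-*ʳ {+ 3} {+ 2} {Y} (bezout (+ 1) -[1+ 0 ] refl) (comaximal-divisor {+ 3} {Y ℤ.* Y} {Y} (divides Y refl) YY-unit)
      Y≢0 : Y ≢ + 0
      Y≢0 e = prime-to-3-not-multiple (+ 2 ℤ.* Y) 2Y-unit (divides (+ 0) (trans (cong (+ 2 ℤ.*_) e) refl))
      doubled : ∃[ M ] (TangentSlope X Y M × TorsionPoint (doubleX X M) (doubleY X Y M)) → ⊥
      doubled (M , s , _) = divided (divides-cancelˡ {+ 3} {+ 2 ℤ.* Y} {M} 2Y-unit
        (divides (X ℤ.* X ℤ.- + 18 ℤ.* X) (ringℤ 3 (λ X Y M → ♯ 2 :* Y :* M := (X :* X :- ♯ 18 :* X) :* ♯ 3 from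
          (♯ 1 · ♯ 2 :* Y :* M ≈ ♯ 3 :* X :* X :+ ♯ 2 :* # -[1+ 26 ] :* X ∷ [])) refl (X ∷ Y ∷ M ∷ []) (s , tt))))
        where
        divided : + 3 ∣ M → ⊥
        divided (divides m m≡) = shifted (shift X M ℤ.≟ + 0)
          where
          shifted : Dec (shift X M ≡ + 0) → ⊥
          shifted (no W≢0) = prime-to-3-not-multiple (+ 2 ℤ.* Y) 2Y-unit (use (triple X Y M P Y≢0 s W≢0))
            where
            use : ∃[ N ] (N ℤ.* shift X M ≡ + 2 ℤ.* Y × TorsionPoint (tripleX X M N) (tripleY X Y M N)) → + 3 ∣ + 2 ℤ.* Y
            use (N , h , _) = divides (N ℤ.* (+ 3 ℤ.* m ℤ.* m ℤ.+ + 9 ℤ.- X)) (ringℤ 5 (λ X Y M m N → ♯ 2 :* Y := N :* (♯ 3 :* m :* m :+ ♯ 9 :- X) :* ♯ 3 from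
              (:- ♯ 1 · N :* (M :* M :- # -[1+ 26 ] :- ♯ 3 :* X) ≈ ♯ 2 :* Y ∷ N :* (M :+ m :* ♯ 3) · M ≈ m :* ♯ 3 ∷ []))
              refl (X ∷ Y ∷ M ∷ m ∷ N ∷ []) (h , m≡ , tt))
          shifted (yes W≡0) = prime-to-3-not-multiple X c (divides (m ℤ.* m ℤ.+ + 3) (cancelℤ {X} {(m ℤ.* m ℤ.+ + 3) ℤ.* + 3} {+ 3} (λ ())
            (ringℤ 3 (λ X M m → ♯ 3 :* X := ♯ 3 :* ((m :* m :+ ♯ 3) :* ♯ 3) from
              (:- ♯ 1 · M :* M :- # -[1+ 26 ] :- ♯ 3 :* X ≈ ♯ 0 ∷ M :+ m :* ♯ 3 · M ≈ m :* ♯ 3 ∷ []))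
              refl (X ∷ M ∷ m ∷ []) (W≡0 , m≡ , tt))))

  record Coordinates (u v t X Y : ℤ) : Set where
    field
      quarter : Quarter k u v
      slope≡ : t ℤ.* (u ℤ.- v) ≡ u ℤ.* v ℤ.+ + 3 ℤ.* (u ℤ.+ v)
      X≡ : X ≡ t ℤ.* t ℤ.+ + 27 ℤ.+ + 3 ℤ.* (u ℤ.+ v)
      2Y≡ : + 2 ℤ.* Y ≡ + 2 ℤ.* t ℤ.* t ℤ.* t ℤ.+ + 54 ℤ.* t ℤ.+ + 9 ℤ.* t ℤ.* (u ℤ.+ v) ℤ.+ + 27 ℤ.* (u ℤ.- v)

  ScaledTorsion : Set
  ScaledTorsion = ∀ k₁ (k₁≢0 : k₁ ≢ + 0) → k ≡ + 27 ℤ.* k₁ → ScaledE₃.AllTorsion K k₁ k₁≢0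

  module _ (scaled-torsion : ScaledTorsion) {u v t X Y : ℤ} (point : TorsionPoint X Y) (C : Coordinates u v t X Y) where
    open Coordinates C

    3∣t : + 3 ∣ t
    3∣t = use (3∣abscissa X Y point)
      where
      use : + 3 ∣ X → + 3 ∣ t
      use (divides q h) = either (factor-3 t t (divides (q ℤ.- + 9 ℤ.- (u ℤ.+ v)) (ringℤ 4 (λ w t X q → t :* t := (q :- ♯ 9 :- w) :* ♯ 3 from
        (:- ♯ 1 · X ≈ t :* t :+ ♯ 27 :+ ♯ 3 :* w ∷ ♯ 1 · X ≈ q :* ♯ 3 ∷ [])) refl (u ℤ.+ v ∷ t ∷ X ∷ q ∷ []) (X≡ , h , tt))))

    -- With uv even and u + v odd, t(u - v) is odd, hence so are t and X. A torsion point with odd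
    -- abscissa has ordinate zero.
    mixed-two-torsion : + 2 ∣ u ℤ.* v → Comaximal (+ 2) (u ℤ.+ v) → Y ≡ + 0
    mixed-two-torsion (divides q uv≡) c = odd-abscissa X Y point (X-odd (odd-form (u ℤ.+ v) c) (odd-form t t-odd))
      where
      t-odd : Comaximal (+ 2) t
      t-odd = 2∤⇒ t λ (divides r t≡) → odd-not-even (u ℤ.+ v) c (divides (r ℤ.* (u ℤ.- v) ℤ.- q ℤ.- (u ℤ.+ v))
        (ringℤ 5 (λ u v t q r → u :+ v := (r :* (u :- v) :- q :- (u :+ v)) :* ♯ 2 from
          (:- ♯ 1 · t :* (u :- v) ≈ u :* v :+ ♯ 3 :* (u :+ v) ∷ u :- v · t ≈ r :* ♯ 2 ∷ :- ♯ 1 · u :* v ≈ q :* ♯ 2 ∷ []))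
          refl (u ∷ v ∷ t ∷ q ∷ r ∷ []) (slope≡ , t≡ , uv≡ , tt)))
      X-odd : ∃[ a ] u ℤ.+ v ≡ + 1 ℤ.+ a ℤ.* + 2 → ∃[ b ] t ≡ + 1 ℤ.+ b ℤ.* + 2 → Comaximal (+ 2) X
      X-odd (a , w≡) (b , t≡) = bezout (ℤ.- (+ 15 ℤ.+ + 3 ℤ.* a ℤ.+ b ℤ.* (t ℤ.+ + 1))) (+ 1) (ringℤ 5 (λ w t X a b →
        (:- (♯ 15 :+ ♯ 3 :* a :+ b :* (t :+ ♯ 1))) :* ♯ 2 :+ ♯ 1 :* X := ♯ 1 from
        (♯ 1 · X ≈ t :* t :+ ♯ 27 :+ ♯ 3 :* w ∷ ♯ 3 · w ≈ ♯ 1 :+ a :* ♯ 2 ∷ t :+ ♯ 1 · t ≈ ♯ 1 :+ b :* ♯ 2 ∷ []))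
        refl (u ℤ.+ v ∷ t ∷ X ∷ a ∷ b ∷ []) (X≡ , w≡ , t≡ , tt))

    module Integers (x y : ℤ) (u≡ : u ≡ + 4 ℤ.* x) (v≡ : v ≡ + 4 ℤ.* y) where

      td : t ℤ.* (x ℤ.- y) ≡ + 4 ℤ.* x ℤ.* y ℤ.+ + 3 ℤ.* (x ℤ.+ y)
      td = cancelℤ {t ℤ.* (x ℤ.- y)} {+ 4 ℤ.* x ℤ.* y ℤ.+ + 3 ℤ.* (x ℤ.+ y)} {+ 4} (λ ()) (ringℤ 5 (λ u v t x y →
        ♯ 4 :* (t :* (x :- y)) := ♯ 4 :* (♯ 4 :* x :* y :+ ♯ 3 :* (x :+ y)) from
        (♯ 1 · t :* (u :- v) ≈ u :* v :+ ♯ 3 :* (u :+ v) ∷ v :+ ♯ 3 :- t · u ≈ ♯ 4 :* x ∷ ♯ 4 :* x :+ ♯ 3 :+ t · v ≈ ♯ 4 :* y ∷ []))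
        refl (u ∷ v ∷ t ∷ x ∷ y ∷ []) (slope≡ , u≡ , v≡ , tt))

      X≡′ : X ≡ t ℤ.* t ℤ.+ + 27 ℤ.+ + 12 ℤ.* (x ℤ.+ y)
      X≡′ = ringℤ 6 (λ u v t x y X → X := t :* t :+ ♯ 27 :+ ♯ 12 :* (x :+ y) from
        (♯ 1 · X ≈ t :* t :+ ♯ 27 :+ ♯ 3 :* (u :+ v) ∷ ♯ 3 · u ≈ ♯ 4 :* x ∷ ♯ 3 · v ≈ ♯ 4 :* y ∷ []))
        refl (u ∷ v ∷ t ∷ x ∷ y ∷ X ∷ []) (X≡ , u≡ , v≡ , tt)

      Y≡′ : Y ≡ t ℤ.* t ℤ.* t ℤ.+ + 27 ℤ.* t ℤ.+ + 18 ℤ.* t ℤ.* (x ℤ.+ y) ℤ.+ + 54 ℤ.* (x ℤ.- y)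
      Y≡′ = cancelℤ {Y} {t ℤ.* t ℤ.* t ℤ.+ + 27 ℤ.* t ℤ.+ + 18 ℤ.* t ℤ.* (x ℤ.+ y) ℤ.+ + 54 ℤ.* (x ℤ.- y)} {+ 2} (λ ()) (ringℤ 6 (λ u v t x y Y →
        ♯ 2 :* Y := ♯ 2 :* (t :* t :* t :+ ♯ 27 :* t :+ ♯ 18 :* t :* (x :+ y) :+ ♯ 54 :* (x :- y)) from
        (♯ 1 · ♯ 2 :* Y ≈ ♯ 2 :* t :* t :* t :+ ♯ 54 :* t :+ ♯ 9 :* t :* (u :+ v) :+ ♯ 27 :* (u :- v)
        ∷ ♯ 9 :* t :+ ♯ 27 · u ≈ ♯ 4 :* x ∷ ♯ 9 :* t :- ♯ 27 · v ≈ ♯ 4 :* y ∷ []))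
        refl (u ∷ v ∷ t ∷ x ∷ y ∷ Y ∷ []) (2Y≡ , u≡ , v≡ , tt))

      3∣xy : + 3 ∣ x ℤ.* y
      3∣xy = use 3∣t
        where
        use : + 3 ∣ t → + 3 ∣ x ℤ.* y
        use (divides τ t≡) = divides-cancelˡ {+ 3} {+ 4} {x ℤ.* y} (bezout -[1+ 0 ] (+ 1) refl) (divides (τ ℤ.* (x ℤ.- y) ℤ.- (x ℤ.+ y))
          (ringℤ 4 (λ t x y τ → ♯ 4 :* (x :* y) := (τ :* (x :- y) :- (x :+ y)) :* ♯ 3 from
            (:- ♯ 1 · t :* (x :- y) ≈ ♯ 4 :* x :* y :+ ♯ 3 :* (x :+ y) ∷ x :- y · t ≈ τ :* ♯ 3 ∷ []))
            refl (t ∷ x ∷ y ∷ τ ∷ []) (td , t≡ , tt)))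

      -- Otherwise the tangent slope and the abscissa of the double are prime to 3.
      unit-difference : Comaximal (+ 3) (x ℤ.- y) → Y ≡ + 0
      unit-difference c = cases (Y ℤ.≟ + 0)
        where
        cases : Dec (Y ≡ + 0) → Y ≡ + 0
        cases (yes e) = e
        cases (no Y≢0) = ⊥-elim (doubled (double X Y point Y≢0) 3∣t 3∣xy)
          where
          doubled : ∃[ M ] (TangentSlope X Y M × TorsionPoint (doubleX X M) (doubleY X Y M)) → + 3 ∣ t → + 3 ∣ x ℤ.* y → ⊥
          doubled (M , tangent , P₂) (divides τ t≡) (divides p xy≡) = use (3∣abscissa (doubleX X M) (doubleY X Y M) P₂)
            where
            s = x ℤ.+ y
            d = x ℤ.- y
            X′ = + 4 ℤ.* s ℤ.+ + 3 ℤ.* (τ ℤ.* τ ℤ.+ + 3)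
            Y′ = τ ℤ.* τ ℤ.* τ ℤ.+ + 3 ℤ.* τ ℤ.+ + 2 ℤ.* τ ℤ.* s ℤ.+ + 2 ℤ.* d
            s-unit : Comaximal (+ 3) s
            s-unit = comaximal-divisor {+ 3} {s ℤ.* s} {s} (divides s refl) (subst (Comaximal (+ 3))
              (ringℤ 3 (λ x y p → (x :- y) :* (x :- y) :+ ♯ 3 :* (♯ 4 :* p) := (x :+ y) :* (x :+ y) from
                (:- ♯ 4 · x :* y ≈ p :* ♯ 3 ∷ [])) refl (x ∷ y ∷ p ∷ []) (xy≡ , tt))
              (comaximal-shift {+ 3} {d ℤ.* d} (+ 4 ℤ.* p) (comaximal-*ʳ {+ 3} {d} {d} c c)))
            X′-unit : Comaximal (+ 3) X′
            X′-unit = comaximal-shift {+ 3} {+ 4 ℤ.* s} (τ ℤ.* τ ℤ.+ + 3) (comaximal-*ʳ {+ 3} {+ 4} {s} (bezout -[1+ 0 ] (+ 1) refl) s-unit)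
            X≡3X′ : X ≡ + 3 ℤ.* X′
            X≡3X′ = ringℤ 4 (λ s t τ X → X := ♯ 3 :* (♯ 4 :* s :+ ♯ 3 :* (τ :* τ :+ ♯ 3)) from
              (♯ 1 · X ≈ t :* t :+ ♯ 27 :+ ♯ 12 :* s ∷ t :+ τ :* ♯ 3 · t ≈ τ :* ♯ 3 ∷ [])) refl (s ∷ t ∷ τ ∷ X ∷ []) (X≡′ , t≡ , tt)
            Y≡27Y′ : Y ≡ + 27 ℤ.* Y′
            Y≡27Y′ = ringℤ 5 (λ s d t τ Y → Y := ♯ 27 :* (τ :* τ :* τ :+ ♯ 3 :* τ :+ ♯ 2 :* τ :* s :+ ♯ 2 :* d) from
              (♯ 1 · Y ≈ t :* t :* t :+ ♯ 27 :* t :+ ♯ 18 :* t :* s :+ ♯ 54 :* d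
              ∷ t :* t :+ t :* τ :* ♯ 3 :+ ♯ 9 :* τ :* τ :+ ♯ 27 :+ ♯ 18 :* s · t ≈ τ :* ♯ 3 ∷ []))
              refl (s ∷ d ∷ t ∷ τ ∷ Y ∷ []) (Y≡′ , t≡ , tt)
            M-unit : Comaximal (+ 3) M
            M-unit = comaximal-divisor {+ 3} {+ 2 ℤ.* Y′ ℤ.* M} {M} (divides (+ 2 ℤ.* Y′) refl) (subst (Comaximal (+ 3))
              (cancelℤ {X′ ℤ.* X′ ℤ.+ + 3 ℤ.* (ℤ.- + 2 ℤ.* X′)} {+ 2 ℤ.* Y′ ℤ.* M} {+ 27} (λ ()) (ringℤ 5 (λ X Y X′ Y′ M →
                ♯ 27 :* (X′ :* X′ :+ ♯ 3 :* (:- ♯ 2 :* X′)) := ♯ 27 :* (♯ 2 :* Y′ :* M) from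
                (:- ♯ 1 · ♯ 2 :* Y :* M ≈ ♯ 3 :* X :* X :+ ♯ 2 :* # -[1+ 26 ] :* X ∷ ♯ 2 :* M · Y ≈ ♯ 27 :* Y′
                ∷ :- ♯ 3 :* (X :+ ♯ 3 :* X′) :+ ♯ 54 · X ≈ ♯ 3 :* X′ ∷ []))
                refl (X ∷ Y ∷ X′ ∷ Y′ ∷ M ∷ []) (tangent , Y≡27Y′ , X≡3X′ , tt)))
              (comaximal-shift {+ 3} {X′ ℤ.* X′} (ℤ.- + 2 ℤ.* X′) (comaximal-*ʳ {+ 3} {X′} {X′} X′-unit X′-unit)))
            use : + 3 ∣ doubleX X M → ⊥
            use (divides q h) = prime-to-3-not-multiple (M ℤ.* M) (comaximal-*ʳ {+ 3} {M} {M} M-unit M-unit) (divides (q ℤ.- + 9 ℤ.+ + 2 ℤ.* X′)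
              (ringℤ 4 (λ X X′ M q → M :* M := (q :- ♯ 9 :+ ♯ 2 :* X′) :* ♯ 3 from
                (♯ 1 · M :* M :- # -[1+ 26 ] :- X :- X ≈ q :* ♯ 3 ∷ ♯ 2 · X ≈ ♯ 3 :* X′ ∷ [])) refl (X ∷ X′ ∷ M ∷ q ∷ []) (h , X≡3X′ , tt)))

      -- Since 3 divides xy, it divides both x and y here. Then (x/3, y/3) has an image on the
      -- rescaled curve, and Y is 27 times the ordinate of that image.
      scaled-difference : + 3 ∣ x ℤ.- y → Y ≡ + 0
      scaled-difference (divides e d≡) = use 3∣t 3∣x×3∣y
        where
        3∣x×3∣y : + 3 ∣ x × + 3 ∣ y
        3∣x×3∣y = cases (factor-3 x y 3∣xy)
          where
          cases : + 3 ∣ x ⊎ + 3 ∣ y → + 3 ∣ x × + 3 ∣ y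
          cases (inj₁ h@(divides a x≡)) = h , divides (a ℤ.- e) (ringℤ 4 (λ x y a e → y := (a :- e) :* ♯ 3 from
            (:- ♯ 1 · x :- y ≈ e :* ♯ 3 ∷ ♯ 1 · x ≈ a :* ♯ 3 ∷ [])) refl (x ∷ y ∷ a ∷ e ∷ []) (d≡ , x≡ , tt))
          cases (inj₂ h@(divides a y≡)) = divides (a ℤ.+ e) (ringℤ 4 (λ x y a e → x := (a :+ e) :* ♯ 3 from
            (♯ 1 · x :- y ≈ e :* ♯ 3 ∷ ♯ 1 · y ≈ a :* ♯ 3 ∷ [])) refl (x ∷ y ∷ a ∷ e ∷ []) (d≡ , y≡ , tt)) , h
        use : + 3 ∣ t → + 3 ∣ x × + 3 ∣ y → Y ≡ + 0
        use (divides τ t≡) (divides a x≡ , divides b y≡) = finish (ScaledE₃.ordinate-zero K k₁ k₁≢0 (scaled-torsion k₁ k₁≢0 k≡) a b τ refl td₁)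
          where
          k₁ = a ℤ.* a ℤ.* a ℤ.+ + 3 ℤ.* a ℤ.* a ℤ.* b ℤ.* b ℤ.+ b ℤ.* b ℤ.* b
          k≡ : k ≡ + 27 ℤ.* k₁
          k≡ = cancelℤ {k} {+ 27 ℤ.* k₁} {+ 256} (λ ()) (ringℤ 5 (λ k u v a b →
            ♯ 256 :* k := ♯ 256 :* (♯ 27 :* (a :* a :* a :+ ♯ 3 :* a :* a :* b :* b :+ b :* b :* b)) from
            (:- ♯ 1 · ♯ 4 :* u :* u :* u :+ u :* u :* v :* v :+ ♯ 4 :* v :* v :* v ≈ ♯ 256 :* k
            ∷ ♯ 4 :* (u :* u :+ u :* (♯ 12 :* a) :+ ♯ 144 :* a :* a) :+ (u :+ ♯ 12 :* a) :* v :* v · u ≈ ♯ 12 :* a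
            ∷ ♯ 4 :* (v :* v :+ v :* (♯ 12 :* b) :+ ♯ 144 :* b :* b) :+ ♯ 144 :* a :* a :* (v :+ ♯ 12 :* b) · v ≈ ♯ 12 :* b ∷ []))
            refl (k ∷ u ∷ v ∷ a ∷ b ∷ []) (quarter , twelve u x a u≡ x≡ , twelve v y b v≡ y≡ , tt))
            where
            twelve : ∀ u x a → u ≡ + 4 ℤ.* x → x ≡ a ℤ.* + 3 → u ≡ + 12 ℤ.* a
            twelve u x a p q = ringℤ 3 (λ u x a → u := ♯ 12 :* a from (♯ 1 · u ≈ ♯ 4 :* x ∷ ♯ 4 · x ≈ a :* ♯ 3 ∷ []))
              refl (u ∷ x ∷ a ∷ []) (p , q , tt)
          k₁≢0 : k₁ ≢ + 0
          k₁≢0 h = k≢0 (trans k≡ (cong (+ 27 ℤ.*_) h))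
          td₁ : τ ℤ.* (a ℤ.- b) ≡ + 4 ℤ.* a ℤ.* b ℤ.+ (a ℤ.+ b)
          td₁ = cancelℤ {τ ℤ.* (a ℤ.- b)} {+ 4 ℤ.* a ℤ.* b ℤ.+ (a ℤ.+ b)} {+ 9} (λ ()) (ringℤ 6 (λ t x y τ a b →
            ♯ 9 :* (τ :* (a :- b)) := ♯ 9 :* (♯ 4 :* a :* b :+ (a :+ b)) from
            (♯ 1 · t :* (x :- y) ≈ ♯ 4 :* x :* y :+ ♯ 3 :* (x :+ y) ∷ :- (♯ 3 :* a :- ♯ 3 :* b) · t ≈ τ :* ♯ 3
            ∷ ♯ 4 :* y :+ ♯ 3 :- t · x ≈ a :* ♯ 3 ∷ ♯ 12 :* a :+ ♯ 3 :+ t · y ≈ b :* ♯ 3 ∷ []))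
            refl (t ∷ x ∷ y ∷ τ ∷ a ∷ b ∷ []) (td , t≡ , x≡ , y≡ , tt))
          finish : τ ℤ.* τ ℤ.* τ ℤ.+ + 3 ℤ.* τ ℤ.+ + 6 ℤ.* τ ℤ.* (a ℤ.+ b) ℤ.+ + 6 ℤ.* (a ℤ.- b) ≡ + 0 → Y ≡ + 0
          finish h = ringℤ 8 (λ t x y τ a b Y Y₁ → Y := ♯ 0 from
            (♯ 1 · Y ≈ t :* t :* t :+ ♯ 27 :* t :+ ♯ 18 :* t :* (x :+ y) :+ ♯ 54 :* (x :- y)
            ∷ t :* t :+ ♯ 3 :* t :* τ :+ ♯ 9 :* τ :* τ :+ ♯ 27 :+ ♯ 18 :* (x :+ y) · t ≈ τ :* ♯ 3
            ∷ ♯ 54 :* τ :+ ♯ 54 · x ≈ a :* ♯ 3 ∷ ♯ 54 :* τ :- ♯ 54 · y ≈ b :* ♯ 3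
            ∷ ♯ 27 · τ :* τ :* τ :+ ♯ 3 :* τ :+ ♯ 6 :* τ :* (a :+ b) :+ ♯ 6 :* (a :- b) ≈ ♯ 0 ∷ []))
            refl (t ∷ x ∷ y ∷ τ ∷ a ∷ b ∷ Y ∷ Y ∷ []) (Y≡′ , t≡ , x≡ , y≡ , h , tt)

      integer-two-torsion : Y ≡ + 0
      integer-two-torsion = cases (mod-3 (x ℤ.- y))
        where
        cases : Residues₃ (x ℤ.- y) → Y ≡ + 0
        cases (multiple₃ h) = scaled-difference h
        cases (prime-to-3 c) = unit-difference c

    two-torsion : Y ≡ + 0
    two-torsion = cases (shape k u v quarter)
      where
      cases : Shape u v → Y ≡ + 0
      cases (integral a b u≡ v≡) = Integers.integer-two-torsion a b u≡ v≡
      cases (mixed h c) = mixed-two-torsion h c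

    coordinates-solved : u ≢ v → ∃[ a ] ∃[ b ] (Exceptional k a b × u ≡ + 4 ℤ.* a × v ≡ + 4 ℤ.* b)
    coordinates-solved u≢v = use 3∣t
      where
      use : + 3 ∣ t → ∃[ a ] ∃[ b ] (Exceptional k a b × u ≡ + 4 ℤ.* a × v ≡ + 4 ℤ.* b)
      use (divides τ t≡) = TwoTorsionE₃.solutions {k} {u} {v} {τ} record
        { k≢0 = k≢0 ; u≢v = u≢v ; quarter = quarter
        ; Δ≡ = cancelℤ {u ℤ.- v} {ℤ.- (τ ℤ.* (+ 2 ℤ.* τ ℤ.* τ ℤ.+ + 6 ℤ.+ (u ℤ.+ v)))} {+ 27} (λ ()) (ringℤ 5 (λ u v t τ Y →
            ♯ 27 :* (u :- v) := ♯ 27 :* (:- (τ :* (♯ 2 :* τ :* τ :+ ♯ 6 :+ (u :+ v)))) from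
            (:- ♯ 1 · ♯ 2 :* Y ≈ ♯ 2 :* t :* t :* t :+ ♯ 54 :* t :+ ♯ 9 :* t :* (u :+ v) :+ ♯ 27 :* (u :- v)
            ∷ ♯ 2 · Y ≈ ♯ 0
            ∷ :- (♯ 2 :* (t :* t :+ ♯ 3 :* t :* τ :+ ♯ 9 :* τ :* τ) :+ ♯ 54 :+ ♯ 9 :* (u :+ v)) · t ≈ τ :* ♯ 3 ∷ []))
            refl (u ∷ v ∷ t ∷ τ ∷ Y ∷ []) (2Y≡ , two-torsion , t≡ , tt))
        ; slope≡ = ringℤ 4 (λ u v t τ → ♯ 3 :* τ :* (u :- v) := u :* v :+ ♯ 3 :* (u :+ v) from
            (♯ 1 · t :* (u :- v) ≈ u :* v :+ ♯ 3 :* (u :+ v) ∷ :- (u :- v) · t ≈ τ :* ♯ 3 ∷ []))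
            refl (u ∷ v ∷ t ∷ τ ∷ []) (slope≡ , t≡ , tt)
        }

  module _ (all-torsion : ∀ P → Torsion P) (scaled-torsion : ScaledTorsion) where

    private
      diagonal-point : ∀ {x y} → OnQuartic x y → x ≡ y → Listed x y
      diagonal-point {x} q refl = use (monic-root (ℤ.- k ∷ + 0 ∷ + 0 ∷ + 2 ∷ [])
        (trans (cong (_+ (x * (ι# (+ 0) + x * (ι# (+ 0) + x * (ι# (+ 2) + x * ι# (+ 1)))))) (ι-neg k))
          (ring 2 (λ k x → :- k :+ x :* (♯ 0 :+ x :* (♯ 0 :+ x :* (♯ 2 :+ x :* ♯ 1))) := ♯ 0 from
            (♯ 1 · x :* x :* x :+ x :* x :* x :* x :+ x :* x :* x ≈ k ∷ [])) refl (ι# k ∷ x ∷ []) (q , tt))))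
        where
        use : Integral x → Listed x x
        use (a , x≡) = diagonal a x≡ x≡

      module Generic {x y i : Carrier} (q : OnQuartic x y) (di : (x - y) * i ≡ ι# (+ 1)) where

        t X Y : Carrier
        t = (ι# (+ 4) * x * y + ι# (+ 3) * (x + y)) * i
        X = t * t + ι# (+ 27) + ι# (+ 12) * (x + y)
        Y = t * t * t + ι# (+ 27) * t + ι# (+ 18) * t * (x + y) + ι# (+ 54) * (x - y)

        td : t * (x - y) ≡ ι# (+ 4) * x * y + ι# (+ 3) * (x + y)
        td = ring 3 (λ a d i → a :* i :* d := a from (a · d :* i ≈ ♯ 1 ∷ [])) refl (ι# (+ 4) * x * y + ι# (+ 3) * (x + y) ∷ x - y ∷ i ∷ []) (di , tt)

        on : OnCurve X Y
        on = trans (ring 4 (λ k x y t → let X = t :* t :+ ♯ 27 :+ ♯ 12 :* (x :+ y)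
                                            Y = t :* t :* t :+ ♯ 27 :* t :+ ♯ 18 :* t :* (x :+ y) :+ ♯ 54 :* (x :- y) in
            Y :* Y := X :* X :* X :+ # -[1+ 26 ] :* X :* X :+ (:- (♯ 1728 :* k)) from
            (♯ 2916 :+ ♯ 108 :* t :* t :+ ♯ 1620 :* x :+ ♯ 1620 :* y :- ♯ 108 :* t :* x :+ ♯ 108 :* t :* y :- ♯ 432 :* x :* y
              · t :* (x :- y) ≈ ♯ 4 :* x :* y :+ ♯ 3 :* (x :+ y)
            ∷ :- ♯ 1728 · x :* x :* x :+ x :* x :* y :* y :+ y :* y :* y ≈ k ∷ [])) refl (ι# k ∷ x ∷ y ∷ t ∷ []) (td , q , tt))
          (cong (_+_ (X * X * X + ι# A₃ * X * X)) (sym (ι-expand 1 (λ k → :- (♯ 1728 :* k)) (k ∷ []))))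

        torsion : Torsion (aff X Y on)
        torsion = all-torsion (aff X Y on)

        module _ (X₀ Y₀ : ℤ) (X≡ : X ≡ ι# X₀) (Y≡ : Y ≡ ι# Y₀) where

          -- With s = x + y and d = x - y the definition of t reads d(t + d) = s(s + 3). Inserting
          -- 12s = X - t² - 27 and 108d = t³ + (27 - 3X)t + 2Y gives a monic sextic in t, of which
          -- these are the coefficients; that of t⁵ is zero.
          c₀ c₁ c₂ c₃ c₄ : ℤ
          c₀ = + 4 ℤ.* Y₀ ℤ.* Y₀ ℤ.- + 81 ℤ.* (X₀ ℤ.- + 27) ℤ.* (X₀ ℤ.+ + 9)
          c₁ = + 2 ℤ.* Y₀ ℤ.* (+ 162 ℤ.- + 6 ℤ.* X₀)
          c₂ = (+ 27 ℤ.- + 3 ℤ.* X₀) ℤ.* (+ 135 ℤ.- + 3 ℤ.* X₀) ℤ.+ + 81 ℤ.* (+ 2 ℤ.* X₀ ℤ.- + 18)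
          c₃ = + 4 ℤ.* Y₀
          c₄ = + 81 ℤ.- + 6 ℤ.* X₀

          t-integral : Integral t
          t-integral = monic-root (c₀ ∷ c₁ ∷ c₂ ∷ c₃ ∷ c₄ ∷ + 0 ∷ []) (ring 10 (λ x y t X Y c₀ c₁ c₂ c₃ c₄ →
              let a = ♯ 27 :- ♯ 3 :* X; b = ♯ 135 :- ♯ 3 :* X; s = x :+ y; d = x :- y
                  X′ = t :* t :+ ♯ 27 :+ ♯ 12 :* s
                  Y′ = t :* t :* t :+ ♯ 27 :* t :+ ♯ 18 :* t :* s :+ ♯ 54 :* d
                  M = t :* t :* t :+ a :* t :+ ♯ 2 :* Y; M′ = t :* t :* t :+ b :* t :+ ♯ 2 :* Y in
              c₀ :+ t :* (c₁ :+ t :* (c₂ :+ t :* (c₃ :+ t :* (c₄ :+ t :* (♯ 0 :+ t :* ♯ 1))))) := ♯ 0 from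
              (♯ 1 · c₀ ≈ ♯ 4 :* Y :* Y :- ♯ 81 :* (X :- ♯ 27) :* (X :+ ♯ 9)
              ∷ t · c₁ ≈ ♯ 2 :* Y :* (♯ 162 :- ♯ 6 :* X)
              ∷ t :* t · c₂ ≈ a :* b :+ ♯ 81 :* (♯ 2 :* X :- ♯ 18)
              ∷ t :* t :* t · c₃ ≈ ♯ 4 :* Y ∷ t :* t :* t :* t · c₄ ≈ ♯ 81 :- ♯ 6 :* X
              ∷ :- (♯ 2 :* M′ :+ ♯ 2 :* (♯ 108 :* d)) · Y′ ≈ Y
              ∷ ♯ 3 :* t :* M′ :+ ♯ 3 :* t :* (♯ 108 :* d) :+ ♯ 81 :* (X :+ ♯ 9 :- t :* t) :+ ♯ 81 :* (♯ 12 :* s) · X′ ≈ X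
              ∷ ♯ 11664 · t :* (x :- y) ≈ ♯ 4 :* x :* y :+ ♯ 3 :* (x :+ y) ∷ []))
              refl (x ∷ y ∷ t ∷ ι# X₀ ∷ ι# Y₀ ∷ ι# c₀ ∷ ι# c₁ ∷ ι# c₂ ∷ ι# c₃ ∷ ι# c₄ ∷ [])
              ( ι-expand 2 (λ X Y → ♯ 4 :* Y :* Y :- ♯ 81 :* (X :- ♯ 27) :* (X :+ ♯ 9)) (X₀ ∷ Y₀ ∷ [])
              , ι-expand 2 (λ X Y → ♯ 2 :* Y :* (♯ 162 :- ♯ 6 :* X)) (X₀ ∷ Y₀ ∷ [])
              , ι-expand 1 (λ X → (♯ 27 :- ♯ 3 :* X) :* (♯ 135 :- ♯ 3 :* X) :+ ♯ 81 :* (♯ 2 :* X :- ♯ 18)) (X₀ ∷ [])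
              , ι-expand 1 (λ Y → ♯ 4 :* Y) (Y₀ ∷ []) , ι-expand 1 (λ X → ♯ 81 :- ♯ 6 :* X) (X₀ ∷ []) , Y≡ , X≡ , td , tt))

          module _ (T : ℤ) (t≡ : t ≡ ι# T) where

            S : ℤ
            S = X₀ ℤ.- T ℤ.* T ℤ.- + 27

            12s : ι# (+ 12) * (x + y) ≡ ι# S
            12s = trans (ring 4 (λ s t X T → ♯ 12 :* s := X :- T :* T :- ♯ 27 from
              (♯ 1 · t :* t :+ ♯ 27 :+ ♯ 12 :* s ≈ X ∷ :- (t :+ T) · t ≈ T ∷ [])) refl (x + y ∷ t ∷ ι# X₀ ∷ ι# T ∷ []) (X≡ , t≡ , tt))
              (sym (ι-expand 2 (λ X T → X :- T :* T :- ♯ 27) (X₀ ∷ T ∷ [])))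

            -- The relation d(t + d) = s(s + 3) times 144 is a monic quadratic equation for 12d,
            -- with integral coefficients once t and 12s are integers.
            12d-integral : Integral (ι# (+ 12) * (x - y))
            12d-integral = monic-root (ℤ.- (S ℤ.* (S ℤ.+ + 36)) ∷ + 12 ℤ.* T ∷ []) (ring 7 (λ x y t T S c₀ c₁ →
              let d = ♯ 12 :* (x :- y) in c₀ :+ d :* (c₁ :+ d :* ♯ 1) := ♯ 0 from
              (♯ 1 · c₀ ≈ :- (S :* (S :+ ♯ 36)) ∷ d · c₁ ≈ ♯ 12 :* T ∷ :- ♯ 12 :* d · t ≈ T
              ∷ ♯ 12 :* (x :+ y) :+ S :+ ♯ 36 · ♯ 12 :* (x :+ y) ≈ S
              ∷ ♯ 144 · t :* (x :- y) ≈ ♯ 4 :* x :* y :+ ♯ 3 :* (x :+ y) ∷ []))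
              refl (x ∷ y ∷ t ∷ ι# T ∷ ι# S ∷ ι# (ℤ.- (S ℤ.* (S ℤ.+ + 36))) ∷ ι# (+ 12 ℤ.* T) ∷ [])
              (ι-expand 1 (λ S → :- (S :* (S :+ ♯ 36))) (S ∷ []) , ι-expand 1 (λ T → ♯ 12 :* T) (T ∷ []) , t≡ , 12s , td , tt))

            module _ (D : ℤ) (12d : ι# (+ 12) * (x - y) ≡ ι# D) where

              24x : ι# (+ 24) * x ≡ ι# (S ℤ.+ D)
              24x = trans (ring 4 (λ x y S D → ♯ 24 :* x := S :+ D from (♯ 1 · ♯ 12 :* (x :+ y) ≈ S ∷ ♯ 1 · ♯ 12 :* (x :- y) ≈ D ∷ []))
                refl (x ∷ y ∷ ι# S ∷ ι# D ∷ []) (12s , 12d , tt)) (sym (ι-+ S D))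

              24y : ι# (+ 24) * y ≡ ι# (S ℤ.- D)
              24y = trans (ring 4 (λ x y S D → ♯ 24 :* y := S :- D from (♯ 1 · ♯ 12 :* (x :+ y) ≈ S ∷ :- ♯ 1 · ♯ 12 :* (x :- y) ≈ D ∷ []))
                refl (x ∷ y ∷ ι# S ∷ ι# D ∷ []) (12s , 12d , tt)) (sym (ι-expand 2 (λ S D → S :- D) (S ∷ D ∷ [])))

              sixths-of-24 : Sixths (S ℤ.+ D) (S ℤ.- D)
              sixths-of-24 = sixths-from k (S ℤ.+ D) (S ℤ.- D) S
                (pull 3 (λ k a b → ♯ 24 :* a :* a :* a :+ a :* a :* b :* b :+ ♯ 24 :* b :* b :* b , ♯ 331776 :* k) (k ∷ S ℤ.+ D ∷ S ℤ.- D ∷ [])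
                  (ring 5 (λ k x y a b → ♯ 24 :* a :* a :* a :+ a :* a :* b :* b :+ ♯ 24 :* b :* b :* b := ♯ 331776 :* k from
                    (♯ 331776 · x :* x :* x :+ x :* x :* y :* y :+ y :* y :* y ≈ k
                    ∷ :- ♯ 24 :* (a :* a :+ a :* (♯ 24 :* x) :+ ♯ 576 :* x :* x) :- (a :+ ♯ 24 :* x) :* b :* b · ♯ 24 :* x ≈ a
                    ∷ :- ♯ 24 :* (b :* b :+ b :* (♯ 24 :* y) :+ ♯ 576 :* y :* y) :- ♯ 576 :* x :* x :* (b :+ ♯ 24 :* y) · ♯ 24 :* y ≈ b ∷ []))
                    refl (ι# k ∷ x ∷ y ∷ ι# (S ℤ.+ D) ∷ ι# (S ℤ.- D) ∷ []) (q , 24x , 24y , tt)))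
                (ringℤ 2 (λ S D → (S :+ D) :+ (S :- D) := S :* ♯ 2 from []) refl (S ∷ D ∷ []) tt)

              sixth : ∀ z a u → ι# (+ 24) * z ≡ ι# a → a ≡ + 6 ℤ.* u → ι# (+ 4) * z ≡ ι# u
              sixth z a u h a≡ = cancelˡ (ι-nonzero {+ 6} (λ ())) (ring 3 (λ z a u → ♯ 6 :* (♯ 4 :* z) := ♯ 6 :* u from
                (♯ 1 · ♯ 24 :* z ≈ a ∷ ♯ 1 · a ≈ ♯ 6 :* u ∷ [])) refl (z ∷ ι# a ∷ ι# u ∷ []) (h , trans (cong ι# a≡) (ι-* (+ 6) u) , tt))

              module _ (u v : ℤ) (4x : ι# (+ 4) * x ≡ ι# u) (4y : ι# (+ 4) * y ≡ ι# v) where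

                coordinates : Coordinates u v T X₀ Y₀
                coordinates = record
                  { quarter = pull 3 (λ k u v → ♯ 4 :* u :* u :* u :+ u :* u :* v :* v :+ ♯ 4 :* v :* v :* v , ♯ 256 :* k) (k ∷ u ∷ v ∷ [])
                      (ring 5 (λ k x y u v → ♯ 4 :* u :* u :* u :+ u :* u :* v :* v :+ ♯ 4 :* v :* v :* v := ♯ 256 :* k from
                        (♯ 256 · x :* x :* x :+ x :* x :* y :* y :+ y :* y :* y ≈ k
                        ∷ :- ♯ 4 :* (u :* u :+ u :* (♯ 4 :* x) :+ ♯ 16 :* x :* x) :- (u :+ ♯ 4 :* x) :* v :* v · ♯ 4 :* x ≈ u
                        ∷ :- ♯ 4 :* (v :* v :+ v :* (♯ 4 :* y) :+ ♯ 16 :* y :* y) :- ♯ 16 :* x :* x :* (v :+ ♯ 4 :* y) · ♯ 4 :* y ≈ v ∷ []))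
                        refl (ι# k ∷ x ∷ y ∷ ι# u ∷ ι# v ∷ []) (q , 4x , 4y , tt))
                  ; slope≡ = pull 3 (λ u v t → t :* (u :- v) , u :* v :+ ♯ 3 :* (u :+ v)) (u ∷ v ∷ T ∷ [])
                      (ring 6 (λ x y t T u v → T :* (u :- v) := u :* v :+ ♯ 3 :* (u :+ v) from
                        (♯ 4 · t :* (x :- y) ≈ ♯ 4 :* x :* y :+ ♯ 3 :* (x :+ y) ∷ :- ♯ 4 :* (x :- y) · t ≈ T
                        ∷ :- T :+ v :+ ♯ 3 · ♯ 4 :* x ≈ u ∷ T :+ ♯ 4 :* x :+ ♯ 3 · ♯ 4 :* y ≈ v ∷ []))
                        refl (x ∷ y ∷ t ∷ ι# T ∷ ι# u ∷ ι# v ∷ []) (td , t≡ , 4x , 4y , tt))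
                  ; X≡ = pull 4 (λ u v t X → X , t :* t :+ ♯ 27 :+ ♯ 3 :* (u :+ v)) (u ∷ v ∷ T ∷ X₀ ∷ [])
                      (ring 7 (λ x y t T u v X → X := T :* T :+ ♯ 27 :+ ♯ 3 :* (u :+ v) from
                        (:- ♯ 1 · t :* t :+ ♯ 27 :+ ♯ 12 :* (x :+ y) ≈ X ∷ t :+ T · t ≈ T ∷ ♯ 3 · ♯ 4 :* x ≈ u ∷ ♯ 3 · ♯ 4 :* y ≈ v ∷ []))
                        refl (x ∷ y ∷ t ∷ ι# T ∷ ι# u ∷ ι# v ∷ ι# X₀ ∷ []) (X≡ , t≡ , 4x , 4y , tt))
                  ; 2Y≡ = pull 4 (λ u v t Y → ♯ 2 :* Y , ♯ 2 :* t :* t :* t :+ ♯ 54 :* t :+ ♯ 9 :* t :* (u :+ v) :+ ♯ 27 :* (u :- v)) (u ∷ v ∷ T ∷ Y₀ ∷ [])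
                      (ring 7 (λ x y t T u v Y → ♯ 2 :* Y := ♯ 2 :* T :* T :* T :+ ♯ 54 :* T :+ ♯ 9 :* T :* (u :+ v) :+ ♯ 27 :* (u :- v) from
                        (:- ♯ 2 · t :* t :* t :+ ♯ 27 :* t :+ ♯ 18 :* t :* (x :+ y) :+ ♯ 54 :* (x :- y) ≈ Y
                        ∷ ♯ 2 :* (t :* t :+ t :* T :+ T :* T) :+ ♯ 54 :+ ♯ 36 :* (x :+ y) · t ≈ T
                        ∷ ♯ 9 :* T :+ ♯ 27 · ♯ 4 :* x ≈ u ∷ ♯ 9 :* T :- ♯ 27 · ♯ 4 :* y ≈ v ∷ []))
                        refl (x ∷ y ∷ t ∷ ι# T ∷ ι# u ∷ ι# v ∷ ι# Y₀ ∷ []) (Y≡ , t≡ , 4x , 4y , tt))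
                  }

                u≢v : u ≢ v
                u≢v u≡v = ι-nonzero {+ 4} (λ ()) (ring 5 (λ x y i u v → ♯ 4 := ♯ 0 from
                  (:- ♯ 4 · (x :- y) :* i ≈ ♯ 1 ∷ i · ♯ 4 :* x ≈ u ∷ :- i · ♯ 4 :* y ≈ v ∷ i · u ≈ v ∷ []))
                  refl (x ∷ y ∷ i ∷ ι# u ∷ ι# v ∷ []) (di , 4x , 4y , cong ι# u≡v , tt))

                quarter-value : ∀ z u a → ι# (+ 4) * z ≡ ι# u → u ≡ + 4 ℤ.* a → z ≡ ι# a
                quarter-value z u a h u≡ = cancelˡ (ι-nonzero {+ 4} (λ ())) (trans h (trans (cong ι# u≡) (ι-* (+ 4) a)))

                listed : Listed x y
                listed = use (coordinates-solved scaled-torsion (torsion-point {X} {Y} {on} X₀ Y₀ X≡ Y≡ torsion) coordinates u≢v)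
                  where
                  use : ∃[ a ] ∃[ b ] (Exceptional k a b × u ≡ + 4 ℤ.* a × v ≡ + 4 ℤ.* b) → Listed x y
                  use (a , b , e , u≡ , v≡) = exceptional a b e (quarter-value x u a 4x u≡) (quarter-value y v b 4y v≡)

              listed-D : Listed x y
              listed-D = use sixths-of-24
                where
                use : Sixths (S ℤ.+ D) (S ℤ.- D) → Listed x y
                use (sixths u v u≡ v≡) = listed u v (sixth x (S ℤ.+ D) u 24x u≡) (sixth y (S ℤ.- D) v 24y v≡)

            listed-T : Listed x y
            listed-T = use 12d-integral
              where
              use : Integral (ι# (+ 12) * (x - y)) → Listed x y
              use (D , h) = listed-D D h

          listed-XY : Listed x y
          listed-XY = use t-integral
            where
            use : Integral t → Listed x y
            use (T , h) = listed-T T h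

        generic-point : Listed x y
        generic-point = use (torsion-integral torsion)
          where
          use : Integral X × Integral Y → Listed x y
          use ((X₀ , X≡) , (Y₀ , Y≡)) = listed-XY X₀ Y₀ X≡ Y≡

    E₃-points : ∀ {x y} → OnQuartic x y → Listed x y
    E₃-points {x} {y} q = cases (x ≟ y)
      where
      cases : Dec (x ≡ y) → Listed x y
      cases (yes x≡y) = diagonal-point q x≡y
      cases (no x≢y) = use (inverse (x - y) (λ h → difference-nonzero x≢y (ring 2 (λ x y → y :- x := ♯ 0 from (:- ♯ 1 · x :- y ≈ ♯ 0 ∷ [])) refl (x ∷ y ∷ []) (h , tt))))
        where
        use : ∃[ i ] (x - y) * i ≡ ι# (+ 1) → Listed x y
        use (_ , di) = Generic.generic-point q di

-- Infinite descent for m² = 768 c⁴ + 1.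

module Descent where
  open import Data.Integer using (_+_; _*_; -_; _-_)

  no-square-minus-one : ∀ x → ¬ + 3 ∣ x * x + + 1
  no-square-minus-one x (divides q h) = cases (mod-3 x)
    where
    cases : Residues₃ x → ⊥
    cases (multiple₃ (divides r e)) = 3∤1 (divides (q - x * r) (ringℤ 3 (λ x q r → ♯ 1 := (q :- x :* r) :* ♯ 3 from
      (♯ 1 · x :* x :+ ♯ 1 ≈ q :* ♯ 3 ∷ :- x · x ≈ r :* ♯ 3 ∷ [])) refl (x ∷ q ∷ r ∷ []) (h , e , tt)))
    cases (prime-to-3 c) = use (divides-cancelˡ {+ 3} {x} {(x + + 1) * (x - + 1)} c (3∣cube-difference x))
      where
      use : + 3 ∣ (x + + 1) * (x - + 1) → ⊥
      use (divides r e) = 3∤1 (divides (+ 1 - q + r) (ringℤ 3 (λ x q r → ♯ 1 := (♯ 1 :- q :+ r) :* ♯ 3 from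
        (:- ♯ 1 · x :* x :+ ♯ 1 ≈ q :* ♯ 3 ∷ ♯ 1 · (x :+ ♯ 1) :* (x :- ♯ 1) ≈ r :* ♯ 3 ∷ []))
        refl (x ∷ q ∷ r ∷ []) (h , e , tt)))

  unit-sign : ∀ e → e * e ≡ + 1 → e ≡ + 1 ⊎ e ≡ -[1+ 0 ]
  unit-sign e h = cases (e ℤ.≟ + 1)
    where
    cases : Dec (e ≡ + 1) → e ≡ + 1 ⊎ e ≡ -[1+ 0 ]
    cases (yes p) = inj₁ p
    cases (no p) = inj₂ (ringℤ 1 (λ e → e := # -[1+ 0 ] from (♯ 1 · e :+ ♯ 1 ≈ ♯ 0 ∷ [])) refl (e ∷ [])
      (zero-productℤ {e - + 1} {e + + 1} (λ q → p (ℤₚ.i-j≡0⇒i≡j e (+ 1) q))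
        (ringℤ 1 (λ e → (e :- ♯ 1) :* (e :+ ♯ 1) := ♯ 0 from (♯ 1 · e :* e ≈ ♯ 1 ∷ [])) refl (e ∷ []) (h , tt)) , tt))

  divides-one-square : ∀ e → e ∣ + 1 → e * e ≡ + 1
  divides-one-square e h = use e (divisor-bound {e} {+ 1} (λ ()) h) h
    where
    use : ∀ e → ℤ.∣ e ∣ ℕ.≤ 1 → e ∣ + 1 → e * e ≡ + 1
    use (+ 0) _ (divides q h) = ⊥-elim (1≢0 (trans h (ℤₚ.*-zeroʳ q)))
      where
      1≢0 : + 1 ≢ + 0
      1≢0 ()
    use (+ 1) _ _ = refl
    use -[1+ 0 ] _ _ = refl
    use (+ suc (suc _)) (ℕ.s≤s ()) _
    use -[1+ suc _ ] (ℕ.s≤s ()) _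

  record SquareFactors (u v w : ℤ) : Set where
    constructor squareFactors
    field
      e α β : ℤ
      ee : e * e ≡ + 1
      u≡ : u ≡ e * (α * α)
      v≡ : v ≡ e * (β * β)
      w≡ : w ≡ e * (α * β)

  comaximal-common : ∀ a b c → a ∣ b → a ∣ c → Comaximal b c → a ∣ + 1
  comaximal-common a b c (divides p p≡) (divides q q≡) (bezout u v h) = divides (u * p + v * q) (ringℤ 7 (λ a b c p q u v →
    ♯ 1 := (u :* p :+ v :* q) :* a from (:- ♯ 1 · u :* b :+ v :* c ≈ ♯ 1 ∷ u · b ≈ p :* a ∷ v · c ≈ q :* a ∷ []))
    refl (a ∷ b ∷ c ∷ p ∷ q ∷ u ∷ v ∷ []) (h , p≡ , q≡ , tt))

  -- Writing w/u = w′/u′ in lowest terms with u = gu′ gives u′v = gw′², so u′ divides g. The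
  -- quotient e divides both u and v and is therefore a sign.
  square-factors : ∀ u v w → Comaximal u v → u * v ≡ w * w → SquareFactors u v w
  square-factors u v w c h = cases (u ℤ.≟ + 0)
    where
    zero-case : u ≡ + 0 → Comaximal u v → w ≡ + 0 → SquareFactors u v w
    zero-case u≡0 (bezout p q e) w≡0 = squareFactors v (+ 0) (+ 1) vv (trans u≡0 (sym (ℤₚ.*-zeroʳ v))) (sym (ℤₚ.*-identityʳ v)) (trans w≡0 (sym (ℤₚ.*-zeroʳ v)))
      where
      vv : v * v ≡ + 1
      vv = divides-one-square v (divides q (ringℤ 4 (λ u v p q → ♯ 1 := q :* v from (:- ♯ 1 · p :* u :+ q :* v ≈ ♯ 1 ∷ p · u ≈ ♯ 0 ∷ []))
        refl (u ∷ v ∷ p ∷ q ∷ []) (e , u≡0 , tt)))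
    square-zero : ∀ w → w * w ≡ + 0 → w ≡ + 0
    square-zero w h = by (w ℤ.≟ + 0)
      where
      by : Dec (w ≡ + 0) → w ≡ + 0
      by (yes e) = e
      by (no n) = zero-productℤ {w} {w} n h
    cases : Dec (u ≡ + 0) → SquareFactors u v w
    cases (yes u≡0) = zero-case u≡0 c (square-zero w (trans (sym h) (trans (cong (_* v) u≡0) (ℤₚ.*-zeroˡ v))))
    cases (no u≢0) = use (reduce w u u≢0)
      where
      use : Reduced w u → SquareFactors u v w
      use (reduced g w′ u′ w≡ u≡ c′) = conclude (divides-cancelˡ {u′} {w′ * w′} {g} (comaximal-*ʳ {u′} {w′} {w′} c′ c′)
          (divides v (trans (ℤₚ.*-comm (w′ * w′) g) (trans (sym u′v) (ℤₚ.*-comm u′ v)))))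
        where
        g≢0 : g ≢ + 0
        g≢0 e = u≢0 (trans u≡ (trans (cong (_* u′) e) (ℤₚ.*-zeroˡ u′)))
        u′≢0 : u′ ≢ + 0
        u′≢0 e = u≢0 (trans u≡ (trans (cong (g *_) e) (ℤₚ.*-zeroʳ g)))
        u′v : u′ * v ≡ g * (w′ * w′)
        u′v = cancelℤ {u′ * v} {g * (w′ * w′)} {g} g≢0 (ringℤ 6 (λ u v w g w′ u′ → g :* (u′ :* v) := g :* (g :* (w′ :* w′)) from
          (♯ 1 · u :* v ≈ w :* w ∷ :- v · u ≈ g :* u′ ∷ w :+ g :* w′ · w ≈ g :* w′ ∷ [])) refl (u ∷ v ∷ w ∷ g ∷ w′ ∷ u′ ∷ []) (h , u≡ , w≡ , tt))
        conclude : u′ ∣ g → SquareFactors u v w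
        conclude (divides e g≡) = squareFactors e u′ w′
          (divides-one-square e (comaximal-common e u v (divides (u′ * u′) u≡e′) (divides (w′ * w′) (trans v≡e (ℤₚ.*-comm e (w′ * w′)))) c))
          (trans u≡e′ (ℤₚ.*-comm (u′ * u′) e)) v≡e
          (ringℤ 5 (λ w g w′ u′ e → w := e :* (u′ :* w′) from (♯ 1 · w ≈ g :* w′ ∷ w′ · g ≈ e :* u′ ∷ [])) refl (w ∷ g ∷ w′ ∷ u′ ∷ e ∷ []) (w≡ , g≡ , tt))
          where
          u≡e′ : u ≡ u′ * u′ * e
          u≡e′ = ringℤ 4 (λ u g u′ e → u := u′ :* u′ :* e from (♯ 1 · u ≈ g :* u′ ∷ u′ · g ≈ e :* u′ ∷ [])) refl (u ∷ g ∷ u′ ∷ e ∷ []) (u≡ , g≡ , tt)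
          v≡e : v ≡ e * (w′ * w′)
          v≡e = cancelℤ {v} {e * (w′ * w′)} {u′} u′≢0 (ringℤ 5 (λ v g w′ u′ e → u′ :* v := u′ :* (e :* (w′ :* w′)) from
            (♯ 1 · u′ :* v ≈ g :* (w′ :* w′) ∷ w′ :* w′ · g ≈ e :* u′ ∷ [])) refl (v ∷ g ∷ w′ ∷ u′ ∷ e ∷ []) (u′v , g≡ , tt))

  infix 9 _⁴
  _⁴ : ℤ → ℤ
  x ⁴ = x * x * (x * x)

  private
    pow4 : ∀ {n} → Expr n → Expr n
    pow4 x = x :* x :* (x :* x)

  record FourthFactors (u v z : ℤ) : Set where
    constructor fourthFactors
    field
      e f γ δ : ℤ
      ee : e * e ≡ + 1
      u≡ : u ≡ e * γ ⁴
      v≡ : v ≡ e * δ ⁴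
      z≡ : z ≡ f * (γ * δ)

  fourth-factors : ∀ u v z → Comaximal u v → u * v ≡ z ⁴ → FourthFactors u v z
  fourth-factors u v z c h = first (square-factors u v (z * z) c h)
    where
    first : SquareFactors u v (z * z) → FourthFactors u v z
    first (squareFactors e α β ee u≡ v≡ zz≡) = second (square-factors (e * α) β z
        (comaximal-divisor {e * α} {v} {β} (divides (e * β) (trans v≡ (sym (ℤₚ.*-assoc e β β))))
          (comaximal-sym (comaximal-divisor {v} {u} {e * α} (divides α (trans u≡ (ringℤ 2 (λ e α → e :* (α :* α) := α :* (e :* α) from []) refl (e ∷ α ∷ []) tt))) (comaximal-sym c))))
        (trans (ℤₚ.*-assoc e α β) (sym zz≡)))
      where
      second : SquareFactors (e * α) β z → FourthFactors u v z
      second (squareFactors f γ δ ff eα≡ β≡ z≡) = fourthFactors e f γ δ ee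
        (ringℤ 5 (λ u e α f γ → u := e :* pow4 γ from (♯ 1 · u ≈ e :* (α :* α) ∷ :- e :* (α :* α) · e :* e ≈ ♯ 1
          ∷ e :* (e :* α :+ f :* (γ :* γ)) · e :* α ≈ f :* (γ :* γ) ∷ e :* pow4 γ · f :* f ≈ ♯ 1 ∷ [])) refl (u ∷ e ∷ α ∷ f ∷ γ ∷ []) (u≡ , ee , eα≡ , ff , tt))
        (ringℤ 5 (λ v e β f δ → v := e :* pow4 δ from (♯ 1 · v ≈ e :* (β :* β) ∷ e :* (β :+ f :* (δ :* δ)) · β ≈ f :* (δ :* δ)
          ∷ e :* pow4 δ · f :* f ≈ ♯ 1 ∷ [])) refl (v ∷ e ∷ β ∷ f ∷ δ ∷ []) (v≡ , β≡ , ff , tt))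
        z≡

  consecutive-even : ∀ q → ∃[ w ] q * (q + + 1) ≡ + 2 * w
  consecutive-even q = by (q IntDM.%ℕ 2) (q IntDM./ℕ 2) (IntDM.a≡a%ℕn+[a/ℕn]*n q 2) (IntDM.n%ℕd<d q 2)
    where
    by : ∀ r p → q ≡ + r + p * + 2 → r ℕ.< 2 → ∃[ w ] q * (q + + 1) ≡ + 2 * w
    by 0 p h _ = p * (q + + 1) , ringℤ 2 (λ q p → q :* (q :+ ♯ 1) := ♯ 2 :* (p :* (q :+ ♯ 1)) from (q :+ ♯ 1 · q ≈ ♯ 0 :+ p :* ♯ 2 ∷ [])) refl (q ∷ p ∷ []) (h , tt)
    by 1 p h _ = (p + + 1) * q , ringℤ 2 (λ q p → q :* (q :+ ♯ 1) := ♯ 2 :* ((p :+ ♯ 1) :* q) from (q · q ≈ ♯ 1 :+ p :* ♯ 2 ∷ [])) refl (q ∷ p ∷ []) (h , tt)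
    by (suc (suc _)) p h (ℕ.s≤s (ℕ.s≤s ()))

  record HalfStep (E z : ℤ) : Set where
    constructor halfStep
    field
      u v f : ℤ
      equation : u ⁴ ≡ + 1 + E * v ⁴
      z≡ : z ≡ f * (v * u)
      4∣ : + 4 ∣ E * v ⁴

  -- (A² - 1) / 2 and (A² + 1) / 2 are coprime with product E z⁴, and E has to divide the first.
  half-step : ∀ E A z → E ≢ + 0 → + 3 ∣ E → (∀ n → Comaximal (+ 2) n → Comaximal (+ 3) n → Comaximal E n) →
    A ⁴ ≡ + 1 + + 4 * (E * z ⁴) → HalfStep E z
  half-step E A z E≢0 (divides E′ E≡) E⊥ h = with-odd (odd-form A A-odd)
    where
    A-odd : Comaximal (+ 2) A
    A-odd = 2∤⇒ A λ (divides r A≡) → 2∤1 (divides (r * (A * (A * A)) - + 2 * (E * z ⁴)) (ringℤ 3 (λ A r Ez → ♯ 1 := (r :* (A :* (A :* A)) :- ♯ 2 :* Ez) :* ♯ 2 from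
      (:- ♯ 1 · pow4 A ≈ ♯ 1 :+ ♯ 4 :* Ez ∷ A :* (A :* A) · A ≈ r :* ♯ 2 ∷ [])) refl (A ∷ r ∷ E * z ⁴ ∷ []) (h , A≡ , tt)))
    with-odd : ∃[ q ] A ≡ + 1 + q * + 2 → HalfStep E z
    with-odd (q , A≡) = with-even (consecutive-even q)
      where
      with-even : ∃[ w ] q * (q + + 1) ≡ + 2 * w → HalfStep E z
      with-even (w , qq≡) = factor (divides-cancelˡ {E} {g + + 1} {g} (E⊥ (g + + 1) g+1-odd g+1⊥3)
          (divides (z ⁴) (trans (ℤₚ.*-comm (g + + 1) g) (trans gg (ℤₚ.*-comm E (z ⁴))))))
        where
        g = + 4 * w
        AA : A * A ≡ + 2 * g + + 1
        AA = ringℤ 3 (λ A q w → A :* A := ♯ 2 :* (♯ 4 :* w) :+ ♯ 1 from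
          (A :+ ♯ 1 :+ q :* ♯ 2 · A ≈ ♯ 1 :+ q :* ♯ 2 ∷ ♯ 4 · q :* (q :+ ♯ 1) ≈ ♯ 2 :* w ∷ [])) refl (A ∷ q ∷ w ∷ []) (A≡ , qq≡ , tt)
        gg : g * (g + + 1) ≡ E * z ⁴
        gg = cancelℤ {g * (g + + 1)} {E * z ⁴} {+ 4} (λ ()) (ringℤ 3 (λ A g Ez → ♯ 4 :* (g :* (g :+ ♯ 1)) := ♯ 4 :* Ez from
          (♯ 1 · pow4 A ≈ ♯ 1 :+ ♯ 4 :* Ez ∷ :- (A :* A :+ ♯ 2 :* g :+ ♯ 1) · A :* A ≈ ♯ 2 :* g :+ ♯ 1 ∷ [])) refl (A ∷ g ∷ E * z ⁴ ∷ []) (h , AA , tt))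
        g+1-odd : Comaximal (+ 2) (g + + 1)
        g+1-odd = bezout (- (+ 2 * w)) (+ 1) (ringℤ 1 (λ w → (:- (♯ 2 :* w)) :* ♯ 2 :+ ♯ 1 :* (♯ 4 :* w :+ ♯ 1) := ♯ 1 from []) refl (w ∷ []) tt)
        g+1⊥3 : Comaximal (+ 3) (g + + 1)
        g+1⊥3 = by (mod-3 (g + + 1))
          where
          by : Residues₃ (g + + 1) → Comaximal (+ 3) (g + + 1)
          by (prime-to-3 c) = c
          by (multiple₃ (divides r e)) = ⊥-elim (no-square-minus-one A (divides (+ 2 * r) (ringℤ 3 (λ A g r → A :* A :+ ♯ 1 := ♯ 2 :* r :* ♯ 3 from
            (♯ 1 · A :* A ≈ ♯ 2 :* g :+ ♯ 1 ∷ ♯ 2 · g :+ ♯ 1 ≈ r :* ♯ 3 ∷ [])) refl (A ∷ g ∷ r ∷ []) (AA , e , tt))))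
        factor : E ∣ g → HalfStep E z
        factor (divides g′ g≡) = finish (fourth-factors g′ (g + + 1) z
            (bezout (- E) (+ 1) (ringℤ 3 (λ E g g′ → (:- E) :* g′ :+ ♯ 1 :* (g :+ ♯ 1) := ♯ 1 from (♯ 1 · g ≈ g′ :* E ∷ [])) refl (E ∷ g ∷ g′ ∷ []) (g≡ , tt)))
            (cancelℤ {g′ * (g + + 1)} {z ⁴} {E} E≢0 (ringℤ 4 (λ E g g′ Z → E :* (g′ :* (g :+ ♯ 1)) := E :* Z from
              (♯ 1 · g :* (g :+ ♯ 1) ≈ E :* Z ∷ :- (g :+ ♯ 1) · g ≈ g′ :* E ∷ [])) refl (E ∷ g ∷ g′ ∷ z ⁴ ∷ []) (gg , g≡ , tt))))
          where
          finish : FourthFactors g′ (g + + 1) z → HalfStep E z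
          finish (fourthFactors e f γ δ ee g′≡ g+1≡ z≡) = signs (unit-sign e ee)
            where
            signs : e ≡ + 1 ⊎ e ≡ -[1+ 0 ] → HalfStep E z
            signs (inj₁ e≡) = halfStep δ γ f
              (ringℤ 6 (λ E e g g′ Γ Δ → Δ := ♯ 1 :+ E :* Γ from
                (:- ♯ 1 · g :+ ♯ 1 ≈ e :* Δ ∷ ♯ 1 · g ≈ g′ :* E ∷ E · g′ ≈ e :* Γ ∷ E :* Γ :- Δ · e ≈ ♯ 1 ∷ []))
                refl (E ∷ e ∷ g ∷ g′ ∷ γ ⁴ ∷ δ ⁴ ∷ []) (g+1≡ , g≡ , g′≡ , e≡ , tt)) z≡
              (divides w (ringℤ 5 (λ E e w g′ Γ → E :* Γ := w :* ♯ 4 from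
                (:- ♯ 1 · ♯ 4 :* w ≈ g′ :* E ∷ :- E · g′ ≈ e :* Γ ∷ :- E :* Γ · e ≈ ♯ 1 ∷ [])) refl (E ∷ e ∷ w ∷ g′ ∷ γ ⁴ ∷ []) (g≡ , g′≡ , e≡ , tt)))
            signs (inj₂ e≡) = ⊥-elim (no-square-minus-one (δ * δ) (divides (E′ * γ ⁴) (ringℤ 7 (λ E e g g′ Γ Δ E′ → Δ :+ ♯ 1 := E′ :* Γ :* ♯ 3 from
                (♯ 1 · g :+ ♯ 1 ≈ e :* Δ ∷ :- ♯ 1 · g ≈ g′ :* E ∷ :- E · g′ ≈ e :* Γ ∷ Δ :- E :* Γ · e ≈ # -[1+ 0 ] ∷ Γ · E ≈ E′ :* ♯ 3 ∷ []))
                refl (E ∷ e ∷ g ∷ g′ ∷ γ ⁴ ∷ δ ⁴ ∷ E′ ∷ []) (g+1≡ , g≡ , g′≡ , e≡ , E≡ , tt))))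

  record Smaller (B : ℤ) : Set where
    constructor smaller
    field
      u v c : ℤ
      equation : u ⁴ ≡ + 1 + + 12 * v ⁴
      B≡ : B ≡ c * (v * + 2)

  -- Two half steps. The first, with E = 3, yields c⁴ = 1 + 3d⁴ with d even; writing d = 2d′ turns
  -- this into c⁴ = 1 + 48d′⁴, and the second, with E = 12, returns to the original equation. The
  -- factor 2 in d makes the new solution strictly smaller.
  smaller-solution : ∀ A B → A ⁴ ≡ + 1 + + 12 * B ⁴ → Smaller B
  smaller-solution A B h = second (half-step (+ 3) A B (λ ()) (divides (+ 1) refl) (λ n _ c → c)
      (trans h (ringℤ 1 (λ Z → ♯ 1 :+ ♯ 12 :* Z := ♯ 1 :+ ♯ 4 :* (♯ 3 :* Z) from []) refl (B ⁴ ∷ []) tt)))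
    where
    second : HalfStep (+ 3) B → Smaller B
    second (halfStep c d f c⁴≡ B≡ (divides r 4∣)) = third (even-square (either (even-factor (d * d) (d * d) 2∣d⁴)))
      where
      even-square : + 2 ∣ d * d → + 2 ∣ d
      even-square e = either (even-factor d d e)
      2∣d⁴ : + 2 ∣ d ⁴
      2∣d⁴ = divides-cancelˡ {+ 2} {+ 3} {d ⁴} (bezout -[1+ 0 ] (+ 1) refl) (divides (r * + 2) (trans 4∣ (sym (ℤₚ.*-assoc r (+ 2) (+ 2)))))
      third : + 2 ∣ d → Smaller B
      third (divides d′ d≡) = last (half-step (+ 12) c d′ (λ ()) (divides (+ 4) refl)
          (λ n c₂ c₃ → comaximal-*ˡ {+ 4} {+ 3} {n} (comaximal-*ˡ {+ 2} {+ 2} {n} c₂ c₂) c₃)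
          (ringℤ 3 (λ c d d′ → pow4 c := ♯ 1 :+ ♯ 4 :* (♯ 12 :* pow4 d′) from
            (♯ 1 · pow4 c ≈ ♯ 1 :+ ♯ 3 :* pow4 d ∷ ♯ 3 :* (d :* d :* d :+ d :* d :* (d′ :* ♯ 2) :+ d :* (d′ :* ♯ 2) :* (d′ :* ♯ 2) :+ (d′ :* ♯ 2) :* (d′ :* ♯ 2) :* (d′ :* ♯ 2)) · d ≈ d′ :* ♯ 2 ∷ []))
            refl (c ∷ d ∷ d′ ∷ []) (c⁴≡ , d≡ , tt)))
        where
        last : HalfStep (+ 12) d′ → Smaller B
        last (halfStep u v f′ u⁴≡ d′≡ _) = smaller u v (f * f′ * u * c) u⁴≡ (ringℤ 8 (λ B c d d′ f f′ u v → B := f :* f′ :* u :* c :* (v :* ♯ 2) from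
          (♯ 1 · B ≈ f :* (d :* c) ∷ f :* c · d ≈ d′ :* ♯ 2 ∷ f :* c :* ♯ 2 · d′ ≈ f′ :* (v :* u) ∷ []))
          refl (B ∷ c ∷ d ∷ d′ ∷ f ∷ f′ ∷ u ∷ v ∷ []) (B≡ , d≡ , d′≡ , tt))

  quartic-descent : ∀ n A B → ℤ.∣ B ∣ ≡ n → A ⁴ ≡ + 1 + + 12 * B ⁴ → B ≡ + 0
  quartic-descent = <-rec _ step
    where
    Claim : ℕ → Set
    Claim n = ∀ A B → ℤ.∣ B ∣ ≡ n → A ⁴ ≡ + 1 + + 12 * B ⁴ → B ≡ + 0
    step : ∀ n → (∀ {m} → m ℕ.< n → Claim m) → Claim n
    step n ih A B B≡n h = cases (B ℤ.≟ + 0)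
      where
      cases : Dec (B ≡ + 0) → B ≡ + 0
      cases (yes e) = e
      cases (no B≢0) = use (smaller-solution A B h)
        where
        use : Smaller B → B ≡ + 0
        use (smaller u v c u⁴≡ B≡) = v-zero (v ℤ.≟ + 0)
          where
          collapse : v ≡ + 0 → B ≡ + 0
          collapse e = trans B≡ (trans (cong (λ v → c * (v * + 2)) e) (ℤₚ.*-zeroʳ c))
          v-zero : Dec (v ≡ + 0) → B ≡ + 0
          v-zero (yes e) = collapse e
          v-zero (no v≢0) = collapse (ih v<B u v refl u⁴≡)
            where
            2v≤B : ℤ.∣ v * + 2 ∣ ℕ.≤ ℤ.∣ B ∣
            2v≤B = divisor-bound {v * + 2} {B} B≢0 (divides c B≡)
            v<B : ℤ.∣ v ∣ ℕ.< n
            v<B = subst (ℤ.∣ v ∣ ℕ.<_) B≡n (ℕₚ.<-≤-trans (ℕₚ.m<m*n ℤ.∣ v ∣ 2 {{ℕ.≢-nonZero (λ e → v≢0 (ℤₚ.∣i∣≡0⇒i≡0 e))}} (ℕ.s≤s (ℕ.s≤s ℕ.z≤n)))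
              (subst (ℕ._≤ ℤ.∣ B ∣) (ℤₚ.abs-* v (+ 2)) 2v≤B))

  odd-fourth : ∀ γ → Comaximal (+ 2) γ → ∃[ w ] γ ⁴ ≡ + 1 + + 8 * w
  odd-fourth γ c = use (odd-form γ c)
    where
    use : ∃[ q ] γ ≡ + 1 + q * + 2 → ∃[ w ] γ ⁴ ≡ + 1 + + 8 * w
    use (q , γ≡) = q * (q + + 1) + + 2 * (q * (q + + 1) * (q * (q + + 1))) , ringℤ 2 (λ γ q → let r = q :* (q :+ ♯ 1); m = ♯ 1 :+ q :* ♯ 2 in
      pow4 γ := ♯ 1 :+ ♯ 8 :* (r :+ ♯ 2 :* (r :* r)) from (γ :* γ :* γ :+ γ :* γ :* m :+ γ :* m :* m :+ m :* m :* m · γ ≈ m ∷ [])) refl (γ ∷ q ∷ []) (γ≡ , tt)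

  -- For odd γ the fourth power is 1 modulo 8 and the left side is 4 or 2; for even γ it is odd.
  no-residue : ∀ e γ δ → e ≡ + 1 ⊎ e ≡ -[1+ 0 ] → ¬ + 3 * γ ⁴ + e ≡ + 8 * δ
  no-residue e γ δ e≡ h = cases (mod-2 γ)
    where
    by : (d : ℤ) → e ≡ d → ¬ + 8 ∣ + 3 + d → Comaximal (+ 2) γ → ⊥
    by d e≡ not c = use (odd-fourth γ c)
      where
      use : ∃[ w ] γ ⁴ ≡ + 1 + + 8 * w → ⊥
      use (w , γ≡) = not (divides (δ - + 3 * w) (ringℤ 5 (λ e d Γ δ w → ♯ 3 :+ d := (δ :- ♯ 3 :* w) :* ♯ 8 from
        (♯ 1 · ♯ 3 :* Γ :+ e ≈ ♯ 8 :* δ ∷ :- ♯ 3 · Γ ≈ ♯ 1 :+ ♯ 8 :* w ∷ :- ♯ 1 · e ≈ d ∷ []))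
        refl (e ∷ d ∷ γ ⁴ ∷ δ ∷ w ∷ []) (h , γ≡ , e≡ , tt)))
    odd-e : + 2 ∣ γ → ∀ d → e ≡ d → ¬ + 2 ∣ d → ⊥
    odd-e (divides r γ≡) d e≡ not = not (divides (+ 4 * δ - + 3 * (r * (γ * γ * γ))) (ringℤ 5 (λ e d γ δ r → d := (♯ 4 :* δ :- ♯ 3 :* (r :* (γ :* γ :* γ))) :* ♯ 2 from
      (♯ 1 · ♯ 3 :* pow4 γ :+ e ≈ ♯ 8 :* δ ∷ :- ♯ 3 :* γ :* γ :* γ · γ ≈ r :* ♯ 2 ∷ :- ♯ 1 · e ≈ d ∷ []))
      refl (e ∷ d ∷ γ ∷ δ ∷ r ∷ []) (h , γ≡ , e≡ , tt)))
    cases : Residues₂ γ → ⊥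
    cases (odd c) = [ (λ p → by (+ 1) p (from-no (+ 8 ∣? + 4)) c) , (λ p → by -[1+ 0 ] p (from-no (+ 8 ∣? + 2)) c) ]′ e≡
    cases (even v) = [ (λ p → odd-e v (+ 1) p 2∤1) , (λ p → odd-e v -[1+ 0 ] p (from-no (+ 2 ∣? -[1+ 0 ]))) ]′ e≡

  private
    -- The sign of m is chosen such that 3 divides r = (m - 1) / 2.
    oriented : ∀ m c r → m ≡ + 1 + + 2 * r → + 3 ∣ r → m * m ≡ + 768 * c ⁴ + + 1 → c ≡ + 0
    oriented m c r m≡ (divides r₁ r≡) h = parity (mod-2 r)
      where
      rr : r * (r + + 1) ≡ + 192 * c ⁴
      rr = cancelℤ {r * (r + + 1)} {+ 192 * c ⁴} {+ 4} (λ ()) (ringℤ 3 (λ m r C → ♯ 4 :* (r :* (r :+ ♯ 1)) := ♯ 4 :* (♯ 192 :* C) from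
        (♯ 1 · m :* m ≈ ♯ 768 :* C :+ ♯ 1 ∷ :- (m :+ ♯ 1 :+ ♯ 2 :* r) · m ≈ ♯ 1 :+ ♯ 2 :* r ∷ [])) refl (m ∷ r ∷ c ⁴ ∷ []) (h , m≡ , tt))
      ⊥64 : ∀ n → Comaximal (+ 2) n → Comaximal (+ 64) n
      ⊥64 n c = comaximal-sym (comaximal-^ʳ 6 (comaximal-sym c))
      suc-odd : ∀ r → + 2 ∣ r → Comaximal (+ 2) (r + + 1)
      suc-odd r h = odd-sum r (+ 1) h (bezout (+ 0) (+ 1) refl)
      parity : Residues₂ r → c ≡ + 0
      parity (even v) = use (divides-cancelˡ {+ 64} {r + + 1} {r} (⊥64 (r + + 1) (suc-odd r v)) (divides (+ 3 * c ⁴) (trans (ℤₚ.*-comm (r + + 1) r) (trans rr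
          (ringℤ 1 (λ C → ♯ 192 :* C := ♯ 3 :* C :* ♯ 64 from []) refl (c ⁴ ∷ []) tt)))))
        where
        use : + 64 ∣ r → c ≡ + 0
        use (divides s r≡s) = finish (fourth-factors t (r + + 1) c
            (bezout (- + 192) (+ 1) (ringℤ 2 (λ r t → :- ♯ 192 :* t :+ ♯ 1 :* (r :+ ♯ 1) := ♯ 1 from (♯ 1 · r ≈ ♯ 192 :* t ∷ [])) refl (r ∷ t ∷ []) (r≡t , tt)))
            (cancelℤ {t * (r + + 1)} {c ⁴} {+ 192} (λ ()) (ringℤ 3 (λ r t C → ♯ 192 :* (t :* (r :+ ♯ 1)) := ♯ 192 :* C from
              (♯ 1 · r :* (r :+ ♯ 1) ≈ ♯ 192 :* C ∷ :- (r :+ ♯ 1) · r ≈ ♯ 192 :* t ∷ [])) refl (r ∷ t ∷ c ⁴ ∷ []) (rr , r≡t , tt))))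
          where
          -- From 1 = 64 - 63 with r = 3r₁ and r = 64s: r = 64 (3r₁) - 63 (64s) = 192 (r₁ - 21s).
          t = r₁ - + 21 * s
          r≡t : r ≡ + 192 * t
          r≡t = ringℤ 3 (λ r r₁ s → r := ♯ 192 :* (r₁ :- ♯ 21 :* s) from
            (♯ 64 · r ≈ r₁ :* ♯ 3 ∷ :- ♯ 63 · r ≈ s :* ♯ 64 ∷ [])) refl (r ∷ r₁ ∷ s ∷ []) (r≡ , r≡s , tt)
          finish : FourthFactors t (r + + 1) c → c ≡ + 0
          finish (fourthFactors e f γ δ ee t≡ r+1≡ c≡) = signs (unit-sign e ee)
            where
            signs : e ≡ + 1 ⊎ e ≡ -[1+ 0 ] → c ≡ + 0
            -- Here δ⁴ = 1 + 192γ⁴, and 192γ⁴ = 12(2γ)⁴ makes this the equation of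
            -- `quartic-descent`.
            signs (inj₁ e≡) = ringℤ 4 (λ c f γ δ → c := ♯ 0 from (♯ 1 · c ≈ f :* (γ :* δ) ∷ f :* δ · γ ≈ ♯ 0 ∷ [])) refl (c ∷ f ∷ γ ∷ δ ∷ [])
              (c≡ , zero-productℤ {+ 2} {γ} (λ ()) (quartic-descent ℤ.∣ + 2 * γ ∣ δ (+ 2 * γ) refl
                (ringℤ 5 (λ e r t γ Δ → Δ := ♯ 1 :+ ♯ 12 :* pow4 (♯ 2 :* γ) from
                  (:- ♯ 1 · r :+ ♯ 1 ≈ e :* Δ ∷ ♯ 1 · r ≈ ♯ 192 :* t ∷ ♯ 192 · t ≈ e :* pow4 γ ∷ ♯ 192 :* pow4 γ :- Δ · e ≈ ♯ 1 ∷ []))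
                  refl (e ∷ r ∷ t ∷ γ ∷ δ ⁴ ∷ []) (r+1≡ , r≡t , t≡ , e≡ , tt))) , tt)
            signs (inj₂ e≡) = ⊥-elim (no-square-minus-one (δ * δ) (divides (+ 64 * γ ⁴) (ringℤ 5 (λ e r t Γ Δ → Δ :+ ♯ 1 := ♯ 64 :* Γ :* ♯ 3 from
                (♯ 1 · r :+ ♯ 1 ≈ e :* Δ ∷ :- ♯ 1 · r ≈ ♯ 192 :* t ∷ :- ♯ 192 · t ≈ e :* Γ ∷ Δ :- ♯ 192 :* Γ · e ≈ # -[1+ 0 ] ∷ []))
                refl (e ∷ r ∷ t ∷ γ ⁴ ∷ δ ⁴ ∷ []) (r+1≡ , r≡t , t≡ , e≡ , tt))))
      parity (odd o) = use (divides-cancelˡ {+ 64} {r} {r + + 1} (⊥64 r o) (divides (+ 3 * c ⁴) (trans rr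
          (ringℤ 1 (λ C → ♯ 192 :* C := ♯ 3 :* C :* ♯ 64 from []) refl (c ⁴ ∷ []) tt))))
        where
        use : + 64 ∣ r + + 1 → c ≡ + 0
        use (divides s r+1≡s) = ⊥-elim (finish (fourth-factors r₁ s c
            (bezout (- + 3) (+ 64) (ringℤ 3 (λ r r₁ s → :- ♯ 3 :* r₁ :+ ♯ 64 :* s := ♯ 1 from (♯ 1 · r ≈ r₁ :* ♯ 3 ∷ :- ♯ 1 · r :+ ♯ 1 ≈ s :* ♯ 64 ∷ []))
              refl (r ∷ r₁ ∷ s ∷ []) (r≡ , r+1≡s , tt)))
            (cancelℤ {r₁ * s} {c ⁴} {+ 192} (λ ()) (ringℤ 4 (λ r r₁ s C → ♯ 192 :* (r₁ :* s) := ♯ 192 :* C from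
              (♯ 1 · r :* (r :+ ♯ 1) ≈ ♯ 192 :* C ∷ :- (r :+ ♯ 1) · r ≈ r₁ :* ♯ 3 ∷ :- ♯ 3 :* r₁ · r :+ ♯ 1 ≈ s :* ♯ 64 ∷ []))
              refl (r ∷ r₁ ∷ s ∷ c ⁴ ∷ []) (rr , r≡ , r+1≡s , tt)))))
          where
          finish : FourthFactors r₁ s c → ⊥
          finish (fourthFactors e f γ δ ee r₁≡ s≡ _) = no-residue e γ (+ 8 * δ ⁴) (unit-sign e ee)
            (ringℤ 6 (λ e r r₁ s Γ Δ → ♯ 3 :* Γ :+ e := ♯ 8 :* (♯ 8 :* Δ) from
              (:- ♯ 3 :* Γ :+ ♯ 64 :* Δ · e :* e ≈ ♯ 1 ∷ :- ♯ 3 :* e · r₁ ≈ e :* Γ ∷ ♯ 64 :* e · s ≈ e :* Δ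
              ∷ :- e · r ≈ r₁ :* ♯ 3 ∷ e · r :+ ♯ 1 ≈ s :* ♯ 64 ∷ []))
              refl (e ∷ r ∷ r₁ ∷ s ∷ γ ⁴ ∷ δ ⁴ ∷ []) (ee , r₁≡ , s≡ , r≡ , r+1≡s , tt))

  square-descent : ∀ m c → m * m ≡ + 768 * c ⁴ + + 1 → c ≡ + 0
  square-descent m c h = use (odd-form m m-odd)
    where
    m-odd : Comaximal (+ 2) m
    m-odd = 2∤⇒ m λ (divides r m≡) → 2∤1 (divides (r * m - + 384 * c ⁴) (ringℤ 3 (λ m r C → ♯ 1 := (r :* m :- ♯ 384 :* C) :* ♯ 2 from
      (:- ♯ 1 · m :* m ≈ ♯ 768 :* C :+ ♯ 1 ∷ m · m ≈ r :* ♯ 2 ∷ [])) refl (m ∷ r ∷ c ⁴ ∷ []) (h , m≡ , tt)))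
    use : ∃[ q ] m ≡ + 1 + q * + 2 → c ≡ + 0
    use (q , m≡) = cases (factor-3 q (q + + 1) (divides (+ 64 * c ⁴) (cancelℤ {q * (q + + 1)} {+ 64 * c ⁴ * + 3} {+ 4} (λ ())
        (ringℤ 3 (λ m q C → ♯ 4 :* (q :* (q :+ ♯ 1)) := ♯ 4 :* (♯ 64 :* C :* ♯ 3) from
          (♯ 1 · m :* m ≈ ♯ 768 :* C :+ ♯ 1 ∷ :- (m :+ ♯ 1 :+ q :* ♯ 2) · m ≈ ♯ 1 :+ q :* ♯ 2 ∷ [])) refl (m ∷ q ∷ c ⁴ ∷ []) (h , m≡ , tt)))))
      where
      cases : + 3 ∣ q ⊎ + 3 ∣ q + + 1 → c ≡ + 0
      cases (inj₁ d) = oriented m c q (trans m≡ (cong (_+_ (+ 1)) (ℤₚ.*-comm q (+ 2)))) d h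
      cases (inj₂ (divides s e)) = oriented (- m) c (- (q + + 1)) (ringℤ 2 (λ m q → :- m := ♯ 1 :+ ♯ 2 :* (:- (q :+ ♯ 1)) from
          (:- ♯ 1 · m ≈ ♯ 1 :+ q :* ♯ 2 ∷ [])) refl (m ∷ q ∷ []) (m≡ , tt))
        (divides (- s) (ringℤ 2 (λ q s → :- (q :+ ♯ 1) := (:- s) :* ♯ 3 from (:- ♯ 1 · q :+ ♯ 1 ≈ s :* ♯ 3 ∷ [])) refl (q ∷ s ∷ []) (e , tt)))
        (trans (ringℤ 1 (λ m → (:- m) :* (:- m) := m :* m from []) refl (m ∷ []) tt) h)

-- The equation satisfied by the slopes at a point of order six.

module OrderSix where
  open import Data.Integer using (_+_; _*_; -_; _-_)
  open Descent

  cube-mod-9 : ∀ s → ∃[ q ] (s * s * s ≡ + 9 * q ⊎ s * s * s ≡ + 1 + + 9 * q ⊎ s * s * s ≡ -[1+ 0 ] + + 9 * q)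
  cube-mod-9 s = by (s IntDM.%ℕ 3) (s IntDM./ℕ 3) (IntDM.a≡a%ℕn+[a/ℕn]*n s 3) (IntDM.n%ℕd<d s 3)
    where
    by : ∀ r p → s ≡ + r + p * + 3 → r ℕ.< 3 → ∃[ q ] (s * s * s ≡ + 9 * q ⊎ s * s * s ≡ + 1 + + 9 * q ⊎ s * s * s ≡ -[1+ 0 ] + + 9 * q)
    by 0 p h _ = + 3 * p * p * p , inj₁ (ringℤ 2 (λ s p → let t = ♯ 0 :+ p :* ♯ 3 in s :* s :* s := ♯ 9 :* (♯ 3 :* p :* p :* p) from
      (s :* s :+ s :* t :+ t :* t · s ≈ t ∷ [])) refl (s ∷ p ∷ []) (h , tt))
    by 1 p h _ = p + + 3 * p * p + + 3 * p * p * p , inj₂ (inj₁ (ringℤ 2 (λ s p → let t = ♯ 1 :+ p :* ♯ 3 in s :* s :* s := ♯ 1 :+ ♯ 9 :* (p :+ ♯ 3 :* p :* p :+ ♯ 3 :* p :* p :* p) from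
      (s :* s :+ s :* t :+ t :* t · s ≈ t ∷ [])) refl (s ∷ p ∷ []) (h , tt)))
    by 2 p h _ = + 1 + + 4 * p + + 6 * p * p + + 3 * p * p * p , inj₂ (inj₂ (ringℤ 2 (λ s p → let t = ♯ 2 :+ p :* ♯ 3 in s :* s :* s := # -[1+ 0 ] :+ ♯ 9 :* (♯ 1 :+ ♯ 4 :* p :+ ♯ 6 :* p :* p :+ ♯ 3 :* p :* p :* p) from
      (s :* s :+ s :* t :+ t :* t · s ≈ t ∷ [])) refl (s ∷ p ∷ []) (h , tt)))
    by (suc (suc (suc _))) p h (ℕ.s≤s (ℕ.s≤s (ℕ.s≤s ())))

  cube-not-4 : ∀ s q e → e * e ≡ + 1 → ¬ s * s * s ≡ + 4 * e + + 9 * q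
  cube-not-4 s q e ee h = use (cube-mod-9 s) (unit-sign e ee)
    where
    by : ∀ r d p → s * s * s ≡ r + + 9 * p → e ≡ d → ¬ + 9 ∣ r - + 4 * d → ⊥
    by r d p h′ e≡ not = not (divides (q - p) (ringℤ 6 (λ S r d e p q → r :- ♯ 4 :* d := (q :- p) :* ♯ 9 from
      (:- ♯ 1 · S ≈ r :+ ♯ 9 :* p ∷ ♯ 1 · S ≈ ♯ 4 :* e :+ ♯ 9 :* q ∷ ♯ 4 · e ≈ d ∷ [])) refl (s * s * s ∷ r ∷ d ∷ e ∷ p ∷ q ∷ []) (h′ , h , e≡ , tt)))
    use : ∃[ p ] (s * s * s ≡ + 9 * p ⊎ s * s * s ≡ + 1 + + 9 * p ⊎ s * s * s ≡ -[1+ 0 ] + + 9 * p) → e ≡ + 1 ⊎ e ≡ -[1+ 0 ] → ⊥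
    use (p , inj₁ h′) (inj₁ e≡) = by (+ 0) (+ 1) p (trans h′ (sym (ℤₚ.+-identityˡ (+ 9 * p)))) e≡ (from-no (+ 9 ∣? -[1+ 3 ]))
    use (p , inj₁ h′) (inj₂ e≡) = by (+ 0) -[1+ 0 ] p (trans h′ (sym (ℤₚ.+-identityˡ (+ 9 * p)))) e≡ (from-no (+ 9 ∣? + 4))
    use (p , inj₂ (inj₁ h′)) (inj₁ e≡) = by (+ 1) (+ 1) p h′ e≡ (from-no (+ 9 ∣? -[1+ 2 ]))
    use (p , inj₂ (inj₁ h′)) (inj₂ e≡) = by (+ 1) -[1+ 0 ] p h′ e≡ (from-no (+ 9 ∣? + 5))
    use (p , inj₂ (inj₂ h′)) (inj₁ e≡) = by -[1+ 0 ] (+ 1) p h′ e≡ (from-no (+ 9 ∣? -[1+ 4 ]))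
    use (p , inj₂ (inj₂ h′)) (inj₂ e≡) = by -[1+ 0 ] -[1+ 0 ] p h′ e≡ (from-no (+ 9 ∣? + 3))

  -- An N prime to 3 would make both factors prime to 3. With N = 3n the product becomes fg = 9. If
  -- L is prime to 3, then so is g, hence f is 9 or -9 and L³ would be 4 or -4 modulo 9, which is no
  -- cube. If L = 3j, both factors are the same sign, and this leaves j² = 1, where the claim can be
  -- read off.
  six-torsion : ∀ L N → (+ 3 * L + + 2 * N) * (+ 3 * L * L * L + + 6 * L * L * N + + 6 * L * N * N + + 2 * N * N * N) ≡ + 81 → (N + L) * (N + + 2 * L) ≡ + 0
  six-torsion L N h = cases (mod-3 N)
    where
    cases : Residues₃ N → (N + L) * (N + + 2 * L) ≡ + 0
    cases (prime-to-3 c) = ⊥-elim (prime-to-3-not-multiple (f * g) (comaximal-*ʳ {+ 3} {f} {g} f⊥3 g⊥3) (divides (+ 27) h))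
      where
      f = + 3 * L + + 2 * N
      g = + 3 * L * L * L + + 6 * L * L * N + + 6 * L * N * N + + 2 * N * N * N
      f⊥3 : Comaximal (+ 3) f
      f⊥3 = subst (Comaximal (+ 3)) (ℤₚ.+-comm (+ 2 * N) (+ 3 * L)) (comaximal-shift {+ 3} {+ 2 * N} L (comaximal-*ʳ {+ 3} {+ 2} {N} (bezout (+ 1) -[1+ 0 ] refl) c))
      g⊥3 : Comaximal (+ 3) g
      g⊥3 = subst (Comaximal (+ 3)) (ringℤ 2 (λ L N → ♯ 2 :* N :* N :* N :+ ♯ 3 :* (L :* L :* L :+ ♯ 2 :* L :* L :* N :+ ♯ 2 :* L :* N :* N) :=
          ♯ 3 :* L :* L :* L :+ ♯ 6 :* L :* L :* N :+ ♯ 6 :* L :* N :* N :+ ♯ 2 :* N :* N :* N from []) refl (L ∷ N ∷ []) tt)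
        (comaximal-shift {+ 3} {+ 2 * N * N * N} (L * L * L + + 2 * L * L * N + + 2 * L * N * N)
          (comaximal-*ʳ {+ 3} {+ 2 * N * N} {N} (comaximal-*ʳ {+ 3} {+ 2 * N} {N} (comaximal-*ʳ {+ 3} {+ 2} {N} (bezout (+ 1) -[1+ 0 ] refl) c) c) c))
    cases (multiple₃ (divides n N≡)) = second (mod-3 L)
      where
      f g : ℤ
      f = L + + 2 * n
      g = L * L * L + + 6 * L * L * n + + 18 * L * n * n + + 18 * n * n * n
      fg : f * g ≡ + 9
      fg = cancelℤ {f * g} {+ 9} {+ 9} (λ ()) (ringℤ 3 (λ L N n → let M = n :* ♯ 3; P = λ N → (♯ 3 :* L :+ ♯ 2 :* N) :* (♯ 3 :* L :* L :* L :+ ♯ 6 :* L :* L :* N :+ ♯ 6 :* L :* N :* N :+ ♯ 2 :* N :* N :* N) in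
        ♯ 9 :* ((L :+ ♯ 2 :* n) :* (L :* L :* L :+ ♯ 6 :* L :* L :* n :+ ♯ 18 :* L :* n :* n :+ ♯ 18 :* n :* n :* n)) := # (+ 9 * + 9) from
        (♯ 1 · P N ≈ ♯ 81
        ∷ :- (♯ 24 :* L :* L :* L :+ ♯ 30 :* L :* L :* (N :+ M) :+ ♯ 18 :* L :* (N :* N :+ N :* M :+ M :* M) :+ ♯ 4 :* (N :+ M) :* (N :* N :+ M :* M)) · N ≈ M ∷ [])) refl (L ∷ N ∷ n ∷ []) (h , N≡ , tt))
      second : Residues₃ L → (N + L) * (N + + 2 * L) ≡ + 0
      second (prime-to-3 c) = use (divides-cancelˡ {+ 9} {g} {f} (comaximal-*ˡ {+ 3} {+ 3} {g} g⊥3 g⊥3) (divides (+ 1) (trans (ℤₚ.*-comm g f) fg)))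
        where
        g⊥3 : Comaximal (+ 3) g
        g⊥3 = subst (Comaximal (+ 3)) (ringℤ 2 (λ L n → L :* L :* L :+ ♯ 3 :* (♯ 2 :* L :* L :* n :+ ♯ 6 :* L :* n :* n :+ ♯ 6 :* n :* n :* n) :=
            L :* L :* L :+ ♯ 6 :* L :* L :* n :+ ♯ 18 :* L :* n :* n :+ ♯ 18 :* n :* n :* n from []) refl (L ∷ n ∷ []) tt)
          (comaximal-shift {+ 3} {L * L * L} (+ 2 * L * L * n + + 6 * L * n * n + + 6 * n * n * n) (comaximal-*ʳ {+ 3} {L * L} {L} (comaximal-*ʳ {+ 3} {L} {L} c c) c))
        use : + 9 ∣ f → (N + L) * (N + + 2 * L) ≡ + 0
        use (divides e f≡) = ⊥-elim (cube-not-4 L (L * L * L - + 12 * e * L * L - + 8 * L * n * n - + 8 * n * n * n) e ee cube)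
          where
          eg : e * g ≡ + 1
          eg = cancelℤ {e * g} {+ 1} {+ 9} (λ ()) (ringℤ 3 (λ e f g → ♯ 9 :* (e :* g) := ♯ 9 :* ♯ 1 from (♯ 1 · f :* g ≈ ♯ 9 ∷ :- g · f ≈ e :* ♯ 9 ∷ [])) refl (e ∷ f ∷ g ∷ []) (fg , f≡ , tt))
          ee : e * e ≡ + 1
          ee = divides-one-square e (divides g (trans (sym eg) (ℤₚ.*-comm e g)))
          cube : L * L * L ≡ + 4 * e + + 9 * (L * L * L - + 12 * e * L * L - + 8 * L * n * n - + 8 * n * n * n)
          cube = ringℤ 3 (λ L n e → let g = L :* L :* L :+ ♯ 6 :* L :* L :* n :+ ♯ 18 :* L :* n :* n :+ ♯ 18 :* n :* n :* n in
            L :* L :* L := ♯ 4 :* e :+ ♯ 9 :* (L :* L :* L :- ♯ 12 :* e :* L :* L :- ♯ 8 :* L :* n :* n :- ♯ 8 :* n :* n :* n) from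
            (♯ 4 :* e · e :* g ≈ ♯ 1 ∷ :- ♯ 4 :* g · e :* e ≈ ♯ 1 ∷ :- ♯ 12 :* L :* L · L :+ ♯ 2 :* n ≈ e :* ♯ 9 ∷ []))
            refl (L ∷ n ∷ e ∷ []) (eg , ee , f≡ , tt)
      second (multiple₃ (divides j L≡)) = finish (j + f ℤ.≟ + 0)
        where
        h′ : ℤ
        h′ = + 3 * j * j * j + + 6 * j * j * n + + 6 * j * n * n + + 2 * n * n * n
        fh : f * h′ ≡ + 1
        fh = cancelℤ {f * h′} {+ 1} {+ 9} (λ ()) (ringℤ 3 (λ L n j → let l = j :* ♯ 3; f = λ L → L :+ ♯ 2 :* n; g = λ L → L :* L :* L :+ ♯ 6 :* L :* L :* n :+ ♯ 18 :* L :* n :* n :+ ♯ 18 :* n :* n :* n in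
          ♯ 9 :* (f L :* (♯ 3 :* j :* j :* j :+ ♯ 6 :* j :* j :* n :+ ♯ 6 :* j :* n :* n :+ ♯ 2 :* n :* n :* n)) := ♯ 9 :* ♯ 1 from
          (♯ 1 · f L :* g L ≈ ♯ 9 ∷ :- f L :* (L :* L :+ L :* l :+ l :* l :+ ♯ 6 :* n :* (L :+ l) :+ ♯ 18 :* n :* n) · L ≈ l ∷ []))
          refl (L ∷ n ∷ j ∷ []) (fg , L≡ , tt))
        ff : f * f ≡ + 1
        ff = divides-one-square f (divides h′ (trans (sym fh) (ℤₚ.*-comm f h′)))
        f≡ : + 3 * j + + 2 * n ≡ f
        f≡ = ringℤ 3 (λ L n j → ♯ 3 :* j :+ ♯ 2 :* n := L :+ ♯ 2 :* n from (:- ♯ 1 · L ≈ j :* ♯ 3 ∷ [])) refl (L ∷ n ∷ j ∷ []) (L≡ , tt)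
        h≡f : h′ ≡ f
        h≡f = ringℤ 2 (λ f h → h := f from (f · f :* h ≈ ♯ 1 ∷ :- h · f :* f ≈ ♯ 1 ∷ [])) refl (f ∷ h′ ∷ []) (fh , ff , tt)
        factored : (j + f) * (j * j - + 1) ≡ + 0
        factored = zero-productℤ {+ 3} {(j + f) * (j * j - + 1)} (λ ()) (ringℤ 3 (λ j n e → ♯ 3 :* ((j :+ e) :* (j :* j :- ♯ 1)) := ♯ 0 from
          (:- ♯ 1 :- ♯ 3 :* j :* j :- ♯ 4 :* n :* n :- ♯ 2 :* e :* n :- ♯ 6 :* j :* n · ♯ 3 :* j :+ ♯ 2 :* n ≈ e
          ∷ ♯ 4 · ♯ 3 :* j :* j :* j :+ ♯ 6 :* j :* j :* n :+ ♯ 6 :* j :* n :* n :+ ♯ 2 :* n :* n :* n ≈ e ∷ :- ♯ 2 :* n · e :* e ≈ ♯ 1 ∷ []))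
          refl (j ∷ n ∷ f ∷ []) (f≡ , h≡f , ff , tt))
        jj-one : j * j - + 1 ≡ + 0 → (N + L) * (N + + 2 * L) ≡ + 0
        jj-one e = zero-productℤ {+ 4} {(N + L) * (N + + 2 * L)} (λ ()) (ringℤ 5 (λ L N n j f → ♯ 4 :* ((N :+ L) :* (N :+ ♯ 2 :* L)) := ♯ 0 from
          (♯ 4 :* (N :+ ♯ 2 :* L :+ n :* ♯ 3 :+ L) · N ≈ n :* ♯ 3
          ∷ ♯ 36 :* n :+ ♯ 8 :* (L :+ j :* ♯ 3) · L ≈ j :* ♯ 3
          ∷ ♯ 9 :* (♯ 3 :* j :+ ♯ 2 :* n :+ f) · ♯ 3 :* j :+ ♯ 2 :* n ≈ f ∷ ♯ 9 · f :* f ≈ ♯ 1 ∷ :- ♯ 9 · j :* j :- ♯ 1 ≈ ♯ 0 ∷ []))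
          refl (L ∷ N ∷ n ∷ j ∷ f ∷ []) (N≡ , L≡ , f≡ , ff , e , tt))
        finish : Dec (j + f ≡ + 0) → (N + L) * (N + + 2 * L) ≡ + 0
        finish (no n≢) = jj-one (zero-productℤ {j + f} {j * j - + 1} n≢ factored)
        finish (yes e) = jj-one (ringℤ 2 (λ j f → j :* j :- ♯ 1 := ♯ 0 from (♯ 1 · f :* f ≈ ♯ 1 ∷ j :- f · j :+ f ≈ ♯ 0 ∷ []))
          refl (j ∷ f ∷ []) (ff , e , tt))

-- Vieta descent on integral points of conics
module Conics where
  open import Data.Integer using (_+_; _*_; -_; _-_)

  Conic : ℤ → ℤ → ℤ → Set
  Conic l x y = (+ 2 * l + + 1) * (x * y) ≡ (x + y) * (x + y + l)

  data Gap (m n : ℕ) : Set where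
    less : ∀ i → n ≡ m ℕ.+ suc i → Gap m n
    more : ∀ i → m ≡ n ℕ.+ i → Gap m n

  gap : ∀ m n → Gap m n
  gap m zero = more m refl
  gap zero (suc n) = less n refl
  gap (suc m) (suc n) = shift (gap m n)
    where
    shift : Gap m n → Gap (suc m) (suc n)
    shift (less i e) = less i (cong suc e)
    shift (more i e) = more i (cong suc e)

  private
    1+_ : ∀ {n} → Expr n → Expr n
    1+ i = ♯ 1 :+ i

    subtract : ∀ {a b} → a ≡ b → a - b ≡ + 0
    subtract {a} refl = ℤₚ.+-inverseʳ a

  too-big : ∀ Q M → Natural (Q - M - + 1) → Natural (M - + 1) → ¬ Q ∣ M
  too-big Q M (a , a≡) (b , b≡) (divides e h) = cases e h
    where
    Q≡ : Q ≡ + 2 + + a + + b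
    Q≡ = ringℤ 4 (λ Q M a b → Q := ♯ 2 :+ a :+ b from (♯ 1 · Q :- M :- ♯ 1 ≈ a ∷ ♯ 1 · M :- ♯ 1 ≈ b ∷ [])) refl (Q ∷ M ∷ + a ∷ + b ∷ []) (a≡ , b≡ , tt)
    M≡ : ∀ e → M ≡ e * Q → + 1 + + b ≡ e * (+ 2 + + a + + b)
    M≡ e h = ringℤ 5 (λ Q M a b e → ♯ 1 :+ b := e :* (♯ 2 :+ a :+ b) from (♯ 1 · M ≈ e :* Q ∷ :- ♯ 1 · M :- ♯ 1 ≈ b ∷ e · Q ≈ ♯ 2 :+ a :+ b ∷ []))
      refl (Q ∷ M ∷ + a ∷ + b ∷ e ∷ []) (h , b≡ , Q≡ , tt)
    cases : ∀ e → M ≡ e * Q → ⊥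
    cases (+ 0) h = impossible 2 (λ a b → 1+ b :- ♯ 0 :* (♯ 2 :+ a :+ b)) refl (a ∷ b ∷ []) (subtract (M≡ (+ 0) h))
    cases (+ suc c) h = impossible 3 (λ a b c → (1+ c) :* (♯ 2 :+ a :+ b) :- 1+ b) refl (a ∷ b ∷ c ∷ []) (subtract (sym (M≡ (+ suc c) h)))
    cases -[1+ c ] h = impossible 3 (λ a b c → 1+ b :- (:- (1+ c)) :* (♯ 2 :+ a :+ b)) refl (a ∷ b ∷ c ∷ []) (subtract (M≡ -[1+ c ] h))

  -- l = - j with j ≥ 2, x = X and y = - W.
  module Negative (i : ℕ) where

    j : ℤ
    j = + 2 + + i

    Curve : ℤ → ℤ → Set
    Curve X W = X * X - (+ 1 + + 2 * j) * X * W + W * W - j * X + j * W ≡ + 0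

    R : ℤ
    R = + 8 * j * j * j * j + + 4 * j * j * j - + 2 * j * j - j

    private
      jₑ : ∀ {n} → Expr n → Expr n
      jₑ i = ♯ 2 :+ i

      curve : ∀ {n} → Expr n → Expr n → Expr n → Expr n
      curve j X W = X :* X :- (♯ 1 :+ ♯ 2 :* j) :* X :* W :+ W :* W :- j :* X :+ j :* W

      Rₑ : ∀ {n} → Expr n → Expr n
      Rₑ j = ♯ 8 :* j :* j :* j :* j :+ ♯ 4 :* j :* j :* j :- ♯ 2 :* j :* j :- j

    -- The chain of Vieta jumps that starts at (0, 0). Four points are listed; from the fifth on the
    -- difference of the coordinates is at least R in absolute value, and R is its value at the
    -- fifth. Since R grows like 8j⁴ and q divides a nonzero number of size about 2j⁴, the far
    -- points cannot satisfy the divisibility condition.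
    data Class (X W : ℤ) : Set where
      origin : X ≡ + 0 → W ≡ + 0 → Class X W
      second : X ≡ j → W ≡ + 0 → Class X W
      third : X ≡ j → W ≡ + 2 * j * j → Class X W
      fourth : X ≡ + 4 * j * j * j + + 2 * j * j → W ≡ + 2 * j * j → Class X W
      far⁺ : Natural (X - W - R) → Class X W
      far⁻ : Natural (W - X - R) → Class X W

    private
      X-partner : ∀ X W → Curve X W → Curve ((+ 1 + + 2 * j) * W + j - X) W
      X-partner X W h = ringℤ 3 (λ j X W → curve j ((♯ 1 :+ ♯ 2 :* j) :* W :+ j :- X) W := ♯ 0 from (♯ 1 · curve j X W ≈ ♯ 0 ∷ []))
        refl (j ∷ X ∷ W ∷ []) (h , tt)

      W-partner : ∀ X W → Curve X W → Curve X ((+ 1 + + 2 * j) * X - j - W)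
      W-partner X W h = ringℤ 3 (λ j X W → curve j X ((♯ 1 :+ ♯ 2 :* j) :* X :- j :- W) := ♯ 0 from (♯ 1 · curve j X W ≈ ♯ 0 ∷ []))
        refl (j ∷ X ∷ W ∷ []) (h , tt)

    Claim : ℕ → Set
    Claim n = ∀ X W → X ℕ.+ W ≡ n → Curve (+ X) (+ W) → Class (+ X) (+ W)

    private
      -- At X = W the quadratic polynomial in X takes the negative value (1 - 2j)W². So W lies
      -- strictly between the two roots, and replacing the root X > W by the other one decreases the
      -- sum. The same holds for the quadratic in W.
      module XStep (w d X : ℕ) (X≡ : X ≡ suc w ℕ.+ suc d) (h : Curve (+ X) (+ suc w))
        (ih : ∀ {m} → m ℕ.< X ℕ.+ suc w → Claim m) where
        W = suc w

        module Partner (X′ : ℕ) (p : (+ 1 + + 2 * j) * + W + j - + X ≡ + X′) where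

          smaller : Gap X′ W → ∃[ g ] W ≡ X′ ℕ.+ suc g
          smaller (less g e) = g , e
          smaller (more g e) = ⊥-elim (impossible 4 (λ i w d g → let j = jₑ i; W = 1+ w in (♯ 2 :* j :- ♯ 1) :* W :* W :+ (1+ d) :* g) refl (i ∷ w ∷ d ∷ g ∷ [])
            (ringℤ 6 (λ j W d g X X′ → (♯ 2 :* j :- ♯ 1) :* W :* W :+ (1+ d) :* g := ♯ 0 from
              (:- ♯ 1 · curve j X W ≈ ♯ 0 ∷ W :- X · (♯ 1 :+ ♯ 2 :* j) :* W :+ j :- X ≈ X′ ∷ W :- X′ · X ≈ W :+ 1+ d ∷ :- (1+ d) · X′ ≈ W :+ g ∷ []))
              refl (j ∷ + W ∷ + d ∷ + g ∷ + X ∷ + X′ ∷ []) (h , p , cong +_ X≡ , cong +_ e , tt)))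

          up : ∀ g → W ≡ X′ ℕ.+ suc g → Class (+ X′) (+ W) → Class (+ X) (+ W)
          up g e (origin _ ())
          up g e (second _ ())
          up g e (third a b) = fourth (ringℤ 4 (λ j X W X′ → X := ♯ 4 :* j :* j :* j :+ ♯ 2 :* j :* j from
              (:- ♯ 1 · (♯ 1 :+ ♯ 2 :* j) :* W :+ j :- X ≈ X′ ∷ :- ♯ 1 · X′ ≈ j ∷ ♯ 1 :+ ♯ 2 :* j · W ≈ ♯ 2 :* j :* j ∷ []))
              refl (j ∷ + X ∷ + W ∷ + X′ ∷ []) (p , a , b , tt)) b
          up g e (fourth a b) = ⊥-elim (impossible 2 (λ i g → let j = jₑ i in ♯ 4 :* j :* j :* j :+ 1+ g) refl (i ∷ g ∷ [])
            (ringℤ 4 (λ j W X′ g → ♯ 4 :* j :* j :* j :+ 1+ g := ♯ 0 from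
              (:- ♯ 1 · W ≈ X′ :+ 1+ g ∷ :- ♯ 1 · X′ ≈ ♯ 4 :* j :* j :* j :+ ♯ 2 :* j :* j ∷ ♯ 1 · W ≈ ♯ 2 :* j :* j ∷ []))
              refl (j ∷ + W ∷ + X′ ∷ + g ∷ []) (cong +_ e , a , b , tt)))
          up g e (far⁺ (k , k≡)) = ⊥-elim (impossible 3 (λ i g k → Rₑ (jₑ i) :+ 1+ g :+ k) refl (i ∷ g ∷ k ∷ [])
            (ringℤ 5 (λ j W X′ g k → Rₑ j :+ 1+ g :+ k := ♯ 0 from (:- ♯ 1 · W ≈ X′ :+ 1+ g ∷ :- ♯ 1 · X′ :- W :- Rₑ j ≈ k ∷ []))
              refl (j ∷ + W ∷ + X′ ∷ + g ∷ + k ∷ []) (cong +_ e , k≡ , tt)))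
          up g e (far⁻ k) = far⁺ (subst Natural (ringℤ 4 (λ j X W X′ → (W :- X′ :- Rₑ j) :+ ((♯ 2 :* j :- ♯ 1) :* W :+ j) := X :- W :- Rₑ j from
              (♯ 1 · (♯ 1 :+ ♯ 2 :* j) :* W :+ j :- X ≈ X′ ∷ [])) refl (j ∷ + X ∷ + W ∷ + X′ ∷ []) (p , tt))
            (natural-+ (+ W - + X′ - R) k 2 (λ i W → let j = jₑ i in (♯ 2 :* j :- ♯ 1) :* W :+ j) refl (i ∷ W ∷ [])))

          conclude : ∃[ g ] W ≡ X′ ℕ.+ suc g → Class (+ X) (+ W)
          conclude (g , e) = up g e (ih (ℕₚ.+-monoˡ-< W (ℕₚ.<-trans (subst (X′ ℕ.<_) (sym e) (ℕₚ.m<m+n X′ (ℕ.s≤s ℕ.z≤n))) (subst (W ℕ.<_) (sym X≡) (ℕₚ.m<m+n W (ℕ.s≤s ℕ.z≤n)))))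
            X′ W refl (subst (λ z → Curve z (+ W)) p (X-partner (+ X) (+ W) h)))

        step : ∀ z → (+ 1 + + 2 * j) * + W + j - + X ≡ z → Class (+ X) (+ W)
        step (+ X′) p = Partner.conclude X′ p (Partner.smaller X′ p (gap X′ W))
        step -[1+ m ] p = ⊥-elim (impossible 3 (λ i w m → curve (jₑ i) (:- (1+ m)) (1+ w)) refl (i ∷ w ∷ m ∷ [])
          (subst (λ z → Curve z (+ W)) p (X-partner (+ X) (+ W) h)))

      module WStep (x d W : ℕ) (W≡ : W ≡ suc x ℕ.+ suc d) (h : Curve (+ suc x) (+ W))
        (ih : ∀ {m} → m ℕ.< suc x ℕ.+ W → Claim m) where
        X = suc x

        module Partner (W′ : ℕ) (p : (+ 1 + + 2 * j) * + X - j - + W ≡ + W′) where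

          smaller : Gap W′ X → ∃[ g ] X ≡ W′ ℕ.+ suc g
          smaller (less g e) = g , e
          smaller (more g e) = ⊥-elim (impossible 4 (λ i x d g → let j = jₑ i; X = 1+ x in (♯ 2 :* j :- ♯ 1) :* X :* X :+ (1+ d) :* g) refl (i ∷ x ∷ d ∷ g ∷ [])
            (ringℤ 6 (λ j X d g W W′ → (♯ 2 :* j :- ♯ 1) :* X :* X :+ (1+ d) :* g := ♯ 0 from
              (:- ♯ 1 · curve j X W ≈ ♯ 0 ∷ X :- W · (♯ 1 :+ ♯ 2 :* j) :* X :- j :- W ≈ W′ ∷ X :- W′ · W ≈ X :+ 1+ d ∷ :- (1+ d) · W′ ≈ X :+ g ∷ []))
              refl (j ∷ + X ∷ + d ∷ + g ∷ + W ∷ + W′ ∷ []) (h , p , cong +_ W≡ , cong +_ e , tt)))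

          up : ∀ g → X ≡ W′ ℕ.+ suc g → Class (+ X) (+ W′) → Class (+ X) (+ W)
          up g e (origin () _)
          up g e (second a b) = third a (ringℤ 4 (λ j X W W′ → W := ♯ 2 :* j :* j from
              (:- ♯ 1 · (♯ 1 :+ ♯ 2 :* j) :* X :- j :- W ≈ W′ ∷ ♯ 1 :+ ♯ 2 :* j · X ≈ j ∷ :- ♯ 1 · W′ ≈ ♯ 0 ∷ []))
              refl (j ∷ + X ∷ + W ∷ + W′ ∷ []) (p , a , b , tt))
          up g e (third a b) = ⊥-elim (impossible 2 (λ i g → let j = jₑ i in ♯ 2 :* j :* j :+ 1+ g :- j) refl (i ∷ g ∷ [])
            (ringℤ 4 (λ j X W′ g → ♯ 2 :* j :* j :+ 1+ g :- j := ♯ 0 from (:- ♯ 1 · X ≈ W′ :+ 1+ g ∷ ♯ 1 · X ≈ j ∷ :- ♯ 1 · W′ ≈ ♯ 2 :* j :* j ∷ []))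
              refl (j ∷ + X ∷ + W′ ∷ + g ∷ []) (cong +_ e , a , b , tt)))
          up g e (fourth a b) = far⁻ (0 , ringℤ 4 (λ j X W W′ → W :- X :- Rₑ j := ♯ 0 from
              (:- ♯ 1 · (♯ 1 :+ ♯ 2 :* j) :* X :- j :- W ≈ W′ ∷ ♯ 2 :* j · X ≈ ♯ 4 :* j :* j :* j :+ ♯ 2 :* j :* j ∷ :- ♯ 1 · W′ ≈ ♯ 2 :* j :* j ∷ []))
              refl (j ∷ + X ∷ + W ∷ + W′ ∷ []) (p , a , b , tt))
          up g e (far⁺ k) = far⁻ (subst Natural (ringℤ 5 (λ j x X W W′ → (X :- W′ :- Rₑ j) :+ ((♯ 2 :* j :- ♯ 1) :* (1+ x) :- j) := W :- X :- Rₑ j from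
              (♯ 1 · (♯ 1 :+ ♯ 2 :* j) :* X :- j :- W ≈ W′ ∷ :- (♯ 2 :* j :- ♯ 1) · X ≈ 1+ x ∷ [])) refl (j ∷ + x ∷ + X ∷ + W ∷ + W′ ∷ []) (p , refl , tt))
            (natural-+ (+ X - + W′ - R) k 2 (λ i x → let j = jₑ i in (♯ 2 :* j :- ♯ 1) :* (1+ x) :- j) refl (i ∷ x ∷ [])))
          up g e (far⁻ (k , k≡)) = ⊥-elim (impossible 3 (λ i g k → Rₑ (jₑ i) :+ 1+ g :+ k) refl (i ∷ g ∷ k ∷ [])
            (ringℤ 5 (λ j X W′ g k → Rₑ j :+ 1+ g :+ k := ♯ 0 from (:- ♯ 1 · X ≈ W′ :+ 1+ g ∷ :- ♯ 1 · W′ :- X :- Rₑ j ≈ k ∷ []))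
              refl (j ∷ + X ∷ + W′ ∷ + g ∷ + k ∷ []) (cong +_ e , k≡ , tt)))

          conclude : ∃[ g ] X ≡ W′ ℕ.+ suc g → Class (+ X) (+ W)
          conclude (g , e) = up g e (ih (ℕₚ.+-monoʳ-< X (ℕₚ.<-trans (subst (W′ ℕ.<_) (sym e) (ℕₚ.m<m+n W′ (ℕ.s≤s ℕ.z≤n))) (subst (X ℕ.<_) (sym W≡) (ℕₚ.m<m+n X (ℕ.s≤s ℕ.z≤n)))))
            X W′ refl (subst (Curve (+ X)) p (W-partner (+ X) (+ W) h)))

        step : ∀ z → (+ 1 + + 2 * j) * + X - j - + W ≡ z → Class (+ X) (+ W)
        step (+ W′) p = Partner.conclude W′ p (Partner.smaller W′ p (gap W′ X))
        step -[1+ m ] p = ⊥-elim (impossible 3 (λ i x m → curve (jₑ i) (1+ x) (:- (1+ m))) refl (i ∷ x ∷ m ∷ [])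
          (subst (Curve (+ X)) p (W-partner (+ X) (+ W) h)))

    classify : ∀ n → Claim n
    classify = <-rec Claim step
      where
      step : ∀ n → (∀ {m} → m ℕ.< n → Claim m) → Claim n
      step _ ih zero zero refl h = origin refl refl
      step _ ih (suc x) zero refl h = second (ringℤ 2 (λ j X → X := j from (♯ 1 · X :- j ≈ ♯ 0 ∷ [])) refl (j ∷ + suc x ∷ [])
        (zero-productℤ {+ suc x} {+ suc x - j} (λ ()) (ringℤ 2 (λ j X → X :* (X :- j) := ♯ 0 from (♯ 1 · curve j X (♯ 0) ≈ ♯ 0 ∷ [])) refl (j ∷ + suc x ∷ []) (h , tt)) , tt)) refl
      step _ ih zero (suc w) refl h = ⊥-elim (impossible 2 (λ i w → curve (jₑ i) (♯ 0) (1+ w)) refl (i ∷ w ∷ []) h)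
      step _ ih (suc x) (suc w) refl h = compare (gap (suc x) (suc w))
        where
        compare : Gap (suc x) (suc w) → Class (+ suc x) (+ suc w)
        compare (less d e) = WStep.step x d (suc w) e h ih _ refl
        compare (more zero e) = ⊥-elim (impossible 2 (λ i w → :- curve (jₑ i) (1+ w) (1+ w)) refl (i ∷ w ∷ [])
          (cong -_ (subst (λ X → Curve X (+ suc w)) (cong +_ (trans e (ℕₚ.+-identityʳ (suc w)))) h)))
        compare (more (suc d) e) = XStep.step w d (suc x) e h ih _ refl

-- The conics with l at least 4.

module ConicsPositive where
  open import Data.Integer using (_+_; _*_; -_; _-_)
  open Conics

  private
    1+_ : ∀ {n} → Expr n → Expr n
    1+ i = ♯ 1 :+ i

    lₑ : ∀ {n} → Expr n → Expr n
    lₑ i = ♯ 4 :+ i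

  -- l ≥ 4, x = - X and y = - Y.
  module NonPositive (i : ℕ) where

    l : ℤ
    l = + 4 + + i

    Curve : ℤ → ℤ → Set
    Curve X Y = X * X - (+ 2 * l - + 1) * X * Y + Y * Y - l * X - l * Y ≡ + 0

    R : ℤ
    R = + 8 * l * l * l * l - + 4 * l * l * l - + 2 * l * l + l

    private
      curve : ∀ {n} → Expr n → Expr n → Expr n → Expr n
      curve l X Y = X :* X :- (♯ 2 :* l :- ♯ 1) :* X :* Y :+ Y :* Y :- l :* X :- l :* Y

      Rₑ : ∀ {n} → Expr n → Expr n
      Rₑ l = ♯ 8 :* l :* l :* l :* l :- ♯ 4 :* l :* l :* l :- ♯ 2 :* l :* l :+ l

    -- Again the chain of Vieta jumps from (0, 0), with the larger coordinate first; R is the sum X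
    -- + Y at the fifth point, about 8l⁴ against about 2l⁴ for the number that q divides.
    data Class (X Y : ℤ) : Set where
      origin : X ≡ + 0 → Y ≡ + 0 → Class X Y
      second : X ≡ l → Y ≡ + 0 → Class X Y
      third : X ≡ + 2 * l * l → Y ≡ l → Class X Y
      fourth : X ≡ + 4 * l * l * l - + 2 * l * l → Y ≡ + 2 * l * l → Class X Y
      far : Natural (X + Y - R) → Class X Y

    Claim : ℕ → Set
    Claim n = ∀ X Y g → X ≡ Y ℕ.+ g → X ℕ.+ Y ≡ n → Curve (+ X) (+ Y) → Class (+ X) (+ Y)

    private
      partner : ∀ X Y → Curve X Y → Curve ((+ 2 * l - + 1) * Y + l - X) Y
      partner X Y h = ringℤ 3 (λ l X Y → curve l ((♯ 2 :* l :- ♯ 1) :* Y :+ l :- X) Y := ♯ 0 from (♯ 1 · curve l X Y ≈ ♯ 0 ∷ []))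
        refl (l ∷ X ∷ Y ∷ []) (h , tt)

      symmetric : ∀ X Y → Curve X Y → Curve Y X
      symmetric X Y h = ringℤ 3 (λ l X Y → curve l Y X := ♯ 0 from (♯ 1 · curve l X Y ≈ ♯ 0 ∷ [])) refl (l ∷ X ∷ Y ∷ []) (h , tt)

      module Step (y d X : ℕ) (X≡ : X ≡ suc y ℕ.+ suc d) (h : Curve (+ X) (+ suc y))
        (ih : ∀ {m} → m ℕ.< X ℕ.+ suc y → Claim m) where
        Y = suc y

        module Partner (X′ : ℕ) (p : (+ 2 * l - + 1) * + Y + l - + X ≡ + X′) where

          smaller : Gap X′ Y → ∃[ g ] Y ≡ X′ ℕ.+ suc g
          smaller (less g e) = g , e
          smaller (more g e) = ⊥-elim (impossible 4 (λ i y d g → let l = lₑ i; Y = 1+ y in (♯ 2 :* l :- ♯ 3) :* Y :* Y :+ ♯ 2 :* l :* Y :+ (1+ d) :* g) refl (i ∷ y ∷ d ∷ g ∷ [])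
            (ringℤ 6 (λ l Y d g X X′ → (♯ 2 :* l :- ♯ 3) :* Y :* Y :+ ♯ 2 :* l :* Y :+ (1+ d) :* g := ♯ 0 from
              (:- ♯ 1 · curve l X Y ≈ ♯ 0 ∷ Y :- X · (♯ 2 :* l :- ♯ 1) :* Y :+ l :- X ≈ X′ ∷ Y :- X′ · X ≈ Y :+ 1+ d ∷ :- (1+ d) · X′ ≈ Y :+ g ∷ []))
              refl (l ∷ + Y ∷ + d ∷ + g ∷ + X ∷ + X′ ∷ []) (h , p , cong +_ X≡ , cong +_ e , tt)))

          up : ∀ g → Y ≡ X′ ℕ.+ suc g → Class (+ Y) (+ X′) → Class (+ X) (+ Y)
          up g e (origin () _)
          up g e (second a b) = third (ringℤ 4 (λ l X Y X′ → X := ♯ 2 :* l :* l from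
              (:- ♯ 1 · (♯ 2 :* l :- ♯ 1) :* Y :+ l :- X ≈ X′ ∷ :- ♯ 1 · X′ ≈ ♯ 0 ∷ ♯ 2 :* l :- ♯ 1 · Y ≈ l ∷ []))
              refl (l ∷ + X ∷ + Y ∷ + X′ ∷ []) (p , b , a , tt)) a
          up g e (third a b) = fourth (ringℤ 4 (λ l X Y X′ → X := ♯ 4 :* l :* l :* l :- ♯ 2 :* l :* l from
              (:- ♯ 1 · (♯ 2 :* l :- ♯ 1) :* Y :+ l :- X ≈ X′ ∷ :- ♯ 1 · X′ ≈ l ∷ ♯ 2 :* l :- ♯ 1 · Y ≈ ♯ 2 :* l :* l ∷ []))
              refl (l ∷ + X ∷ + Y ∷ + X′ ∷ []) (p , b , a , tt)) a
          up g e (fourth a b) = far (0 , ringℤ 4 (λ l X Y X′ → X :+ Y :- Rₑ l := ♯ 0 from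
              (:- ♯ 1 · (♯ 2 :* l :- ♯ 1) :* Y :+ l :- X ≈ X′ ∷ :- ♯ 1 · X′ ≈ ♯ 2 :* l :* l ∷ ♯ 2 :* l · Y ≈ ♯ 4 :* l :* l :* l :- ♯ 2 :* l :* l ∷ []))
              refl (l ∷ + X ∷ + Y ∷ + X′ ∷ []) (p , b , a , tt))
          up g e (far k) = far (subst Natural (ringℤ 6 (λ l X Y X′ d g → (Y :+ X′ :- Rₑ l) :+ (♯ 2 :+ d :+ g) := X :+ Y :- Rₑ l from
              (:- ♯ 1 · X ≈ Y :+ 1+ d ∷ :- ♯ 1 · Y ≈ X′ :+ 1+ g ∷ [])) refl (l ∷ + X ∷ + Y ∷ + X′ ∷ + d ∷ + g ∷ []) (cong +_ X≡ , cong +_ e , tt))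
            (natural-+ (+ Y + + X′ - R) k 2 (λ d g → ♯ 2 :+ d :+ g) refl (d ∷ g ∷ [])))

          conclude : ∃[ g ] Y ≡ X′ ℕ.+ suc g → Class (+ X) (+ Y)
          conclude (g , e) = up g e (ih (subst (Y ℕ.+ X′ ℕ.<_) (ℕₚ.+-comm Y X) (ℕₚ.+-monoʳ-< Y
              (ℕₚ.<-trans (subst (X′ ℕ.<_) (sym e) (ℕₚ.m<m+n X′ (ℕ.s≤s ℕ.z≤n))) (subst (Y ℕ.<_) (sym X≡) (ℕₚ.m<m+n Y (ℕ.s≤s ℕ.z≤n))))))
            Y X′ (suc g) e refl (symmetric (+ X′) (+ Y) (subst (λ z → Curve z (+ Y)) p (partner (+ X) (+ Y) h))))

        step : ∀ z → (+ 2 * l - + 1) * + Y + l - + X ≡ z → Class (+ X) (+ Y)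
        step (+ X′) p = Partner.conclude X′ p (Partner.smaller X′ p (gap X′ Y))
        step -[1+ m ] p = ⊥-elim (impossible 3 (λ i y m → curve (lₑ i) (:- (1+ m)) (1+ y)) refl (i ∷ y ∷ m ∷ [])
          (subst (λ z → Curve z (+ Y)) p (partner (+ X) (+ Y) h)))

    classify : ∀ n → Claim n
    classify = <-rec Claim step
      where
      step : ∀ n → (∀ {m} → m ℕ.< n → Claim m) → Claim n
      step _ ih zero zero _ _ refl h = origin refl refl
      step _ ih (suc x) zero _ _ refl h = second (ringℤ 2 (λ l X → X := l from (♯ 1 · X :- l ≈ ♯ 0 ∷ [])) refl (l ∷ + suc x ∷ [])
        (zero-productℤ {+ suc x} {+ suc x - l} (λ ()) (ringℤ 2 (λ l X → X :* (X :- l) := ♯ 0 from (♯ 1 · curve l X (♯ 0) ≈ ♯ 0 ∷ [])) refl (l ∷ + suc x ∷ []) (h , tt)) , tt)) refl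
      step _ ih X (suc y) zero e refl h = ⊥-elim (impossible 2 (λ i y → :- curve (lₑ i) (1+ y) (1+ y)) refl (i ∷ y ∷ [])
          (cong -_ (subst (λ X → Curve X (+ suc y)) (cong +_ (trans e (ℕₚ.+-identityʳ (suc y)))) h)))
      step _ ih X (suc y) (suc d) e refl h = Step.step y d X e h ih _ refl

  -- The descent finds no smallest point with positive coordinates. The exception is l = 7, where
  -- (2, 1) and (4, 1) lie on the conic; that conic is left to a finite search.
  module Positive (i : ℕ) (i≢3 : i ≢ 3) where

    l : ℤ
    l = + 4 + + i

    Curve : ℤ → ℤ → Set
    Curve X Y = X * X - (+ 2 * l - + 1) * X * Y + Y * Y + l * X + l * Y ≡ + 0

    private
      curve : ∀ {n} → Expr n → Expr n → Expr n → Expr n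
      curve l X Y = X :* X :- (♯ 2 :* l :- ♯ 1) :* X :* Y :+ Y :* Y :+ l :* X :+ l :* Y

    Claim : ℕ → Set
    Claim n = ∀ X y g → X ≡ suc y ℕ.+ g → X ℕ.+ suc y ≡ n → ¬ Curve (+ X) (+ suc y)

    private
      partner : ∀ X Y → Curve X Y → Curve ((+ 2 * l - + 1) * Y - l - X) Y
      partner X Y h = ringℤ 3 (λ l X Y → curve l ((♯ 2 :* l :- ♯ 1) :* Y :- l :- X) Y := ♯ 0 from (♯ 1 · curve l X Y ≈ ♯ 0 ∷ []))
        refl (l ∷ X ∷ Y ∷ []) (h , tt)

      symmetric : ∀ X Y → Curve X Y → Curve Y X
      symmetric X Y h = ringℤ 3 (λ l X Y → curve l Y X := ♯ 0 from (♯ 1 · curve l X Y ≈ ♯ 0 ∷ [])) refl (l ∷ X ∷ Y ∷ []) (h , tt)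

      -- At X = Y the quadratic in X is (3 - 2l)Y² + 2lY, negative for Y ≥ 2 but equal to 3 for Y =
      -- 1, where the jump need not descend. There the two roots satisfy (X - 1)(X′ - 1) = 3 and
      -- have sum l - 1, which happens for l = 7 only.
      product-three : ∀ a b → (+ 1 + + a) * + b ≡ + 3 → + i ≡ + a + + b → ⊥
      product-three 0 b h s = i≢3 (ℤₚ.+-injective (ringℤ 2 (λ b i → i := ♯ 3 from (♯ 1 · i ≈ ♯ 0 :+ b ∷ ♯ 1 · (1+ ♯ 0) :* b ≈ ♯ 3 ∷ [])) refl (+ b ∷ + i ∷ []) (s , h , tt)))
      product-three 1 b h s = from-no (+ 2 ∣? + 3) (divides (+ b) (trans (sym h) (ℤₚ.*-comm (+ 2) (+ b))))
      product-three 2 b h s = i≢3 (ℤₚ.+-injective (cancelℤ {+ i} {+ 3} {+ 3} (λ ()) (ringℤ 2 (λ b i → ♯ 3 :* i := # (+ 3 * + 3) from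
        (♯ 3 · i ≈ ♯ 2 :+ b ∷ ♯ 1 · (1+ ♯ 2) :* b ≈ ♯ 3 ∷ [])) refl (+ b ∷ + i ∷ []) (s , h , tt))))
      product-three (suc (suc (suc a))) 0 h s = impossible 1 (λ a → ♯ 3 :- (♯ 4 :+ a) :* ♯ 0) refl (a ∷ []) (ℤₚ.i≡j⇒i-j≡0 (sym h))
      product-three (suc (suc (suc a))) (suc b) h s = impossible 2 (λ a b → (♯ 4 :+ a) :* (1+ b) :- ♯ 3) refl (a ∷ b ∷ []) (ℤₚ.i≡j⇒i-j≡0 h)

      module Step (y d X : ℕ) (X≡ : X ≡ suc y ℕ.+ suc d) (h : Curve (+ X) (+ suc y))
        (ih : ∀ {m} → m ℕ.< X ℕ.+ suc y → Claim m) where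
        Y = suc y

        module Partner (x′ : ℕ) (p : (+ 2 * l - + 1) * + Y - l - + X ≡ + suc x′) where
          X′ = suc x′

          unit-case : y ≡ 0 → ⊥
          unit-case y≡0 = product-three d x′
            (ringℤ 6 (λ l Y X X′ d x → (1+ d) :* x := ♯ 3 from
              (:- ♯ 1 · curve l X Y ≈ ♯ 0 ∷ ♯ 1 :- X · (♯ 2 :* l :- ♯ 1) :* Y :- l :- X ≈ X′
              ∷ ♯ 1 :- X′ · X ≈ Y :+ 1+ d ∷ :- Y :- d · X′ ≈ 1+ x ∷ ♯ 2 :+ Y :- l :- x · Y ≈ ♯ 1 ∷ []))
              refl (l ∷ + Y ∷ + X ∷ + X′ ∷ + d ∷ + x′ ∷ []) (h , p , cong +_ X≡ , refl , cong (λ y → + suc y) y≡0 , tt))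
            (ringℤ 6 (λ i Y X X′ d x → let l = lₑ i in i := d :+ x from
              (♯ 1 · (♯ 2 :* l :- ♯ 1) :* Y :- l :- X ≈ X′ ∷ ♯ 1 · X ≈ Y :+ 1+ d ∷ ♯ 1 · X′ ≈ 1+ x
              ∷ ♯ 1 :- (♯ 2 :* l :- ♯ 1) · Y ≈ ♯ 1 ∷ [])) refl (+ i ∷ + Y ∷ + X ∷ + X′ ∷ + d ∷ + x′ ∷ []) (p , cong +_ X≡ , refl , cong (λ y → + suc y) y≡0 , tt))

          smaller : ∀ y′ → y ≡ suc y′ → Gap X′ Y → ∃[ g ] Y ≡ X′ ℕ.+ suc g
          smaller y′ y≡ (less g e) = g , e
          smaller y′ y≡ (more g e) = ⊥-elim (impossible 4 (λ i y d g → let l = lₑ i; Y = ♯ 2 :+ y in (♯ 2 :* l :- ♯ 3) :* Y :* Y :- ♯ 2 :* l :* Y :+ (1+ d) :* g) refl (i ∷ y′ ∷ d ∷ g ∷ [])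
            (ringℤ 7 (λ l Y d g X X′ y → let Z = ♯ 2 :+ y in (♯ 2 :* l :- ♯ 3) :* Z :* Z :- ♯ 2 :* l :* Z :+ (1+ d) :* g := ♯ 0 from
              (:- ♯ 1 · curve l X Y ≈ ♯ 0 ∷ Y :- X · (♯ 2 :* l :- ♯ 1) :* Y :- l :- X ≈ X′ ∷ Y :- X′ · X ≈ Y :+ 1+ d ∷ :- (1+ d) · X′ ≈ Y :+ g
              ∷ :- (♯ 2 :* l :- ♯ 3) :* (Y :+ Z) :+ ♯ 2 :* l · Y ≈ Z ∷ []))
              refl (l ∷ + Y ∷ + d ∷ + g ∷ + X ∷ + X′ ∷ + y′ ∷ []) (h , p , cong +_ X≡ , cong +_ e , cong (λ y → + suc y) y≡ , tt)))

          conclude : ∃[ g ] Y ≡ X′ ℕ.+ suc g → ⊥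
          conclude (g , e) = ih (subst (Y ℕ.+ X′ ℕ.<_) (ℕₚ.+-comm Y X) (ℕₚ.+-monoʳ-< Y
              (ℕₚ.<-trans (subst (X′ ℕ.<_) (sym e) (ℕₚ.m<m+n X′ (ℕ.s≤s ℕ.z≤n))) (subst (Y ℕ.<_) (sym X≡) (ℕₚ.m<m+n Y (ℕ.s≤s ℕ.z≤n))))))
            Y x′ (suc g) e refl (symmetric (+ X′) (+ Y) (subst (λ z → Curve z (+ Y)) p (partner (+ X) (+ Y) h)))

          by : ∀ z → y ≡ z → ⊥
          by zero e = unit-case e
          by (suc y′) e = conclude (smaller y′ e (gap X′ Y))

        step : ∀ z → (+ 2 * l - + 1) * + Y - l - + X ≡ z → ⊥
        step (+ 0) p = impossible 2 (λ i y → curve (lₑ i) (♯ 0) (1+ y)) refl (i ∷ y ∷ []) (subst (λ z → Curve z (+ Y)) p (partner (+ X) (+ Y) h))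
        step (+ suc x′) p = Partner.by x′ p y refl
        step -[1+ m ] p = impossible 3 (λ i y m → curve (lₑ i) (:- (1+ m)) (1+ y)) refl (i ∷ y ∷ m ∷ [])
          (subst (λ z → Curve z (+ Y)) p (partner (+ X) (+ Y) h))

      equal : ∀ y → ¬ Curve (+ suc y) (+ suc y)
      equal zero h = impossible 1 (λ i → curve (lₑ i) (♯ 1) (♯ 1)) refl (i ∷ []) h
      equal (suc y) h = impossible 2 (λ i y → :- curve (lₑ i) (♯ 2 :+ y) (♯ 2 :+ y)) refl (i ∷ y ∷ []) (cong -_ h)

    no-points : ∀ n → Claim n
    no-points = <-rec Claim step
      where
      step : ∀ n → (∀ {m} → m ℕ.< n → Claim m) → Claim n
      step _ ih X y zero e refl h = equal y (subst (λ X → Curve X (+ suc y)) (cong +_ (trans e (ℕₚ.+-identityʳ (suc y)))) h)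
      step _ ih X y (suc d) e refl h = Step.step y d X e h ih _ refl

-- Finite search on the conics with small l.

module ConicSearch where
  open import Data.Integer using (_+_; _*_; -_; _-_)

  square-of-abs : ∀ z → z * z ≡ + (ℤ.∣ z ∣ ℕ.* ℤ.∣ z ∣)
  square-of-abs z = use (sign-split z)
    where
    use : ∃[ s ] (s * s ≡ + 1 × z ≡ s * + ℤ.∣ z ∣) → z * z ≡ + (ℤ.∣ z ∣ ℕ.* ℤ.∣ z ∣)
    use (s , ss , z≡) = trans (ringℤ 3 (λ z s a → z :* z := a :* a from (z :+ s :* a · z ≈ s :* a ∷ a :* a · s :* s ≈ ♯ 1 ∷ []))
      refl (z ∷ s ∷ + ℤ.∣ z ∣ ∷ []) (z≡ , ss , tt)) (sym (ℤₚ.pos-* ℤ.∣ z ∣ ℤ.∣ z ∣))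

  between-squares : ∀ r n m → n ℕ.* n ≡ m → r ℕ.* r ℕ.< m → m ℕ.< suc r ℕ.* suc r → ⊥
  between-squares r n _ refl lower upper = cases (n ℕ.≤? r)
    where
    cases : Dec (n ℕ.≤ r) → ⊥
    cases (yes n≤r) = ℕₚ.<⇒≱ lower (ℕₚ.*-mono-≤ n≤r n≤r)
    cases (no n≰r) = ℕₚ.<⇒≱ upper (ℕₚ.*-mono-≤ (ℕₚ.≰⇒> n≰r) (ℕₚ.≰⇒> n≰r))

  private
    improve : ℕ → ℕ → ℕ → ℕ
    improve m r b = if (r ℕ.+ b) ℕ.* (r ℕ.+ b) ℕ.≤ᵇ m then r ℕ.+ b else r

    -- Chooses the binary digits of the root from the top. The numbers tested stay below 2³⁶, so 18
    -- digits are enough.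
    isqrt-from : ℕ → ℕ → ℕ → ℕ
    isqrt-from m zero r = r
    isqrt-from m (suc k) r = isqrt-from m k (improve m r (2 ℕ.^ k))

    -- The split keeps isqrt m from unfolding when m is a variable.
    isqrt : ℕ → ℕ
    isqrt zero = 0
    isqrt (suc m) = isqrt-from (suc m) 18 0

  strictly-between : ℕ → ℕ → Bool
  strictly-between r m = (r ℕ.* r ℕ.<ᵇ m) ∧ (m ℕ.<ᵇ suc r ℕ.* suc r)

  strictly-between-sound : ∀ r m n → strictly-between r m ≡ true → n ℕ.* n ≢ m
  strictly-between-sound r m n ok h = let a , b = ∧-elim {r ℕ.* r ℕ.<ᵇ m} ok in
    between-squares r n m h (<ᵇ-sound (r ℕ.* r) m a) (<ᵇ-sound m (suc r ℕ.* suc r) b)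
    where
    <ᵇ-sound : ∀ a b → (a ℕ.<ᵇ b) ≡ true → a ℕ.< b
    <ᵇ-sound a b e = ℕₚ.<ᵇ⇒< a b (subst T (sym e) tt)

  -- The value of isqrt needs no specification, as strictly-between verifies it.
  non-square : ℤ → Bool
  non-square (+ m) = strictly-between (isqrt m) m
  non-square -[1+ _ ] = true

  non-square-sound : ∀ N z → non-square N ≡ true → z * z ≢ N
  non-square-sound N z ok h = by N (trans (sym (square-of-abs z)) h) ok
    where
    by : ∀ N → + (ℤ.∣ z ∣ ℕ.* ℤ.∣ z ∣) ≡ N → non-square N ≡ true → ⊥
    by (+ m) e ok = strictly-between-sound (isqrt m) m ℤ.∣ z ∣ ok (ℤₚ.+-injective e)

  divides? : ℕ → ℕ → Bool
  divides? zero m = false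
  divides? (suc d) m = (m ℕ.% suc d) ℕ.≡ᵇ 0

  divides?-complete : ∀ q m → q ≢ + 0 → q ∣ + m → divides? ℤ.∣ q ∣ m ≡ true
  divides?-complete q m q≢0 h = by ℤ.∣ q ∣ (λ e → q≢0 (ℤₚ.∣i∣≡0⇒i≡0 e)) (∣⇒∣ᵤ h)
    where
    by : ∀ d → d ≢ 0 → d ℕDiv.∣ m → divides? d m ≡ true
    by zero d≢0 _ = ⊥-elim (d≢0 refl)
    by (suc d) _ h = cong (ℕ._≡ᵇ 0) (ℕDivₚ.n∣m⇒m%n≡0 m (suc d) h)

  -- The number that q = l(l + 1) + x + y has to divide, which makes the search finite for each l.
  Divisible : ℕ → ℕ
  Divisible l = l ℕ.* suc l ℕ.* (2 ℕ.* l ℕ.* l ℕ.+ 2 ℕ.* l ℕ.+ 1)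

  -- The discriminant of z² - s z + p, times (2l + 1)².
  disc : ℤ → ℤ → ℤ
  disc l s = (+ 2 * l + + 1) * (s * ((+ 2 * l - + 3) * s - + 4 * l))

  any : ℤ → List ℤ → Bool
  any z [] = false
  any z (s ∷ ss) = (z == s) ∨ any z ss

  Among : ℤ → List ℤ → Set
  Among z [] = ⊥
  Among z (s ∷ ss) = z ≡ s ⊎ Among z ss

  any-sound : ∀ z ss → any z ss ≡ true → Among z ss
  any-sound z (s ∷ ss) h = [ (λ e → inj₁ (==-sound e)) , (λ e → inj₂ (any-sound z ss e)) ]′ (∨-elim {z == s} h)

  test : List ℤ → ℕ → ℤ → Bool
  test ss l q = divides? ℤ.∣ q ∣ (Divisible l) ⇒ᵇ (non-square (disc (+ l) (q - + (l ℕ.* suc l))) ∨ any (q - + (l ℕ.* suc l)) ss)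

  record Verified (ss : List ℤ) (l : ℕ) : Set where
    constructor verified
    field check : range-check (Divisible l) (test ss l) ≡ true

  -- The sums 0 and -4 belong to (0, 0) and (-2, -2), the sum -1 to the pair 0, -1 and the sum -3 to
  -- the pair -1, -2. For l = 2 the sum -32 belongs to the pair -8, -24.
  verified-1 : Verified (+ 0 ∷ -[1+ 0 ] ∷ -[1+ 2 ] ∷ -[1+ 3 ] ∷ []) 1
  verified-1 = verified refl

  verified-2 : Verified (+ 0 ∷ -[1+ 31 ] ∷ []) 2
  verified-2 = verified refl

  verified-3 : Verified (+ 0 ∷ []) 3
  verified-3 = verified refl

  verified-7 : Verified (+ 0 ∷ []) 7
  verified-7 = verified refl

-- Points of the conics under the divisibility condition.

module ConicPoints where
  open import Data.Integer using (_+_; _*_; -_; _-_)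
  open Conics
  open ConicSearch
  open ConicsPositive

  -- Values of k/27 at the pairs 0, -1, then -1, -2, then -8, -24. They satisfy the conic and the
  -- divisibility, so only another point on E₁ can exclude them.
  data Special : ℤ → Set where
    [-1] : Special -[1+ 0 ]
    [3] : Special (+ 3)
    [96256] : Special (+ 96256)

  data Outcome (x y : ℤ) : Set where
    equal : x ≡ y → Outcome x y
    special : ∀ c → Special c → x * x * x + + 3 * x * x * y * y + y * y * y ≡ c → Outcome x y

  outcome-swap : ∀ x y → Outcome x y → Outcome y x
  outcome-swap x y (equal e) = equal (sym e)
  outcome-swap x y (special c p h) = special c p (trans (ringℤ 2 (λ x y → y :* y :* y :+ ♯ 3 :* y :* y :* x :* x :+ x :* x :* x :=
    x :* x :* x :+ ♯ 3 :* x :* x :* y :* y :+ y :* y :* y from []) refl (x ∷ y ∷ []) tt) h)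

  square-zero : ∀ w → w * w ≡ + 0 → w ≡ + 0
  square-zero w h = by (w ℤ.≟ + 0)
    where
    by : Dec (w ≡ + 0) → w ≡ + 0
    by (yes e) = e
    by (no n) = zero-productℤ {w} {w} n h

  private
    1+_ : ∀ {n} → Expr n → Expr n
    1+ i = ♯ 1 :+ i

    equal-from : ∀ x y → (x - y) * (x - y) ≡ + 0 → x ≡ y
    equal-from x y h = ℤₚ.i-j≡0⇒i≡j x y (square-zero (x - y) h)

    equal-case : ∀ x y s p → x + y ≡ s → x * y ≡ p → s * s ≡ + 4 * p → Outcome x y
    equal-case x y s p s≡ p≡ e = equal (equal-from x y (ringℤ 4 (λ x y s p → (x :- y) :* (x :- y) := ♯ 0 from
      (x :+ y :+ s · x :+ y ≈ s ∷ :- ♯ 4 · x :* y ≈ p ∷ ♯ 1 · s :* s ≈ ♯ 4 :* p ∷ [])) refl (x ∷ y ∷ s ∷ p ∷ []) (s≡ , p≡ , e , tt)))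

    special-case : ∀ x y s p c → Special c → x + y ≡ s → x * y ≡ p → s * s * s - + 3 * s * p + + 3 * p * p ≡ c → Outcome x y
    special-case x y s p c q s≡ p≡ e = special c q (ringℤ 5 (λ x y s p c → x :* x :* x :+ ♯ 3 :* x :* x :* y :* y :+ y :* y :* y := c from
      ((x :+ y) :* (x :+ y) :+ (x :+ y) :* s :+ s :* s :- ♯ 3 :* x :* y · x :+ y ≈ s ∷ ♯ 3 :* (x :* y :+ p) :- ♯ 3 :* s · x :* y ≈ p
      ∷ ♯ 1 · s :* s :* s :- ♯ 3 :* s :* p :+ ♯ 3 :* p :* p ≈ c ∷ [])) refl (x ∷ y ∷ s ∷ p ∷ c ∷ []) (s≡ , p≡ , e , tt))

    product-from : ∀ l x y s p → Conic (+ l) x y → x + y ≡ s → (+ 2 * + l + + 1) * p ≡ s * (s + + l) → x * y ≡ p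
    product-from l x y s p C s≡ e = cancelℤ {x * y} {p} {+ 2 * + l + + 1} nonzero (trans C (trans (cong (λ s → s * (s + + l)) s≡) (sym e)))
      where
      nonzero : + 2 * + l + + 1 ≢ + 0
      nonzero h = impossible 1 (λ l → ♯ 2 :* l :+ ♯ 1) refl (l ∷ []) h

  -- With p = xy the conic turns (2l + 1)(2p - s) into s(2s - 1). Modulo q this vanishes while s is
  -- -l(l + 1), so that l(l + 1)(2l(l + 1) + 1) vanishes too.
  q-divides : ∀ l x y n → let s = x + y; q = l * (l + + 1) + s in Conic l x y → q * n ≡ + 2 * (x * y) - s →
    q ∣ l * (l + + 1) * (+ 2 * l * l + + 2 * l + + 1)
  q-divides l x y n C D = divides ((+ 2 * l + + 1) * n - + 2 * (x + y) + + 2 * (l * (l + + 1)) + + 1) (ringℤ 4 (λ l x y n →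
    let s = x :+ y; t = l :* (l :+ ♯ 1); q = t :+ s in
    t :* (♯ 2 :* l :* l :+ ♯ 2 :* l :+ ♯ 1) := ((♯ 2 :* l :+ ♯ 1) :* n :- ♯ 2 :* s :+ ♯ 2 :* t :+ ♯ 1) :* q from
    (:- (♯ 2 :* l :+ ♯ 1) · q :* n ≈ ♯ 2 :* (x :* y) :- s ∷ :- ♯ 2 · (♯ 2 :* l :+ ♯ 1) :* (x :* y) ≈ s :* (s :+ l) ∷ []))
    refl (l ∷ x ∷ y ∷ n ∷ []) (D , C , tt))

  searched : ∀ ss l → Verified ss l → + Divisible l ≢ + 0 → ∀ x y q → Conic (+ l) x y → q ≡ + (l ℕ.* suc l) + (x + y) → q ≢ + 0 → q ∣ + Divisible l → Among (x + y) ss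
  searched ss l (verified ok) M≢0 x y q C q≡ q≢0 q∣M = finish (∨-elim {non-square (disc (+ l) (q - + (l ℕ.* suc l)))} (⇒ᵇ-elim {divides? ℤ.∣ q ∣ (Divisible l)}
      (range-search (Divisible l) (test ss l) ok q (divisor-bound {q} {+ Divisible l} M≢0 q∣M)) (divides?-complete q (Divisible l) q≢0 q∣M)))
    where
    t = + (l ℕ.* suc l)
    s≡ : q - t ≡ x + y
    s≡ = ringℤ 3 (λ q t s → q :- t := s from (♯ 1 · q ≈ t :+ s ∷ [])) refl (q ∷ t ∷ x + y ∷ []) (q≡ , tt)
    z = (+ 2 * + l + + 1) * (x - y)
    zz : z * z ≡ disc (+ l) (x + y)
    zz = ringℤ 3 (λ l x y → let a = ♯ 2 :* l :+ ♯ 1; s = x :+ y in a :* (x :- y) :* (a :* (x :- y)) := a :* (s :* ((♯ 2 :* l :- ♯ 3) :* s :- ♯ 4 :* l)) from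
      (:- ♯ 4 :* a · a :* (x :* y) ≈ s :* (s :+ l) ∷ [])) refl (+ l ∷ x ∷ y ∷ []) (C , tt)
    finish : non-square (disc (+ l) (q - t)) ≡ true ⊎ any (q - t) ss ≡ true → Among (x + y) ss
    finish (inj₁ e) = ⊥-elim (non-square-sound (disc (+ l) (q - t)) z e (trans zz (cong (disc (+ l)) (sym s≡))))
    finish (inj₂ e) = subst (λ z → Among z ss) s≡ (any-sound (q - t) ss e)

  module _ (x y : ℤ) where

    one : Conic (+ 1) x y → Among (x + y) (+ 0 ∷ -[1+ 0 ] ∷ -[1+ 2 ] ∷ -[1+ 3 ] ∷ []) → Outcome x y
    one C (inj₁ e) = equal-case x y (+ 0) (+ 0) e (product-from 1 x y (+ 0) (+ 0) C e refl) refl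
    one C (inj₂ (inj₁ e)) = special-case x y -[1+ 0 ] (+ 0) -[1+ 0 ] [-1] e (product-from 1 x y -[1+ 0 ] (+ 0) C e refl) refl
    one C (inj₂ (inj₂ (inj₁ e))) = special-case x y -[1+ 2 ] (+ 2) (+ 3) [3] e (product-from 1 x y -[1+ 2 ] (+ 2) C e refl) refl
    one C (inj₂ (inj₂ (inj₂ (inj₁ e)))) = equal-case x y -[1+ 3 ] (+ 4) e (product-from 1 x y -[1+ 3 ] (+ 4) C e refl) refl

    two : Conic (+ 2) x y → Among (x + y) (+ 0 ∷ -[1+ 31 ] ∷ []) → Outcome x y
    two C (inj₁ e) = equal-case x y (+ 0) (+ 0) e (product-from 2 x y (+ 0) (+ 0) C e refl) refl
    two C (inj₂ (inj₁ e)) = special-case x y -[1+ 31 ] (+ 192) (+ 96256) [96256] e (product-from 2 x y -[1+ 31 ] (+ 192) C e refl) refl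

    zero-sum : ∀ l → Conic (+ l) x y → Among (x + y) (+ 0 ∷ []) → Outcome x y
    zero-sum l C (inj₁ e) = equal-case x y (+ 0) (+ 0) e (product-from l x y (+ 0) (+ 0) C e (trans (ℤₚ.*-zeroʳ (+ 2 * + l + + 1)) refl)) refl

  -- x² + x y + y² = 0.
  degenerate : ∀ x y → Conic (+ 0) x y → Outcome x y
  degenerate x y C = equal (equal-from x y (trans (square-of-abs (x - y)) (cong +_ (ℕₚ.m+n≡0⇒n≡0 (3 ℕ.* (ℤ.∣ x + y ∣ ℕ.* ℤ.∣ x + y ∣)) (ℤₚ.+-injective sum)))))
    where
    sum : + (3 ℕ.* (ℤ.∣ x + y ∣ ℕ.* ℤ.∣ x + y ∣) ℕ.+ ℤ.∣ x - y ∣ ℕ.* ℤ.∣ x - y ∣) ≡ + 0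
    sum = trans (cong₂ _+_ (trans (ℤₚ.pos-* 3 (ℤ.∣ x + y ∣ ℕ.* ℤ.∣ x + y ∣)) (cong (+ 3 *_) (sym (square-of-abs (x + y))))) (sym (square-of-abs (x - y))))
      (ringℤ 2 (λ x y → ♯ 3 :* ((x :+ y) :* (x :+ y)) :+ (x :- y) :* (x :- y) := ♯ 0 from
        (:- ♯ 4 · (♯ 2 :* ♯ 0 :+ ♯ 1) :* (x :* y) ≈ (x :+ y) :* (x :+ y :+ ♯ 0) ∷ [])) refl (x ∷ y ∷ []) (C , tt))

  module NegativeCase (i : ℕ) where
    open Negative i

    private
      j∤1 : ∀ c → + 1 ≢ c * j
      j∤1 c h = ℕₚ.<⇒≱ (ℕ.s≤s (ℕ.s≤s ℕ.z≤n)) (divisor-bound {j} {+ 1} (λ ()) (divides c h))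

      j≢0 : j ≢ + 0
      j≢0 ()

      jₑ : ∀ {n} → Expr n → Expr n
      jₑ i = ♯ 2 :+ i

      Rₑ Mₑ : ∀ {n} → Expr n → Expr n
      Rₑ j = ♯ 8 :* j :* j :* j :* j :+ ♯ 4 :* j :* j :* j :- ♯ 2 :* j :* j :- j
      Mₑ j = (:- j) :* (:- j :+ ♯ 1) :* (♯ 2 :* (:- j) :* (:- j) :+ ♯ 2 :* (:- j) :+ ♯ 1)

    M : ℤ
    M = (- j) * (- j + + 1) * (+ 2 * (- j) * (- j) + + 2 * (- j) + + 1)

    module _ (X W n : ℤ) (D : ((- j) * (- j + + 1) + (X - W)) * n ≡ + 2 * (X * - W) - (X - W))
      (q∣M : (- j) * (- j + + 1) + (X - W) ∣ M) where

      -- The second and third points would make j divide 1, the fourth would make 4j² + j - 1 divide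
      -- the smaller positive number j² + j - 2, and at the far points q exceeds in absolute value
      -- the positive number M that it divides. Only x = y = 0 is left.
      finish : Class X W → Outcome X (- W)
      finish (origin a b) = equal (trans a (sym (cong -_ b)))
      finish (second a b) = ⊥-elim (j∤1 (- n) (cancelℤ {+ 1} {(- n) * j} {j} j≢0 (ringℤ 4 (λ j X W n → j :* ♯ 1 := j :* ((:- n) :* j) from
          (♯ 1 · ((:- j) :* (:- j :+ ♯ 1) :+ (X :- W)) :* n ≈ ♯ 2 :* (X :* (:- W)) :- (X :- W)
          ∷ :- n :- ♯ 2 :* W :- ♯ 1 · X ≈ j ∷ n :- ♯ 2 :* j :+ ♯ 1 · W ≈ ♯ 0 ∷ [])) refl (j ∷ X ∷ W ∷ n ∷ []) (D , a , b , tt))))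
      finish (third a b) = ⊥-elim (j∤1 (n - + 4 * j + + 2) (cancelℤ {+ 1} {(n - + 4 * j + + 2) * j} {j} j≢0 (ringℤ 4 (λ j X W n → j :* ♯ 1 := j :* ((n :- ♯ 4 :* j :+ ♯ 2) :* j) from
          (♯ 1 · ((:- j) :* (:- j :+ ♯ 1) :+ (X :- W)) :* n ≈ ♯ 2 :* (X :* (:- W)) :- (X :- W)
          ∷ :- n :- ♯ 2 :* W :- ♯ 1 · X ≈ j ∷ n :- ♯ 2 :* j :+ ♯ 1 · W ≈ ♯ 2 :* j :* j ∷ [])) refl (j ∷ X ∷ W ∷ n ∷ []) (D , a , b , tt))))
      finish (fourth a b) = ⊥-elim (too-big (+ 4 * j * j + j - + 1) (j * j + j - + 2)
        (natural 1 (λ i → let j = jₑ i in ♯ 4 :* j :* j :+ j :- ♯ 1 :- (j :* j :+ j :- ♯ 2) :- ♯ 1) refl (i ∷ []))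
        (natural 1 (λ i → let j = jₑ i in j :* j :+ j :- ♯ 2 :- ♯ 1) refl (i ∷ []))
        (divides (n + + 4 * j * j + j + + 2) (cancelℤ {j * j + j - + 2} {(n + + 4 * j * j + j + + 2) * (+ 4 * j * j + j - + 1)} {j} j≢0
          (ringℤ 4 (λ j X W n → let F = ♯ 4 :* j :* j :* j :+ ♯ 2 :* j :* j in
            j :* (j :* j :+ j :- ♯ 2) := j :* ((n :+ ♯ 4 :* j :* j :+ j :+ ♯ 2) :* (♯ 4 :* j :* j :+ j :- ♯ 1)) from
            (:- ♯ 1 · ((:- j) :* (:- j :+ ♯ 1) :+ (X :- W)) :* n ≈ ♯ 2 :* (X :* (:- W)) :- (X :- W)
            ∷ n :+ ♯ 2 :* W :+ ♯ 1 · X ≈ F ∷ :- n :+ ♯ 2 :* F :- ♯ 1 · W ≈ ♯ 2 :* j :* j ∷ [])) refl (j ∷ X ∷ W ∷ n ∷ []) (D , a , b , tt)))))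
      finish (far⁺ k) = ⊥-elim (too-big ((- j) * (- j + + 1) + (X - W)) M
        (subst Natural (ringℤ 3 (λ j X W → (X :- W :- Rₑ j) :+ ((:- j) :* (:- j :+ ♯ 1) :+ Rₑ j :- Mₑ j :- ♯ 1) := (:- j) :* (:- j :+ ♯ 1) :+ (X :- W) :- Mₑ j :- ♯ 1 from [])
            refl (j ∷ X ∷ W ∷ []) tt)
          (natural-+ (X - W - R) k 1 (λ i → let j = jₑ i in (:- j) :* (:- j :+ ♯ 1) :+ Rₑ j :- Mₑ j :- ♯ 1) refl (i ∷ [])))
        (natural 1 (λ i → Mₑ (jₑ i) :- ♯ 1) refl (i ∷ [])) q∣M)
      finish (far⁻ k) = ⊥-elim (too-big (- ((- j) * (- j + + 1) + (X - W))) M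
        (subst Natural (ringℤ 3 (λ j X W → (W :- X :- Rₑ j) :+ (:- ((:- j) :* (:- j :+ ♯ 1)) :+ Rₑ j :- Mₑ j :- ♯ 1) := :- ((:- j) :* (:- j :+ ♯ 1) :+ (X :- W)) :- Mₑ j :- ♯ 1 from [])
            refl (j ∷ X ∷ W ∷ []) tt)
          (natural-+ (W - X - R) k 1 (λ i → let j = jₑ i in :- ((:- j) :* (:- j :+ ♯ 1)) :+ Rₑ j :- Mₑ j :- ♯ 1) refl (i ∷ [])))
        (natural 1 (λ i → Mₑ (jₑ i) :- ♯ 1) refl (i ∷ [])) (negated q∣M))
        where
        negated : ∀ {q M} → q ∣ M → - q ∣ M
        negated {q} {M} (divides e h) = divides (- e) (trans h (ringℤ 2 (λ q e → e :* q := (:- e) :* (:- q) from []) refl (q ∷ e ∷ []) tt))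

    to-curve : ∀ X W → Conic (- j) X (- W) → Curve X W
    to-curve X W C = ringℤ 3 (λ j X W → X :* X :- (♯ 1 :+ ♯ 2 :* j) :* X :* W :+ W :* W :- j :* X :+ j :* W := ♯ 0 from
      (:- ♯ 1 · (♯ 2 :* (:- j) :+ ♯ 1) :* (X :* (:- W)) ≈ (X :- W) :* (X :- W :- j) ∷ [])) refl (j ∷ X ∷ W ∷ []) (C , tt)

    oriented : ∀ X W n → Conic (- j) (+ X) (- (+ W)) → ((- j) * (- j + + 1) + (+ X - + W)) * n ≡ + 2 * (+ X * - (+ W)) - (+ X - + W) → Outcome (+ X) (- (+ W))
    oriented X W n C D = finish (+ X) (+ W) n D (q-divides (- j) (+ X) (- (+ W)) n C D) (classify (X ℕ.+ W) X W refl (to-curve (+ X) (+ W) C))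

    conic-swap : ∀ x y → Conic (- j) x y → Conic (- j) y x
    conic-swap x y C = ringℤ 3 (λ j x y → (♯ 2 :* (:- j) :+ ♯ 1) :* (y :* x) := (y :+ x) :* (y :+ x :- j) from
      (♯ 1 · (♯ 2 :* (:- j) :+ ♯ 1) :* (x :* y) ≈ (x :+ y) :* (x :+ y :- j) ∷ [])) refl (j ∷ x ∷ y ∷ []) (C , tt)

    D-swap : ∀ x y n → ((- j) * (- j + + 1) + (x + y)) * n ≡ + 2 * (x * y) - (x + y) → ((- j) * (- j + + 1) + (y + x)) * n ≡ + 2 * (y * x) - (y + x)
    D-swap x y n D = ringℤ 4 (λ j x y n → ((:- j) :* (:- j :+ ♯ 1) :+ (y :+ x)) :* n := ♯ 2 :* (y :* x) :- (y :+ x) from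
      (♯ 1 · ((:- j) :* (:- j :+ ♯ 1) :+ (x :+ y)) :* n ≈ ♯ 2 :* (x :* y) :- (x :+ y) ∷ [])) refl (j ∷ x ∷ y ∷ n ∷ []) (D , tt)

    outcome : ∀ x y n → Conic (- j) x y → ((- j) * (- j + + 1) + (x + y)) * n ≡ + 2 * (x * y) - (x + y) → Outcome x y
    outcome (+ X) (+ 0) n C D = oriented X 0 n C D
    outcome (+ X) -[1+ w ] n C D = oriented X (suc w) n C D
    outcome (+ 0) (+ suc y) n C D = outcome-swap (+ suc y) (+ 0) (oriented (suc y) 0 n (conic-swap (+ 0) (+ suc y) C) (D-swap (+ 0) (+ suc y) n D))
    outcome -[1+ w ] (+ Y) n C D = outcome-swap (+ Y) -[1+ w ] (oriented Y (suc w) n (conic-swap -[1+ w ] (+ Y) C) (D-swap -[1+ w ] (+ Y) n D))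
    outcome (+ suc x) (+ suc y) n C D = ⊥-elim (impossible 3 (λ i x y → let j = jₑ i; X = 1+ x; Y = 1+ y in (X :+ Y) :* (X :+ Y :- j) :- (♯ 2 :* (:- j) :+ ♯ 1) :* (X :* Y))
      refl (i ∷ x ∷ y ∷ []) (ℤₚ.i≡j⇒i-j≡0 (sym C)))
    outcome -[1+ x ] -[1+ y ] n C D = ⊥-elim (impossible 3 (λ i x y → let j = jₑ i; X = :- (1+ x); Y = :- (1+ y) in (X :+ Y) :* (X :+ Y :- j) :- (♯ 2 :* (:- j) :+ ♯ 1) :* (X :* Y))
      refl (i ∷ x ∷ y ∷ []) (ℤₚ.i≡j⇒i-j≡0 (sym C)))

  module PositiveCase (i : ℕ) (i≢3 : i ≢ 3) where
    open NonPositive i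

    private
      l∤1 : ∀ c → + 1 ≢ c * l
      l∤1 c h = ℕₚ.<⇒≱ (ℕ.s≤s (ℕ.s≤s ℕ.z≤n)) (divisor-bound {l} {+ 1} (λ ()) (divides c h))

      l≢0 : l ≢ + 0
      l≢0 ()

      lₑ : ∀ {n} → Expr n → Expr n
      lₑ i = ♯ 4 :+ i

      Rₑ Mₑ : ∀ {n} → Expr n → Expr n
      Rₑ l = ♯ 8 :* l :* l :* l :* l :- ♯ 4 :* l :* l :* l :- ♯ 2 :* l :* l :+ l
      Mₑ l = l :* (l :+ ♯ 1) :* (♯ 2 :* l :* l :+ ♯ 2 :* l :+ ♯ 1)

    M : ℤ
    M = l * (l + + 1) * (+ 2 * l * l + + 2 * l + + 1)

    module _ (X Y n : ℤ) (D : (l * (l + + 1) + (- X + - Y)) * n ≡ + 2 * (- X * - Y) - (- X + - Y))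
      (q∣M : l * (l + + 1) + (- X + - Y) ∣ M) where

      finish : Class X Y → Outcome (- X) (- Y)
      finish (origin a b) = equal (trans (cong -_ a) (sym (cong -_ b)))
      finish (second a b) = ⊥-elim (l∤1 n (cancelℤ {+ 1} {n * l} {l} l≢0 (ringℤ 4 (λ l X Y n → l :* ♯ 1 := l :* (n :* l) from
          (:- ♯ 1 · (l :* (l :+ ♯ 1) :+ (:- X :+ :- Y)) :* n ≈ ♯ 2 :* ((:- X) :* (:- Y)) :- (:- X :+ :- Y)
          ∷ :- n :- ♯ 2 :* Y :- ♯ 1 · X ≈ l ∷ :- n :- ♯ 2 :* l :- ♯ 1 · Y ≈ ♯ 0 ∷ [])) refl (l ∷ X ∷ Y ∷ n ∷ []) (D , a , b , tt))))
      finish (third a b) = ⊥-elim (l∤1 (- n - + 4 * l - + 2) (cancelℤ {+ 1} {(- n - + 4 * l - + 2) * l} {l} l≢0 (ringℤ 4 (λ l X Y n → l :* ♯ 1 := l :* ((:- n :- ♯ 4 :* l :- ♯ 2) :* l) from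
          (:- ♯ 1 · (l :* (l :+ ♯ 1) :+ (:- X :+ :- Y)) :* n ≈ ♯ 2 :* ((:- X) :* (:- Y)) :- (:- X :+ :- Y)
          ∷ :- n :- ♯ 2 :* Y :- ♯ 1 · X ≈ ♯ 2 :* l :* l ∷ :- n :- ♯ 4 :* l :* l :- ♯ 1 · Y ≈ l ∷ [])) refl (l ∷ X ∷ Y ∷ n ∷ []) (D , a , b , tt))))
      finish (fourth a b) = ⊥-elim (too-big (+ 4 * l * l - l - + 1) (l * l - l - + 2)
        (natural 1 (λ i → let l = lₑ i in ♯ 4 :* l :* l :- l :- ♯ 1 :- (l :* l :- l :- ♯ 2) :- ♯ 1) refl (i ∷ []))
        (natural 1 (λ i → let l = lₑ i in l :* l :- l :- ♯ 2 :- ♯ 1) refl (i ∷ []))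
        (divides (n + + 4 * l * l - l + + 2) (cancelℤ {l * l - l - + 2} {(n + + 4 * l * l - l + + 2) * (+ 4 * l * l - l - + 1)} {l} l≢0
          (ringℤ 4 (λ l X Y n → let F = ♯ 4 :* l :* l :* l :- ♯ 2 :* l :* l in
            l :* (l :* l :- l :- ♯ 2) := l :* ((n :+ ♯ 4 :* l :* l :- l :+ ♯ 2) :* (♯ 4 :* l :* l :- l :- ♯ 1)) from
            (♯ 1 · (l :* (l :+ ♯ 1) :+ (:- X :+ :- Y)) :* n ≈ ♯ 2 :* ((:- X) :* (:- Y)) :- (:- X :+ :- Y)
            ∷ n :+ ♯ 2 :* Y :+ ♯ 1 · X ≈ F ∷ n :+ ♯ 2 :* F :+ ♯ 1 · Y ≈ ♯ 2 :* l :* l ∷ [])) refl (l ∷ X ∷ Y ∷ n ∷ []) (D , a , b , tt)))))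
      finish (far k) = ⊥-elim (too-big (- (l * (l + + 1) + (- X + - Y))) M
        (subst Natural (ringℤ 3 (λ l X Y → (X :+ Y :- Rₑ l) :+ (:- (l :* (l :+ ♯ 1)) :+ Rₑ l :- Mₑ l :- ♯ 1) := :- (l :* (l :+ ♯ 1) :+ (:- X :+ :- Y)) :- Mₑ l :- ♯ 1 from [])
            refl (l ∷ X ∷ Y ∷ []) tt)
          (natural-+ (X + Y - R) k 1 (λ i → let l = lₑ i in :- (l :* (l :+ ♯ 1)) :+ Rₑ l :- Mₑ l :- ♯ 1) refl (i ∷ [])))
        (natural 1 (λ i → Mₑ (lₑ i) :- ♯ 1) refl (i ∷ [])) (negated q∣M))
        where
        negated : ∀ {q M} → q ∣ M → - q ∣ M
        negated {q} {M} (divides e h) = divides (- e) (trans h (ringℤ 2 (λ q e → e :* q := (:- e) :* (:- q) from []) refl (q ∷ e ∷ []) tt))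

    to-curve : ∀ X Y → Conic l (- X) (- Y) → Curve X Y
    to-curve X Y C = ringℤ 3 (λ l X Y → X :* X :- (♯ 2 :* l :- ♯ 1) :* X :* Y :+ Y :* Y :- l :* X :- l :* Y := ♯ 0 from
      (:- ♯ 1 · (♯ 2 :* l :+ ♯ 1) :* ((:- X) :* (:- Y)) ≈ (:- X :+ :- Y) :* (:- X :+ :- Y :+ l) ∷ [])) refl (l ∷ X ∷ Y ∷ []) (C , tt)

    conic-swap : ∀ x y → Conic l x y → Conic l y x
    conic-swap x y C = ringℤ 3 (λ l x y → (♯ 2 :* l :+ ♯ 1) :* (y :* x) := (y :+ x) :* (y :+ x :+ l) from
      (♯ 1 · (♯ 2 :* l :+ ♯ 1) :* (x :* y) ≈ (x :+ y) :* (x :+ y :+ l) ∷ [])) refl (l ∷ x ∷ y ∷ []) (C , tt)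

    D-swap : ∀ x y n → (l * (l + + 1) + (x + y)) * n ≡ + 2 * (x * y) - (x + y) → (l * (l + + 1) + (y + x)) * n ≡ + 2 * (y * x) - (y + x)
    D-swap x y n D = ringℤ 4 (λ l x y n → (l :* (l :+ ♯ 1) :+ (y :+ x)) :* n := ♯ 2 :* (y :* x) :- (y :+ x) from
      (♯ 1 · (l :* (l :+ ♯ 1) :+ (x :+ y)) :* n ≈ ♯ 2 :* (x :* y) :- (x :+ y) ∷ [])) refl (l ∷ x ∷ y ∷ n ∷ []) (D , tt)

    descending : ∀ X Y n g → X ≡ Y ℕ.+ g → Conic l (- (+ X)) (- (+ Y)) → (l * (l + + 1) + (- (+ X) + - (+ Y))) * n ≡ + 2 * (- (+ X) * - (+ Y)) - (- (+ X) + - (+ Y)) → Outcome (- (+ X)) (- (+ Y))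
    descending X Y n g e C D = finish (+ X) (+ Y) n D (q-divides l (- (+ X)) (- (+ Y)) n C D) (classify (X ℕ.+ Y) X Y g e refl (to-curve (+ X) (+ Y) C))

    non-positive : ∀ X Y n → Conic l (- (+ X)) (- (+ Y)) → (l * (l + + 1) + (- (+ X) + - (+ Y))) * n ≡ + 2 * (- (+ X) * - (+ Y)) - (- (+ X) + - (+ Y)) → Outcome (- (+ X)) (- (+ Y))
    non-positive X Y n C D = by (gap X Y)
      where
      by : Gap X Y → Outcome (- (+ X)) (- (+ Y))
      by (more g e) = descending X Y n g e C D
      by (less g e) = outcome-swap (- (+ Y)) (- (+ X)) (descending Y X n (suc g) e (conic-swap (- (+ X)) (- (+ Y)) C) (D-swap (- (+ X)) (- (+ Y)) n D))

    no-positive : ∀ x y → ¬ Conic l (+ suc x) (+ suc y)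
    no-positive x y C = by (gap (suc x) (suc y))
      where
      open Positive i i≢3 using (no-points)
      curve : ∀ X Y → Conic l X Y → Positive.Curve i i≢3 X Y
      curve X Y C = ringℤ 3 (λ l X Y → X :* X :- (♯ 2 :* l :- ♯ 1) :* X :* Y :+ Y :* Y :+ l :* X :+ l :* Y := ♯ 0 from
        (:- ♯ 1 · (♯ 2 :* l :+ ♯ 1) :* (X :* Y) ≈ (X :+ Y) :* (X :+ Y :+ l) ∷ [])) refl (l ∷ X ∷ Y ∷ []) (C , tt)
      by : Gap (suc x) (suc y) → ⊥
      by (more g e) = no-points (suc x ℕ.+ suc y) (suc x) y g e refl (curve (+ suc x) (+ suc y) C)
      by (less g e) = no-points (suc y ℕ.+ suc x) (suc y) x (suc g) e refl (curve (+ suc y) (+ suc x) (conic-swap (+ suc x) (+ suc y) C))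

    no-mixed : ∀ x w → ¬ Conic l (+ suc x) (- (+ w))
    no-mixed x w C = impossible 3 (λ i x w → let l = lₑ i; X = 1+ x; W = :- w in (X :+ W) :* (X :+ W :+ l) :- (♯ 2 :* l :+ ♯ 1) :* (X :* W))
      refl (i ∷ x ∷ w ∷ []) (ℤₚ.i≡j⇒i-j≡0 (sym C))

    outcome : ∀ x y n → Conic l x y → (l * (l + + 1) + (x + y)) * n ≡ + 2 * (x * y) - (x + y) → Outcome x y
    outcome (+ 0) (+ 0) n C D = non-positive 0 0 n C D
    outcome (+ 0) -[1+ y ] n C D = non-positive 0 (suc y) n C D
    outcome -[1+ x ] (+ 0) n C D = non-positive (suc x) 0 n C D
    outcome -[1+ x ] -[1+ y ] n C D = non-positive (suc x) (suc y) n C D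
    outcome (+ suc x) (+ suc y) n C D = ⊥-elim (no-positive x y C)
    outcome (+ suc x) (+ 0) n C D = ⊥-elim (no-mixed x 0 C)
    outcome (+ suc x) -[1+ y ] n C D = ⊥-elim (no-mixed x (suc y) C)
    outcome (+ 0) (+ suc y) n C D = ⊥-elim (no-mixed y 0 (conic-swap (+ 0) (+ suc y) C))
    outcome -[1+ x ] (+ suc y) n C D = ⊥-elim (no-mixed y (suc x) (conic-swap -[1+ x ] (+ suc y) C))

  -- For l = -1 the conic is p = -s(s - 1) and q = s, so q divides 2p - s = s(1 - 2s) on the whole
  -- conic; this case is out of reach of the divisibility and is excluded here.
  conic-points : ∀ l x y n → l ≢ -[1+ 0 ] → l * (l + + 1) + (x + y) ≢ + 0 → Conic l x y →
    (l * (l + + 1) + (x + y)) * n ≡ + 2 * (x * y) - (x + y) → Outcome x y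
  conic-points (+ 0) x y n _ _ C D = degenerate x y C
  conic-points (+ 1) x y n _ q≢0 C D = one x y C (searched _ 1 verified-1 (λ ()) x y (+ 2 + (x + y)) C refl q≢0 (q-divides (+ 1) x y n C D))
  conic-points (+ 2) x y n _ q≢0 C D = two x y C (searched _ 2 verified-2 (λ ()) x y (+ 6 + (x + y)) C refl q≢0 (q-divides (+ 2) x y n C D))
  conic-points (+ 3) x y n _ q≢0 C D = zero-sum x y 3 C (searched _ 3 verified-3 (λ ()) x y (+ 12 + (x + y)) C refl q≢0 (q-divides (+ 3) x y n C D))
  conic-points (+ suc (suc (suc (suc i)))) x y n _ q≢0 C D = by i (i ℕ.≟ 3) C q≢0 D
    where
    by : ∀ i → Dec (i ≡ 3) → let l = + 4 + + i in Conic l x y → l * (l + + 1) + (x + y) ≢ + 0 → (l * (l + + 1) + (x + y)) * n ≡ + 2 * (x * y) - (x + y) → Outcome x y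
    by _ (yes refl) C q≢0 D = zero-sum x y 7 C (searched _ 7 verified-7 (λ ()) x y (+ 56 + (x + y)) C refl q≢0 (q-divides (+ 7) x y n C D))
    by i (no i≢3) C q≢0 D = PositiveCase.outcome i i≢3 x y n C D
  conic-points -[1+ 0 ] x y n l≢-1 _ _ _ = ⊥-elim (l≢-1 refl)
  conic-points -[1+ suc i ] x y n _ _ C D = NegativeCase.outcome i x y n C D

-- Small orders of the image on E₁.

-- Arithmetic of the slopes L of 2P and -(L + N) of 3P, where P = (-4s, 4 (2p - 3s)) lies on Y² = X³ + 9X² + 64k
-- with s = x + y and p = x y, and Q = X(2P) - X(P).
module SlopesE₁ where
  open import Data.Integer using (_+_; _*_; -_; _-_)
  open Descent
  open OrderSix
  open Conics
  open ConicSearch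
  open ConicPoints

  private
    small-sums : ℤ → ℤ → Bool
    small-sums e f = (e * f == + 36) ⇒ᵇ ((ℤ.∣ e + f + + 3 ∣ ℕ.<ᵇ 64) ∧ not (e + f + + 3 == + 0))

    record SmallSums : Set where
      constructor verified
      field check : range-check 36 (λ e → range-check 36 (small-sums e)) ≡ true

    small-sums-verified : SmallSums
    small-sums-verified = verified refl

    not-elim : ∀ {b} → not b ≡ true → b ≡ true → ⊥
    not-elim {true} () _

    no-sum : SmallSums → ∀ e f → e * f ≡ + 36 → + 64 ∣ e + f + + 3 → e + f + + 3 ≢ + 0 → ⊥
    no-sum (verified ok) e f h d z≢0 = use (∧-elim {ℤ.∣ e + f + + 3 ∣ ℕ.<ᵇ 64} (⇒ᵇ-elim {e * f == + 36} (range-search 36 (small-sums e)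
        (range-search 36 (λ e → range-check 36 (small-sums e)) ok e (divisor-bound {e} {+ 36} (λ ()) (divides f (trans (sym h) (ℤₚ.*-comm e f))))) f
        (divisor-bound {f} {+ 36} (λ ()) (divides e (sym h)))) (==-complete h)))
      where
      use : (ℤ.∣ e + f + + 3 ∣ ℕ.<ᵇ 64) ≡ true × not (e + f + + 3 == + 0) ≡ true → ⊥
      use (lt , _) = ℕₚ.<⇒≱ (ℕₚ.<ᵇ⇒< ℤ.∣ e + f + + 3 ∣ 64 (subst T (sym lt) tt)) (divisor-bound {+ 64} {e + f + + 3} z≢0 d)

  -- The hypothesis is (u - 6)(v - 6) = 36 and turns the quartic into w²(w - 9) = 64k with w = u + v
  -- odd. So 64 divides w - 9, which is the sum of two complementary divisors of 36 plus 3 and too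
  -- small for that unless it is zero; but then k = 0.
  mixed-impossible : ∀ k u v → k ≢ + 0 → Quarter k u v → Comaximal (+ 2) (u + v) → u * v ≡ + 6 * (u + v) → ⊥
  mixed-impossible k u v k≢0 h c uv = no-sum small-sums-verified (u - + 6) (v - + 6)
      (ringℤ 2 (λ u v → (u :- ♯ 6) :* (v :- ♯ 6) := ♯ 36 from (♯ 1 · u :* v ≈ ♯ 6 :* (u :+ v) ∷ [])) refl (u ∷ v ∷ []) (uv , tt))
      (subst (+ 64 ∣_) w-9 (divides-cancelˡ {+ 64} {w * w} {w - + 9} (comaximal-sym (comaximal-^ʳ 6 (comaximal-sym (comaximal-*ʳ {+ 2} {w} {w} c c))))
        (divides k (trans ww (ℤₚ.*-comm (+ 64) k)))))
      (λ e → k≢0 (cancelℤ {k} {+ 0} {+ 64} (λ ()) (trans (sym ww) (ringℤ 1 (λ w → w :* w :* (w :- ♯ 9) := ♯ 0 from (w :* w · w :- ♯ 9 ≈ ♯ 0 ∷ [])) refl (w ∷ []) (trans w-9 e , tt)))))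
    where
    w = u + v
    w-9 : w - + 9 ≡ u - + 6 + (v - + 6) + + 3
    w-9 = ringℤ 2 (λ u v → u :+ v :- ♯ 9 := u :- ♯ 6 :+ (v :- ♯ 6) :+ ♯ 3 from []) refl (u ∷ v ∷ []) tt
    ww : w * w * (w - + 9) ≡ + 64 * k
    ww = cancelℤ {w * w * (w - + 9)} {+ 64 * k} {+ 4} (λ ()) (ringℤ 3 (λ k u v → let w = u :+ v in ♯ 4 :* (w :* w :* (w :- ♯ 9)) := ♯ 4 :* (♯ 64 :* k) from
      (♯ 1 · ♯ 4 :* u :* u :* u :+ u :* u :* v :* v :+ ♯ 4 :* v :* v :* v ≈ ♯ 256 :* k
      ∷ ♯ 12 :* w :- u :* v :- ♯ 6 :* w · u :* v ≈ ♯ 6 :* w ∷ [])) refl (k ∷ u ∷ v ∷ []) (h , uv , tt))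

  private
    two-torsion-test : ℤ → ℤ → Bool
    two-torsion-test x y = (+ 2 * (x * y) == + 3 * (x + y)) ⇒ᵇ ((x == y) ∨ (x * x * x + x * x * y * y + y * y * y == + 368) ∨ (x * x * x + x * x * y * y + y * y * y == -[1+ 16 ]))

    record TwoTorsion : Set where
      constructor verified
      field check : range-check 6 (λ x → range-check 6 (two-torsion-test x)) ≡ true

    two-torsion-verified : TwoTorsion
    two-torsion-verified = verified refl

  -- Equivalently (2x - 3)(2y - 3) = 9, so both coordinates are at most 6 in absolute value. Besides
  -- x = y there are the pairs 6, 2 and 1, -3, with k = 368 and k = -17.
  two-torsion-points : ∀ x y k → x * x * x + x * x * y * y + y * y * y ≡ k → + 2 * (x * y) ≡ + 3 * (x + y) → x ≡ y ⊎ k ≡ + 368 ⊎ k ≡ -[1+ 16 ]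
  two-torsion-points x y k k≡ h = search two-torsion-verified
    where
    factors : (+ 2 * x - + 3) * (+ 2 * y - + 3) ≡ + 9
    factors = ringℤ 2 (λ x y → (♯ 2 :* x :- ♯ 3) :* (♯ 2 :* y :- ♯ 3) := ♯ 9 from (♯ 2 · ♯ 2 :* (x :* y) ≈ ♯ 3 :* (x :+ y) ∷ [])) refl (x ∷ y ∷ []) (h , tt)
    bound : ∀ x → + 2 * x - + 3 ∣ + 9 → ℤ.∣ x ∣ ℕ.≤ 6
    bound x d = ℕₚ.*-cancelˡ-≤ 2 (subst (ℕ._≤ 12) (trans (cong ℤ.∣_∣ (ringℤ 1 (λ x → (♯ 2 :* x :- ♯ 3) :+ ♯ 3 := ♯ 2 :* x from []) refl (x ∷ []) tt)) (ℤₚ.abs-* (+ 2) x))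
      (ℕₚ.≤-trans (ℤₚ.∣i+j∣≤∣i∣+∣j∣ (+ 2 * x - + 3) (+ 3)) (ℕₚ.+-monoˡ-≤ 3 (divisor-bound {+ 2 * x - + 3} {+ 9} (λ ()) d))))
    search : TwoTorsion → x ≡ y ⊎ k ≡ + 368 ⊎ k ≡ -[1+ 16 ]
    search (verified ok) = use (∨-elim {x == y} (⇒ᵇ-elim {+ 2 * (x * y) == + 3 * (x + y)} (range-search 6 (two-torsion-test x)
        (range-search 6 (λ x → range-check 6 (two-torsion-test x)) ok x (bound x (divides (+ 2 * y - + 3) (trans (sym factors) (ℤₚ.*-comm (+ 2 * x - + 3) (+ 2 * y - + 3))))))
        y (bound y (divides (+ 2 * x - + 3) (sym factors)))) (==-complete h)))
      where
      K = x * x * x + x * x * y * y + y * y * y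
      last : (K == + 368) ≡ true ⊎ (K == -[1+ 16 ]) ≡ true → x ≡ y ⊎ k ≡ + 368 ⊎ k ≡ -[1+ 16 ]
      last (inj₁ e) = inj₂ (inj₁ (trans (sym k≡) (==-sound e)))
      last (inj₂ e) = inj₂ (inj₂ (trans (sym k≡) (==-sound e)))
      use : (x == y) ≡ true ⊎ (K == + 368) ∨ (K == -[1+ 16 ]) ≡ true → x ≡ y ⊎ k ≡ + 368 ⊎ k ≡ -[1+ 16 ]
      use (inj₁ e) = inj₁ (==-sound e)
      use (inj₂ e) = last (∨-elim {K == + 368} e)

  private
    -- This is a²(s² - 4p) for s = -3l(l + 1), ap = 9l³(l + 1) and a = 2l + 1, the values forced by
    -- Q = 0.
    discriminant₃ : ℤ → ℤ
    discriminant₃ l = let a = + 1 + l * + 2 in + 9 * l * l * (l + + 1) * (a * a * (l + + 1) - + 4 * a * l)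

    three-torsion-test : ℤ → Bool
    three-torsion-test l = non-square (discriminant₃ l) ∨ (l == + 0) ∨ (l == -[1+ 0 ])

    record ThreeTorsion : Set where
      constructor verified
      field check : range-check 5 three-torsion-test ≡ true

    three-torsion-verified : ThreeTorsion
    three-torsion-verified = verified refl

  module _ (x y L : ℤ) (LD : L * (+ 2 * (x * y) - + 3 * (x + y)) ≡ + 3 * (x + y) * (+ 2 * (x + y) - + 3))
    (D≢0 : + 2 * (x * y) - + 3 * (x + y) ≢ + 0) where

    private
      s p D Q : ℤ
      s = x + y
      p = x * y
      D = + 2 * p - + 3 * s
      Q = L * L - + 9 + + 12 * s

    -- From L² = 9 - 12s the slope is three times an odd number a = 2l + 1. The tangent equation
    -- becomes ap = 9l³(l + 1), and as a is prime to l and l + 1 it divides 9. For the finitely many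
    -- l the discriminant is no square, except where s = p = 0.
    three-torsion-impossible : Q ≢ + 0
    three-torsion-impossible Q≡0 = with-a (either (factor-3 L L (divides (+ 3 - + 4 * s) (ringℤ 2 (λ L s → L :* L := (♯ 3 :- ♯ 4 :* s) :* ♯ 3 from
        (♯ 1 · L :* L :- ♯ 9 :+ ♯ 12 :* s ≈ ♯ 0 ∷ [])) refl (L ∷ s ∷ []) (Q≡0 , tt)))))
      where
      with-a : + 3 ∣ L → ⊥
      with-a (divides a L≡) = with-l (odd-form a a-odd)
        where
        aa : + 3 * (a * a) ≡ + 3 - + 4 * s
        aa = cancelℤ {+ 3 * (a * a)} {+ 3 - + 4 * s} {+ 3} (λ ()) (ringℤ 3 (λ L s a → ♯ 3 :* (♯ 3 :* (a :* a)) := ♯ 3 :* (♯ 3 :- ♯ 4 :* s) from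
          (♯ 1 · L :* L :- ♯ 9 :+ ♯ 12 :* s ≈ ♯ 0 ∷ :- (L :+ a :* ♯ 3) · L ≈ a :* ♯ 3 ∷ [])) refl (L ∷ s ∷ a ∷ []) (Q≡0 , L≡ , tt))
        a-odd : Comaximal (+ 2) a
        a-odd = 2∤⇒ a λ (divides b a≡) → 2∤1 (divides (+ 3 * (b * a) + + 2 * s - + 1) (ringℤ 3 (λ s a b → ♯ 1 := (♯ 3 :* (b :* a) :+ ♯ 2 :* s :- ♯ 1) :* ♯ 2 from
          (:- ♯ 1 · ♯ 3 :* (a :* a) ≈ ♯ 3 :- ♯ 4 :* s ∷ ♯ 3 :* a · a ≈ b :* ♯ 2 ∷ [])) refl (s ∷ a ∷ b ∷ []) (aa , a≡ , tt)))
        with-l : ∃[ l ] a ≡ + 1 + l * + 2 → ⊥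
        with-l (l , a≡) = search three-torsion-verified
          where
          s≡ : s ≡ - (+ 3 * (l * (l + + 1)))
          s≡ = cancelℤ {s} { - (+ 3 * (l * (l + + 1)))} {+ 4} (λ ()) (ringℤ 3 (λ s a l → ♯ 4 :* s := ♯ 4 :* (:- (♯ 3 :* (l :* (l :+ ♯ 1)))) from
            (♯ 1 · ♯ 3 :* (a :* a) ≈ ♯ 3 :- ♯ 4 :* s ∷ :- (♯ 3 :* (a :+ ♯ 1 :+ l :* ♯ 2)) · a ≈ ♯ 1 :+ l :* ♯ 2 ∷ []))
            refl (s ∷ a ∷ l ∷ []) (aa , a≡ , tt))
          ap : a * p ≡ + 9 * (l * l * l * (l + + 1))
          ap = cancelℤ {a * p} {+ 9 * (l * l * l * (l + + 1))} {+ 6} (λ ()) (ringℤ 5 (λ L s p a l → let σ = :- (♯ 3 :* (l :* (l :+ ♯ 1))) in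
            ♯ 6 :* (a :* p) := ♯ 6 :* (♯ 9 :* (l :* l :* l :* (l :+ ♯ 1))) from
            (♯ 1 · L :* (♯ 2 :* p :- ♯ 3 :* s) ≈ ♯ 3 :* s :* (♯ 2 :* s :- ♯ 3) ∷ :- (♯ 2 :* p :- ♯ 3 :* s) · L ≈ a :* ♯ 3
            ∷ ♯ 9 :* s · a ≈ ♯ 1 :+ l :* ♯ 2 ∷ ♯ 6 :* (s :+ σ) :+ ♯ 18 :* l · s ≈ σ ∷ []))
            refl (L ∷ s ∷ p ∷ a ∷ l ∷ []) (LD , L≡ , a≡ , s≡ , tt))
          a∣9 : a ∣ + 9
          a∣9 = divides-cancelˡ {a} {l * l * l * (l + + 1)} {+ 9} (comaximal-*ʳ {a} {l * l * l} {l + + 1} (comaximal-*ʳ {a} {l * l} {l} (comaximal-*ʳ {a} {l} {l} ⊥l ⊥l) ⊥l) ⊥l+1)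
            (divides p (trans (ℤₚ.*-comm (l * l * l * (l + + 1)) (+ 9)) (trans (sym ap) (ℤₚ.*-comm a p))))
            where
            ⊥l : Comaximal a l
            ⊥l = bezout (+ 1) -[1+ 1 ] (ringℤ 2 (λ a l → ♯ 1 :* a :+ # -[1+ 1 ] :* l := ♯ 1 from (♯ 1 · a ≈ ♯ 1 :+ l :* ♯ 2 ∷ [])) refl (a ∷ l ∷ []) (a≡ , tt))
            ⊥l+1 : Comaximal a (l + + 1)
            ⊥l+1 = bezout -[1+ 0 ] (+ 2) (ringℤ 2 (λ a l → # -[1+ 0 ] :* a :+ ♯ 2 :* (l :+ ♯ 1) := ♯ 1 from (:- ♯ 1 · a ≈ ♯ 1 :+ l :* ♯ 2 ∷ [])) refl (a ∷ l ∷ []) (a≡ , tt))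
          l≤5 : ℤ.∣ l ∣ ℕ.≤ 5
          l≤5 = ℕₚ.*-cancelˡ-≤ 2 (subst (ℕ._≤ 10) (trans (cong ℤ.∣_∣ (ringℤ 2 (λ a l → a :+ :- ♯ 1 := ♯ 2 :* l from (♯ 1 · a ≈ ♯ 1 :+ l :* ♯ 2 ∷ [])) refl (a ∷ l ∷ []) (a≡ , tt))) (ℤₚ.abs-* (+ 2) l))
            (ℕₚ.≤-trans (ℤₚ.∣i+j∣≤∣i∣+∣j∣ a -[1+ 0 ]) (ℕₚ.+-monoˡ-≤ 1 (divisor-bound {a} {+ 9} (λ ()) a∣9))))
          square : a * (x - y) * (a * (x - y)) ≡ discriminant₃ l
          square = ringℤ 4 (λ x y a l → let s = x :+ y; σ = :- (♯ 3 :* (l :* (l :+ ♯ 1))); b = ♯ 1 :+ l :* ♯ 2; t = ♯ 9 :* (l :* l :* l :* (l :+ ♯ 1)) in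
            a :* (x :- y) :* (a :* (x :- y)) := ♯ 9 :* l :* l :* (l :+ ♯ 1) :* (b :* b :* (l :+ ♯ 1) :- ♯ 4 :* b :* l) from
            (a :* a :* (s :+ σ) · s ≈ σ ∷ :- ♯ 4 :* a · a :* (x :* y) ≈ t ∷ σ :* σ :* (a :+ b) :- ♯ 4 :* t · a ≈ b ∷ [])) refl (x ∷ y ∷ a ∷ l ∷ []) (s≡ , ap , a≡ , tt)
          vanishing : s ≡ + 0 → a * p ≡ + 0 → a ≢ + 0 → ⊥
          vanishing e h a≢0 = D≢0 (ringℤ 2 (λ s p → ♯ 2 :* p :- ♯ 3 :* s := ♯ 0 from (♯ 2 · p ≈ ♯ 0 ∷ :- ♯ 3 · s ≈ ♯ 0 ∷ [])) refl (s ∷ p ∷ []) (zero-productℤ {a} {p} a≢0 h , e , tt))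
          a≢0 : a ≢ + 0
          a≢0 e = odd-not-even a a-odd (divides (+ 0) e)
          last : (l == + 0) ≡ true ⊎ (l == -[1+ 0 ]) ≡ true → ⊥
          last (inj₁ e) = vanishing (trans s≡ (cong (λ l → - (+ 3 * (l * (l + + 1)))) (==-sound {l} {+ 0} e))) (trans ap (cong (λ l → + 9 * (l * l * l * (l + + 1))) (==-sound {l} {+ 0} e))) a≢0
          last (inj₂ e) = vanishing (trans s≡ (cong (λ l → - (+ 3 * (l * (l + + 1)))) (==-sound {l} { -[1+ 0 ]} e))) (trans ap (cong (λ l → + 9 * (l * l * l * (l + + 1))) (==-sound {l} { -[1+ 0 ]} e))) a≢0
          search : ThreeTorsion → ⊥
          search (verified ok) = [ (λ e → non-square-sound (discriminant₃ l) (a * (x - y)) e square) , (λ e → last (∨-elim {l == + 0} e)) ]′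
            (∨-elim {non-square (discriminant₃ l)} (range-search 5 three-torsion-test ok l l≤5))

    module _ (N : ℤ) (NQ : N * Q ≡ + 8 * D) (Q≢0 : Q ≢ + 0) where

      -- Both sides are 72s(2s - 3): the left one by the tangent equation, the right one because Q -
      -- L² = 12s - 9. It relates the slopes without s and p.
      key : + 3 * L * N * Q ≡ (Q - L * L) * (Q - L * L) - + 81
      key = ringℤ 4 (λ L N s p → let D = ♯ 2 :* p :- ♯ 3 :* s; Q = L :* L :- ♯ 9 :+ ♯ 12 :* s in
        ♯ 3 :* L :* N :* Q := (Q :- L :* L) :* (Q :- L :* L) :- ♯ 81 from
        (♯ 3 :* L · N :* Q ≈ ♯ 8 :* D ∷ ♯ 24 · L :* D ≈ ♯ 3 :* s :* (♯ 2 :* s :- ♯ 3) ∷ [])) refl (L ∷ N ∷ s ∷ p ∷ []) (NQ , LD , tt)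

      N≢0 : N ≢ + 0
      N≢0 e = D≢0 (cancelℤ {D} {+ 0} {+ 8} (λ ()) (trans (sym NQ) (trans (cong (_* Q) e) (ℤₚ.*-zeroˡ Q))))

      -- For N = -2L the identity `key` becomes (Q + 2L²)² = 3L⁴ + 81. As Q is odd, NQ = 8D makes 4
      -- divide L; the equation makes 3 divide L and the base of the square. With L = 12c what
      -- remains is m² = 768c⁴ + 1, hence c = 0, L = 0, N = 0 and D = 0.
      four-torsion-impossible : + 2 ∣ L → N ≡ - (+ 2 * L) → ⊥
      four-torsion-impossible (divides L₁ L≡) N≡ = with-4 (divides-cancelˡ {+ 4} {Q} {L} (comaximal-*ˡ {+ 2} {+ 2} {Q} Q-odd Q-odd)
          (divides (- D) (cancelℤ {Q * L} {(- D) * + 4} {+ 2} (λ ()) (ringℤ 4 (λ L N Q D → ♯ 2 :* (Q :* L) := ♯ 2 :* ((:- D) :* ♯ 4) from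
            (:- ♯ 1 · N :* Q ≈ ♯ 8 :* D ∷ Q · N ≈ :- (♯ 2 :* L) ∷ [])) refl (L ∷ N ∷ Q ∷ D ∷ []) (NQ , N≡ , tt)))))
        where
        Q-odd : Comaximal (+ 2) Q
        Q-odd = bezout (- (L₁ * L - + 5 + + 6 * s)) (+ 1) (ringℤ 3 (λ L L₁ s → (:- (L₁ :* L :- ♯ 5 :+ ♯ 6 :* s)) :* ♯ 2 :+ ♯ 1 :* (L :* L :- ♯ 9 :+ ♯ 12 :* s) := ♯ 1 from
          (L · L ≈ L₁ :* ♯ 2 ∷ [])) refl (L ∷ L₁ ∷ s ∷ []) (L≡ , tt))
        square : (Q + + 2 * L * L) * (Q + + 2 * L * L) ≡ + 3 * (L * L * (L * L)) + + 81
        square = ringℤ 3 (λ L N Q → (Q :+ ♯ 2 :* L :* L) :* (Q :+ ♯ 2 :* L :* L) := ♯ 3 :* (L :* L :* (L :* L)) :+ ♯ 81 from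
          (:- ♯ 1 · ♯ 3 :* L :* N :* Q ≈ (Q :- L :* L) :* (Q :- L :* L) :- ♯ 81 ∷ ♯ 3 :* L :* Q · N ≈ :- (♯ 2 :* L) ∷ [])) refl (L ∷ N ∷ Q ∷ []) (key , N≡ , tt)
        m = Q + + 2 * L * L
        with-4 : + 4 ∣ L → ⊥
        with-4 (divides r L≡4r) = with-m (either (factor-3 m m (divides (L * L * (L * L) + + 27) (trans square (ringℤ 1 (λ z → ♯ 3 :* z :+ ♯ 81 := (z :+ ♯ 27) :* ♯ 3 from []) refl (L * L * (L * L) ∷ []) tt)))))
          where
          with-m : + 3 ∣ m → ⊥
          with-m (divides m₁ m≡) = with-3 3∣r
            where
            3m₁m₁ : + 3 * (m₁ * m₁) ≡ L * L * (L * L) + + 27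
            3m₁m₁ = cancelℤ {+ 3 * (m₁ * m₁)} {L * L * (L * L) + + 27} {+ 3} (λ ()) (ringℤ 3 (λ z m m₁ → ♯ 3 :* (♯ 3 :* (m₁ :* m₁)) := ♯ 3 :* (z :+ ♯ 27) from
              (♯ 1 · m :* m ≈ ♯ 3 :* z :+ ♯ 81 ∷ :- (m :+ m₁ :* ♯ 3) · m ≈ m₁ :* ♯ 3 ∷ [])) refl (L * L * (L * L) ∷ m ∷ m₁ ∷ []) (square , m≡ , tt))
            3∣L : + 3 ∣ L
            3∣L = either (factor-3 L L (either (factor-3 (L * L) (L * L) (divides (m₁ * m₁ - + 9) (ringℤ 2 (λ z w → z := (w :- ♯ 9) :* ♯ 3 from
              (:- ♯ 1 · ♯ 3 :* w ≈ z :+ ♯ 27 ∷ [])) refl (L * L * (L * L) ∷ m₁ * m₁ ∷ []) (3m₁m₁ , tt))))))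
            3∣r : + 3 ∣ r
            3∣r = divides-cancelˡ {+ 3} {+ 4} {r} (bezout -[1+ 0 ] (+ 1) refl) (subst (+ 3 ∣_) (trans L≡4r (ℤₚ.*-comm r (+ 4))) 3∣L)
            with-3 : + 3 ∣ r → ⊥
            with-3 (divides c r≡) = with-m₁ (either (factor-3 m₁ m₁ (divides (+ 2304 * c ⁴ + + 3) (trans m₁m₁ (ringℤ 1 (λ C → ♯ 6912 :* C :+ ♯ 9 := (♯ 2304 :* C :+ ♯ 3) :* ♯ 3 from []) refl (c ⁴ ∷ []) tt)))))
              where
              L≡12c : L ≡ + 12 * c
              L≡12c = ringℤ 3 (λ L r c → L := ♯ 12 :* c from (♯ 1 · L ≈ r :* ♯ 4 ∷ ♯ 4 · r ≈ c :* ♯ 3 ∷ [])) refl (L ∷ r ∷ c ∷ []) (L≡4r , r≡ , tt)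
              m₁m₁ : m₁ * m₁ ≡ + 6912 * c ⁴ + + 9
              m₁m₁ = cancelℤ {m₁ * m₁} {+ 6912 * c ⁴ + + 9} {+ 3} (λ ()) (ringℤ 3 (λ L c w → let t = ♯ 12 :* c in ♯ 3 :* w := ♯ 3 :* (♯ 6912 :* (c :* c :* (c :* c)) :+ ♯ 9) from
                (♯ 1 · ♯ 3 :* w ≈ L :* L :* (L :* L) :+ ♯ 27 ∷ L :* L :* L :+ L :* L :* t :+ L :* t :* t :+ t :* t :* t · L ≈ t ∷ [])) refl (L ∷ c ∷ m₁ * m₁ ∷ []) (3m₁m₁ , L≡12c , tt))
              with-m₁ : + 3 ∣ m₁ → ⊥
              with-m₁ (divides m₂ m₁≡) = D≢0 (cancelℤ {D} {+ 0} {+ 8} (λ ()) (ringℤ 5 (λ L N Q D c → ♯ 8 :* D := ♯ 8 :* ♯ 0 from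
                (:- ♯ 1 · N :* Q ≈ ♯ 8 :* D ∷ Q · N ≈ :- (♯ 2 :* L) ∷ :- ♯ 2 :* Q · L ≈ ♯ 12 :* c ∷ :- ♯ 24 :* Q · c ≈ ♯ 0 ∷ []))
                refl (L ∷ N ∷ Q ∷ D ∷ c ∷ []) (NQ , N≡ , L≡12c , c≡0 , tt)))
                where
                c≡0 : c ≡ + 0
                c≡0 = square-descent m₂ c (cancelℤ {m₂ * m₂} {+ 768 * c ⁴ + + 1} {+ 9} (λ ()) (ringℤ 3 (λ m₁ m₂ C → ♯ 9 :* (m₂ :* m₂) := ♯ 9 :* (♯ 768 :* C :+ ♯ 1) from
                  (♯ 1 · m₁ :* m₁ ≈ ♯ 6912 :* C :+ ♯ 9 ∷ :- (m₁ :+ m₂ :* ♯ 3) · m₁ ≈ m₂ :* ♯ 3 ∷ [])) refl (m₁ ∷ m₂ ∷ c ⁴ ∷ []) (m₁m₁ , m₁≡ , tt)))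

      -- Substituting Q into `key` gives exactly the equation of `six-torsion`, whose solutions make
      -- Q vanish.
      six-torsion-impossible : Q ≡ + 2 * (N + L) * (N + + 2 * L) → ⊥
      six-torsion-impossible Q≡ = Q≢0 (trans Q≡ (trans (ℤₚ.*-assoc (+ 2) (N + L) (N + + 2 * L)) (cong (+ 2 *_) (six-torsion L N
        (ringℤ 3 (λ L N Q → let R = ♯ 2 :* (N :+ L) :* (N :+ ♯ 2 :* L) in
          (♯ 3 :* L :+ ♯ 2 :* N) :* (♯ 3 :* L :* L :* L :+ ♯ 6 :* L :* L :* N :+ ♯ 6 :* L :* N :* N :+ ♯ 2 :* N :* N :* N) := ♯ 81 from
          (:- ♯ 1 · ♯ 3 :* L :* N :* Q ≈ (Q :- L :* L) :* (Q :- L :* L) :- ♯ 81 ∷ ♯ 3 :* L :* N :- (Q :+ R) :+ ♯ 2 :* L :* L · Q ≈ R ∷ []))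
          refl (L ∷ N ∷ Q ∷ []) (key , Q≡ , tt))))))

      -- The doubling of 2P: F = -(M + L) satisfies F (N + 2L) = Q.
      double-slope : ∀ M X₂ Y₂ → + 3 * X₂ ≡ L * L + + 2 * Q - + 9 → + 2 * Y₂ ≡ - (Q * (N + + 2 * L)) → + 2 * Y₂ * M ≡ + 3 * X₂ * X₂ + + 18 * X₂ →
        Q ≡ - ((N + + 2 * L) * (M + L))
      double-slope M X₂ Y₂ hX hY hM = cancelℤ {Q} { - ((N + + 2 * L) * (M + L))} {+ 3 * Q} (product-nonzeroℤ {+ 3} {Q} (λ ()) Q≢0)
        (ringℤ 6 (λ L N Q M X Y → ♯ 3 :* Q :* Q := ♯ 3 :* Q :* (:- ((N :+ ♯ 2 :* L) :* (M :+ L))) from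
          (:- ♯ 3 · ♯ 2 :* Y :* M ≈ ♯ 3 :* X :* X :+ ♯ 18 :* X ∷ ♯ 3 :* M · ♯ 2 :* Y ≈ :- (Q :* (N :+ ♯ 2 :* L))
          ∷ :- (♯ 3 :* X :+ ♯ 18 :+ L :* L :+ ♯ 2 :* Q :- ♯ 9) · ♯ 3 :* X ≈ L :* L :+ ♯ 2 :* Q :- ♯ 9
          ∷ ♯ 1 · ♯ 3 :* L :* N :* Q ≈ (Q :- L :* L) :* (Q :- L :* L) :- ♯ 81 ∷ []))
          refl (L ∷ N ∷ Q ∷ M ∷ X₂ ∷ Y₂ ∷ []) (hM , hY , hX , key , tt))

      -- 3 (2P) = O.
      double-three-torsion : ∀ M → Q ≡ - ((N + + 2 * L) * (M + L)) → M * M ≡ L * L + + 2 * Q → ⊥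
      double-three-torsion M h MM = by (M + L ℤ.≟ + 0)
        where
        factored : (M + L) * (M - L + + 2 * (N + + 2 * L)) ≡ + 0
        factored = ringℤ 4 (λ L N Q M → (M :+ L) :* (M :- L :+ ♯ 2 :* (N :+ ♯ 2 :* L)) := ♯ 0 from
          (♯ 1 · M :* M ≈ L :* L :+ ♯ 2 :* Q ∷ ♯ 2 · Q ≈ :- ((N :+ ♯ 2 :* L) :* (M :+ L)) ∷ [])) refl (L ∷ N ∷ Q ∷ M ∷ []) (MM , h , tt)
        by : Dec (M + L ≡ + 0) → ⊥
        by (yes e) = Q≢0 (trans h (trans (cong (λ z → - ((N + + 2 * L) * z)) e) (cong -_ (ℤₚ.*-zeroʳ (N + + 2 * L)))))
        by (no M+L≢0) = six-torsion-impossible (ringℤ 4 (λ L N Q M → Q := ♯ 2 :* (N :+ L) :* (N :+ ♯ 2 :* L) from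
          (♯ 1 · Q ≈ :- ((N :+ ♯ 2 :* L) :* (M :+ L)) ∷ :- (N :+ ♯ 2 :* L) · M :- L :+ ♯ 2 :* (N :+ ♯ 2 :* L) ≈ ♯ 0 ∷ []))
          refl (L ∷ N ∷ Q ∷ M ∷ []) (h , zero-productℤ {M + L} {M - L + + 2 * (N + + 2 * L)} M+L≢0 factored , tt))

-- Integral points of the quartic when E₁ has rank zero.

module IntegerPointsE₁ (K : FractionField) (k : ℤ) (k≢0 : k ≢ + 0) where
  open import Data.Integer using (_+_; _*_; -_; _-_)
  open Conics using (Conic)
  open ConicSearch using (non-square; non-square-sound; divides?; divides?-complete)
  open ConicPoints
  open SlopesE₁

  A₁ B₁ : ℤ
  A₁ = + 9
  B₁ = + 64 * k

  nonsingular₁ : EllipticCurve.Nonsingular K (FractionField.ι# K A₁) (FractionField.ι# K B₁)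
  nonsingular₁ = nonsingular-criterion K A₁ B₁ (product-nonzeroℤ {+ 64} {k} (λ ()) k≢0)
    (λ h → 2∤1 (divides (+ 14 + + 8 * k) (cancelℤ {+ 1} {(+ 14 + + 8 * k) * + 2} {+ 108} (λ ()) (ringℤ 1 (λ k → ♯ 108 :* ♯ 1 := ♯ 108 :* ((♯ 14 :+ ♯ 8 :* k) :* ♯ 2) from
      (:- ♯ 1 · ♯ 2916 :+ ♯ 27 :* (♯ 64 :* k) ≈ ♯ 0 ∷ [])) refl (k ∷ []) (h , tt)))))

  open FractionField K using (ι#)
  open NagellLutz K A₁ B₁ nonsingular₁
  open TorsionPoints K A₁ B₁ nonsingular₁
  open TorsionCongruences K A₁ B₁ nonsingular₁

  private
    minus-one-test : ℤ → Bool
    minus-one-test s = divides? ℤ.∣ s + + 1 ∣ 9 ⇒ᵇ (non-square (+ 5 * s * s - + 4 * s) ∨ (s == + 0))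

    record MinusOne : Set where
      constructor verified
      field check : range-check 10 minus-one-test ≡ true

    minus-one-verified : MinusOne
    minus-one-verified = verified refl

    minus-one-solved : MinusOne → ∀ s d M → s ≢ + 0 → d * d ≡ + 5 * s * s - + 4 * s → (s + + 1) * (+ 12 - M) ≡ + 9 → ⊥
    minus-one-solved (verified ok) s d M s≢0 dd h =
      [ (λ e → non-square-sound (+ 5 * s * s - + 4 * s) d e dd) , (λ e → s≢0 (==-sound {s} {+ 0} e)) ]′
      (∨-elim {non-square (+ 5 * s * s - + 4 * s)} (⇒ᵇ-elim {divides? ℤ.∣ s + + 1 ∣ 9} (range-search 10 minus-one-test ok s s≤10)
        (divides?-complete (s + + 1) 9 s+1≢0 s+1∣9)))
      where
      s+1∣9 : s + + 1 ∣ + 9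
      s+1∣9 = divides (+ 12 - M) (trans (sym h) (ℤₚ.*-comm (s + + 1) (+ 12 - M)))
      s+1≢0 : s + + 1 ≢ + 0
      s+1≢0 e = absurd (trans (sym h) (trans (cong (_* (+ 12 - M)) e) (ℤₚ.*-zeroˡ (+ 12 - M))))
        where
        absurd : + 9 ≢ + 0
        absurd ()
      s≤10 : ℤ.∣ s ∣ ℕ.≤ 10
      s≤10 = subst (ℕ._≤ 10) (cong ℤ.∣_∣ (ringℤ 1 (λ s → s :+ ♯ 1 :+ # -[1+ 0 ] := s from []) refl (s ∷ []) tt))
        (ℕₚ.≤-trans (ℤₚ.∣i+j∣≤∣i∣+∣j∣ (s + + 1) -[1+ 0 ]) (ℕₚ.+-monoˡ-≤ 1 (divisor-bound {s + + 1} {+ 9} (λ ()) s+1∣9)))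

    [3,-6]∈ : ∀ {k x y} → k ≡ + 135 → x ≡ + 3 → y ≡ -[1+ 5 ] → Exceptional k x y
    [3,-6]∈ refl refl refl = [3,-6]

    [-6,3]∈ : ∀ {k x y} → k ≡ + 135 → x ≡ -[1+ 5 ] → y ≡ + 3 → Exceptional k x y
    [-6,3]∈ refl refl refl = [-6,3]

    2⊥3 : Comaximal (+ 3) (+ 2)
    2⊥3 = bezout (+ 1) -[1+ 0 ] refl

  module _ (all-torsion : ∀ P → Torsion P) where

    integer-point : ∀ X Y → OnℤCurve X Y → TorsionPoint X Y
    integer-point X Y on = torsionPoint on (all-torsion (aff (ι# X) (ι# Y) (embed {X} {Y} on)))

    nonintegral-tangent : ∀ X Y → OnℤCurve X Y → Y ≢ + 0 → ¬ + 2 * Y ∣ + 3 * X * X + + 18 * X → ⊥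
    nonintegral-tangent X Y on Y≢0 h = use (double X Y (integer-point X Y on) Y≢0)
      where
      use : ∃[ M ] (TangentSlope X Y M × TorsionPoint (doubleX X M) (doubleY X Y M)) → ⊥
      use (M , s , _) = h (divides M (trans (sym s) (ℤₚ.*-comm (+ 2 * Y) M)))

    private
      on-by : ∀ X Y c → k ≡ c → Y * Y ≡ X * X * X + A₁ * X * X + + 64 * c → OnℤCurve X Y
      on-by X Y _ refl h = h

    k≢368 : k ≢ + 368
    k≢368 h = nonintegral-tangent (+ 32) (+ 256) (on-by (+ 32) (+ 256) (+ 368) h refl) (λ ()) (from-no (+ 512 ∣? + 3648))

    k≢-17 : k ≢ -[1+ 16 ]
    k≢-17 h = nonintegral-tangent (+ 12) (+ 44) (on-by (+ 12) (+ 44) -[1+ 16 ] h refl) (λ ()) (from-no (+ 88 ∣? + 648))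

    no-special : ∀ c → Special c → k ≢ + 27 * c
    no-special _ [-1] h = nonintegral-tangent (+ 48) (+ 360) (on-by (+ 48) (+ 360) -[1+ 26 ] h refl) (λ ()) (from-no (+ 720 ∣? + 7776))
    no-special _ [3] h = nonintegral-tangent -[1+ 8 ] (+ 72) (on-by -[1+ 8 ] (+ 72) (+ 81) h refl) (λ ()) (from-no (+ 144 ∣? + 81))
    no-special _ [96256] h = nonintegral-tangent (+ 448) (+ 16064) (on-by (+ 448) (+ 16064) (+ 2598912) h refl) (λ ()) (from-no (+ 32128 ∣? + 610176))

    module IntegerPoint (x y : ℤ) (quartic≡ : x * x * x + x * x * y * y + y * y * y ≡ k) where

      s p D X Y : ℤ
      s = x + y
      p = x * y
      D = + 2 * p - + 3 * s
      X = - (+ 4 * s)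
      Y = + 4 * D

      Conclusion : Set
      Conclusion = x ≡ y ⊎ Exceptional k x y

      point : TorsionPoint X Y
      point = integer-point X Y (ringℤ 3 (λ k x y → let s = x :+ y; X = :- (♯ 4 :* s); Y = ♯ 4 :* (♯ 2 :* (x :* y) :- ♯ 3 :* s) in
        Y :* Y := X :* X :* X :+ ♯ 9 :* X :* X :+ ♯ 64 :* k from
        (♯ 64 · x :* x :* x :+ x :* x :* y :* y :+ y :* y :* y ≈ k ∷ [])) refl (k ∷ x ∷ y ∷ []) (quartic≡ , tt))

      two-torsion : D ≡ + 0 → Conclusion
      two-torsion e = use (two-torsion-points x y k quartic≡ (ℤₚ.i-j≡0⇒i≡j (+ 2 * p) (+ 3 * s) e))
        where
        use : x ≡ y ⊎ k ≡ + 368 ⊎ k ≡ -[1+ 16 ] → Conclusion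
        use (inj₁ h) = inj₁ h
        use (inj₂ (inj₁ h)) = ⊥-elim (k≢368 h)
        use (inj₂ (inj₂ h)) = ⊥-elim (k≢-17 h)

      module _ (D≢0 : D ≢ + 0) (L : ℤ) (tangent : TangentSlope X Y L) (2P : TorsionPoint (doubleX X L) (doubleY X Y L)) where

        Q X₂ Y₂ : ℤ
        Q = L * L - + 9 + + 12 * s
        X₂ = doubleX X L
        Y₂ = doubleY X Y L

        LD : L * D ≡ + 3 * s * (+ 2 * s - + 3)
        LD = cancelℤ {L * D} {+ 3 * s * (+ 2 * s - + 3)} {+ 8} (λ ()) (ringℤ 3 (λ s D L → let X = :- (♯ 4 :* s) in
          ♯ 8 :* (L :* D) := ♯ 8 :* (♯ 3 :* s :* (♯ 2 :* s :- ♯ 3)) from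
          (♯ 1 · ♯ 2 :* (♯ 4 :* D) :* L ≈ ♯ 3 :* X :* X :+ ♯ 18 :* X ∷ [])) refl (s ∷ D ∷ L ∷ []) (tangent , tt))

        Q≢0 : Q ≢ + 0
        Q≢0 = three-torsion-impossible x y L LD D≢0

        shift≡Q : shift X L ≡ Q
        shift≡Q = ringℤ 2 (λ s L → L :* L :- ♯ 9 :- ♯ 3 :* (:- (♯ 4 :* s)) := L :* L :- ♯ 9 :+ ♯ 12 :* s from []) refl (s ∷ L ∷ []) tt

        3X₂ : + 3 * X₂ ≡ L * L + + 2 * Q - + 9
        3X₂ = ringℤ 2 (λ s L → let X = :- (♯ 4 :* s) in ♯ 3 :* (L :* L :- ♯ 9 :- X :- X) := L :* L :+ ♯ 2 :* (L :* L :- ♯ 9 :+ ♯ 12 :* s) :- ♯ 9 from [])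
          refl (s ∷ L ∷ []) tt

        module _ (N : ℤ) (N-shift : N * shift X L ≡ + 2 * Y) (3P : TorsionPoint (tripleX X L N) (tripleY X Y L N)) where

          NQ : N * Q ≡ + 8 * D
          NQ = trans (cong (N *_) (sym shift≡Q)) (trans N-shift (sym (ℤₚ.*-assoc (+ 2) (+ 4) D)))

          2Y₂ : + 2 * Y₂ ≡ - (Q * (N + + 2 * L))
          2Y₂ = ringℤ 4 (λ s D L N → let X = :- (♯ 4 :* s); Q = L :* L :- ♯ 9 :+ ♯ 12 :* s in
            ♯ 2 :* (:- (♯ 4 :* D :+ L :* (L :* L :- ♯ 9 :- ♯ 3 :* X))) := :- (Q :* (N :+ ♯ 2 :* L)) from
            (♯ 1 · N :* Q ≈ ♯ 8 :* D ∷ [])) refl (s ∷ D ∷ L ∷ N ∷ []) (NQ , tt)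

          N+2L≡0 : Y₂ ≡ + 0 → N + + 2 * L ≡ + 0
          N+2L≡0 e = zero-productℤ {Q} {N + + 2 * L} Q≢0 (ringℤ 2 (λ z Y → z := ♯ 0 from (♯ 1 · ♯ 2 :* Y ≈ :- z ∷ :- ♯ 2 · Y ≈ ♯ 0 ∷ []))
            refl (Q * (N + + 2 * L) ∷ Y₂ ∷ []) (2Y₂ , e , tt))

          -- For even L the abscissa L² - 9 + 8s of 2P is odd. So 2P has order two, P has order four
          -- and N = -2L.
          even-slope : + 2 ∣ L → ⊥
          even-slope L-even@(divides a L≡) = four-torsion-impossible x y L LD D≢0 N NQ Q≢0 L-even (ringℤ 2 (λ L N → N := :- (♯ 2 :* L) from
              (♯ 1 · N :+ ♯ 2 :* L ≈ ♯ 0 ∷ [])) refl (L ∷ N ∷ []) (N+2L≡0 (odd-abscissa X₂ Y₂ 2P X₂-odd) , tt))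
            where
            X₂-odd : Comaximal (+ 2) X₂
            X₂-odd = bezout (- (a * L - + 5 + + 4 * s)) (+ 1) (ringℤ 3 (λ s L a → let X = :- (♯ 4 :* s) in
              (:- (a :* L :- ♯ 5 :+ ♯ 4 :* s)) :* ♯ 2 :+ ♯ 1 :* (L :* L :- ♯ 9 :- X :- X) := ♯ 1 from
              (L · L ≈ a :* ♯ 2 ∷ [])) refl (s ∷ L ∷ a ∷ []) (L≡ , tt))

          -- The abscissa of 3P is N² + 2LN - 4s and has the parity of N. For odd N the ordinate of
          -- 3P is therefore zero, and multiplied by N this is the relation of order six.
          odd-N : Comaximal (+ 2) N → ⊥
          odd-N c = six-torsion-impossible x y L LD D≢0 N NQ Q≢0 (cancelℤ {Q} {+ 2 * (N + L) * (N + + 2 * L)} {N} (N≢0 x y L LD D≢0 N NQ Q≢0)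
              (ringℤ 4 (λ s D L N → let X = :- (♯ 4 :* s); Q = L :* L :- ♯ 9 :+ ♯ 12 :* s; X₃ = (L :+ N) :* (L :+ N) :- ♯ 9 :- (L :* L :- ♯ 9 :- X :- X) :- X in
                N :* Q := N :* (♯ 2 :* (N :+ L) :* (N :+ ♯ 2 :* L)) from
                (♯ 1 · N :* Q ≈ ♯ 8 :* D ∷ :- ♯ 2 · (L :+ N) :* (X₃ :- X) :- ♯ 4 :* D ≈ ♯ 0 ∷ [])) refl (s ∷ D ∷ L ∷ N ∷ [])
                (NQ , odd-abscissa (tripleX X L N) (tripleY X Y L N) 3P (X₃-odd (odd-form N c)) , tt)))
            where
            X₃-odd : ∃[ b ] N ≡ + 1 + b * + 2 → Comaximal (+ 2) (tripleX X L N)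
            X₃-odd (b , N≡) = bezout (- (L * N + b * (N + + 1) - + 2 * s)) (+ 1) (ringℤ 4 (λ s L N b → let X = :- (♯ 4 :* s) in
              (:- (L :* N :+ b :* (N :+ ♯ 1) :- ♯ 2 :* s)) :* ♯ 2 :+ ♯ 1 :* ((L :+ N) :* (L :+ N) :- ♯ 9 :- (L :* L :- ♯ 9 :- X :- X) :- X) := ♯ 1 from
              (N :+ ♯ 1 · N ≈ ♯ 1 :+ b :* ♯ 2 ∷ [])) refl (s ∷ L ∷ N ∷ b ∷ []) (N≡ , tt))

          -- Here D = 2p - 3s is prime to 3, so 3 divides L by the tangent equation, then Q, and
          -- then NQ = 8D.
          unit-product : Comaximal (+ 3) p → ⊥
          unit-product c = use (divides-cancelˡ {+ 3} {D} {L} D-unit (divides (s * (+ 2 * s - + 3)) (ringℤ 3 (λ s D L →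
              D :* L := s :* (♯ 2 :* s :- ♯ 3) :* ♯ 3 from (♯ 1 · L :* D ≈ ♯ 3 :* s :* (♯ 2 :* s :- ♯ 3) ∷ [])) refl (s ∷ D ∷ L ∷ []) (LD , tt))))
            where
            D-unit : Comaximal (+ 3) D
            D-unit = subst (Comaximal (+ 3)) (ringℤ 2 (λ s p → ♯ 2 :* p :+ ♯ 3 :* (:- s) := ♯ 2 :* p :- ♯ 3 :* s from []) refl (s ∷ p ∷ []) tt)
              (comaximal-shift {+ 3} {+ 2 * p} (- s) (comaximal-*ʳ {+ 3} {+ 2} {p} 2⊥3 c))
            use : + 3 ∣ L → ⊥
            use (divides a L≡) = prime-to-3-not-multiple (+ 8 * D) (comaximal-*ʳ {+ 3} {+ 8} {D} (bezout (+ 3) -[1+ 0 ] refl) D-unit)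
              (divides (N * (a * L - + 3 + + 4 * s)) (ringℤ 5 (λ s D L N a → ♯ 8 :* D := N :* (a :* L :- ♯ 3 :+ ♯ 4 :* s) :* ♯ 3 from
                (:- ♯ 1 · N :* (L :* L :- ♯ 9 :+ ♯ 12 :* s) ≈ ♯ 8 :* D ∷ N :* L · L ≈ a :* ♯ 3 ∷ [])) refl (s ∷ D ∷ L ∷ N ∷ a ∷ []) (NQ , L≡ , tt)))

          -- Modulo 3 the number 2Y(2P) is L³, hence prime to 3. The tangent slope M at 2P is then
          -- divisible by 3, and so is X(4P) - X(2P), which divides 2Y(2P) unless it vanishes; in
          -- that case 3(2P) = O.
          unit-slope : + 3 ∣ p → Comaximal (+ 3) L → ⊥
          unit-slope (divides p′ p≡) c = doubled (double X₂ Y₂ 2P (λ e → prime-to-3-not-multiple (+ 2 * Y₂) 2Y₂-unit (divides (+ 0) (cong (+ 2 *_) e))))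
            where
            2Y₂-unit : Comaximal (+ 3) (+ 2 * Y₂)
            2Y₂-unit = subst (Comaximal (+ 3)) (ringℤ 4 (λ s p L p′ → let X = :- (♯ 4 :* s) in
                L :* L :* L :+ ♯ 3 :* (:- (L :* L :* L) :- ♯ 16 :* p′ :+ ♯ 8 :* s :+ ♯ 6 :* L :- ♯ 8 :* L :* s) :=
                ♯ 2 :* (:- (♯ 4 :* (♯ 2 :* p :- ♯ 3 :* s) :+ L :* (L :* L :- ♯ 9 :- ♯ 3 :* X))) from
                (♯ 16 · p ≈ p′ :* ♯ 3 ∷ [])) refl (s ∷ p ∷ L ∷ p′ ∷ []) (p≡ , tt))
              (comaximal-shift {+ 3} {L * L * L} (- (L * L * L) - + 16 * p′ + + 8 * s + + 6 * L - + 8 * L * s) (comaximal-*ʳ {+ 3} {L * L} {L} (comaximal-*ʳ {+ 3} {L} {L} c c) c))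
            doubled : ∃[ M ] (TangentSlope X₂ Y₂ M × TorsionPoint (doubleX X₂ M) (doubleY X₂ Y₂ M)) → ⊥
            doubled (M , tangent₂ , _) = divided (divides-cancelˡ {+ 3} {+ 2 * Y₂} {M} 2Y₂-unit
              (divides (X₂ * X₂ + + 6 * X₂) (trans tangent₂ (ringℤ 1 (λ X → ♯ 3 :* X :* X :+ ♯ 18 :* X := (X :* X :+ ♯ 6 :* X) :* ♯ 3 from []) refl (X₂ ∷ []) tt))))
              where
              divided : + 3 ∣ M → ⊥
              divided (divides m M≡) = shifted (shift X₂ M ℤ.≟ + 0)
                where
                shifted : Dec (shift X₂ M ≡ + 0) → ⊥
                shifted (no W≢0) = prime-to-3-not-multiple (+ 2 * Y₂) 2Y₂-unit (use (triple X₂ Y₂ M 2P (λ e → prime-to-3-not-multiple (+ 2 * Y₂) 2Y₂-unit (divides (+ 0) (cong (+ 2 *_) e))) tangent₂ W≢0))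
                  where
                  use : ∃[ N′ ] (N′ * shift X₂ M ≡ + 2 * Y₂ × TorsionPoint (tripleX X₂ M N′) (tripleY X₂ Y₂ M N′)) → + 3 ∣ + 2 * Y₂
                  use (N′ , h , _) = divides (N′ * (m * M - + 3 - X₂)) (trans (sym h) (ringℤ 4 (λ X M m N′ → N′ :* (M :* M :- ♯ 9 :- ♯ 3 :* X) := N′ :* (m :* M :- ♯ 3 :- X) :* ♯ 3 from
                    (N′ :* M · M ≈ m :* ♯ 3 ∷ [])) refl (X₂ ∷ M ∷ m ∷ N′ ∷ []) (M≡ , tt)))
                shifted (yes W≡0) = double-three-torsion x y L LD D≢0 N NQ Q≢0 M (double-slope x y L LD D≢0 N NQ Q≢0 M X₂ Y₂ 3X₂ 2Y₂ tangent₂)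
                  (ringℤ 4 (λ L Q X M → M :* M := L :* L :+ ♯ 2 :* Q from
                    (♯ 1 · M :* M :- ♯ 9 :- ♯ 3 :* X ≈ ♯ 0 ∷ ♯ 1 · ♯ 3 :* X ≈ L :* L :+ ♯ 2 :* Q :- ♯ 9 ∷ [])) refl (L ∷ Q ∷ X₂ ∷ M ∷ []) (W≡0 , 3X₂ , tt))

          -- With L = 3(2l + 1) and N = 2n the tangent equation for L becomes the conic, Q becomes
          -- 36q, and NQ = 8D becomes the condition that q divides 2p₁ - s₁, with quotient n.
          module Thirds (x₁ y₁ l n : ℤ) (x≡ : x ≡ x₁ * + 3) (y≡ : y ≡ y₁ * + 3) (L≡ : L ≡ (+ 1 + l * + 2) * + 3) (N≡ : N ≡ n * + 2) where

            s₁ p₁ q : ℤ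
            s₁ = x₁ + y₁
            p₁ = x₁ * y₁
            q = l * (l + + 1) + s₁

            s≡ : s ≡ + 3 * s₁
            s≡ = ringℤ 4 (λ x y x₁ y₁ → x :+ y := ♯ 3 :* (x₁ :+ y₁) from (♯ 1 · x ≈ x₁ :* ♯ 3 ∷ ♯ 1 · y ≈ y₁ :* ♯ 3 ∷ [])) refl (x ∷ y ∷ x₁ ∷ y₁ ∷ []) (x≡ , y≡ , tt)

            p≡ : p ≡ + 9 * p₁
            p≡ = ringℤ 4 (λ x y x₁ y₁ → x :* y := ♯ 9 :* (x₁ :* y₁) from (y · x ≈ x₁ :* ♯ 3 ∷ ♯ 3 :* x₁ · y ≈ y₁ :* ♯ 3 ∷ [])) refl (x ∷ y ∷ x₁ ∷ y₁ ∷ []) (x≡ , y≡ , tt)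

            Q≡ : Q ≡ + 36 * q
            Q≡ = ringℤ 4 (λ s s₁ L l → let a = (♯ 1 :+ l :* ♯ 2) :* ♯ 3 in L :* L :- ♯ 9 :+ ♯ 12 :* s := ♯ 36 :* (l :* (l :+ ♯ 1) :+ s₁) from
              (L :+ a · L ≈ a ∷ ♯ 12 · s ≈ ♯ 3 :* s₁ ∷ [])) refl (s ∷ s₁ ∷ L ∷ l ∷ []) (L≡ , s≡ , tt)

            q≢0 : q ≢ + 0
            q≢0 e = Q≢0 (trans Q≡ (cong (+ 36 *_) e))

            conic : Conic l x₁ y₁
            conic = cancelℤ {(+ 2 * l + + 1) * p₁} {s₁ * (s₁ + l)} {+ 54} (λ ()) (ringℤ 6 (λ s p s₁ p₁ L l → let a = (♯ 1 :+ l :* ♯ 2) :* ♯ 3 in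
              ♯ 54 :* ((♯ 2 :* l :+ ♯ 1) :* p₁) := ♯ 54 :* (s₁ :* (s₁ :+ l)) from
              (♯ 1 · L :* (♯ 2 :* p :- ♯ 3 :* s) ≈ ♯ 3 :* s :* (♯ 2 :* s :- ♯ 3)
              ∷ :- (♯ 2 :* p :- ♯ 3 :* s) · L ≈ a ∷ :- ♯ 2 :* a · p ≈ ♯ 9 :* p₁
              ∷ ♯ 3 :* a :+ ♯ 6 :* (s :+ ♯ 3 :* s₁) :- ♯ 9 · s ≈ ♯ 3 :* s₁ ∷ [])) refl (s ∷ p ∷ s₁ ∷ p₁ ∷ L ∷ l ∷ []) (LD , L≡ , p≡ , s≡ , tt))

            qn : q * n ≡ + 2 * p₁ - s₁
            qn = cancelℤ {q * n} {+ 2 * p₁ - s₁} {+ 72} (λ ()) (ringℤ 8 (λ s p s₁ p₁ Q q N n →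
              ♯ 72 :* (q :* n) := ♯ 72 :* (♯ 2 :* p₁ :- s₁) from
              (♯ 1 · N :* Q ≈ ♯ 8 :* (♯ 2 :* p :- ♯ 3 :* s) ∷ :- N · Q ≈ ♯ 36 :* q ∷ :- ♯ 36 :* q · N ≈ n :* ♯ 2
              ∷ ♯ 16 · p ≈ ♯ 9 :* p₁ ∷ :- ♯ 24 · s ≈ ♯ 3 :* s₁ ∷ [])) refl (s ∷ p ∷ s₁ ∷ p₁ ∷ Q ∷ q ∷ N ∷ n ∷ []) (NQ , Q≡ , N≡ , p≡ , s≡ , tt))

            k≡ : k ≡ + 27 * (x₁ * x₁ * x₁ + + 3 * x₁ * x₁ * y₁ * y₁ + y₁ * y₁ * y₁)
            k≡ = ringℤ 5 (λ k x y x₁ y₁ → let a = x₁ :* ♯ 3; b = y₁ :* ♯ 3 in k := ♯ 27 :* (x₁ :* x₁ :* x₁ :+ ♯ 3 :* x₁ :* x₁ :* y₁ :* y₁ :+ y₁ :* y₁ :* y₁) from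
              (:- ♯ 1 · x :* x :* x :+ x :* x :* y :* y :+ y :* y :* y ≈ k
              ∷ x :* x :+ x :* a :+ a :* a :+ (x :+ a) :* y :* y · x ≈ a ∷ y :* y :+ y :* b :+ b :* b :+ a :* a :* (y :+ b) · y ≈ b ∷ []))
              refl (k ∷ x ∷ y ∷ x₁ ∷ y₁ ∷ []) (quartic≡ , x≡ , y≡ , tt)

            module _ (l≡-1 : l ≡ -[1+ 0 ]) where

              q≡s₁ : q ≡ s₁
              q≡s₁ = ringℤ 2 (λ l s → l :* (l :+ ♯ 1) :+ s := s from (l · l ≈ # -[1+ 0 ] ∷ [])) refl (l ∷ s₁ ∷ []) (l≡-1 , tt)

              s₁≢0 : s₁ ≢ + 0
              s₁≢0 e = q≢0 (trans q≡s₁ e)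

              p₁≡ : p₁ ≡ - (s₁ * (s₁ - + 1))
              p₁≡ = ringℤ 3 (λ l s p → p := :- (s :* (s :- ♯ 1)) from
                (:- ♯ 1 · (♯ 2 :* l :+ ♯ 1) :* p ≈ s :* (s :+ l) ∷ ♯ 2 :* p :- s · l ≈ # -[1+ 0 ] ∷ [])) refl (l ∷ s₁ ∷ p₁ ∷ []) (conic , l≡-1 , tt)

              n≡ : n ≡ + 1 - + 2 * s₁
              n≡ = cancelℤ {n} {+ 1 - + 2 * s₁} {s₁} s₁≢0 (ringℤ 4 (λ s p q n → s :* n := s :* (♯ 1 :- ♯ 2 :* s) from
                (♯ 1 · q :* n ≈ ♯ 2 :* p :- s ∷ :- n · q ≈ s ∷ ♯ 2 · p ≈ :- (s :* (s :- ♯ 1)) ∷ [])) refl (s₁ ∷ p₁ ∷ q ∷ n ∷ []) (qn , q≡s₁ , p₁≡ , tt))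

              N+2L≡ : N + + 2 * L ≡ - (+ 4 * (s₁ + + 1))
              N+2L≡ = ringℤ 5 (λ L N l n s → N :+ ♯ 2 :* L := :- (♯ 4 :* (s :+ ♯ 1)) from
                (♯ 1 · N ≈ n :* ♯ 2 ∷ ♯ 2 · L ≈ (♯ 1 :+ l :* ♯ 2) :* ♯ 3 ∷ ♯ 12 · l ≈ # -[1+ 0 ] ∷ ♯ 2 · n ≈ ♯ 1 :- ♯ 2 :* s ∷ []))
                refl (L ∷ N ∷ l ∷ n ∷ s₁ ∷ []) (N≡ , L≡ , l≡-1 , n≡ , tt)

              -- Order four forces N + 2L = 0, that is s₁ = -1, and then p₁ = -2. So x₁ and y₁ are 1
              -- and -2 in some order, which are the extra points for k = 135.
              exceptional-pair : Y₂ ≡ + 0 → Conclusion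
              exceptional-pair e = by (x₁ - + 1 ℤ.≟ + 0)
                where
                s₁≡-1 : s₁ ≡ -[1+ 0 ]
                s₁≡-1 = cancelℤ {s₁} { -[1+ 0 ]} {+ 4} (λ ()) (ringℤ 2 (λ s z → ♯ 4 :* s := ♯ 4 :* # -[1+ 0 ] from (:- ♯ 1 · z ≈ ♯ 0 ∷ ♯ 1 · z ≈ :- (♯ 4 :* (s :+ ♯ 1)) ∷ []))
                  refl (s₁ ∷ N + + 2 * L ∷ []) (N+2L≡0 e , N+2L≡ , tt))
                factors : (x₁ - + 1) * (x₁ + + 2) ≡ + 0
                factors = ringℤ 2 (λ x y → let s = x :+ y in (x :- ♯ 1) :* (x :+ ♯ 2) := ♯ 0 from
                  (:- ♯ 1 · x :* y ≈ :- (s :* (s :- ♯ 1)) ∷ x :+ (s :- ♯ 2) · s ≈ # -[1+ 0 ] ∷ [])) refl (x₁ ∷ y₁ ∷ []) (p₁≡ , s₁≡-1 , tt)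
                second : ∀ c → x₁ ≡ c → y₁ ≡ -[1+ 0 ] - c
                second c h = ringℤ 3 (λ x y c → y := # -[1+ 0 ] :- c from (♯ 1 · x :+ y ≈ # -[1+ 0 ] ∷ :- ♯ 1 · x ≈ c ∷ [])) refl (x₁ ∷ y₁ ∷ c ∷ []) (s₁≡-1 , h , tt)
                k≡135 : ∀ a b → x₁ ≡ a → y₁ ≡ b → + 27 * (a * a * a + + 3 * a * a * b * b + b * b * b) ≡ + 135 → k ≡ + 135
                k≡135 _ _ refl refl h = trans k≡ h
                thrice : ∀ {z z₁} c → z ≡ z₁ * + 3 → z₁ ≡ c → z ≡ c * + 3
                thrice c h refl = h
                by : Dec (x₁ - + 1 ≡ + 0) → Conclusion
                by (yes h) = inj₂ ([3,-6]∈ (k≡135 (+ 1) -[1+ 1 ] x₁≡ (second (+ 1) x₁≡) refl) (thrice (+ 1) x≡ x₁≡) (thrice -[1+ 1 ] y≡ (second (+ 1) x₁≡)))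
                  where
                  x₁≡ : x₁ ≡ + 1
                  x₁≡ = ℤₚ.i-j≡0⇒i≡j x₁ (+ 1) h
                by (no h) = inj₂ ([-6,3]∈ (k≡135 -[1+ 1 ] (+ 1) x₁≡ (second -[1+ 1 ] x₁≡) refl) (thrice -[1+ 1 ] x≡ x₁≡) (thrice (+ 1) y≡ (second -[1+ 1 ] x₁≡)))
                  where
                  x₁≡ : x₁ ≡ -[1+ 1 ]
                  x₁≡ = ℤₚ.i-j≡0⇒i≡j x₁ -[1+ 1 ] (zero-productℤ {x₁ - + 1} {x₁ + + 2} h factors)

              -- Now L = -3, N + 2L = -4(s₁ + 1) and Q = 36s₁, so the formula for the tangent slope
              -- M at 2P becomes (s₁ + 1)(12 - M) = 9. Among the few possible s₁ only s₁ = 0 makes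
              -- (x₁ - y₁)² = 5s₁² - 4s₁ a square, and there q = 0.
              minus-one : Conclusion
              minus-one = by (Y₂ ℤ.≟ + 0)
                where
                by : Dec (Y₂ ≡ + 0) → Conclusion
                by (yes e) = exceptional-pair e
                by (no Y₂≢0) = ⊥-elim (use (double X₂ Y₂ 2P Y₂≢0))
                  where
                  use : ∃[ M ] (TangentSlope X₂ Y₂ M × TorsionPoint (doubleX X₂ M) (doubleY X₂ Y₂ M)) → ⊥
                  use (M , tangent₂ , _) = minus-one-solved minus-one-verified s₁ (x₁ - y₁) M s₁≢0
                    (ringℤ 2 (λ x y → let s = x :+ y in (x :- y) :* (x :- y) := ♯ 5 :* s :* s :- ♯ 4 :* s from (:- ♯ 4 · x :* y ≈ :- (s :* (s :- ♯ 1)) ∷ [])) refl (x₁ ∷ y₁ ∷ []) (p₁≡ , tt))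
                    (cancelℤ {(s₁ + + 1) * (+ 12 - M)} {+ 9} {+ 4} (λ ()) (ringℤ 6 (λ L Q M l s z → ♯ 4 :* ((s :+ ♯ 1) :* (♯ 12 :- M)) := ♯ 4 :* ♯ 9 from
                      (♯ 1 · Q ≈ :- (z :* (M :+ L)) ∷ :- ♯ 1 · Q ≈ ♯ 36 :* s ∷ :- (M :+ L) · z ≈ :- (♯ 4 :* (s :+ ♯ 1))
                      ∷ ♯ 4 :* (s :+ ♯ 1) · L ≈ (♯ 1 :+ l :* ♯ 2) :* ♯ 3 ∷ ♯ 24 :* (s :+ ♯ 1) · l ≈ # -[1+ 0 ] ∷ []))
                      refl (L ∷ Q ∷ M ∷ l ∷ s₁ ∷ N + + 2 * L ∷ [])
                      (double-slope x y L LD D≢0 N NQ Q≢0 M X₂ Y₂ 3X₂ 2Y₂ tangent₂ , trans Q≡ (cong (+ 36 *_) q≡s₁) , N+2L≡ , L≡ , l≡-1 , tt)))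

            conclusion : Conclusion
            conclusion = by (l ℤ.≟ -[1+ 0 ])
              where
              outcome : Outcome x₁ y₁ → Conclusion
              outcome (equal e) = inj₁ (trans x≡ (trans (cong (_* + 3) e) (sym y≡)))
              outcome (special c p h) = ⊥-elim (no-special c p (trans k≡ (cong (+ 27 *_) h)))
              by : Dec (l ≡ -[1+ 0 ]) → Conclusion
              by (yes e) = minus-one e
              by (no l≢-1) = outcome (conic-points l x₁ y₁ n l≢-1 q≢0 conic qn)

          multiple-of-3 : Comaximal (+ 2) L → + 2 ∣ N → + 3 ∣ p → + 3 ∣ L → Conclusion
          multiple-of-3 L-odd (divides n N≡) (divides p′ p≡) (divides a L≡) = with-s 3∣s
            where
            -- After division by 3 the tangent equation expresses 2s² through D and 3s, and D = 2p -
            -- 3s is divisible by 3.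
            3∣s : + 3 ∣ s
            3∣s = either (factor-3 s s (divides-cancelˡ {+ 3} {+ 2} {s * s} 2⊥3 (divides (+ 2 * a * p′ - a * s + s) (cancelℤ {+ 2 * (s * s)} {(+ 2 * a * p′ - a * s + s) * + 3} {+ 3} (λ ())
              (ringℤ 5 (λ s p L a p′ → ♯ 3 :* (♯ 2 :* (s :* s)) := ♯ 3 :* ((♯ 2 :* a :* p′ :- a :* s :+ s) :* ♯ 3) from
                (:- ♯ 1 · L :* (♯ 2 :* p :- ♯ 3 :* s) ≈ ♯ 3 :* s :* (♯ 2 :* s :- ♯ 3)
                ∷ ♯ 2 :* p :- ♯ 3 :* s · L ≈ a :* ♯ 3 ∷ ♯ 6 :* a · p ≈ p′ :* ♯ 3 ∷ [])) refl (s ∷ p ∷ L ∷ a ∷ p′ ∷ []) (LD , L≡ , p≡ , tt))))))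
            with-s : + 3 ∣ s → Conclusion
            with-s (divides s′ s≡) = with-xy (3∣root x y s≡ p≡) (3∣root y x (trans (ℤₚ.+-comm y x) s≡) (trans (ℤₚ.*-comm y x) p≡)) (odd-form a a-odd)
              where
              3∣root : ∀ x y → x + y ≡ s′ * + 3 → x * y ≡ p′ * + 3 → + 3 ∣ x
              3∣root x y h h′ = either (factor-3 x x (divides (x * s′ - p′) (ringℤ 4 (λ x y s′ p′ → x :* x := (x :* s′ :- p′) :* ♯ 3 from
                (x · x :+ y ≈ s′ :* ♯ 3 ∷ :- ♯ 1 · x :* y ≈ p′ :* ♯ 3 ∷ [])) refl (x ∷ y ∷ s′ ∷ p′ ∷ []) (h , h′ , tt))))
              a-odd : Comaximal (+ 2) a
              a-odd = comaximal-divisor {+ 2} {L} {a} (divides (+ 3) (trans L≡ (ℤₚ.*-comm a (+ 3)))) L-odd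
              with-xy : + 3 ∣ x → + 3 ∣ y → ∃[ l ] a ≡ + 1 + l * + 2 → Conclusion
              with-xy (divides x₁ x≡) (divides y₁ y≡) (l , a≡) = Thirds.conclusion x₁ y₁ l n x≡ y≡ (trans L≡ (cong (_* + 3) a≡)) N≡

          tripled : Conclusion
          tripled = parity (mod-2 N) (mod-2 L)
            where
            modulo-3 : Comaximal (+ 2) L → + 2 ∣ N → Residues₃ p → Residues₃ L → Conclusion
            modulo-3 _ _ (prime-to-3 c) _ = ⊥-elim (unit-product c)
            modulo-3 _ _ (multiple₃ h) (prime-to-3 c) = ⊥-elim (unit-slope h c)
            modulo-3 L-odd N-even (multiple₃ h) (multiple₃ h′) = multiple-of-3 L-odd N-even h h′
            parity : Residues₂ N → Residues₂ L → Conclusion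
            parity (odd c) _ = ⊥-elim (odd-N c)
            parity (even _) (even e) = ⊥-elim (even-slope e)
            parity (even e) (odd c) = modulo-3 c e (mod-3 p) (mod-3 L)

      integer-conclusion : Conclusion
      integer-conclusion = by (D ℤ.≟ + 0)
        where
        by : Dec (D ≡ + 0) → Conclusion
        by (yes e) = two-torsion e
        by (no D≢0) = doubled (double X Y point Y≢0)
          where
          Y≢0 : Y ≢ + 0
          Y≢0 = product-nonzeroℤ {+ 4} {D} (λ ()) D≢0
          doubled : ∃[ L ] (TangentSlope X Y L × TorsionPoint (doubleX X L) (doubleY X Y L)) → Conclusion
          doubled (L , tangent , 2P) = use (triple X Y L point Y≢0 tangent (λ e → Q≢0 D≢0 L tangent 2P (trans (sym (shift≡Q D≢0 L tangent 2P)) e)))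
            where
            use : ∃[ N ] (N * shift X L ≡ + 2 * Y × TorsionPoint (tripleX X L N) (tripleY X Y L N)) → Conclusion
            use (N , h , 3P) = tripled D≢0 L tangent 2P N h 3P

-- Reduction of rational points to integral ones for E₁.

module RankZeroE₁ (K : FractionField) (k : ℤ) (k≢0 : k ≢ + 0) where
  open FractionField K
  open FieldProperties K
  open Embedding K
  open Points K k
  open IntegerPointsE₁ K k k≢0 hiding (module IntegerPoint)
  open NagellLutz K A₁ B₁ nonsingular₁
  open TorsionPoints K A₁ B₁ nonsingular₁
  open TorsionCongruences K A₁ B₁ nonsingular₁

  module _ (all-torsion : ∀ P → Torsion P) where
    open IntegerPointsE₁.IntegerPoint K k k≢0 all-torsion using (integer-conclusion)

    module _ {x y : Carrier} (q : OnQuartic x y) where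

      private
        X Y : Carrier
        X = - (ι# (+ 4) * (x + y))
        Y = ι# (+ 8) * x * y - ι# (+ 12) * (x + y)

        on : OnCurve X Y
        on = trans (ring 3 (λ k x y → let X = :- (♯ 4 :* (x :+ y)); Y = ♯ 8 :* x :* y :- ♯ 12 :* (x :+ y) in
            Y :* Y := X :* X :* X :+ ♯ 9 :* X :* X :+ ♯ 64 :* k from
            (♯ 64 · x :* x :* x :+ x :* x :* y :* y :+ y :* y :* y ≈ k ∷ [])) refl (ι# k ∷ x ∷ y ∷ []) (q , tt))
          (cong (λ b → X * X * X + ι# (+ 9) * X * X + b) (sym (ι-* (+ 64) k)))

        torsion : Torsion (aff X Y on)
        torsion = all-torsion (aff X Y on)

        module _ (X₀ Y₀ : ℤ) (X≡ : X ≡ ι# X₀) (Y≡ : Y ≡ ι# Y₀) where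

          constant : ℤ
          constant = + 2 ℤ.* (Y₀ ℤ.- + 3 ℤ.* X₀)

          -- The numbers 4x and 4y have sum -X and product 2(Y - 3X), so they are the roots of a
          -- monic integral quadratic.
          quarter-integral : ∀ z w → z + w ≡ x + y → z * w ≡ x * y → Integral (ι# (+ 4) * z)
          quarter-integral z w zw+ zw* = monic-root (constant ∷ X₀ ∷ []) (ring 7 (λ x y z w X Y c → let t = ♯ 4 :* z in
              c :+ t :* (X :+ t :* ♯ 1) := ♯ 0 from
              (♯ 1 · c ≈ ♯ 2 :* (Y :- ♯ 3 :* X) ∷ :- ♯ 2 · ♯ 8 :* x :* y :- ♯ 12 :* (x :+ y) ≈ Y
              ∷ ♯ 6 :- t · :- (♯ 4 :* (x :+ y)) ≈ X
              ∷ ♯ 4 :* t · z :+ w ≈ x :+ y ∷ :- ♯ 16 · z :* w ≈ x :* y ∷ []))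
            refl (x ∷ y ∷ z ∷ w ∷ ι# X₀ ∷ ι# Y₀ ∷ ι# constant ∷ [])
            (ι-expand 2 (λ X Y → ♯ 2 :* (Y :- ♯ 3 :* X)) (X₀ ∷ Y₀ ∷ []) , Y≡ , X≡ , zw+ , zw* , tt))

          module _ (u v : ℤ) (4x : ι# (+ 4) * x ≡ ι# u) (4y : ι# (+ 4) * y ≡ ι# v) where

            quarter : Quarter k u v
            quarter = pull 3 (λ k u v → ♯ 4 :* u :* u :* u :+ u :* u :* v :* v :+ ♯ 4 :* v :* v :* v , ♯ 256 :* k) (k ∷ u ∷ v ∷ [])
              (ring 5 (λ k x y u v → ♯ 4 :* u :* u :* u :+ u :* u :* v :* v :+ ♯ 4 :* v :* v :* v := ♯ 256 :* k from
                (♯ 256 · x :* x :* x :+ x :* x :* y :* y :+ y :* y :* y ≈ k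
                ∷ :- ♯ 4 :* (u :* u :+ u :* (♯ 4 :* x) :+ ♯ 16 :* x :* x) :- (u :+ ♯ 4 :* x) :* v :* v · ♯ 4 :* x ≈ u
                ∷ :- ♯ 4 :* (v :* v :+ v :* (♯ 4 :* y) :+ ♯ 16 :* y :* y) :- ♯ 16 :* x :* x :* (v :+ ♯ 4 :* y) · ♯ 4 :* y ≈ v ∷ []))
                refl (ι# k ∷ x ∷ y ∷ ι# u ∷ ι# v ∷ []) (q , 4x , 4y , tt))

            X₀≡ : X₀ ≡ ℤ.- (u ℤ.+ v)
            X₀≡ = pull 3 (λ u v X → X , :- (u :+ v)) (u ∷ v ∷ X₀ ∷ []) (ring 5 (λ x y u v X → X := :- (u :+ v) from
              (:- ♯ 1 · :- (♯ 4 :* (x :+ y)) ≈ X ∷ :- ♯ 1 · ♯ 4 :* x ≈ u ∷ :- ♯ 1 · ♯ 4 :* y ≈ v ∷ []))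
              refl (x ∷ y ∷ ι# u ∷ ι# v ∷ ι# X₀ ∷ []) (X≡ , 4x , 4y , tt))

            2Y₀≡ : + 2 ℤ.* Y₀ ≡ u ℤ.* v ℤ.- + 6 ℤ.* (u ℤ.+ v)
            2Y₀≡ = pull 3 (λ u v Y → ♯ 2 :* Y , u :* v :- ♯ 6 :* (u :+ v)) (u ∷ v ∷ Y₀ ∷ []) (ring 5 (λ x y u v Y → ♯ 2 :* Y := u :* v :- ♯ 6 :* (u :+ v) from
              (:- ♯ 2 · ♯ 8 :* x :* y :- ♯ 12 :* (x :+ y) ≈ Y ∷ ♯ 4 :* y :- ♯ 6 · ♯ 4 :* x ≈ u ∷ u :- ♯ 6 · ♯ 4 :* y ≈ v ∷ []))
              refl (x ∷ y ∷ ι# u ∷ ι# v ∷ ι# Y₀ ∷ []) (Y≡ , 4x , 4y , tt))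

            quarter-value : ∀ z u a → ι# (+ 4) * z ≡ ι# u → u ≡ + 4 ℤ.* a → z ≡ ι# a
            quarter-value z u a h u≡ = cancelˡ (ι-nonzero {+ 4} (λ ())) (trans h (trans (cong ι# u≡) (ι-* (+ 4) a)))

            integer-pair : ∀ a b → x ≡ ι# a → y ≡ ι# b → Listed x y
            integer-pair a b x≡ y≡ = use (integer-conclusion a b (pull 3 (λ k a b → a :* a :* a :+ a :* a :* b :* b :+ b :* b :* b , k) (k ∷ a ∷ b ∷ [])
                (subst₂ OnQuartic x≡ y≡ q)))
              where
              use : a ≡ b ⊎ Exceptional k a b → Listed x y
              use (inj₁ e) = diagonal a x≡ (trans y≡ (cong ι# (sym e)))
              use (inj₂ e) = exceptional a b e x≡ y≡

            -- The abscissa -(u + v) is odd, so the image has order two, and its vanishing ordinate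
            -- means uv = 6(u + v).
            mixed-pair : Comaximal (+ 2) (u ℤ.+ v) → ⊥
            mixed-pair c = mixed-impossible k u v k≢0 quarter c (ringℤ 3 (λ u v Y → u :* v := ♯ 6 :* (u :+ v) from
                (:- ♯ 1 · ♯ 2 :* Y ≈ u :* v :- ♯ 6 :* (u :+ v) ∷ ♯ 2 · Y ≈ ♯ 0 ∷ [])) refl (u ∷ v ∷ Y₀ ∷ []) (2Y₀≡ , Y₀≡0 , tt))
              where
              open SlopesE₁ using (mixed-impossible)
              negated : Comaximal (+ 2) (u ℤ.+ v) → Comaximal (+ 2) X₀
              negated (bezout a b e) = bezout a (ℤ.- b) (ringℤ 4 (λ w X a b → a :* ♯ 2 :+ (:- b) :* X := ♯ 1 from
                (♯ 1 · a :* ♯ 2 :+ b :* w ≈ ♯ 1 ∷ :- b · X ≈ :- w ∷ [])) refl (u ℤ.+ v ∷ X₀ ∷ a ∷ b ∷ []) (e , X₀≡ , tt))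
              Y₀≡0 : Y₀ ≡ + 0
              Y₀≡0 = odd-abscissa X₀ Y₀ (torsion-point {X} {Y} {on} X₀ Y₀ X≡ Y≡ torsion) (negated c)

            from-quarters : Listed x y
            from-quarters = by (shape k u v quarter)
              where
              by : Shape u v → Listed x y
              by (integral a b u≡ v≡) = integer-pair a b (quarter-value x u a 4x u≡) (quarter-value y v b 4y v≡)
              by (Shape.mixed _ c) = ⊥-elim (mixed-pair c)

          from-integers : Listed x y
          from-integers = use (quarter-integral x y refl refl) (quarter-integral y x (ring 2 (λ x y → y :+ x := x :+ y from []) refl (x ∷ y ∷ []) tt)
              (ring 2 (λ x y → y :* x := x :* y from []) refl (x ∷ y ∷ []) tt))
            where
            use : Integral (ι# (+ 4) * x) → Integral (ι# (+ 4) * y) → Listed x y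
            use (u , 4x) (v , 4y) = from-quarters u v 4x 4y

      E₁-points : Listed x y
      E₁-points = use (torsion-integral torsion)
        where
        use : Integral X × Integral Y → Listed x y
        use ((X₀ , X≡) , (Y₀ , Y≡)) = from-integers X₀ Y₀ X≡ Y≡

-- The rational numbers as a field of fractions.

module RationalNumbers where
  open import Data.Rational as ℚ using (ℚ; mkℚ; 0ℚ; 1ℚ; toℚᵘ; ↥_; ↧_)
  open import Data.Rational.Unnormalised as ℚᵘ using (mkℚᵘ; *≡*) renaming (_≃_ to _≃ᵘ_)
  import Data.Rational.Properties as ℚₚ
  import Data.Rational.Unnormalised.Properties as ℚᵘₚ

  private
    unnormalised : ∀ z → toℚᵘ (Defs.ι z) ≃ᵘ mkℚᵘ z 0
    unnormalised z = ℚₚ.toℚᵘ-fromℚᵘ (mkℚᵘ z 0)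

    ι-+ : ∀ a b → Defs.ι (a ℤ.+ b) ≡ Defs.ι a ℚ.+ Defs.ι b
    ι-+ a b = ℚₚ.toℚᵘ-injective (ℚᵘₚ.≃-trans (unnormalised (a ℤ.+ b)) (ℚᵘₚ.≃-trans
      (*≡* (cong (ℤ._* + 1) (sym (cong₂ ℤ._+_ (ℤₚ.*-identityʳ a) (ℤₚ.*-identityʳ b)))))
      (ℚᵘₚ.≃-sym (ℚᵘₚ.≃-trans (ℚₚ.toℚᵘ-homo-+ (Defs.ι a) (Defs.ι b)) (ℚᵘₚ.+-cong (unnormalised a) (unnormalised b))))))

    ι-* : ∀ a b → Defs.ι (a ℤ.* b) ≡ Defs.ι a ℚ.* Defs.ι b
    ι-* a b = ℚₚ.toℚᵘ-injective (ℚᵘₚ.≃-trans (unnormalised (a ℤ.* b))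
      (ℚᵘₚ.≃-sym (ℚᵘₚ.≃-trans (ℚₚ.toℚᵘ-homo-* (Defs.ι a) (Defs.ι b)) (ℚᵘₚ.*-cong (unnormalised a) (unnormalised b)))))

    ι-neg : ∀ a → Defs.ι (ℤ.- a) ≡ ℚ.- Defs.ι a
    ι-neg a = ℚₚ.toℚᵘ-injective (ℚᵘₚ.≃-trans (unnormalised (ℤ.- a))
      (ℚᵘₚ.≃-sym (ℚᵘₚ.≃-trans (ℚₚ.toℚᵘ-homo‿- (Defs.ι a)) (ℚᵘₚ.-‿cong (unnormalised a)))))

    ι-injective : ∀ {a b} → Defs.ι a ≡ Defs.ι b → a ≡ b
    ι-injective {a} {b} h = from-equation (ℚᵘₚ.≃-trans (ℚᵘₚ.≃-sym (unnormalised a)) (ℚᵘₚ.≃-trans (ℚᵘₚ.≃-reflexive (cong toℚᵘ h)) (unnormalised b)))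
      where
      from-equation : mkℚᵘ a 0 ≃ᵘ mkℚᵘ b 0 → a ≡ b
      from-equation (*≡* e) = trans (sym (ℤₚ.*-identityʳ a)) (trans e (ℤₚ.*-identityʳ b))

    fraction : ∀ x → ∃[ n ] ∃[ d ] (d ≢ + 0 × x ℚ.* Defs.ι d ≡ Defs.ι n)
    fraction x@(mkℚ n d-1 _) = n , + suc d-1 , (λ ()) , ℚₚ.toℚᵘ-injective (ℚᵘₚ.≃-trans (ℚₚ.toℚᵘ-homo-* x (Defs.ι (+ suc d-1)))
      (ℚᵘₚ.≃-trans (ℚᵘₚ.*-congˡ {toℚᵘ x} (unnormalised (+ suc d-1))) (ℚᵘₚ.≃-trans
        (*≡* (trans (ℤₚ.*-identityʳ (n ℤ.* + suc d-1)) (cong (λ d → n ℤ.* + d) (sym (ℕₚ.*-identityʳ (suc d-1))))))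
        (ℚᵘₚ.≃-sym (unnormalised n)))))

  ℚ-field : FractionField
  ℚ-field = record
    { algebra = record
        { isCommutativeRing = ℚₚ.+-*-isCommutativeRing
        ; ι# = Defs.ι
        ; ι-+ = ι-+
        ; ι-* = ι-*
        ; ι-neg = ι-neg
        ; ι-0 = refl
        ; ι-1 = refl
        }
    ; _≟_ = ℚₚ._≟_
    ; inverse = λ x x≢0 → ℚ.1/_ x {{ℚ.≢-nonZero x≢0}} , ℚₚ.*-inverseʳ x {{ℚ.≢-nonZero x≢0}}
    ; ι-injective = ι-injective
    ; fraction = fraction
    }

open RationalNumbers public using (ℚ-field)

-- Transport of rank zero to the models Y² = X³ + AX² + B.

module WeierstrassModels where
  open FractionField ℚ-field

  -- The substitution (x, y) ↦ (u² x, u³ y + u² w x) carries y² + a₁ x y = x³ + a₂ x² + a₆ to Y² = X³ + A X² + B.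
  module Transfer (a₁ a₂ a₆ u w : Carrier) (A B : ℤ)
    (nonsingular : EllipticCurve.Nonsingular ℚ-field (ι# A) (ι# B))
    (u≢0 : u ≢ ι# (+ 0)) (2w≡ : ι# (+ 2) * w ≡ u * a₁) (A≡ : ι# A ≡ u * u * a₂ + w * w) (B≡ : ι# B ≡ u * u * u * (u * u * u) * a₆) where
    open FieldProperties ℚ-field
    open NagellLutz ℚ-field A B nonsingular

    private
      E : Defs.Weierstrass
      E = Defs.W a₁ a₂ (ι# (+ 0)) (ι# (+ 0)) a₆

      X : Carrier → Carrier
      X x = u * u * x

      Y : Carrier → Carrier → Carrier
      Y x y = u * u * u * y + u * u * w * x

      u²≢0 : u * u ≢ ι# (+ 0)
      u²≢0 = product-nonzero u≢0 u≢0

      u³≢0 : u * u * u ≢ ι# (+ 0)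
      u³≢0 = product-nonzero u²≢0 u≢0

      module _ {n : ℕ} where
        Xₑ : Expr n → Expr n → Expr n
        Xₑ u x = u :* u :* x
        Yₑ : Expr n → Expr n → Expr n → Expr n → Expr n
        Yₑ u w x y = u :* u :* u :* y :+ u :* u :* w :* x

      on : ∀ {x y} → Defs.OnCurve E x y → OnCurve (X x) (Y x y)
      on {x} {y} p = ring 9 (λ a₁ a₂ a₆ u w A B x y → let X = Xₑ u x; Y = Yₑ u w x y in
        Y :* Y := X :* X :* X :+ A :* X :* X :+ B from
        (u :* u :* u :* u :* u :* u · y :* y :+ a₁ :* x :* y :+ ♯ 0 :* y ≈ x :* x :* x :+ a₂ :* x :* x :+ ♯ 0 :* x :+ a₆
        ∷ u :* u :* u :* u :* u :* x :* y · ♯ 2 :* w ≈ u :* a₁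
        ∷ :- (u :* u :* u :* u :* x :* x) · A ≈ u :* u :* a₂ :+ w :* w
        ∷ :- ♯ 1 · B ≈ u :* u :* u :* (u :* u :* u) :* a₆ ∷ []))
        refl (a₁ ∷ a₂ ∷ a₆ ∷ u ∷ w ∷ ι# A ∷ ι# B ∷ x ∷ y ∷ []) (p , 2w≡ , A≡ , B≡ , tt)

      on⁻¹ : ∀ {x y} → OnCurve (X x) (Y x y) → Defs.OnCurve E x y
      on⁻¹ {x} {y} p = cancelˡ (product-nonzero u³≢0 u³≢0) (ring 9 (λ a₁ a₂ a₆ u w A B x y → let X = Xₑ u x; Y = Yₑ u w x y; c = u :* u :* u :* (u :* u :* u) in
        c :* (y :* y :+ a₁ :* x :* y :+ ♯ 0 :* y) := c :* (x :* x :* x :+ a₂ :* x :* x :+ ♯ 0 :* x :+ a₆) from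
        (♯ 1 · Y :* Y ≈ X :* X :* X :+ A :* X :* X :+ B
        ∷ :- (u :* u :* u :* u :* u :* x :* y) · ♯ 2 :* w ≈ u :* a₁
        ∷ u :* u :* u :* u :* x :* x · A ≈ u :* u :* a₂ :+ w :* w
        ∷ ♯ 1 · B ≈ u :* u :* u :* (u :* u :* u) :* a₆ ∷ []))
        refl (a₁ ∷ a₂ ∷ a₆ ∷ u ∷ w ∷ ι# A ∷ ι# B ∷ x ∷ y ∷ []) (p , 2w≡ , A≡ , B≡ , tt))

      φ : Defs.Pt E → Point
      φ Defs.O = O
      φ (Defs.aff x y p) = aff (X x) (Y x y) (on {x} {y} p)

      abscissa : ∀ l x₁ x₂ → X (Defs.x₃ E l x₁ x₂) ≡ (u * l + w) * (u * l + w) - ι# A - X x₁ - X x₂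
      abscissa l x₁ x₂ = ring 8 (λ a₁ a₂ u w A l x₁ x₂ → let m = u :* l :+ w in
        Xₑ u (l :* l :+ a₁ :* l :- a₂ :- x₁ :- x₂) := m :* m :- A :- Xₑ u x₁ :- Xₑ u x₂ from
        (:- (u :* l) · ♯ 2 :* w ≈ u :* a₁ ∷ ♯ 1 · A ≈ u :* u :* a₂ :+ w :* w ∷ []))
        refl (a₁ ∷ a₂ ∷ u ∷ w ∷ ι# A ∷ l ∷ x₁ ∷ x₂ ∷ []) (2w≡ , A≡ , tt)

      ordinate : ∀ l x₁ y₁ x₃ → Y x₃ (Defs.y₃ E l x₁ y₁ x₃) ≡ - (Y x₁ y₁ + (u * l + w) * (X x₃ - X x₁))
      ordinate l x₁ y₁ x₃ = ring 7 (λ a₁ u w l x₁ y₁ x₃ → Yₑ u w x₃ (:- ((l :+ a₁) :* x₃) :- (y₁ :- l :* x₁) :- ♯ 0) :=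
        :- (Yₑ u w x₁ y₁ :+ (u :* l :+ w) :* (Xₑ u x₃ :- Xₑ u x₁)) from
        (u :* u :* x₃ · ♯ 2 :* w ≈ u :* a₁ ∷ []))
        refl (a₁ ∷ u ∷ w ∷ l ∷ x₁ ∷ y₁ ∷ x₃ ∷ []) (2w≡ , tt)

      -- A line with slope l goes to one with slope ul + w. Only one of the two slope equations is
      -- at hand, according to whether the line is a chord or a tangent; so a slope is taken from
      -- `slope-exists` and identified with ul + w by that equation.
      line-image : ∀ {x₁ y₁ x₂ y₂ x₃ y₃} (p : Defs.OnCurve E x₁ y₁) (q : Defs.OnCurve E x₂ y₂) (r : Defs.OnCurve E x₃ y₃) l →
        X x₃ ≡ (u * l + w) * (u * l + w) - ι# A - X x₁ - X x₂ → Y x₃ y₃ ≡ - (Y x₁ y₁ + (u * l + w) * (X x₃ - X x₁)) →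
        ¬ Opposite (X x₁) (Y x₁ y₁) (X x₂) (Y x₂ y₂) → (∀ m → Slope (X x₁) (Y x₁ y₁) (X x₂) (Y x₂ y₂) m → m ≡ u * l + w) →
        Add (aff (X x₁) (Y x₁ y₁) (on p)) (aff (X x₂) (Y x₂ y₂) (on q)) (aff (X x₃) (Y x₃ y₃) (on r))
      line-image {x₁} {y₁} {x₂} {y₂} p q r l X₃≡ Y₃≡ ¬opp unique = use (slope-exists (on p) (on q) ¬opp)
        where
        use : ∃[ m ] Slope (X x₁) (Y x₁ y₁) (X x₂) (Y x₂ y₂) m → Add (aff (X x₁) (Y x₁ y₁) (on p)) (aff (X x₂) (Y x₂ y₂) (on q)) (aff _ _ (on r))
        use (m , s) = line (u * l + w) ¬opp (subst (Slope (X x₁) (Y x₁ y₁) (X x₂) (Y x₂ y₂)) (unique m s) s) X₃≡ Y₃≡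

      add : ∀ {P Q R} → Defs.AddR E P Q R → Add (φ P) (φ Q) (φ R)
      add (Defs.O-l Q) = O-l (φ Q)
      add (Defs.O-r Defs.O) = O-l O
      add (Defs.O-r (Defs.aff x y p)) = O-r
      add (Defs.neg {x₁} {y₁} {x₂} {y₂} x≡ h) = opposite (cong X x≡ ,
        ring 7 (λ a₁ u w x₁ y₁ x₂ y₂ → Yₑ u w x₁ y₁ :+ Yₑ u w x₂ y₂ := ♯ 0 from
          (u :* u :* u · y₁ :+ y₂ :+ a₁ :* x₂ :+ ♯ 0 ≈ ♯ 0 ∷ u :* u :* x₂ · ♯ 2 :* w ≈ u :* a₁ ∷ u :* u :* w · x₁ ≈ x₂ ∷ []))
          refl (a₁ ∷ u ∷ w ∷ x₁ ∷ y₁ ∷ x₂ ∷ y₂ ∷ []) (h , 2w≡ , x≡ , tt))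
      add (Defs.chord {x₁} {y₁} {x₂} {y₂} {p} {q} l {r} x₁≢x₂ h) = line-image p q r l (abscissa l x₁ x₂) (ordinate l x₁ y₁ (Defs.x₃ E l x₁ x₂)) (λ (e , _) → x₁≢x₂ (cancelˡ u²≢0 e))
        λ m s → cancelˡ (product-nonzero u²≢0 (difference-nonzero x₁≢x₂)) (ring 8 (λ u w l m x₁ y₁ x₂ y₂ → let d = u :* u :* (x₂ :- x₁) in
          d :* m := d :* (u :* l :+ w) from
          (♯ 1 · m :* (Xₑ u x₂ :- Xₑ u x₁) ≈ Yₑ u w x₂ y₂ :- Yₑ u w x₁ y₁ ∷ :- (u :* u :* u) · l :* (x₂ :- x₁) ≈ y₂ :- y₁ ∷ []))
          refl (u ∷ w ∷ l ∷ m ∷ x₁ ∷ y₁ ∷ x₂ ∷ y₂ ∷ []) (Slope.chord s , h , tt))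
      add (Defs.tangent {x} {y} {p} {q} l {r} 2y≢0 h) = line-image p q r l (abscissa l x x) (ordinate l x y (Defs.x₃ E l x x)) (λ (_ , e) → 2y≢0 (halved e))
        λ m s → cancelˡ (product-nonzero u³≢0 2y≢0) (ring 9 (λ a₁ a₂ u w A l m x y → let d = u :* u :* u :* (y :+ y :+ a₁ :* x :+ ♯ 0); X = Xₑ u x; Y = Yₑ u w x y in
          d :* m := d :* (u :* l :+ w) from
          (♯ 1 · m :* (Y :+ Y) ≈ X :* X :+ X :* X :+ X :* X :+ A :* (X :+ X)
          ∷ :- (u :* u :* u :* u) · l :* (y :+ y :+ a₁ :* x :+ ♯ 0) ≈ ♯ 3 :* x :* x :+ ♯ 2 :* a₂ :* x :+ ♯ 0 :- a₁ :* y
          ∷ :- (u :* u :* m :* x) :+ u :* u :* w :* x :- u :* u :* u :* y · ♯ 2 :* w ≈ u :* a₁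
          ∷ ♯ 2 :* u :* u :* x · A ≈ u :* u :* a₂ :+ w :* w ∷ []))
          refl (a₁ ∷ a₂ ∷ u ∷ w ∷ ι# A ∷ l ∷ m ∷ x ∷ y ∷ []) (Slope.tangent s , h , 2w≡ , A≡ , tt))
        where
        halved : Y x y + Y x y ≡ ι# (+ 0) → y + y + a₁ * x + ι# (+ 0) ≡ ι# (+ 0)
        halved e = zero-product u³≢0 (ring 5 (λ a₁ u w x y → u :* u :* u :* (y :+ y :+ a₁ :* x :+ ♯ 0) := ♯ 0 from
          (♯ 1 · Yₑ u w x y :+ Yₑ u w x y ≈ ♯ 0 ∷ :- (u :* u :* x) · ♯ 2 :* w ≈ u :* a₁ ∷ []))
          refl (a₁ ∷ u ∷ w ∷ x ∷ y ∷ []) (e , 2w≡ , tt))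

      mul : ∀ {n P R} → Defs.MulR E n P R → Mul n (φ P) (φ R)
      mul (Defs.mul0 P) = mul-0
      mul (Defs.mulS h a) = mul-suc (mul h) (add a)

    -- The substitution is onto, as u is invertible, and it carries addition to addition; so a
    -- relation nP = O on the given curve transfers to every point of the model.
    all-torsion : Defs.RankZero E → ∀ P → Torsion P
    all-torsion rank-zero O = 0 , mul-suc mul-0 (O-l O)
    all-torsion rank-zero (aff X₀ Y₀ p) = use (inverse u u≢0)
      where
      use : ∃[ v ] u * v ≡ ι# (+ 1) → Torsion (aff X₀ Y₀ p)
      use (v , uv) = subst Torsion (aff-cong X≡ Y≡) (torsion (rank-zero (Defs.aff x y (on⁻¹ (subst₂ OnCurve (sym X≡) (sym Y≡) p)))))
        where
        x = v * v * X₀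
        y = v * v * v * Y₀ - v * w * x
        X≡ : X x ≡ X₀
        X≡ = ring 3 (λ u v X → u :* u :* (v :* v :* X) := X from ((u :* v :+ ♯ 1) :* X · u :* v ≈ ♯ 1 ∷ [])) refl (u ∷ v ∷ X₀ ∷ []) (uv , tt)
        Y≡ : Y x y ≡ Y₀
        Y≡ = ring 5 (λ u v w x Y → u :* u :* u :* (v :* v :* v :* Y :- v :* w :* x) :+ u :* u :* w :* x := Y from
          ((u :* v :* u :* v :+ u :* v :+ ♯ 1) :* Y :- u :* u :* w :* x · u :* v ≈ ♯ 1 ∷ [])) refl (u ∷ v ∷ w ∷ x ∷ Y₀ ∷ []) (uv , tt)
        torsion : ∀ {P} → Defs.IsTorsion E P → Torsion (φ P)
        torsion (n , h) = n , mul h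

open WeierstrassModels public

-- The three curves combined.

module AffinePoints (k : ℤ) (k≢0 : k ≢ + 0) where
  open FractionField ℚ-field
  open FieldProperties ℚ-field
  open Embedding ℚ-field
  open Points ℚ-field k

  private
    1≢0 : ι# (+ 1) ≢ ι# (+ 0)
    1≢0 = ι-nonzero {+ 1} (λ ())

  E₁-affine : RankZero (E₁ k) → ∀ {x y} → OnQuartic x y → Listed x y
  E₁-affine h = E₁-points (Transfer.all-torsion (ι# (+ 3)) (ι# (+ 0)) (ι# k) (ι# (+ 2)) (ι# (+ 3)) A₁ B₁ nonsingular₁
      (ι-nonzero {+ 2} (λ ())) refl (ring 0 (♯ 9 := ♯ 2 :* ♯ 2 :* ♯ 0 :+ ♯ 3 :* ♯ 3 from []) refl [] tt)
      (trans (ι-* (+ 64) k) (ring 1 (λ k → ♯ 64 :* k := ♯ 2 :* ♯ 2 :* ♯ 2 :* (♯ 2 :* ♯ 2 :* ♯ 2) :* k from []) refl (ι# k ∷ []) tt)) h)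
    where
    open IntegerPointsE₁ ℚ-field k k≢0 using (A₁; B₁; nonsingular₁)
    open RankZeroE₁ ℚ-field k k≢0 using (E₁-points)

  private
    unscaled : ∀ a → a ≡ ι# (+ 1) * ι# (+ 1) * a + ι# (+ 0) * ι# (+ 0)
    unscaled a = ring 1 (λ a → a := ♯ 1 :* ♯ 1 :* a :+ ♯ 0 :* ♯ 0 from []) refl (a ∷ []) tt

    unscaled₆ : ∀ b → b ≡ ι# (+ 1) * ι# (+ 1) * ι# (+ 1) * (ι# (+ 1) * ι# (+ 1) * ι# (+ 1)) * b
    unscaled₆ b = ring 1 (λ b → b := ♯ 1 :* ♯ 1 :* ♯ 1 :* (♯ 1 :* ♯ 1 :* ♯ 1) :* b from []) refl (b ∷ []) tt

    no-shift : ∀ u → ι# (+ 2) * ι# (+ 0) ≡ u * ι# (+ 0)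
    no-shift u = ring 1 (λ u → ♯ 2 :* ♯ 0 := u :* ♯ 0 from []) refl (u ∷ []) tt

  E₂-affine : RankZero (E₂ k) → ∀ {x y} → OnQuartic x y → Listed x y
  E₂-affine h = E₂-points (Transfer.all-torsion (ι# (+ 0)) (ι# A₂) (ι# B₂) (ι# (+ 1)) (ι# (+ 0)) A₂ B₂ nonsingular₂
      1≢0 (no-shift (ι# (+ 1))) (unscaled (ι# A₂)) (unscaled₆ (ι# B₂)) h)
    where open RankZeroE₂ ℚ-field k k≢0

  E₃-affine : RankZero (E₃ k) → ∀ {x y} → OnQuartic x y → Listed x y
  E₃-affine h = E₃-points (Transfer.all-torsion (ι# (+ 0)) (ι# A₃) (ι# B₃) (ι# (+ 1)) (ι# (+ 0)) A₃ B₃ nonsingular₃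
      1≢0 (no-shift (ι# (+ 1))) (unscaled (ι# A₃)) (unscaled₆ (ι# B₃)) h) scaled
    where
    open RankZeroE₃ ℚ-field k k≢0
    scaled : ScaledTorsion
    -- The substitution with u = 1/3: only the new coefficients have to be integers, u does not.
    scaled k₁ k₁≢0 k≡ = use (inverse (ι# (+ 3)) (ι-nonzero {+ 3} (λ ())))
      where
      open ScaledE₃ ℚ-field k₁ k₁≢0 using (A; B; nonsingular; AllTorsion)
      use : ∃[ u ] ι# (+ 3) * u ≡ ι# (+ 1) → AllTorsion
      use (u , 3u) = Transfer.all-torsion (ι# (+ 0)) (ι# A₃) (ι# B₃) u (ι# (+ 0)) A B nonsingular
        (λ u≡0 → 1≢0 (ring 1 (λ u → ♯ 1 := ♯ 0 from (:- ♯ 1 · ♯ 3 :* u ≈ ♯ 1 ∷ ♯ 3 · u ≈ ♯ 0 ∷ [])) refl (u ∷ []) (3u , u≡0 , tt)))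
        (no-shift u)
        (ring 1 (λ u → # -[1+ 2 ] := u :* u :* # -[1+ 26 ] :+ ♯ 0 :* ♯ 0 from
          (♯ 3 :* (♯ 3 :* u :+ ♯ 1) · ♯ 3 :* u ≈ ♯ 1 ∷ [])) refl (u ∷ []) (3u , tt))
        (ring 5 (λ u k k₁ B B₃ → let t = ♯ 3 :* u; u⁶ = u :* u :* u :* (u :* u :* u) in B := u⁶ :* B₃ from
          (♯ 1 · B ≈ :- (♯ 64 :* k₁) ∷ :- u⁶ · B₃ ≈ :- (♯ 1728 :* k) ∷ ♯ 1728 :* u⁶ · k ≈ ♯ 27 :* k₁
          ∷ ♯ 64 :* k₁ :* (t :* t :+ t :+ ♯ 1) :* (t :* t :* t :+ ♯ 1) · t ≈ ♯ 1 ∷ []))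
          refl (u ∷ ι# k ∷ ι# k₁ ∷ ι# B ∷ ι# B₃ ∷ [])
          ( ι-expand 1 (λ k → :- (♯ 64 :* k)) (k₁ ∷ []) , ι-expand 1 (λ k → :- (♯ 1728 :* k)) (k ∷ [])
          , trans (cong ι# k≡) (ι-* (+ 27) k₁) , 3u , tt)) h

  affine-points : RankZero (E₁ k) ⊎ RankZero (E₂ k) ⊎ RankZero (E₃ k) → ∀ {x y} → OnQuartic x y → Listed x y
  affine-points (inj₁ h) = E₁-affine h
  affine-points (inj₂ (inj₁ h)) = E₂-affine h
  affine-points (inj₂ (inj₂ h)) = E₃-affine h

-- Injectivity of 2a³ + a⁴ on its nonzero values.

module QuarticValues where
  open import Data.Integer using (_+_; _*_; -_; _-_)

  -- With σ = a + b and m = ab, the difference quotient of the quartic is σ² (σ + 2) - 2m (σ + 1), and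
  -- σ² (σ + 2) ≡ 1 modulo σ + 1.
  quartic-injective : ∀ a b → quartic a ≢ + 0 → quartic a ≡ quartic b → a ≡ b
  quartic-injective a b q≢0 h = by (a - b ℤ.≟ + 0)
    where
    σ m : ℤ
    σ = a + b
    m = a * b
    absurd : a - b ≢ + 0 → ⊥
    absurd a-b≢0 = cases (σ + + 1) refl (divisor-bound {σ + + 1} {+ 1} (λ ()) (divides (+ 2 * m - σ * σ - σ + + 1)
        (ringℤ 2 (λ σ m → ♯ 1 := (♯ 2 :* m :- σ :* σ :- σ :+ ♯ 1) :* (σ :+ ♯ 1) from
          (♯ 1 · σ :* σ :* (σ :+ ♯ 2) :- ♯ 2 :* m :* (σ :+ ♯ 1) ≈ ♯ 0 ∷ [])) refl (σ ∷ m ∷ []) (quotient , tt))))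
      where
      quotient : σ * σ * (σ + + 2) - + 2 * m * (σ + + 1) ≡ + 0
      quotient = zero-productℤ {a - b} {σ * σ * (σ + + 2) - + 2 * m * (σ + + 1)} a-b≢0 (ringℤ 2 (λ a b → let σ = a :+ b; m = a :* b in
        (a :- b) :* (σ :* σ :* (σ :+ ♯ 2) :- ♯ 2 :* m :* (σ :+ ♯ 1)) := ♯ 0 from
        (♯ 1 · ♯ 2 :* (a :* (a :* a)) :+ a :* (a :* (a :* a)) ≈ ♯ 2 :* (b :* (b :* b)) :+ b :* (b :* (b :* b)) ∷ [])) refl (a ∷ b ∷ []) (h , tt))
      -- If σ + 1 is a unit, then σ is 0 or -2, and the quotient equation gives m = 0. So a and b
      -- are among 0 and -2, where 2a³ + a⁴ vanishes; this collision is the one that the hypothesis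
      -- excludes.
      vanishing : ∀ c → σ + + 1 ≡ c → c * c ≡ + 1 → ⊥
      vanishing c e cc = q≢0 (ringℤ 2 (λ a b → let σ = a :+ b; m = a :* b in ♯ 2 :* (a :* (a :* a)) :+ a :* (a :* (a :* a)) := ♯ 0 from
        (a :* a · σ :* (σ :+ ♯ 2) ≈ ♯ 0 ∷ :- (♯ 2 :* a :* a :+ a :* b :+ ♯ 2 :* a) · m ≈ ♯ 0 ∷ [])) refl (a ∷ b ∷ []) (σσ+2 , m≡0 , tt))
        where
        σσ+2 : σ * (σ + + 2) ≡ + 0
        σσ+2 = ringℤ 2 (λ σ c → σ :* (σ :+ ♯ 2) := ♯ 0 from (σ :+ ♯ 1 :+ c · σ :+ ♯ 1 ≈ c ∷ ♯ 1 · c :* c ≈ ♯ 1 ∷ [])) refl (σ ∷ c ∷ []) (e , cc , tt)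
        m≡0 : m ≡ + 0
        m≡0 = cancelℤ {m} {+ 0} {+ 2} (λ ()) (ringℤ 3 (λ σ m c → ♯ 2 :* m := ♯ 2 :* ♯ 0 from
          (:- c · σ :* σ :* (σ :+ ♯ 2) :- ♯ 2 :* m :* (σ :+ ♯ 1) ≈ ♯ 0 ∷ c :* σ · σ :* (σ :+ ♯ 2) ≈ ♯ 0
          ∷ :- ♯ 2 :* m :* c · σ :+ ♯ 1 ≈ c ∷ :- ♯ 2 :* m · c :* c ≈ ♯ 1 ∷ [])) refl (σ ∷ m ∷ c ∷ []) (quotient , σσ+2 , e , cc , tt))
      cases : ∀ c → σ + + 1 ≡ c → ℤ.∣ c ∣ ℕ.≤ 1 → ⊥
      cases (+ 1) e _ = vanishing (+ 1) e refl
      cases -[1+ 0 ] e _ = vanishing -[1+ 0 ] e refl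
      cases (+ 0) e _ = 2∤1 (divides (+ 0) (ringℤ 2 (λ σ m → ♯ 1 := ♯ 0 from
        (♯ 1 · σ :* σ :* (σ :+ ♯ 2) :- ♯ 2 :* m :* (σ :+ ♯ 1) ≈ ♯ 0 ∷ ♯ 2 :* m :- σ :* σ :- σ :+ ♯ 1 · σ :+ ♯ 1 ≈ ♯ 0 ∷ []))
        refl (σ ∷ m ∷ []) (quotient , e , tt)))
      cases (+ suc (suc _)) e (ℕ.s≤s ())
      cases -[1+ suc _ ] e (ℕ.s≤s ())
    by : Dec (a - b ≡ + 0) → a ≡ b
    by (yes e) = ℤₚ.i-j≡0⇒i≡j a b e
    by (no a-b≢0) = ⊥-elim (absurd a-b≢0)

open QuarticValues public

-- From affine to projective points.

module ProjectivePoints (k : ℤ) where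
  open FractionField ℚ-field
  open FieldProperties ℚ-field
  open Embedding ℚ-field
  open Points ℚ-field k
  open Defs using (Triple; OnC; _∼_; NonZeroTriple)

  OnCℤ : ℤ → ℤ → ℤ → Set
  OnCℤ a b c = a ℤ.* a ℤ.* a ℤ.* c ℤ.+ a ℤ.* a ℤ.* b ℤ.* b ℤ.+ b ℤ.* b ℤ.* b ℤ.* c ≡ k ℤ.* c ℤ.* c ℤ.* c ℤ.* c

  integral-on : ∀ a b c → OnCℤ a b c → OnC k (pt a b c)
  integral-on a b c = push 4 (λ k a b c → a :* a :* a :* c :+ a :* a :* b :* b :+ b :* b :* b :* c , k :* c :* c :* c :* c) (k ∷ a ∷ b ∷ c ∷ [])

  [1,0,0]-on : OnC k (pt (+ 1) (+ 0) (+ 0))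
  [1,0,0]-on = integral-on (+ 1) (+ 0) (+ 0) (ringℤ 1 (λ k → ♯ 0 := k :* ♯ 0 :* ♯ 0 :* ♯ 0 :* ♯ 0 from []) refl (k ∷ []) tt)

  [0,1,0]-on : OnC k (pt (+ 0) (+ 1) (+ 0))
  [0,1,0]-on = integral-on (+ 0) (+ 1) (+ 0) (ringℤ 1 (λ k → ♯ 0 := k :* ♯ 0 :* ♯ 0 :* ♯ 0 :* ♯ 0 from []) refl (k ∷ []) tt)

  diagonal-on : ∀ a → k ≡ quartic a → OnC k (pt a a (+ 1))
  diagonal-on a h = integral-on a a (+ 1) (ringℤ 2 (λ k a → a :* a :* a :* ♯ 1 :+ a :* a :* a :* a :+ a :* a :* a :* ♯ 1 := k :* ♯ 1 :* ♯ 1 :* ♯ 1 :* ♯ 1 from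
    (:- ♯ 1 · k ≈ ♯ 2 :* (a :* (a :* a)) :+ a :* (a :* (a :* a)) ∷ [])) refl (k ∷ a ∷ []) (h , tt))

  rescaled : ∀ {P Q} → P ∼ Q → OnC k Q → OnC k P
  rescaled {x , y , z} {x′ , y′ , z′} (c , _ , x≡ , y≡ , z≡) h = subst (OnC k) (sym (cong₂ _,_ x≡ (cong₂ _,_ y≡ z≡)))
    (ring 5 (λ k c x y z → let X = c :* x; Y = c :* y; Z = c :* z in
      X :* X :* X :* Z :+ X :* X :* Y :* Y :+ Y :* Y :* Y :* Z := k :* Z :* Z :* Z :* Z from
      (c :* c :* c :* c · x :* x :* x :* z :+ x :* x :* y :* y :+ y :* y :* y :* z ≈ k :* z :* z :* z :* z ∷ []))
      refl (ι# k ∷ c ∷ x′ ∷ y′ ∷ z′ ∷ []) (h , tt))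

  all-on : ∀ {P L} → All (OnC k) L → Any (P ∼_) L → OnC k P
  all-on (h All.∷ _) (here e) = rescaled e h
  all-on (_ All.∷ hs) (there e) = all-on hs e

  data Point∼ (P : Triple) : Set where
    [1,0,0] : P ∼ pt (+ 1) (+ 0) (+ 0) → Point∼ P
    [0,1,0] : P ∼ pt (+ 0) (+ 1) (+ 0) → Point∼ P
    diagonal∼ : ∀ a → k ≡ quartic a → P ∼ pt a a (+ 1) → Point∼ P
    exceptional∼ : ∀ a b → Exceptional k a b → P ∼ pt a b (+ 1) → Point∼ P

  module _ (affine : ∀ {x y} → OnQuartic x y → Listed x y) where

    classify : ∀ P → NonZeroTriple P → OnC k P → Point∼ P
    classify (x , y , z) P≢0 h = by (z ≟ ι# (+ 0)) (x ≟ ι# (+ 0))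
      where
      times-1 : ∀ c → c ≡ c * ι# (+ 1)
      times-1 c = ring 1 (λ c → c := c :* ♯ 1 from []) refl (c ∷ []) tt
      times-0 : ∀ c {w} → w ≡ ι# (+ 0) → w ≡ c * ι# (+ 0)
      times-0 c {w} e = ring 2 (λ c w → w := c :* ♯ 0 from (♯ 1 · w ≈ ♯ 0 ∷ [])) refl (c ∷ w ∷ []) (e , tt)
      finite : z ≢ ι# (+ 0) → ∃[ i ] z * i ≡ ι# (+ 1) → Point∼ (x , y , z)
      finite z≢0 (i , zi) = use (affine on-quartic)
        where
        coordinate : ∀ w {c} → w * i ≡ c → w ≡ z * c
        coordinate w {c} e = ring 4 (λ w z i c → w := z :* c from (z · w :* i ≈ c ∷ :- w · z :* i ≈ ♯ 1 ∷ [])) refl (w ∷ z ∷ i ∷ c ∷ []) (e , zi , tt)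
        quartic-value : ∀ a → OnQuartic (ι# a) (ι# a) → k ≡ quartic a
        quartic-value a q = sym (pull 2 (λ k a → ♯ 2 :* (a :* (a :* a)) :+ a :* (a :* (a :* a)) , k) (k ∷ a ∷ [])
          (ring 2 (λ k a → ♯ 2 :* (a :* (a :* a)) :+ a :* (a :* (a :* a)) := k from (♯ 1 · a :* a :* a :+ a :* a :* a :* a :+ a :* a :* a ≈ k ∷ []))
            refl (ι# k ∷ ι# a ∷ []) (q , tt)))
        on-quartic : OnQuartic (x * i) (y * i)
        on-quartic = ring 5 (λ k x y z i → let X = x :* i; Y = y :* i; t = z :* i in
          X :* X :* X :+ X :* X :* Y :* Y :+ Y :* Y :* Y := k from
          (i :* i :* i :* i · x :* x :* x :* z :+ x :* x :* y :* y :+ y :* y :* y :* z ≈ k :* z :* z :* z :* z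
          ∷ k :* (t :* t :+ ♯ 1) :* (t :+ ♯ 1) :- X :* X :* X :- Y :* Y :* Y · t ≈ ♯ 1 ∷ []))
          refl (ι# k ∷ x ∷ y ∷ z ∷ i ∷ []) (h , zi , tt)
        use : Listed (x * i) (y * i) → Point∼ (x , y , z)
        use (diagonal a x≡ y≡) = diagonal∼ a (quartic-value a (subst₂ OnQuartic x≡ y≡ on-quartic)) (z , z≢0 , coordinate x x≡ , coordinate y y≡ , times-1 z)
        use (exceptional a b e x≡ y≡) = exceptional∼ a b e (z , z≢0 , coordinate x x≡ , coordinate y y≡ , times-1 z)
      by : Dec (z ≡ ι# (+ 0)) → Dec (x ≡ ι# (+ 0)) → Point∼ (x , y , z)
      by (no z≢0) _ = finite z≢0 (inverse z z≢0)
      by (yes z≡0) (yes x≡0) = [0,1,0] (y , (λ y≡0 → P≢0 (x≡0 , y≡0 , z≡0)) , times-0 y x≡0 , times-1 y , times-0 y z≡0)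
      by (yes z≡0) (no x≢0) = [1,0,0] (x , x≢0 , times-1 x , times-0 x (y≡0 (y ≟ ι# (+ 0))) , times-0 x z≡0)
        where
        -- At infinity the equation reduces to x²y² = 0.
        y≡0 : Dec (y ≡ ι# (+ 0)) → y ≡ ι# (+ 0)
        y≡0 (yes e) = e
        y≡0 (no y≢0) = ⊥-elim (product-nonzero (product-nonzero x≢0 x≢0) (product-nonzero y≢0 y≢0) (ring 4 (λ k x y z → x :* x :* (y :* y) := ♯ 0 from
          (♯ 1 · x :* x :* x :* z :+ x :* x :* y :* y :+ y :* y :* y :* z ≈ k :* z :* z :* z :* z
          ∷ k :* z :* z :* z :- x :* x :* x :- y :* y :* y · z ≈ ♯ 0 ∷ [])) refl (ι# k ∷ x ∷ y ∷ z ∷ []) (h , z≡0 , tt)))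

    points-are : ∀ L → All (OnC k) L → (∀ P → Point∼ P → Any (P ∼_) L) → CkPointsAre k L
    points-are L on complete P P≢0 = mk⇔ (λ h → complete P (classify P P≢0 h)) (all-on on)

theorem1p1 : (k : ℤ) → k ≢ + 0 →
    (RankZero (E₁ k) ⊎ RankZero (E₂ k) ⊎ RankZero (E₃ k)) →
    ((∀ (a : ℤ) → k ≢ quartic a) →
    CkPointsAre k (pt (+ 1) (+ 0) (+ 0) ∷ pt (+ 0) (+ 1) (+ 0) ∷ []))
    × (∀ (a : ℤ) → a ≢ -[1+ 0 ] → a ≢ + 3 → k ≡ quartic a →
    CkPointsAre k (pt (+ 1) (+ 0) (+ 0) ∷ pt (+ 0) (+ 1) (+ 0) ∷ pt a a (+ 1) ∷ []))
    × (k ≡ -[1+ 0 ] →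
    CkPointsAre k (pt (+ 1) (+ 0) (+ 0) ∷ pt (+ 0) (+ 1) (+ 0) ∷ pt -[1+ 0 ] (+ 0) (+ 1)
    ∷ pt (+ 0) -[1+ 0 ] (+ 1) ∷ pt -[1+ 0 ] -[1+ 0 ] (+ 1) ∷ []))
    × (k ≡ + 135 →
    CkPointsAre k (pt (+ 1) (+ 0) (+ 0) ∷ pt (+ 0) (+ 1) (+ 0) ∷ pt (+ 3) (+ 3) (+ 1)
    ∷ pt -[1+ 5 ] (+ 3) (+ 1) ∷ pt (+ 3) -[1+ 5 ] (+ 1) ∷ []))
theorem1p1 k k≢0 rank-zero = generic , one-diagonal , k≡-1 affine , k≡135 affine
  where
  open ProjectivePoints
  open Defs using (_∼_)

  affine : ∀ {x y} → Points.OnQuartic ℚ-field k x y → Points.Listed ℚ-field k x y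
  affine = AffinePoints.affine-points k k≢0 rank-zero

  diagonal-unique : ∀ {k} a b → k ≢ + 0 → k ≡ quartic a → k ≡ quartic b → a ≡ b
  diagonal-unique a b k≢0 p q = quartic-injective a b (λ e → k≢0 (trans p e)) (trans (sym p) q)

  exceptional-value : ∀ {k a b} → Exceptional k a b → k ≡ quartic -[1+ 0 ] ⊎ k ≡ quartic (+ 3)
  exceptional-value [-1,0] = inj₁ refl
  exceptional-value [0,-1] = inj₁ refl
  exceptional-value [-6,3] = inj₂ refl
  exceptional-value [3,-6] = inj₂ refl

  same-diagonal : ∀ {P a b} → a ≡ b → P ∼ pt a a (+ 1) → P ∼ pt b b (+ 1)
  same-diagonal refl h = h

  generic : (∀ a → k ≢ quartic a) → CkPointsAre k (pt (+ 1) (+ 0) (+ 0) ∷ pt (+ 0) (+ 1) (+ 0) ∷ [])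
  generic k≢ = points-are k affine _ ([1,0,0]-on k All.∷ [0,1,0]-on k All.∷ All.[]) complete
    where
    complete : ∀ P → Point∼ k P → Any (P ∼_) (pt (+ 1) (+ 0) (+ 0) ∷ pt (+ 0) (+ 1) (+ 0) ∷ [])
    complete P ([1,0,0] h) = here h
    complete P ([0,1,0] h) = there (here h)
    complete P (diagonal∼ a e _) = ⊥-elim (k≢ a e)
    complete P (exceptional∼ a b e _) = ⊥-elim ([ k≢ -[1+ 0 ] , k≢ (+ 3) ]′ (exceptional-value e))

  one-diagonal : ∀ a → a ≢ -[1+ 0 ] → a ≢ + 3 → k ≡ quartic a → CkPointsAre k (pt (+ 1) (+ 0) (+ 0) ∷ pt (+ 0) (+ 1) (+ 0) ∷ pt a a (+ 1) ∷ [])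
  one-diagonal a a≢-1 a≢3 k≡ = points-are k affine _ ([1,0,0]-on k All.∷ [0,1,0]-on k All.∷ diagonal-on k a k≡ All.∷ All.[]) complete
    where
    complete : ∀ P → Point∼ k P → Any (P ∼_) (pt (+ 1) (+ 0) (+ 0) ∷ pt (+ 0) (+ 1) (+ 0) ∷ pt a a (+ 1) ∷ [])
    complete P ([1,0,0] h) = here h
    complete P ([0,1,0] h) = there (here h)
    complete P (diagonal∼ b e h) = there (there (here (same-diagonal (diagonal-unique b a k≢0 e k≡) h)))
    complete P (exceptional∼ _ _ e _) = ⊥-elim ([ (λ h → a≢-1 (diagonal-unique a -[1+ 0 ] k≢0 k≡ h)) , (λ h → a≢3 (diagonal-unique a (+ 3) k≢0 k≡ h)) ]′ (exceptional-value e))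

  -- Generalised over k together with the affine classification, so that the value of k can be
  -- substituted by matching on the equation.
  k≡-1 : ∀ {k} → (∀ {x y} → Points.OnQuartic ℚ-field k x y → Points.Listed ℚ-field k x y) → k ≡ -[1+ 0 ] →
    CkPointsAre k (pt (+ 1) (+ 0) (+ 0) ∷ pt (+ 0) (+ 1) (+ 0) ∷ pt -[1+ 0 ] (+ 0) (+ 1) ∷ pt (+ 0) -[1+ 0 ] (+ 1) ∷ pt -[1+ 0 ] -[1+ 0 ] (+ 1) ∷ [])
  k≡-1 affine refl = points-are κ affine _ ([1,0,0]-on κ All.∷ [0,1,0]-on κ All.∷ integral-on κ -[1+ 0 ] (+ 0) (+ 1) refl
      All.∷ integral-on κ (+ 0) -[1+ 0 ] (+ 1) refl All.∷ integral-on κ -[1+ 0 ] -[1+ 0 ] (+ 1) refl All.∷ All.[]) complete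
    where
    κ = -[1+ 0 ]
    complete : ∀ P → Point∼ κ P → Any (P ∼_) (pt (+ 1) (+ 0) (+ 0) ∷ pt (+ 0) (+ 1) (+ 0) ∷ pt -[1+ 0 ] (+ 0) (+ 1) ∷ pt (+ 0) -[1+ 0 ] (+ 1) ∷ pt -[1+ 0 ] -[1+ 0 ] (+ 1) ∷ [])
    complete P ([1,0,0] h) = here h
    complete P ([0,1,0] h) = there (here h)
    complete P (diagonal∼ b e h) = there (there (there (there (here (same-diagonal (diagonal-unique b -[1+ 0 ] (λ ()) e refl) h)))))
    complete P (exceptional∼ _ _ [-1,0] h) = there (there (here h))
    complete P (exceptional∼ _ _ [0,-1] h) = there (there (there (here h)))

  k≡135 : ∀ {k} → (∀ {x y} → Points.OnQuartic ℚ-field k x y → Points.Listed ℚ-field k x y) → k ≡ + 135 →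
    CkPointsAre k (pt (+ 1) (+ 0) (+ 0) ∷ pt (+ 0) (+ 1) (+ 0) ∷ pt (+ 3) (+ 3) (+ 1) ∷ pt -[1+ 5 ] (+ 3) (+ 1) ∷ pt (+ 3) -[1+ 5 ] (+ 1) ∷ [])
  k≡135 affine refl = points-are κ affine _ ([1,0,0]-on κ All.∷ [0,1,0]-on κ All.∷ integral-on κ (+ 3) (+ 3) (+ 1) refl
      All.∷ integral-on κ -[1+ 5 ] (+ 3) (+ 1) refl All.∷ integral-on κ (+ 3) -[1+ 5 ] (+ 1) refl All.∷ All.[]) complete
    where
    κ = + 135
    complete : ∀ P → Point∼ κ P → Any (P ∼_) (pt (+ 1) (+ 0) (+ 0) ∷ pt (+ 0) (+ 1) (+ 0) ∷ pt (+ 3) (+ 3) (+ 1) ∷ pt -[1+ 5 ] (+ 3) (+ 1) ∷ pt (+ 3) -[1+ 5 ] (+ 1) ∷ [])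
    complete P ([1,0,0] h) = here h
    complete P ([0,1,0] h) = there (here h)
    complete P (diagonal∼ b e h) = there (there (here (same-diagonal (diagonal-unique b (+ 3) (λ ()) e refl) h)))
    complete P (exceptional∼ _ _ [-6,3] h) = there (there (there (here h)))
    complete P (exceptional∼ _ _ [3,-6] h) = there (there (there (there (here h))))
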